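{- Let $\mathbb{T}$ and $\mathbb{T}'$ be cartesian theories. Then $\mathbb{T}$ and $\mathbb{T}'$ are (cartesian) J-Morita equivalent if and only if they are cartesian T-Morita equivalent.
   Context: Cartesian theories and cartesian formulas are as in Johnstone's Elephant (D1.3.4): sequents between formulas built from atomic formulas using $\top$, $\wedge$ and $\mathbb{T}$-provably unique existential quantification. Two cartesian theories are (cartesian) J-Morita equivalent if their syntactic categories $\mathcal{C}_\mathbb{T}$ and $\mathcal{C}_{\mathbb{T}'}$ are equivalent, where $\mathcal{C}_\mathbb{T}$ has objects the formulas-in-context $\{\vec x.\phi\}$ (up to renaming variables) and morphisms the $\mathbb{T}$-provable equivalence classes of $\mathbb{T}$-provably functional relations. Standing assumption: every theory has at least one sort $S$ with $\mathbb{T}\models\top\vdash\exists x{:}S\,(\top)$. For $\mathbb{T}_1$ over $\Sigma_1$ and $\mathbb{T}_2$ over $\Sigma_2\supseteq\Sigma_1$, $\mathbb{T}_2$ is a cartesian Morita extension of $\mathbb{T}_1$ if $\mathbb{T}_2$ consists of $\mathbb{T}_1$ plus, for each new symbol, defining sequents of one of the kinds: (a) explicitly defined function/relation symbols $f(\vec x)=y\dashv\vdash\phi(\vec x,y)$ ($\phi$ $\mathbb{T}_1$-provably functional) or $R(\vec x)\dashv\vdash\phi(\vec x)$, with $\phi$ cartesian over $\Sigma_1$; (b) product sort $S_1\times\dots\times S_n$ with projections $\pi_i$: $\top\vdash\exists x\,(\bigwedge_i\pi_i(x)=x_i)$ and $\bigwedge_i\pi_i(x)=x_i\wedge\bigwedge_i\pi_i(z)=x_i\vdash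 x=z$; (c) subsort $S$ of $T$ via a cartesian $\Sigma_1$-formula $\phi$ and $i:S\to T$: $\phi(x)\dashv\vdash_{x:T}\exists y{:}S\,(i(y)=x)$, $i(x)=i(y)\vdash x=y$; (d) singleton sort $T$: $\top\vdash\exists x{:}T\,(\top)$ and $\top\vdash_{x,y:T}x=y$. Cartesian Morita chains, pre-cartesian-T-Morita equivalence (chains from each theory ending in logically equivalent theories) and cartesian T-Morita equivalence (its transitive closure, allowing renamed copies) are defined accordingly. -}

module Defs where

open import Level using (Level)
open import Data.List using (List; []; _∷_; _++_; map)
open import Data.List.Membership.Propositional using (_∈_)
open import Data.List.Relation.Unary.Any using (here; there)
open import Data.Sum using (_⊎_; inj₁; inj₂)
open import Data.Product using (Σ; _×_; _,_; proj₁; proj₂)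
open import Relation.Binary.PropositionalEquality using (_≡_; refl)
open import Relation.Binary.Structures using (IsStrictTotalOrder)
open import Relation.Binary.Construct.Closure.Transitive using (TransClosure)
open import Induction.WellFounded using (WellFounded)
open import Function.Bundles using (_↔_; Inverse)

record Signature : Set₁ where
  field
    Sort : Set
    Fun  : List Sort → Sort → Set
    Rel  : List Sort → Set
open Signature

-- Variable renamings between contexts (contexts = lists of sorts,
-- variables = de Bruijn positions, so α-equivalence is identity)

Ren : {A : Set} → List A → List A → Set
Ren Γ Δ = ∀ {s} → s ∈ Γ → s ∈ Δ

inl : {A : Set} {Δ Γ : List A} → Ren Δ (Δ ++ Γ)
inl (here p)  = here p
inl (there x) = there (inl x)

inr : {A : Set} (Δ : List A) {Γ : List A} → Ren Γ (Δ ++ Γ)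
inr []      x = x
inr (_ ∷ Δ) x = there (inr Δ x)

++-elim : {A : Set} (Δ : List A) {Γ Ξ : List A} → Ren Δ Ξ → Ren Γ Ξ → Ren (Δ ++ Γ) Ξ
++-elim []      f g x         = g x
++-elim (_ ∷ Δ) f g (here p)  = f (here p)
++-elim (_ ∷ Δ) f g (there x) = ++-elim Δ (λ y → f (there y)) g x

mapVar : {A B : Set} (f : A → B) {xs : List A} {x : A} → x ∈ xs → f x ∈ map f xs
mapVar f (here refl) = here refl
mapVar f (there x)   = there (mapVar f x)

module _ (Sg : Signature) where
  mutual
    data Term (Γ : List (Sort Sg)) : Sort Sg → Set where
      var : ∀ {s} → s ∈ Γ → Term Γ s
      app : ∀ {ss s} → Fun Sg ss s → Terms Γ ss → Term Γ s

    data Terms (Γ : List (Sort Sg)) : List (Sort Sg) → Set where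
      []ₜ  : Terms Γ []
      _∷ₜ_ : ∀ {s ss} → Term Γ s → Terms Γ ss → Terms Γ (s ∷ ss)

  infixr 6 _∧ᶠ_
  infix 7 _≐_
  data Formula (Γ : List (Sort Sg)) : Set where
    ⊤ᶠ   : Formula Γ
    _∧ᶠ_ : Formula Γ → Formula Γ → Formula Γ
    _≐_  : ∀ {s} → Term Γ s → Term Γ s → Formula Γ
    rel  : ∀ {ss} → Rel Sg ss → Terms Γ ss → Formula Γ
    ∃ᶠ   : (s : Sort Sg) → Formula (s ∷ Γ) → Formula Γ

  Sub : List (Sort Sg) → List (Sort Sg) → Set
  Sub Γ Δ = ∀ {s} → s ∈ Γ → Term Δ s

  record Sequent : Set where
    constructor seq
    field
      ctx : List (Sort Sg)
      ant : Formula ctx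
      con : Formula ctx

  record Theory : Set₁ where
    field
      Ax    : Set
      axiom : Ax → Sequent
open Theory

module _ {Sg : Signature} where
  mutual
    renT : ∀ {Γ Δ s} → Ren Γ Δ → Term Sg Γ s → Term Sg Δ s
    renT ρ (var x)    = var (ρ x)
    renT ρ (app f ts) = app f (renTs ρ ts)

    renTs : ∀ {Γ Δ ss} → Ren Γ Δ → Terms Sg Γ ss → Terms Sg Δ ss
    renTs ρ []ₜ       = []ₜ
    renTs ρ (t ∷ₜ ts) = renT ρ t ∷ₜ renTs ρ ts

  liftR : ∀ {Γ Δ : List (Sort Sg)} {s} → Ren Γ Δ → Ren (s ∷ Γ) (s ∷ Δ)
  liftR ρ (here p)  = here p
  liftR ρ (there x) = there (ρ x)

  renF : ∀ {Γ Δ} → Ren Γ Δ → Formula Sg Γ → Formula Sg Δ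
  renF ρ ⊤ᶠ         = ⊤ᶠ
  renF ρ (φ ∧ᶠ ψ)   = renF ρ φ ∧ᶠ renF ρ ψ
  renF ρ (t ≐ u)    = renT ρ t ≐ renT ρ u
  renF ρ (rel R ts) = rel R (renTs ρ ts)
  renF ρ (∃ᶠ s φ)   = ∃ᶠ s (renF (liftR ρ) φ)

  mutual
    subT : ∀ {Γ Δ s} → Sub Sg Γ Δ → Term Sg Γ s → Term Sg Δ s
    subT σ (var x)    = σ x
    subT σ (app f ts) = app f (subTs σ ts)

    subTs : ∀ {Γ Δ ss} → Sub Sg Γ Δ → Terms Sg Γ ss → Terms Sg Δ ss
    subTs σ []ₜ       = []ₜ
    subTs σ (t ∷ₜ ts) = subT σ t ∷ₜ subTs σ ts

  liftS : ∀ {Γ Δ s} → Sub Sg Γ Δ → Sub Sg (s ∷ Γ) (s ∷ Δ)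
  liftS σ (here p)  = var (here p)
  liftS σ (there x) = renT (λ y → there y) (σ x)

  subF : ∀ {Γ Δ} → Sub Sg Γ Δ → Formula Sg Γ → Formula Sg Δ
  subF σ ⊤ᶠ         = ⊤ᶠ
  subF σ (φ ∧ᶠ ψ)   = subF σ φ ∧ᶠ subF σ ψ
  subF σ (t ≐ u)    = subT σ t ≐ subT σ u
  subF σ (rel R ts) = rel R (subTs σ ts)
  subF σ (∃ᶠ s φ)   = ∃ᶠ s (subF (liftS σ) φ)

  wk : ∀ {Γ s} → Formula Sg Γ → Formula Sg (s ∷ Γ)
  wk = renF (λ x → there x)

  v₀ v₁ : ∀ {Γ s} → Term Sg (s ∷ s ∷ Γ) s
  v₀ = var (here refl)
  v₁ = var (there (here refl))

  at₀ at₁ : ∀ {Γ s} → Formula Sg (s ∷ Γ) → Formula Sg (s ∷ s ∷ Γ)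
  at₀ = subF σ where
    σ : Sub Sg _ _
    σ (here p)  = var (here p)
    σ (there x) = var (there (there x))
  at₁ = subF σ where
    σ : Sub Sg _ _
    σ (here p)  = var (there (here p))
    σ (there x) = var (there (there x))

  varsOf : ∀ {Γ Δ} → Ren Γ Δ → Terms Sg Δ Γ
  varsOf {[]}    ρ = []ₜ
  varsOf {_ ∷ Γ} ρ = var (ρ (here refl)) ∷ₜ varsOf (λ x → ρ (there x))

  allEq : ∀ {Ξ} (Δ : List (Sort Sg)) → (∀ {s} → s ∈ Δ → Term Sg Ξ s)
        → (∀ {s} → s ∈ Δ → Term Sg Ξ s) → Formula Sg Ξ
  allEq []      f g = ⊤ᶠ
  allEq (_ ∷ Δ) f g = (f (here refl) ≐ g (here refl)) ∧ᶠ allEq Δ (λ x → f (there x)) (λ x → g (there x))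

  bigAnd : ∀ {Ξ} {A : Set} (Δ : List A) → (∀ {s} → s ∈ Δ → Formula Sg Ξ) → Formula Sg Ξ
  bigAnd []      F = ⊤ᶠ
  bigAnd (_ ∷ Δ) F = F (here refl) ∧ᶠ bigAnd Δ (λ x → F (there x))

  ∃* : ∀ {Γ} (Δ : List (Sort Sg)) → Formula Sg (Δ ++ Γ) → Formula Sg Γ
  ∃* []      θ = θ
  ∃* (s ∷ Δ) θ = ∃* Δ (∃ᶠ s θ)

-- Derivability in regular logic (Johnstone, Elephant D1.3.1)

module _ {Sg : Signature} (T : Theory Sg) where
  data Deriv : (Γ : List (Sort Sg)) → Formula Sg Γ → Formula Sg Γ → Set where
    axiom-rule : (a : Ax T) → Deriv (Sequent.ctx (axiom T a)) (Sequent.ant (axiom T a)) (Sequent.con (axiom T a))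
    identity   : ∀ {Γ φ} → Deriv Γ φ φ
    cut        : ∀ {Γ φ ψ χ} → Deriv Γ φ ψ → Deriv Γ ψ χ → Deriv Γ φ χ
    substitution : ∀ {Γ Δ φ ψ} (σ : Sub Sg Γ Δ) → Deriv Γ φ ψ → Deriv Δ (subF σ φ) (subF σ ψ)
    eq-refl    : ∀ {Γ s} → Deriv (s ∷ Γ) ⊤ᶠ (var (here refl) ≐ var (here refl))
    eq-subst   : ∀ {Γ s} (φ : Formula Sg (s ∷ Γ)) → Deriv (s ∷ s ∷ Γ) ((v₀ ≐ v₁) ∧ᶠ at₀ φ) (at₁ φ)
    ⊤-intro    : ∀ {Γ φ} → Deriv Γ φ ⊤ᶠ
    ∧-elimˡ    : ∀ {Γ φ ψ} → Deriv Γ (φ ∧ᶠ ψ) φ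
    ∧-elimʳ    : ∀ {Γ φ ψ} → Deriv Γ (φ ∧ᶠ ψ) ψ
    ∧-intro    : ∀ {Γ φ ψ χ} → Deriv Γ φ ψ → Deriv Γ φ χ → Deriv Γ φ (ψ ∧ᶠ χ)
    ∃-elim     : ∀ {Γ s φ ψ} → Deriv (s ∷ Γ) φ (wk ψ) → Deriv Γ (∃ᶠ s φ) ψ
    ∃-elim⁻¹   : ∀ {Γ s φ ψ} → Deriv Γ (∃ᶠ s φ) ψ → Deriv (s ∷ Γ) φ (wk ψ)
    frobenius  : ∀ {Γ s φ ψ} → Deriv Γ (φ ∧ᶠ ∃ᶠ s ψ) (∃ᶠ s (wk φ ∧ᶠ ψ))

  Derivable : Sequent Sg → Set
  Derivable (seq Γ φ ψ) = Deriv Γ φ ψ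

  Unique : ∀ {Γ s} → Formula Sg (s ∷ Γ) → Set
  Unique φ = Deriv _ (at₀ φ ∧ᶠ at₁ φ) (v₀ ≐ v₁)

  Functional : ∀ {Γ s} → Formula Sg (s ∷ Γ) → Set
  Functional {Γ} {s} φ = Deriv Γ ⊤ᶠ (∃ᶠ s φ) × Unique φ

  -- cartesian formulas relative to T (Elephant D1.3.4)
  data Cart : {Γ : List (Sort Sg)} → Formula Sg Γ → Set where
    ⊤-cart : ∀ {Γ} → Cart {Γ} ⊤ᶠ
    ∧-cart : ∀ {Γ} {φ ψ : Formula Sg Γ} → Cart φ → Cart ψ → Cart (φ ∧ᶠ ψ)
    ≐-cart : ∀ {Γ s} {t u : Term Sg Γ s} → Cart (t ≐ u)
    rel-cart : ∀ {Γ ss} {R : Rel Sg ss} {ts : Terms Sg Γ ss} → Cart (rel R ts)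
    ∃-cart : ∀ {Γ s} {φ : Formula Sg (s ∷ Γ)} → Cart φ → Unique φ → Cart (∃ᶠ s φ)

-- Cartesian theories (Elephant D1.3.4): the axioms can be well-ordered
-- so that each axiom is cartesian relative to the preceding ones.

module _ {Sg : Signature} where
  subtheory : (T : Theory Sg) → (Ax T → Set) → Theory Sg
  subtheory T P = record { Ax = Σ (Ax T) P ; axiom = λ a → axiom T (proj₁ a) }

  CartSeq : Theory Sg → Sequent Sg → Set
  CartSeq T (seq Γ φ ψ) = Cart T φ × Cart T ψ

  IsCartesian : Theory Sg → Set₁
  IsCartesian T =
    Σ (Ax T → Ax T → Set) λ _<_ →
      IsStrictTotalOrder _≡_ _<_ × WellFounded _<_ ×
      (∀ a → CartSeq (subtheory T (λ b → b < a)) (axiom T a))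

  -- standing assumption: some sort S with  T ⊢ (⊤ ⊢ ∃x:S. ⊤)
  HasInhabitedSort : Theory Sg → Set
  HasInhabitedSort T = Σ (Sort Sg) λ S → Deriv T [] ⊤ᶠ (∃ᶠ S ⊤ᶠ)

  LogEquiv : Theory Sg → Theory Sg → Set
  LogEquiv T U = (∀ a → Derivable U (axiom T a)) × (∀ b → Derivable T (axiom U b))

record CartTheory : Set₁ where
  field
    sig       : Signature
    theory    : Theory sig
    cartesian : IsCartesian theory
    inhabited : HasInhabitedSort theory
open CartTheory

-- Categories, presented with a raw (representative) level on which
-- identities and composites are computed, and a setoid equality _≈_.
-- (Only the data needed to state "equivalence of categories".)

record Category : Set₁ where
  infix 4 _≈_
  infixr 9 _∘_
  field
    Obj : Set
    Raw : Obj → Obj → Set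
    Hom : Obj → Obj → Set
    ⌊_⌋ : ∀ {A B} → Hom A B → Raw A B
    _≈_ : ∀ {A B} → Raw A B → Raw A B → Set
    id  : ∀ A → Raw A A
    _∘_ : ∀ {A B C} → Raw B C → Raw A B → Raw A C

record Functor (C D : Category) : Set where
  private module C = Category C
  private module D = Category D
  field
    F₀ : C.Obj → D.Obj
    F₁ : ∀ {A B} → C.Hom A B → D.Hom (F₀ A) (F₀ B)
    resp : ∀ {A B} (f g : C.Hom A B) → C.⌊ f ⌋ C.≈ C.⌊ g ⌋ → D.⌊ F₁ f ⌋ D.≈ D.⌊ F₁ g ⌋
    pres-id : ∀ {A} (f : C.Hom A A) → C.⌊ f ⌋ C.≈ C.id A → D.⌊ F₁ f ⌋ D.≈ D.id (F₀ A)
    pres-∘ : ∀ {A B E} (f : C.Hom A B) (g : C.Hom B E) (h : C.Hom A E)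
           → C.⌊ h ⌋ C.≈ C.⌊ g ⌋ C.∘ C.⌊ f ⌋
           → D.⌊ F₁ h ⌋ D.≈ D.⌊ F₁ g ⌋ D.∘ D.⌊ F₁ f ⌋

record Equivalence (C D : Category) : Set where
  private module C = Category C
  private module D = Category D
  field
    F : Functor C D
    G : Functor D C
  open Functor F renaming (F₀ to F₀; F₁ to F₁)
  open Functor G renaming (F₀ to G₀; F₁ to G₁)
  field
    η    : ∀ A → C.Hom A (G₀ (F₀ A))
    η⁻¹  : ∀ A → C.Hom (G₀ (F₀ A)) A
    η-isoˡ : ∀ A → C.⌊ η⁻¹ A ⌋ C.∘ C.⌊ η A ⌋ C.≈ C.id A
    η-isoʳ : ∀ A → C.⌊ η A ⌋ C.∘ C.⌊ η⁻¹ A ⌋ C.≈ C.id (G₀ (F₀ A))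
    η-natural : ∀ {A B} (f : C.Hom A B) → C.⌊ G₁ (F₁ f) ⌋ C.∘ C.⌊ η A ⌋ C.≈ C.⌊ η B ⌋ C.∘ C.⌊ f ⌋
    ε    : ∀ B → D.Hom (F₀ (G₀ B)) B
    ε⁻¹  : ∀ B → D.Hom B (F₀ (G₀ B))
    ε-isoˡ : ∀ B → D.⌊ ε⁻¹ B ⌋ D.∘ D.⌊ ε B ⌋ D.≈ D.id (F₀ (G₀ B))
    ε-isoʳ : ∀ B → D.⌊ ε B ⌋ D.∘ D.⌊ ε⁻¹ B ⌋ D.≈ D.id B
    ε-natural : ∀ {A B} (g : D.Hom A B) → D.⌊ g ⌋ D.∘ D.⌊ ε A ⌋ D.≈ D.⌊ ε B ⌋ D.∘ D.⌊ F₁ (G₁ g) ⌋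

-- The cartesian syntactic category C_T (Elephant D1.4.1/D1.4.2)
--   objects : cartesian formulas-in-context {Γ . φ}
--   morphisms {Γ.φ} → {Δ.ψ} : cartesian formulas θ in context Δ ++ Γ
--   (target variables first) which are T-provably functional from φ to ψ,
--   up to T-provable equivalence.

module _ {Sg : Signature} (T : Theory Sg) where
  record SynObj : Set where
    constructor ⟨_∣_,_⟩
    field
      octx  : List (Sort Sg)
      ofml  : Formula Sg octx
      ocart : Cart T ofml
  open SynObj

  record SynRaw (A B : SynObj) : Set where
    constructor raw
    field
      fml : Formula Sg (octx B ++ octx A)
  open SynRaw

  record IsFunctionalRel (A B : SynObj) (r : SynRaw A B) : Set where
    θ = fml r
    Γ = octx A
    Δ = octx B
    field
      cart   : Cart T θ
      typed  : Deriv T (Δ ++ Γ) θ (renF (inr Δ) (ofml A) ∧ᶠ renF inl (ofml B))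
      total  : Deriv T Γ (ofml A) (∃* Δ θ)
      single : Deriv T (Δ ++ (Δ ++ Γ))
                 (renF (++-elim Δ inl (λ x → inr Δ (inr Δ x))) θ
                   ∧ᶠ renF (++-elim Δ (λ x → inr Δ (inl x)) (λ x → inr Δ (inr Δ x))) θ)
                 (allEq Δ (λ x → var (inl x)) (λ x → var (inr Δ (inl x))))

  SynHom : SynObj → SynObj → Set
  SynHom A B = Σ (SynRaw A B) (IsFunctionalRel A B)

  _≈ₛ_ : ∀ {A B} → SynRaw A B → SynRaw A B → Set
  _≈ₛ_ {A} {B} (raw θ) (raw θ') = Deriv T (octx B ++ octx A) θ θ' × Deriv T (octx B ++ octx A) θ' θ

  synId : ∀ A → SynRaw A A
  synId A = raw (renF (inr (octx A)) (ofml A)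
            ∧ᶠ allEq (octx A) (λ x → var (inl x)) (λ x → var (inr (octx A) x)))

  synComp : ∀ {A B C} → SynRaw B C → SynRaw A B → SynRaw A C
  synComp {A} {B} {C} (raw η) (raw θ) = raw (
    ∃* Δ (renF (++-elim Δ inl (λ x → inr Δ (inr Ξ x))) θ
          ∧ᶠ renF (++-elim Ξ (λ x → inr Δ (inl x)) inl) η))
    where
      Δ = octx B
      Ξ = octx C

  SyntacticCategory : Category
  SyntacticCategory = record
    { Obj = SynObj ; Raw = SynRaw ; Hom = SynHom ; ⌊_⌋ = proj₁
    ; _≈_ = _≈ₛ_ ; id = synId ; _∘_ = synComp }

JMorita : CartTheory → CartTheory → Set
JMorita T T' = Equivalence (SyntacticCategory (theory T)) (SyntacticCategory (theory T'))

record SigMor (A B : Signature) : Set where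
  field
    sortMap : Sort A → Sort B
    funMap  : ∀ {ss s} → Fun A ss s → Fun B (map sortMap ss) (sortMap s)
    relMap  : ∀ {ss} → Rel A ss → Rel B (map sortMap ss)

module _ {A B : Signature} (m : SigMor A B) where
  open SigMor m
  mutual
    trT : ∀ {Γ s} → Term A Γ s → Term B (map sortMap Γ) (sortMap s)
    trT (var x)    = var (mapVar sortMap x)
    trT (app f ts) = app (funMap f) (trTs ts)

    trTs : ∀ {Γ ss} → Terms A Γ ss → Terms B (map sortMap Γ) (map sortMap ss)
    trTs []ₜ       = []ₜ
    trTs (t ∷ₜ ts) = trT t ∷ₜ trTs ts

  trF : ∀ {Γ} → Formula A Γ → Formula B (map sortMap Γ)
  trF ⊤ᶠ         = ⊤ᶠ
  trF (φ ∧ᶠ ψ)   = trF φ ∧ᶠ trF ψ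
  trF (t ≐ u)    = trT t ≐ trT u
  trF (rel R ts) = rel (relMap R) (trTs ts)
  trF (∃ᶠ s φ)   = ∃ᶠ (sortMap s) (trF φ)

  trSeq : Sequent A → Sequent B
  trSeq (seq Γ φ ψ) = seq (map sortMap Γ) (trF φ) (trF ψ)

  trTheory : Theory A → Theory B
  trTheory T = record { Ax = Ax T ; axiom = λ a → trSeq (axiom T a) }

record SigIso (A B : Signature) : Set where
  field
    sortIso : Sort A ↔ Sort B
  sortTo : Sort A → Sort B
  sortTo = Inverse.to sortIso
  field
    funIso  : ∀ ss s → Fun A ss s ↔ Fun B (map sortTo ss) (sortTo s)
    relIso  : ∀ ss → Rel A ss ↔ Rel B (map sortTo ss)
  asMor : SigMor A B
  asMor = record { sortMap = sortTo
                 ; funMap = λ {ss} {s} f → Inverse.to (funIso ss s) f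
                 ; relMap = λ {ss} R → Inverse.to (relIso ss) R }

module _ {Sg : Signature} (T : Theory Sg) where
  record MoritaSpec : Set₁ where
    field
      -- (a) explicitly defined function symbols  f(x⃗) = y ⊣⊢ φ(x⃗,y)
      FunIx   : Set
      fArgs   : FunIx → List (Sort Sg)
      fCod    : FunIx → Sort Sg
      fDef    : (f : FunIx) → Formula Sg (fCod f ∷ fArgs f)   -- y is variable 0
      fCart   : ∀ f → Cart T (fDef f)
      fFunc   : ∀ f → Functional T (fDef f)
      RelIx   : Set
      rArgs   : RelIx → List (Sort Sg)
      rDef    : (r : RelIx) → Formula Sg (rArgs r)
      rCart   : ∀ r → Cart T (rDef r)
      ProdIx  : Set
      factors : ProdIx → List (Sort Sg)
      SubIx   : Set
      subBase : SubIx → Sort Sg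
      subDef  : (i : SubIx) → Formula Sg (subBase i ∷ [])
      subCart : ∀ i → Cart T (subDef i)
      OneIx   : Set

module _ {Sg : Signature} {T : Theory Sg} (M : MoritaSpec T) where
  open MoritaSpec M

  data NewSort : Set where
    prodS : ProdIx → NewSort
    subS  : SubIx → NewSort
    oneS  : OneIx → NewSort

  ExtSort : Set
  ExtSort = Sort Sg ⊎ NewSort

  data ExtFun : List ExtSort → ExtSort → Set where
    oldF : ∀ {ss s} → Fun Sg ss s → ExtFun (map inj₁ ss) (inj₁ s)
    defF : (f : FunIx) → ExtFun (map inj₁ (fArgs f)) (inj₁ (fCod f))
    proj : (p : ProdIx) {s : Sort Sg} → s ∈ factors p → ExtFun (inj₂ (prodS p) ∷ []) (inj₁ s)
    incl : (i : SubIx) → ExtFun (inj₂ (subS i) ∷ []) (inj₁ (subBase i))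

  data ExtRel : List ExtSort → Set where
    oldR : ∀ {ss} → Rel Sg ss → ExtRel (map inj₁ ss)
    defR : (r : RelIx) → ExtRel (map inj₁ (rArgs r))

  ExtSig : Signature
  ExtSig = record { Sort = ExtSort ; Fun = ExtFun ; Rel = ExtRel }

  inclusion : SigMor Sg ExtSig
  inclusion = record { sortMap = inj₁ ; funMap = oldF ; relMap = oldR }

  data DefAx : Set where
    fun→ fun← : FunIx → DefAx
    rel→ rel← : RelIx → DefAx
    prodEx prodUniq : ProdIx → DefAx
    sub→ sub← subInj : SubIx → DefAx
    oneEx oneUniq : OneIx → DefAx

  private
    projEqs : ∀ {Ξ} (p : ProdIx) → Term ExtSig Ξ (inj₂ (prodS p))
            → Ren (map inj₁ (factors p)) Ξ → Formula ExtSig Ξ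
    projEqs p t ρ = bigAnd (factors p) (λ i → app (proj p i) (t ∷ₜ []ₜ) ≐ var (ρ (mapVar inj₁ i)))

    incl-app : ∀ {Ξ} (i : SubIx) → Term ExtSig Ξ (inj₂ (subS i)) → Term ExtSig Ξ (inj₁ (subBase i))
    incl-app i t = app (incl i) (t ∷ₜ []ₜ)

  defSeq : DefAx → Sequent ExtSig
  defSeq (fun→ f) = seq (map inj₁ (fCod f ∷ fArgs f))
                        (app (defF f) (varsOf (λ x → there x)) ≐ var (here refl))
                        (trF inclusion (fDef f))
  defSeq (fun← f) = seq (map inj₁ (fCod f ∷ fArgs f))
                        (trF inclusion (fDef f))
                        (app (defF f) (varsOf (λ x → there x)) ≐ var (here refl))
  defSeq (rel→ r) = seq (map inj₁ (rArgs r)) (rel (defR r) (varsOf (λ x → x))) (trF inclusion (rDef r))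
  defSeq (rel← r) = seq (map inj₁ (rArgs r)) (trF inclusion (rDef r)) (rel (defR r) (varsOf (λ x → x)))
  defSeq (prodEx p) = seq (map inj₁ (factors p)) ⊤ᶠ
                          (∃ᶠ (inj₂ (prodS p)) (projEqs p (var (here refl)) (λ x → there x)))
  defSeq (prodUniq p) = seq (inj₂ (prodS p) ∷ inj₂ (prodS p) ∷ map inj₁ (factors p))
                            (projEqs p v₀ (λ x → there (there x)) ∧ᶠ projEqs p v₁ (λ x → there (there x)))
                            (v₀ ≐ v₁)
  defSeq (sub→ i) = seq (inj₁ (subBase i) ∷ [])
                        (trF inclusion (subDef i))
                        (∃ᶠ (inj₂ (subS i)) (incl-app i (var (here refl)) ≐ var (there (here refl))))
  defSeq (sub← i) = seq (inj₁ (subBase i) ∷ [])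
                        (∃ᶠ (inj₂ (subS i)) (incl-app i (var (here refl)) ≐ var (there (here refl))))
                        (trF inclusion (subDef i))
  defSeq (subInj i) = seq (inj₂ (subS i) ∷ inj₂ (subS i) ∷ [])
                          (incl-app i v₀ ≐ incl-app i v₁) (v₀ ≐ v₁)
  defSeq (oneEx o) = seq [] ⊤ᶠ (∃ᶠ (inj₂ (oneS o)) ⊤ᶠ)
  defSeq (oneUniq o) = seq (inj₂ (oneS o) ∷ inj₂ (oneS o) ∷ []) ⊤ᶠ (v₀ ≐ v₁)

  ExtTheory : Theory ExtSig
  ExtTheory = record
    { Ax = Ax T ⊎ DefAx
    ; axiom = λ { (inj₁ a) → trSeq inclusion (axiom T a) ; (inj₂ d) → defSeq d } }

data MoritaChain : (Sg : Signature) → Theory Sg → (Sg' : Signature) → Theory Sg' → Set₁ where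
  done : ∀ {Sg} {T : Theory Sg} → MoritaChain Sg T Sg T
  step : ∀ {Sg} {T : Theory Sg} (M : MoritaSpec T) {Sg'} {T' : Theory Sg'}
       → MoritaChain (ExtSig M) (ExtTheory M) Sg' T' → MoritaChain Sg T Sg' T'

-- pre-cartesian-T-Morita equivalence: Morita chains from T and T' ending in
-- logically equivalent theories (over the same signature up to renaming)
PreTMorita : CartTheory → CartTheory → Set₁
PreTMorita T T' =
  Σ Signature λ S₁ → Σ (Theory S₁) λ U₁ →
  Σ Signature λ S₂ → Σ (Theory S₂) λ U₂ →
    MoritaChain (sig T) (theory T) S₁ U₁ ×
    MoritaChain (sig T') (theory T') S₂ U₂ ×
    Σ (SigIso S₁ S₂) λ ι → LogEquiv (trTheory (SigIso.asMor ι) U₁) U₂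

TMorita : CartTheory → CartTheory → Set₁
TMorita = TransClosure PreTMorita

{-# OPTIONS --safe #-}
-- Idea.  For a cartesian theory T the arrows out of an object A form a model K A of T (its elements
-- of sort s are the arrows A → {s}), so cartesian sequents are derivable as soon as they hold in all
-- models, arrows A → B are the same as natural maps between the functors of points of A and B on
-- models (Yoneda), and every functor built by finite limits from representable ones is representable.
--
-- Call two theories model-equivalent if their categories of models are equivalent by functors whose
-- values at sorts and relations are representable.  Such functors make the points of every object
-- representable, which yields an equivalence of syntactic categories; each kind of Morita extension
-- is a model-equivalence, and these compose.  Conversely, an equivalence (F, G) of syntactic categories
-- sends a model M of T to the T'-structure with carriers G{s}(M); it takes K A to the canonical model
-- of F A, hence models to models, because satisfaction in M always comes from some K A → M.
--
-- Finally, given a model-equivalence, made adjoint, extend T by the products and subsorts representing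
-- the sorts of T', then by the symbols of T' and by the products and maps that embed the sorts of T into
-- products of the new sorts.  The models of this extension are the pairs of corresponding models of T
-- and T' with their coordinates; by the triangle identities this description is symmetric in T and T',
-- so the extension built from T' has, up to renaming, the same models.
module Submission where

open import Defs
open import Data.List using (List; []; _∷_; _++_; map)
open import Data.List.Membership.Propositional using (_∈_)
open import Data.List.Relation.Unary.Any using (here; there)
open import Data.Sum using (_⊎_; inj₁; inj₂)
open import Data.Product using (Σ; _×_; _,_; proj₁; proj₂)
open import Data.Unit using (⊤; tt)
open import Data.Empty using (⊥)
open import Relation.Binary.PropositionalEquality using (_≡_; refl; sym; trans; cong; cong₂; subst)
open import Relation.Binary.Construct.Closure.Transitive using (TransClosure) renaming ([_] to [_]⁺; _∷_ to _∷⁺_)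
open import Function.Bundles using (_⇔_; mk⇔; _↔_; mk↔ₛ′; Inverse)
open Signature
open Theory
open SynObj

-- The obstacle is that a Morita extension may only add a product of existing sorts or a subsort of
-- one existing sort, while an equivalence represents a sort s of T' by a whole object {Γ. φ} of T.
-- Hence a product P of the sorts in Γ is added and s is carved out of it. The return half is
-- recorded the other way round: a sort t of T gets a product Q of new sorts and an explicitly
-- defined function t → Q. Read from the side of T', the same data are products Q with subsorts t,
-- and functions s → P, so the two signatures match symbol by symbol, and only the two sets of
-- axioms have to be compared. Comparing them through models replaces formal derivations, which are
-- built mainly for the canonical models and for translation along signature morphisms. Carriers are
-- setoids and satisfaction is proof-relevant, so neither quotients nor choice are required;
-- elements of canonical models are formulas with proofs, compared up to provable equivalence.

-- Families indexed by the variables of a context: environments and substitutions alike.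
Fam : {S : Set} → (S → Set) → List S → Set
Fam P Γ = ∀ s → s ∈ Γ → P s

module _ {S : Set} {P : S → Set} where
  infixr 5 _▹_
  _▹_ : ∀ {s Γ} → P s → Fam P Γ → Fam P (s ∷ Γ)
  (a ▹ e) _ (here refl) = a
  (a ▹ e) s (there x)   = e s x

  ε : Fam P []
  ε s ()

  tail : ∀ {s Γ} → Fam P (s ∷ Γ) → Fam P Γ
  tail e s x = e s (there x)

  cat : ∀ Δ {Γ} → Fam P Δ → Fam P Γ → Fam P (Δ ++ Γ)
  cat []      d e = e
  cat (s ∷ Δ) d e = d s (here refl) ▹ cat Δ (tail d) e

  cat-inl : ∀ Δ {Γ} (d : Fam P Δ) (e : Fam P Γ) s (x : s ∈ Δ) → cat Δ d e s (inl x) ≡ d s x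
  cat-inl (_ ∷ Δ) d e s (here refl) = refl
  cat-inl (_ ∷ Δ) d e s (there x)   = cat-inl Δ (tail d) e s x

  cat-inr : ∀ Δ {Γ} (d : Fam P Δ) (e : Fam P Γ) s (x : s ∈ Γ) → cat Δ d e s (inr Δ x) ≡ e s x
  cat-inr []      d e s x = refl
  cat-inr (_ ∷ Δ) d e s x = cat-inr Δ (tail d) e s x

module _ {S : Set} where
  -- Eliminator for positions in a concatenation. Environments are functions and are compared
  -- pointwise, so nearly every equation between them is proved by such a case split.
  ++-cases : ∀ Δ {Γ : List S} (Q : ∀ s → s ∈ Δ ++ Γ → Set) →
             (∀ s (x : s ∈ Δ) → Q s (inl x)) → (∀ s x → Q s (inr Δ x)) → ∀ s x → Q s x
  ++-cases []      Q l r s x           = r s x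
  ++-cases (_ ∷ Δ) Q l r _ (here refl) = l _ (here refl)
  ++-cases (_ ∷ Δ) Q l r s (there x)   =
    ++-cases Δ (λ s y → Q s (there y)) (λ s y → l s (there y)) r s x

  ∷-cases : ∀ {t} {Γ : List S} (Q : ∀ s → s ∈ t ∷ Γ → Set) →
            Q t (here refl) → (∀ s x → Q s (there x)) → ∀ s x → Q s x
  ∷-cases Q h k _ (here refl) = h
  ∷-cases Q h k s (there x)   = k s x

  ++-elim-inl : ∀ Δ {Γ Ξ : List S} (f : Ren Δ Ξ) (g : Ren Γ Ξ) s (x : s ∈ Δ) → ++-elim Δ f g (inl x) ≡ f x
  ++-elim-inl (_ ∷ Δ) f g s (here refl) = refl
  ++-elim-inl (_ ∷ Δ) f g s (there x)   = ++-elim-inl Δ (λ y → f (there y)) g s x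

  ++-elim-inr : ∀ Δ {Γ Ξ : List S} (f : Ren Δ Ξ) (g : Ren Γ Ξ) s (x : s ∈ Γ) → ++-elim Δ f g (inr Δ x) ≡ g x
  ++-elim-inr []      f g s x = refl
  ++-elim-inr (_ ∷ Δ) f g s x = ++-elim-inr Δ (λ y → f (there y)) g s x

-- Substitution calculus

module Substitution (Sg : Signature) where
  Subst : List (Sort Sg) → List (Sort Sg) → Set
  Subst Γ Δ = Fam (Term Sg Δ) Γ

  infixl 20 _[_] _[_]ᵗ _[_]ᵗˢ
  _[_] : ∀ {Γ Δ} → Formula Sg Γ → Subst Γ Δ → Formula Sg Δ
  φ [ σ ] = subF (λ {s} → σ s) φ

  _[_]ᵗ : ∀ {Γ Δ s} → Term Sg Γ s → Subst Γ Δ → Term Sg Δ s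
  t [ σ ]ᵗ = subT (λ {s} → σ s) t

  _[_]ᵗˢ : ∀ {Γ Δ ss} → Terms Sg Γ ss → Subst Γ Δ → Terms Sg Δ ss
  ts [ σ ]ᵗˢ = subTs (λ {s} → σ s) ts

  infixl 15 _⨾_
  _⨾_ : ∀ {Γ Δ Ξ} → Subst Γ Δ → Subst Δ Ξ → Subst Γ Ξ
  (σ ⨾ τ) s x = σ s x [ τ ]ᵗ

  vars : ∀ {Γ Δ} → Ren Γ Δ → Subst Γ Δ
  vars ρ s x = var (ρ x)

  ids : ∀ {Γ} → Subst Γ Γ
  ids s x = var x

  mutual
    -- Substitutions are functions and extensionality is not assumed, so their equality is pointwise
    -- and has to be carried through the syntax by hand.
    subT-ext : ∀ {Γ Δ s} {σ τ : Subst Γ Δ} → (∀ s x → σ s x ≡ τ s x) → (t : Term Sg Γ s) → t [ σ ]ᵗ ≡ t [ τ ]ᵗ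
    subT-ext e (var x)    = e _ x
    subT-ext e (app f ts) = cong (app f) (subTs-ext e ts)

    subTs-ext : ∀ {Γ Δ ss} {σ τ : Subst Γ Δ} → (∀ s x → σ s x ≡ τ s x) → (t : Terms Sg Γ ss) → t [ σ ]ᵗˢ ≡ t [ τ ]ᵗˢ
    subTs-ext e []ₜ       = refl
    subTs-ext e (t ∷ₜ ts) = cong₂ _∷ₜ_ (subT-ext e t) (subTs-ext e ts)

  liftˢ : ∀ {Γ Δ s} → Subst Γ Δ → Subst (s ∷ Γ) (s ∷ Δ)
  liftˢ σ s x = liftS (λ {s} → σ s) x

  liftˢ-ext : ∀ {Γ Δ t} {σ τ : Subst Γ Δ} → (∀ s x → σ s x ≡ τ s x) → ∀ s (x : s ∈ t ∷ Γ) →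
      liftˢ σ s x ≡ liftˢ τ s x
  liftˢ-ext e s (here p)  = refl
  liftˢ-ext e s (there x) = cong (renT there) (e s x)

  sub-ext : ∀ {Γ Δ} {σ τ : Subst Γ Δ} → (∀ s x → σ s x ≡ τ s x) → (φ : Formula Sg Γ) → φ [ σ ] ≡ φ [ τ ]
  sub-ext e ⊤ᶠ         = refl
  sub-ext e (φ ∧ᶠ ψ)   = cong₂ _∧ᶠ_ (sub-ext e φ) (sub-ext e ψ)
  sub-ext e (t ≐ u)    = cong₂ _≐_ (subT-ext e t) (subT-ext e u)
  sub-ext e (rel R ts) = cong (rel R) (subTs-ext e ts)
  sub-ext e (∃ᶠ s φ)   = cong (∃ᶠ s) (sub-ext (liftˢ-ext e) φ)

  mutual
    renT-sub : ∀ {Γ Δ s} (ρ : Ren Γ Δ) (t : Term Sg Γ s) → renT ρ t ≡ t [ vars ρ ]ᵗ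
    renT-sub ρ (var x)    = refl
    renT-sub ρ (app f ts) = cong (app f) (renTs-sub ρ ts)

    renTs-sub : ∀ {Γ Δ ss} (ρ : Ren Γ Δ) (t : Terms Sg Γ ss) → renTs ρ t ≡ t [ vars ρ ]ᵗˢ
    renTs-sub ρ []ₜ       = refl
    renTs-sub ρ (t ∷ₜ ts) = cong₂ _∷ₜ_ (renT-sub ρ t) (renTs-sub ρ ts)

  -- Absorbs renaming into substitution, so that the single fusion law `sub-sub` serves for both.
  ren-sub : ∀ {Γ Δ} (ρ : Ren Γ Δ) (φ : Formula Sg Γ) → renF ρ φ ≡ φ [ vars ρ ]
  ren-sub ρ ⊤ᶠ         = refl
  ren-sub ρ (φ ∧ᶠ ψ)   = cong₂ _∧ᶠ_ (ren-sub ρ φ) (ren-sub ρ ψ)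
  ren-sub ρ (t ≐ u)    = cong₂ _≐_ (renT-sub ρ t) (renT-sub ρ u)
  ren-sub ρ (rel R ts) = cong (rel R) (renTs-sub ρ ts)
  ren-sub ρ (∃ᶠ s φ)   = cong (∃ᶠ s) (trans (ren-sub (liftR ρ) φ) (sub-ext lift-vars φ))
    where
      lift-vars : ∀ t x → vars (liftR ρ) t x ≡ liftˢ (vars ρ) t x
      lift-vars t (here p)  = refl
      lift-vars t (there x) = refl

  mutual
    subT-sub : ∀ {Γ Δ Ξ s} (σ : Subst Γ Δ) (τ : Subst Δ Ξ) (t : Term Sg Γ s) → t [ σ ]ᵗ [ τ ]ᵗ ≡ t [ σ ⨾ τ ]ᵗ
    subT-sub σ τ (var x)    = refl
    subT-sub σ τ (app f ts) = cong (app f) (subTs-sub σ τ ts)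

    subTs-sub : ∀ {Γ Δ Ξ ss} (σ : Subst Γ Δ) (τ : Subst Δ Ξ) (t : Terms Sg Γ ss) → t [ σ ]ᵗˢ [ τ ]ᵗˢ ≡ t [ σ ⨾ τ ]ᵗˢ
    subTs-sub σ τ []ₜ       = refl
    subTs-sub σ τ (t ∷ₜ ts) = cong₂ _∷ₜ_ (subT-sub σ τ t) (subTs-sub σ τ ts)

  renT-subT : ∀ {Γ Δ Ξ s} (ρ : Ren Γ Δ) (τ : Subst Δ Ξ) (t : Term Sg Γ s) → renT ρ t [ τ ]ᵗ ≡ t [
      (λ s x → τ s (ρ x)) ]ᵗ
  renT-subT ρ τ t = trans (cong (_[ τ ]ᵗ) (renT-sub ρ t)) (subT-sub (vars ρ) τ t)

  subT-renT : ∀ {Γ Δ Ξ s} (σ : Subst Γ Δ) (ρ : Ren Δ Ξ) (t : Term Sg Γ s) → renT ρ (t [ σ ]ᵗ) ≡ t [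
      (λ s x → renT ρ (σ s x)) ]ᵗ
  subT-renT σ ρ t = trans (renT-sub ρ (t [ σ ]ᵗ)) (trans (subT-sub σ (vars ρ) t)
      (subT-ext (λ s x → sym (renT-sub ρ (σ s x))) t))

  sub-sub : ∀ {Γ Δ Ξ} (σ : Subst Γ Δ) (τ : Subst Δ Ξ) (φ : Formula Sg Γ) → φ [ σ ] [ τ ] ≡ φ [ σ ⨾ τ ]
  sub-sub σ τ ⊤ᶠ         = refl
  sub-sub σ τ (φ ∧ᶠ ψ)   = cong₂ _∧ᶠ_ (sub-sub σ τ φ) (sub-sub σ τ ψ)
  sub-sub σ τ (t ≐ u)    = cong₂ _≐_ (subT-sub σ τ t) (subT-sub σ τ u)
  sub-sub σ τ (rel R ts) = cong (rel R) (subTs-sub σ τ ts)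
  sub-sub σ τ (∃ᶠ s φ)   = cong (∃ᶠ s) (trans (sub-sub (liftˢ σ) (liftˢ τ) φ) (sub-ext lift-⨾ φ))
    where
      lift-⨾ : ∀ t x → (liftˢ σ ⨾ liftˢ τ) t x ≡ liftˢ (σ ⨾ τ) t x
      lift-⨾ t (here p)  = refl
      lift-⨾ t (there x) = trans (renT-subT there (liftˢ τ) (σ t x)) (sym (subT-renT τ there (σ t x)))

  mutual
    subT-id : ∀ {Γ s} (t : Term Sg Γ s) → t [ ids ]ᵗ ≡ t
    subT-id (var x)    = refl
    subT-id (app f ts) = cong (app f) (subTs-id ts)

    subTs-id : ∀ {Γ ss} (t : Terms Sg Γ ss) → t [ ids ]ᵗˢ ≡ t
    subTs-id []ₜ       = refl
    subTs-id (t ∷ₜ ts) = cong₂ _∷ₜ_ (subT-id t) (subTs-id ts)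

  sub-id : ∀ {Γ} (φ : Formula Sg Γ) → φ [ ids ] ≡ φ
  sub-id ⊤ᶠ         = refl
  sub-id (φ ∧ᶠ ψ)   = cong₂ _∧ᶠ_ (sub-id φ) (sub-id ψ)
  sub-id (t ≐ u)    = cong₂ _≐_ (subT-id t) (subT-id u)
  sub-id (rel R ts) = cong (rel R) (subTs-id ts)
  sub-id (∃ᶠ s φ)   = cong (∃ᶠ s) (trans (sub-ext lift-ids φ) (sub-id φ))
    where
      lift-ids : ∀ t x → liftˢ ids t x ≡ ids t x
      lift-ids t (here p)  = refl
      lift-ids t (there x) = refl

  -- The form in which fusion is applied: the composite is supplied up to pointwise equality,
  -- usually as an explicit tuple such as `t ▹ σ`.
  sub-sub-ext : ∀ {Γ Δ Ξ} (σ : Subst Γ Δ) (τ : Subst Δ Ξ) {υ : Subst Γ Ξ} → (∀ s x → (σ ⨾ τ) s x ≡ υ s x) →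
                (φ : Formula Sg Γ) → φ [ σ ] [ τ ] ≡ φ [ υ ]
  sub-sub-ext σ τ e φ = trans (sub-sub σ τ φ) (sub-ext e φ)

  ren-sub-ext : ∀ {Γ Δ Ξ} (ρ : Ren Γ Δ) (τ : Subst Δ Ξ) {υ : Subst Γ Ξ} → (∀ s x → τ s (ρ x) ≡ υ s x) →
                (φ : Formula Sg Γ) → renF ρ φ [ τ ] ≡ φ [ υ ]
  ren-sub-ext ρ τ e φ = trans (cong (_[ τ ]) (ren-sub ρ φ)) (sub-sub-ext (vars ρ) τ e φ)

  infixl 25 _↑
  _↑ : ∀ {Γ Δ s} → Subst Γ Δ → Subst Γ (s ∷ Δ)
  (σ ↑) s x = renT there (σ s x)

  lift-▹ : ∀ {Γ Δ t} (σ : Subst Γ Δ) s x → liftˢ {s = t} σ s x ≡ (var (here refl) ▹ σ ↑) s x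
  lift-▹ σ _ (here refl) = refl
  lift-▹ σ s (there x)   = refl

  termsFam : ∀ {Γ ss} → Terms Sg Γ ss → Subst ss Γ
  termsFam (t ∷ₜ ts) _ (here refl) = t
  termsFam (t ∷ₜ ts) s (there x)   = termsFam ts s x

  famTerms : ∀ {Γ ss} → Subst ss Γ → Terms Sg Γ ss
  famTerms {ss = []}     σ = []ₜ
  famTerms {ss = s ∷ ss} σ = σ s (here refl) ∷ₜ famTerms (tail σ)

  varsOf-sub : ∀ {Γ Δ Ξ} (ρ : Ren Γ Δ) (σ : Subst Δ Ξ) → varsOf ρ [ σ ]ᵗˢ ≡ famTerms (λ s x → σ s (ρ x))
  varsOf-sub {[]}    ρ σ = refl
  varsOf-sub {_ ∷ Γ} ρ σ = cong (_ ∷ₜ_) (varsOf-sub (λ x → ρ (there x)) σ)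

  famTerms-ext : ∀ {Γ ss} {σ τ : Subst ss Γ} → (∀ s x → σ s x ≡ τ s x) → famTerms σ ≡ famTerms τ
  famTerms-ext {ss = []}     e = refl
  famTerms-ext {ss = s ∷ ss} e = cong₂ _∷ₜ_ (e s (here refl)) (famTerms-ext (λ s x → e s (there x)))

  famTerms-termsFam : ∀ {Γ ss} (ts : Terms Sg Γ ss) → famTerms (termsFam ts) ≡ ts
  famTerms-termsFam []ₜ       = refl
  famTerms-termsFam (t ∷ₜ ts) = cong (t ∷ₜ_) (famTerms-termsFam ts)

-- Natural deduction

module Deduction {Sg : Signature} (T : Theory Sg) where
  open Substitution Sg
  infix 4 _⊢_
  _⊢_ : ∀ {Γ} → Formula Sg Γ → Formula Sg Γ → Set
  φ ⊢ ψ = Deriv T _ φ ψ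

  ⊢-≡ : ∀ {Γ} {k φ ψ : Formula Sg Γ} → φ ≡ ψ → k ⊢ φ → k ⊢ ψ
  ⊢-≡ refl d = d

  -- Reasoning in Kripke-Joyal style: `k` is a stock of hypotheses on generalised elements σ, and a
  -- derivable sequent acts as an implication between their properties.
  instantiate : ∀ {Γ Δ} {φ ψ : Formula Sg Γ} {k : Formula Sg Δ} → φ ⊢ ψ → (σ : Subst Γ Δ) → k ⊢ φ [ σ ] →
      k ⊢ ψ [ σ ]
  instantiate d σ h = cut h (substitution (λ {s} → σ s) d)

  ∃-intro : ∀ {Γ Δ s} {k : Formula Sg Δ} (φ : Formula Sg (s ∷ Γ)) (t : Term Sg Δ s) (σ : Subst Γ Δ) →
            k ⊢ φ [ t ▹ σ ] → k ⊢ (∃ᶠ s φ) [ σ ]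
  ∃-intro φ t σ d = ⊢-≡ (ren-sub-ext there (t ▹ σ) (λ _ _ → refl) (∃ᶠ _ φ))
      -- `∃-elim⁻¹ identity` is the generic instance: φ entails its weakened existential closure.
      -- Every other instance is a substitution of it.
      (instantiate (∃-elim⁻¹ identity) (t ▹ σ) d)

  -- k' ⊢ k [ ρ ] says that (Ξ', k') is an extension of the world (Ξ, k).
  ∃-use : ∀ {Γ Ξ s} {k χ : Formula Sg Ξ} (φ : Formula Sg (s ∷ Γ)) (σ : Subst Γ Ξ) → k ⊢ (∃ᶠ s φ) [ σ ] →
          (∀ {Ξ'} (k' : Formula Sg Ξ') (ρ : Subst Ξ Ξ') → k' ⊢ k [ ρ ] → (y : Term Sg Ξ' s) →
            k' ⊢ φ [ y ▹ (σ ⨾ ρ) ] → k' ⊢ χ [ ρ ]) → k ⊢ χ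
  ∃-use {s = s} {k} {χ} φ σ d c = cut (∧-intro identity d) (cut frobenius
      (∃-elim (⊢-≡ (sym (ren-sub there χ)) body)))
    where
      -- The extension handed to `c` is the universal one: a fresh variable and the assumption that
      -- it is a witness. Frobenius has moved `k` under the quantifier.
      body = c (wk k ∧ᶠ subF (liftS (λ {s} → σ s)) φ) (vars there) (⊢-≡ (ren-sub there k) ∧-elimˡ) (var (here refl))
               (⊢-≡ (sub-ext (λ t x → trans (lift-▹ σ t x) (ext t x)) φ) ∧-elimʳ)
        where
          ext : ∀ t x → (var (here refl) ▹ σ ↑) t x ≡ (var (here refl) ▹ (σ ⨾ vars there)) t x
          ext = ∷-cases _ refl (λ t x → renT-sub there (σ t x))

  ≐-refl : ∀ {Γ s} {k : Formula Sg Γ} (t : Term Sg Γ s) → k ⊢ t ≐ t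
  ≐-refl t = instantiate eq-refl (t ▹ ids) ⊤-intro

  ≐-leibniz : ∀ {Γ Δ s} {k : Formula Sg Δ} (φ : Formula Sg (s ∷ Γ)) (σ : Subst Γ Δ) {t u : Term Sg Δ s} →
              k ⊢ t ≐ u → k ⊢ φ [ t ▹ σ ] → k ⊢ φ [ u ▹ σ ]
  ≐-leibniz φ σ {t} {u} e d =
    ⊢-≡ (sub-sub-ext _ (t ▹ u ▹ σ) (∷-cases _ refl (λ _ _ → refl)) φ)
      (instantiate (eq-subst φ) (t ▹ u ▹ σ)
        (∧-intro e (⊢-≡ (sym (sub-sub-ext _ (t ▹ u ▹ σ) (∷-cases _ refl (λ _ _ → refl)) φ)) d)))

  ≐-sym : ∀ {Γ s} {k : Formula Sg Γ} {t u : Term Sg Γ s} → k ⊢ t ≐ u → k ⊢ u ≐ t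
  ≐-sym {t = t} {u} e = ⊢-≡ (cong (u ≐_) (eq u))
    (≐-leibniz (var (here refl) ≐ renT there t) ids e (⊢-≡ (cong (t ≐_) (sym (eq t))) (≐-refl t)))
    where
      eq : ∀ v → renT there t [ v ▹ ids ]ᵗ ≡ t
      eq v = trans (renT-subT there (v ▹ ids) t) (subT-id t)

  ≐-trans : ∀ {Γ s} {k : Formula Sg Γ} {t u v : Term Sg Γ s} → k ⊢ t ≐ u → k ⊢ u ≐ v → k ⊢ t ≐ v
  ≐-trans {t = t} {u} {v} d e = ⊢-≡ (cong (_≐ v) (eq v))
    (≐-leibniz (renT there t ≐ var (here refl)) ids e (⊢-≡ (cong (_≐ u) (sym (eq u))) d))
    where
      eq : ∀ v → renT there t [ v ▹ ids ]ᵗ ≡ t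
      eq v = trans (renT-subT there (v ▹ ids) t) (subT-id t)

  private
    -- Replaces one variable at a time. The formula lives over Γ ++ Δ so that terms over Δ that are
    -- already plugged in can stay inside it during the recursion.
    leibniz-++ : ∀ Γ {Δ} {k : Formula Sg Δ} (φ : Formula Sg (Γ ++ Δ)) (σ τ : Subst Γ Δ) →
                 (∀ s x → k ⊢ σ s x ≐ τ s x) → k ⊢ φ [ cat Γ σ ids ] → k ⊢ φ [ cat Γ τ ids ]
    leibniz-++ []      φ σ τ e d = d
    leibniz-++ (s ∷ Γ) {Δ} φ σ τ e d =
      ≐-leibniz φ (cat Γ (tail τ) ids) (e s (here refl))
        (⊢-≡ (eq τ) (leibniz-++ Γ (φ [ put ]) (tail σ) (tail τ) (λ s x → e s (there x)) (⊢-≡ (sym (eq σ)) d)))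
      where
        put : Subst (s ∷ (Γ ++ Δ)) (Γ ++ Δ)
        put = renT (inr Γ) (σ s (here refl)) ▹ ids
        eq : ∀ τ → φ [ put ] [ cat Γ (tail τ) ids ] ≡ φ [ σ s (here refl) ▹ cat Γ (tail τ) ids ]
        eq τ = sub-sub-ext put (cat Γ (tail τ) ids)
                 (∷-cases _ (trans (renT-subT (inr Γ) (cat Γ (tail τ) ids) (σ s (here refl)))
                   (trans (subT-ext (λ t x → cat-inr Γ (tail τ) ids t x) (σ s (here refl))) (subT-id _)))
                       (λ _ _ → refl)) φ

  leibniz : ∀ {Γ Δ} {k : Formula Sg Δ} (φ : Formula Sg Γ) (σ τ : Subst Γ Δ) →
            (∀ s x → k ⊢ σ s x ≐ τ s x) → k ⊢ φ [ σ ] → k ⊢ φ [ τ ]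
  leibniz {Γ} φ σ τ e d =
    ⊢-≡ (ren-sub-ext inl (cat Γ τ ids) (cat-inl Γ τ ids) φ)
      (leibniz-++ Γ (renF inl φ) σ τ e (⊢-≡ (sym (ren-sub-ext inl (cat Γ σ ids) (cat-inl Γ σ ids) φ)) d))

  -- `Unique` stated for generalised elements. In this form it is visibly stable under substitution,
  -- which is what closes `Cart` under substitution.
  SingleValued : ∀ {Γ s} → Formula Sg (s ∷ Γ) → Set
  SingleValued {Γ} {s} φ = ∀ {Ξ} (k : Formula Sg Ξ) (σ : Subst Γ Ξ) (t u : Term Sg Ξ s) →
                           k ⊢ φ [ t ▹ σ ] → k ⊢ φ [ u ▹ σ ] → k ⊢ t ≐ u

  unique⇒single : ∀ {Γ s} {φ : Formula Sg (s ∷ Γ)} → Unique T φ → SingleValued φ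
  unique⇒single {φ = φ} d k σ t u p q = instantiate d (t ▹ u ▹ σ)
    (∧-intro (⊢-≡ (sym (sub-sub-ext _ (t ▹ u ▹ σ) (∷-cases _ refl (λ _ _ → refl)) φ)) p)
             (⊢-≡ (sym (sub-sub-ext _ (t ▹ u ▹ σ) (∷-cases _ refl (λ _ _ → refl)) φ)) q))

  single⇒unique : ∀ {Γ s} {φ : Formula Sg (s ∷ Γ)} → SingleValued φ → Unique T φ
  single⇒unique {φ = φ} d = d _ (vars (λ x → there (there x))) v₀ v₁
    (⊢-≡ (sub-ext (∷-cases _ refl (λ _ _ → refl)) φ) ∧-elimˡ)
    (⊢-≡ (sub-ext (∷-cases _ refl (λ _ _ → refl)) φ) ∧-elimʳ)

  ∃-cart′ : ∀ {Γ s} {φ : Formula Sg (s ∷ Γ)} → Cart T φ → SingleValued φ → Cart T (∃ᶠ s φ)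
  ∃-cart′ c u = ∃-cart c (single⇒unique u)

  cart-sub : ∀ {Γ Δ} {φ : Formula Sg Γ} → Cart T φ → (σ : Subst Γ Δ) → Cart T (φ [ σ ])
  cart-sub ⊤-cart       σ = ⊤-cart
  cart-sub (∧-cart c d) σ = ∧-cart (cart-sub c σ) (cart-sub d σ)
  cart-sub ≐-cart       σ = ≐-cart
  cart-sub rel-cart     σ = rel-cart
  cart-sub (∃-cart {φ = φ} c u) σ = ∃-cart′ (cart-sub c (liftˢ σ)) (λ k τ t v p q →
      unique⇒single {φ = φ} u k (σ ⨾ τ) t v (⊢-≡ (eq τ t) p) (⊢-≡ (eq τ v) q))
    where
      eq : ∀ {Ξ} (τ : Subst _ Ξ) t → φ [ liftˢ σ ] [ t ▹ τ ] ≡ φ [ t ▹ (σ ⨾ τ) ]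
      eq τ t = sub-sub-ext (liftˢ σ) (t ▹ τ) (∷-cases _ refl (λ s x → renT-subT there (t ▹ τ) (σ s x))) φ

  cart-ren : ∀ {Γ Δ} {φ : Formula Sg Γ} → Cart T φ → (ρ : Ren Γ Δ) → Cart T (renF ρ φ)
  cart-ren {φ = φ} c ρ = subst (Cart T) (sym (ren-sub ρ φ)) (cart-sub c (vars ρ))

-- Set-valued models (carriers are setoids)

record Structure (Sg : Signature) : Set₁ where
  no-eta-equality
  open Substitution Sg
  infix 4 _≈_
  field
    Car : Sort Sg → Set
    _≈_ : ∀ {s} → Car s → Car s → Set
    ≈-refl  : ∀ {s} {a : Car s} → a ≈ a
    ≈-sym   : ∀ {s} {a b : Car s} → a ≈ b → b ≈ a
    ≈-trans : ∀ {s} {a b c : Car s} → a ≈ b → b ≈ c → a ≈ c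
    fun : ∀ {ss s} → Fun Sg ss s → Fam Car ss → Car s
    fun-cong : ∀ {ss s} (f : Fun Sg ss s) {d e : Fam Car ss} → (∀ s x → d s x ≈ e s x) → fun f d ≈ fun f e
    rl : ∀ {ss} → Rel Sg ss → Fam Car ss → Set
    rl-cong : ∀ {ss} (R : Rel Sg ss) {d e : Fam Car ss} → (∀ s x → d s x ≈ e s x) → rl R d → rl R e

  ≈-≡ : ∀ {s} {a b : Car s} → a ≡ b → a ≈ b
  ≈-≡ refl = ≈-refl

  Env : List (Sort Sg) → Set
  Env = Fam Car

  infix 4 _≋_
  _≋_ : ∀ {Γ} → Env Γ → Env Γ → Set
  d ≋ e = ∀ s x → d s x ≈ e s x

  mutual
    evalT : ∀ {Γ s} → Term Sg Γ s → Env Γ → Car s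
    evalT (var x)    e = e _ x
    evalT (app f ts) e = fun f (evalTs ts e)

    evalTs : ∀ {Γ ss} → Terms Sg Γ ss → Env Γ → Env ss
    evalTs (t ∷ₜ ts) e _ (here refl) = evalT t e
    evalTs (t ∷ₜ ts) e s (there x)   = evalTs ts e s x

  -- Proof-relevant: evidence for an existential carries its witness, so functions can be read off
  -- total relations without choice.
  Sat : ∀ {Γ} → Formula Sg Γ → Env Γ → Set
  Sat ⊤ᶠ         e = ⊤
  Sat (φ ∧ᶠ ψ)   e = Sat φ e × Sat ψ e
  Sat (t ≐ u)    e = evalT t e ≈ evalT u e
  Sat (rel R ts) e = rl R (evalTs ts e)
  Sat (∃ᶠ s φ)   e = Σ (Car s) λ a → Sat φ (a ▹ e)

  ▹-cong : ∀ {s Γ} {a b : Car s} {d e : Env Γ} → a ≈ b → d ≋ e → (a ▹ d) ≋ (b ▹ e)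
  ▹-cong p q = ∷-cases _ p q

  cat-cong : ∀ Δ {Γ} {d d' : Env Δ} {e e' : Env Γ} → d ≋ d' → e ≋ e' → cat Δ d e ≋ cat Δ d' e'
  cat-cong []      p q = q
  cat-cong (s ∷ Δ) p q = ▹-cong (p s (here refl)) (cat-cong Δ (λ s x → p s (there x)) q)

  mutual
    evalT-sub : ∀ {Γ Δ s} (t : Term Sg Γ s) (σ : Subst Γ Δ) {e : Env Δ} {d : Env Γ} →
                (∀ s x → evalT (σ s x) e ≈ d s x) → evalT (t [ σ ]ᵗ) e ≈ evalT t d
    evalT-sub (var x)    σ p = p _ x
    evalT-sub (app f ts) σ p = fun-cong f (evalTs-sub ts σ p)

    evalTs-sub : ∀ {Γ Δ ss} (ts : Terms Sg Γ ss) (σ : Subst Γ Δ) {e : Env Δ} {d : Env Γ} →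
                 (∀ s x → evalT (σ s x) e ≈ d s x) → evalTs (ts [ σ ]ᵗˢ) e ≋ evalTs ts d
    evalTs-sub (t ∷ₜ ts) σ p _ (here refl) = evalT-sub t σ p
    evalTs-sub (t ∷ₜ ts) σ p s (there x)   = evalTs-sub ts σ p s x

  evalT-ren : ∀ {Γ Δ s} (t : Term Sg Γ s) (ρ : Ren Γ Δ) {e : Env Δ} {d : Env Γ} →
              (∀ s x → e s (ρ x) ≈ d s x) → evalT (renT ρ t) e ≈ evalT t d
  evalT-ren t ρ {e} p = ≈-trans (≈-≡ (cong (λ u → evalT u e) (renT-sub ρ t))) (evalT-sub t (vars ρ) p)

  evalT-cong : ∀ {Γ s} (t : Term Sg Γ s) {d e : Env Γ} → d ≋ e → evalT t d ≈ evalT t e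
  evalT-cong t {d} p = ≈-trans (≈-≡ (cong (λ u → evalT u d) (sym (subT-id t)))) (evalT-sub t ids p)

  evalTs-cong : ∀ {Γ ss} (ts : Terms Sg Γ ss) {d e : Env Γ} → d ≋ e → evalTs ts d ≋ evalTs ts e
  evalTs-cong (t ∷ₜ ts) p _ (here refl) = evalT-cong t p
  evalTs-cong (t ∷ₜ ts) p s (there x)   = evalTs-cong ts p s x

  private
    lift-env : ∀ {Γ Δ t} (σ : Subst Γ Δ) {e : Env Δ} {d : Env Γ} → (∀ s x → evalT (σ s x) e ≈ d s x) →
               (a : Car t) → ∀ s x → evalT (liftˢ σ s x) (a ▹ e) ≈ (a ▹ d) s x
    lift-env σ p a _ (here refl) = ≈-refl
    lift-env σ p a s (there x)   = ≈-trans (evalT-ren (σ s x) there (λ _ _ → ≈-refl)) (p s x)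

  mutual
    -- The environment `d` need only agree up to `≈` with the evaluated substitution. This slack
    -- absorbs every mismatch between environments that agree pointwise without being equal as
    -- functions.
    Sat-sub : ∀ {Γ Δ} (φ : Formula Sg Γ) (σ : Subst Γ Δ) {e : Env Δ} {d : Env Γ} →
              (∀ s x → evalT (σ s x) e ≈ d s x) → Sat (φ [ σ ]) e → Sat φ d
    Sat-sub ⊤ᶠ         σ p q       = tt
    Sat-sub (φ ∧ᶠ ψ)   σ p (q , r) = Sat-sub φ σ p q , Sat-sub ψ σ p r
    Sat-sub (t ≐ u)    σ p q       = ≈-trans (≈-sym (evalT-sub t σ p)) (≈-trans q (evalT-sub u σ p))
    Sat-sub (rel R ts) σ p q       = rl-cong R (evalTs-sub ts σ p) q
    Sat-sub (∃ᶠ s φ)   σ p (a , q) = a , Sat-sub φ (liftˢ σ) (lift-env σ p a) q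

    Sat-unsub : ∀ {Γ Δ} (φ : Formula Sg Γ) (σ : Subst Γ Δ) {e : Env Δ} {d : Env Γ} →
                (∀ s x → evalT (σ s x) e ≈ d s x) → Sat φ d → Sat (φ [ σ ]) e
    Sat-unsub ⊤ᶠ         σ p q       = tt
    Sat-unsub (φ ∧ᶠ ψ)   σ p (q , r) = Sat-unsub φ σ p q , Sat-unsub ψ σ p r
    Sat-unsub (t ≐ u)    σ p q       = ≈-trans (evalT-sub t σ p) (≈-trans q (≈-sym (evalT-sub u σ p)))
    Sat-unsub (rel R ts) σ p q       = rl-cong R (λ s x → ≈-sym (evalTs-sub ts σ p s x)) q
    Sat-unsub (∃ᶠ s φ)   σ p (a , q) = a , Sat-unsub φ (liftˢ σ) (lift-env σ p a) q

  Sat-ren : ∀ {Γ Δ} (φ : Formula Sg Γ) (ρ : Ren Γ Δ) {e : Env Δ} {d : Env Γ} →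
            (∀ s x → e s (ρ x) ≈ d s x) → Sat (renF ρ φ) e → Sat φ d
  Sat-ren φ ρ {e} p q = Sat-sub φ (vars ρ) p (subst (λ ψ → Sat ψ e) (ren-sub ρ φ) q)

  Sat-unren : ∀ {Γ Δ} (φ : Formula Sg Γ) (ρ : Ren Γ Δ) {e : Env Δ} {d : Env Γ} →
              (∀ s x → e s (ρ x) ≈ d s x) → Sat φ d → Sat (renF ρ φ) e
  Sat-unren φ ρ {e} p q = subst (λ ψ → Sat ψ e) (sym (ren-sub ρ φ)) (Sat-unsub φ (vars ρ) p q)

  Sat-cong : ∀ {Γ} (φ : Formula Sg Γ) {d e : Env Γ} → d ≋ e → Sat φ d → Sat φ e
  Sat-cong φ {d} p q = Sat-sub φ ids p (subst (λ ψ → Sat ψ d) (sym (sub-id φ)) q)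

  Sat-∃* : ∀ Δ {Γ} (θ : Formula Sg (Δ ++ Γ)) {e : Env Γ} → Sat (∃* Δ θ) e → Σ (Env Δ) λ d → Sat θ (cat Δ d e)
  Sat-∃* []      θ q = ε , q
  Sat-∃* (s ∷ Δ) θ q with Sat-∃* Δ (∃ᶠ s θ) q
  ... | d , a , r = a ▹ d , r

  Sat-∃*-intro : ∀ Δ {Γ} (θ : Formula Sg (Δ ++ Γ)) {e : Env Γ} (d : Env Δ) → Sat θ (cat Δ d e) → Sat (∃* Δ θ) e
  Sat-∃*-intro []      θ d q = q
  Sat-∃*-intro (s ∷ Δ) θ d q = Sat-∃*-intro Δ (∃ᶠ s θ) (tail d) (d s (here refl) , q)

  Sat-allEq : ∀ {Ξ} Δ (f g : Subst Δ Ξ) {e : Env Ξ} → Sat (allEq Δ (λ {s} → f s) (λ {s} → g s)) e →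
              ∀ s x → evalT (f s x) e ≈ evalT (g s x) e
  Sat-allEq (_ ∷ Δ) f g (q , r) _ (here refl) = q
  Sat-allEq (_ ∷ Δ) f g (q , r) s (there x)   = Sat-allEq Δ (tail f) (tail g) r s x

  Sat-allEq-intro : ∀ {Ξ} Δ (f g : Subst Δ Ξ) {e : Env Ξ} → (∀ s x → evalT (f s x) e ≈ evalT (g s x) e) →
                    Sat (allEq Δ (λ {s} → f s) (λ {s} → g s)) e
  Sat-allEq-intro []      f g p = tt
  Sat-allEq-intro (_ ∷ Δ) f g p = p _ (here refl) , Sat-allEq-intro Δ (tail f) (tail g) (λ s x → p s (there x))

  Sat-bigAnd : ∀ {Ξ} {A : Set} (Δ : List A) (F : ∀ s → s ∈ Δ → Formula Sg Ξ) {e : Env Ξ} →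
               Sat (bigAnd Δ (λ {s} → F s)) e → ∀ s x → Sat (F s x) e
  Sat-bigAnd (_ ∷ Δ) F (q , r) _ (here refl) = q
  Sat-bigAnd (_ ∷ Δ) F (q , r) s (there x)   = Sat-bigAnd Δ (λ s x → F s (there x)) r s x

  Sat-bigAnd-intro : ∀ {Ξ} {A : Set} (Δ : List A) (F : ∀ s → s ∈ Δ → Formula Sg Ξ) {e : Env Ξ} →
                     (∀ s x → Sat (F s x) e) → Sat (bigAnd Δ (λ {s} → F s)) e
  Sat-bigAnd-intro []      F p = tt
  Sat-bigAnd-intro (_ ∷ Δ) F p = p _ (here refl) , Sat-bigAnd-intro Δ (λ s x → F s (there x))
      (λ s x → p s (there x))

  evalTs-varsOf : ∀ {Γ Δ} (ρ : Ren Γ Δ) (e : Env Δ) s x → evalTs (varsOf ρ) e s x ≈ e s (ρ x)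
  evalTs-varsOf {_ ∷ Γ} ρ e _ (here refl) = ≈-refl
  evalTs-varsOf {_ ∷ Γ} ρ e s (there x)   = evalTs-varsOf (λ y → ρ (there y)) e s x

  evalTs-fam : ∀ {Γ Δ} (σ : Subst Γ Δ) (e : Env Δ) s x → evalTs (famTerms σ) e s x ≈ evalT (σ s x) e
  evalTs-fam {_ ∷ Γ} σ e _ (here refl) = ≈-refl
  evalTs-fam {_ ∷ Γ} σ e s (there x)   = evalTs-fam (tail σ) e s x

  Valid : Sequent Sg → Set
  Valid (seq Γ φ ψ) = (e : Env Γ) → Sat φ e → Sat ψ e

open Structure using (Car; Env; evalT; evalTs; Sat; Valid)

record Model {Sg : Signature} (T : Theory Sg) : Set₁ where
  no-eta-equality
  field
    str   : Structure Sg
    valid : ∀ a → Valid str (axiom T a)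
  open Structure str public
open Model using (str)

module _ {Sg : Signature} {T : Theory Sg} (M : Structure Sg) (v : ∀ a → Valid M (axiom T a)) where
  open Structure M hiding (Sat; evalT; Env)

  soundness : ∀ {Γ φ ψ} → Deriv T Γ φ ψ → (e : Env M Γ) → Sat M φ e → Sat M ψ e
  soundness (axiom-rule a) e q = v a e q
  soundness identity e q = q
  soundness (cut d d') e q = soundness d' e (soundness d e q)
  soundness (substitution {φ = φ} {ψ} σ d) e q =
    Sat-unsub ψ (λ s → σ {s}) (λ _ _ → ≈-refl) (soundness d (λ s x → evalT M (σ x) e)
        (Sat-sub φ (λ s → σ {s}) (λ _ _ → ≈-refl) q))
  soundness eq-refl e q = ≈-refl
  soundness (eq-subst φ) e (p , q) = Sat-unsub φ _ (λ _ _ → ≈-refl) (Sat-sub φ _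
    (∷-cases _ p (λ s x → ≈-refl)) q)
  soundness ⊤-intro e q = tt
  soundness ∧-elimˡ e q = proj₁ q
  soundness ∧-elimʳ e q = proj₂ q
  soundness (∧-intro d d') e q = soundness d e q , soundness d' e q
  soundness (∃-elim {ψ = ψ} d) e (a , q) = Sat-ren ψ there (λ _ _ → ≈-refl) (soundness d (a ▹ e) q)
  soundness (∃-elim⁻¹ {φ = φ} {ψ} d) e q = Sat-unren ψ there (λ _ _ → ≈-refl)
    (soundness d (tail e) (e _ (here refl) , Sat-cong φ (∷-cases _ ≈-refl (λ _ _ → ≈-refl)) q))
  soundness (frobenius {φ = φ}) e (q , a , r) = a , Sat-unren φ there (λ _ _ → ≈-refl) q , r

sound : ∀ {Sg} {T : Theory Sg} (M : Model T) {Γ φ ψ} → Deriv T Γ φ ψ → (e : Env (str M) Γ) → Sat (str M) φ e → Sat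
    (str M) ψ e
sound M = soundness (Model.str M) (Model.valid M)

-- Homomorphisms and isomorphisms of structures

record Hom {Sg : Signature} (M N : Structure Sg) : Set where
  no-eta-equality
  private
    module M = Structure M
    module N = Structure N
  field
    fn : ∀ {s} → M.Car s → N.Car s
    fn-cong : ∀ {s} {a b : M.Car s} → a M.≈ b → fn a N.≈ fn b
    fn-fun : ∀ {ss s} (f : Fun Sg ss s) (e : M.Env ss) → fn (M.fun f e) N.≈ N.fun f (λ s x → fn (e s x))
    fn-rel : ∀ {ss} (R : Rel Sg ss) (e : M.Env ss) → M.rl R e → N.rl R (λ s x → fn (e s x))

  mutual
    fn-evalT : ∀ {Γ s} (t : Term Sg Γ s) (e : M.Env Γ) → fn (M.evalT t e) N.≈ N.evalT t (λ s x → fn (e s x))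
    fn-evalT (var x)    e = N.≈-refl
    fn-evalT (app f ts) e = N.≈-trans (fn-fun f _) (N.fun-cong f (fn-evalTs ts e))

    fn-evalTs : ∀ {Γ ss} (ts : Terms Sg Γ ss) (e : M.Env Γ) s x →
                fn (M.evalTs ts e s x) N.≈ N.evalTs ts (λ s x → fn (e s x)) s x
    fn-evalTs (t ∷ₜ ts) e _ (here refl) = fn-evalT t e
    fn-evalTs (t ∷ₜ ts) e s (there x)   = fn-evalTs ts e s x

  -- Regular formulas are positive, so homomorphisms preserve them although they need not reflect
  -- relations. This is why points of objects are functorial in the model.
  fn-Sat : ∀ {Γ} (φ : Formula Sg Γ) (e : M.Env Γ) → M.Sat φ e → N.Sat φ (λ s x → fn (e s x))
  fn-Sat ⊤ᶠ         e q       = tt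
  fn-Sat (φ ∧ᶠ ψ)   e (q , r) = fn-Sat φ e q , fn-Sat ψ e r
  fn-Sat (t ≐ u)    e q       = N.≈-trans (N.≈-sym (fn-evalT t e)) (N.≈-trans (fn-cong q) (fn-evalT u e))
  fn-Sat (rel R ts) e q       = N.rl-cong R (fn-evalTs ts e) (fn-rel R _ q)
  fn-Sat (∃ᶠ s φ)   e (a , q) = fn a , N.Sat-cong φ (∷-cases _ N.≈-refl (λ _ _ → N.≈-refl)) (fn-Sat φ (a ▹ e) q)

open Hom using (fn; fn-cong)

module _ {Sg : Signature} where
  idHom : (M : Structure Sg) → Hom M M
  idHom M .fn a = a
  idHom M .fn-cong p = p
  idHom M .Hom.fn-fun f e = Structure.≈-refl M
  idHom M .Hom.fn-rel R e q = q

  infixr 9 _∘ʰ_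
  _∘ʰ_ : {M N O : Structure Sg} → Hom N O → Hom M N → Hom M O
  (g ∘ʰ f) .fn a = fn g (fn f a)
  (g ∘ʰ f) .fn-cong p = fn-cong g (fn-cong f p)
  _∘ʰ_ {O = O} g f .Hom.fn-fun u e = Structure.≈-trans O (fn-cong g (Hom.fn-fun f u e)) (Hom.fn-fun g u _)
  (g ∘ʰ f) .Hom.fn-rel R e q = Hom.fn-rel g R _ (Hom.fn-rel f R e q)

  infix 4 _≗ʰ_
  _≗ʰ_ : {M N : Structure Sg} → Hom M N → Hom M N → Set
  _≗ʰ_ {M} {N} f g = ∀ {s} (a : Car M s) → Structure._≈_ N (fn f a) (fn g a)

  record Iso (M N : Structure Sg) : Set where
    no-eta-equality
    field
      to   : Hom M N
      from : Hom N M
      from-to : from ∘ʰ to ≗ʰ idHom M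
      to-from : to ∘ʰ from ≗ʰ idHom N

  iso-refl : (M : Structure Sg) → Iso M M
  iso-refl M .Iso.to = idHom M
  iso-refl M .Iso.from = idHom M
  iso-refl M .Iso.from-to a = Structure.≈-refl M
  iso-refl M .Iso.to-from a = Structure.≈-refl M

  iso-sym : {M N : Structure Sg} → Iso M N → Iso N M
  iso-sym i .Iso.to = Iso.from i
  iso-sym i .Iso.from = Iso.to i
  iso-sym i .Iso.from-to = Iso.to-from i
  iso-sym i .Iso.to-from = Iso.from-to i

  iso-trans : {M N O : Structure Sg} → Iso M N → Iso N O → Iso M O
  iso-trans i j .Iso.to = Iso.to j ∘ʰ Iso.to i
  iso-trans i j .Iso.from = Iso.from i ∘ʰ Iso.from j
  iso-trans {M = M} i j .Iso.from-to a = Structure.≈-trans M (fn-cong (Iso.from i) (Iso.from-to j _))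
      (Iso.from-to i a)
  iso-trans {O = O} i j .Iso.to-from a = Structure.≈-trans O (fn-cong (Iso.to j) (Iso.to-from i _))
      (Iso.to-from j a)

  iso-valid : {M N : Structure Sg} → Iso M N → (σ : Sequent Sg) → Valid M σ → Valid N σ
  iso-valid {M} {N} i (seq Γ φ ψ) v e q =
    Structure.Sat-cong N ψ (λ s x → Iso.to-from i (e s x))
      (Hom.fn-Sat (Iso.to i) ψ _ (v _ (Hom.fn-Sat (Iso.from i) φ e q)))

-- Canonical models: elements over A are the definable ones, that is, arrows from A to a sort.

-- Cartesianness relative to the whole theory instead of the preceding axioms. This consequence of
-- `IsCartesian` passes to Morita extensions without constructing a well-order on the new axioms.
CartAx : {Sg : Signature} → Theory Sg → Set
CartAx T = ∀ a → CartSeq T (axiom T a)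

module _ {Sg : Signature} {T : Theory Sg} where
  open Deduction T
  open Substitution Sg

  bigAnd-elim : ∀ {Ξ} {I : Set} (Δ : List I) (F : ∀ s → s ∈ Δ → Formula Sg Ξ) {k : Formula Sg Ξ} →
                k ⊢ bigAnd Δ (λ {s} → F s) → ∀ s x → k ⊢ F s x
  bigAnd-elim (_ ∷ Δ) F d _ (here refl) = cut d ∧-elimˡ
  bigAnd-elim (_ ∷ Δ) F d s (there x)   = bigAnd-elim Δ (λ s x → F s (there x)) (cut d ∧-elimʳ) s x

  bigAnd-cart : ∀ {Ξ} {I : Set} (Δ : List I) (F : ∀ s → s ∈ Δ → Formula Sg Ξ) → (∀ s x → Cart T (F s x)) →
                Cart T (bigAnd Δ (λ {s} → F s))
  bigAnd-cart []      F c = ⊤-cart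
  bigAnd-cart (_ ∷ Δ) F c = ∧-cart (c _ (here refl)) (bigAnd-cart Δ (λ s x → F s (there x)) (λ s x → c s (there x)))

  -- ∃ x₁ … xₙ. θ₁(x₁, ρ) ∧ … ∧ θₙ(xₙ, ρ) ∧ φ, one variable at a time.
  pull : ∀ Δ {Γ Ξ} → Fam (λ s → Formula Sg (s ∷ Γ)) Δ → Subst Γ Ξ → Formula Sg (Δ ++ Ξ) → Formula Sg Ξ
  pull []      θ ρ φ = φ
  pull (s ∷ Δ) θ ρ φ = pull Δ (tail θ) ρ (∃ᶠ s (θ s (here refl) [ var (here refl) ▹
      (ρ ⨾ vars (λ x → there (inr Δ x))) ] ∧ᶠ φ))

  pull-sub : ∀ Δ {Γ Ξ Ξ' s} (θ : Formula Sg (s ∷ Γ)) (ρ : Subst Γ Ξ) (t : Subst Δ Ξ') (σ : Subst Ξ Ξ')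
      (y : Term Sg Ξ' s) →
             θ [ var (here refl) ▹ (ρ ⨾ vars (λ x → there (inr Δ x))) ] [ y ▹ cat Δ t σ ] ≡ θ [ y ▹ (ρ ⨾ σ) ]
  pull-sub Δ θ ρ t σ y = sub-sub-ext _ (y ▹ cat Δ t σ) (∷-cases _ refl (λ s x →
    trans (subT-sub (vars (λ x → there (inr Δ x))) (y ▹ cat Δ t σ) (ρ s x)) (subT-ext (cat-inr Δ t σ) (ρ s x)))) θ

  pull-intro : ∀ Δ {Γ Ξ Ξ'} (θ : Fam (λ s → Formula Sg (s ∷ Γ)) Δ) (ρ : Subst Γ Ξ) (φ : Formula Sg (Δ ++ Ξ))
               {k : Formula Sg Ξ'} (t : Subst Δ Ξ') (σ : Subst Ξ Ξ') →
               (∀ s x → k ⊢ θ s x [ t s x ▹ (ρ ⨾ σ) ]) → k ⊢ φ [ cat Δ t σ ] → k ⊢ pull Δ θ ρ φ [ σ ]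
  pull-intro []      θ ρ φ t σ p d = d
  pull-intro (s ∷ Δ) θ ρ φ t σ p d = pull-intro Δ (tail θ) ρ _ (tail t) σ (λ s x → p s (there x))
    (∃-intro _ (t s (here refl)) (cat Δ (tail t) σ)
      (∧-intro (⊢-≡ (sym (pull-sub Δ (θ s (here refl)) ρ (tail t) σ (t s (here refl)))) (p s (here refl))) d))

  pull-elim : ∀ Δ {Γ Ξ Ξ'} (θ : Fam (λ s → Formula Sg (s ∷ Γ)) Δ) (ρ : Subst Γ Ξ) (φ : Formula Sg (Δ ++ Ξ))
              {k χ : Formula Sg Ξ'} (σ : Subst Ξ Ξ') → k ⊢ pull Δ θ ρ φ [ σ ] →
              (∀ {Ξ″} (k' : Formula Sg Ξ″) (τ : Subst Ξ' Ξ″) → k' ⊢ k [ τ ] → (t : Subst Δ Ξ″) →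
                (∀ s x → k' ⊢ θ s x [ t s x ▹ (ρ ⨾ (σ ⨾ τ)) ]) → k' ⊢ φ [ cat Δ t (σ ⨾ τ) ] → k' ⊢ χ [ τ ]) → k ⊢ χ
  pull-elim [] θ ρ φ {k} {χ} σ d c =
    ⊢-≡ (sub-id χ) (c k ids (⊢-≡ (sym (sub-id k)) identity) ε (λ s ())
        (⊢-≡ (sub-ext (λ s x → sym (subT-id (σ s x))) φ) d))
  pull-elim (s ∷ Δ) θ ρ φ {k} {χ} σ d c = pull-elim Δ (tail θ) ρ _ σ d λ k' τ kk t ts d' →
    ∃-use _ (cat Δ t (σ ⨾ τ)) d' λ k″ υ kk' y dy →
      let eqc : ∀ s x → (cat Δ t (σ ⨾ τ) ⨾ υ) s x ≡ cat Δ (t ⨾ υ) (σ ⨾ (τ ⨾ υ)) s x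
          eqc = ++-cases Δ _
            (λ s x → trans (cong (_[ υ ]ᵗ) (cat-inl Δ t (σ ⨾ τ) s x)) (sym (cat-inl Δ (t ⨾ υ) (σ ⨾ (τ ⨾ υ)) s x)))
            (λ s x → trans (cong (_[ υ ]ᵗ) (cat-inr Δ t (σ ⨾ τ) s x))
                       (trans (subT-sub τ υ (σ s x)) (sym (cat-inr Δ (t ⨾ υ) (σ ⨾ (τ ⨾ υ)) s x))))
          dy' = ⊢-≡ (sub-ext (∷-cases _ refl eqc) (θ s (here refl) [ _ ] ∧ᶠ φ)) dy
      in ⊢-≡ (sym (sub-sub τ υ χ)) (c k″ (τ ⨾ υ) (⊢-≡ (sub-sub τ υ k) (instantiate kk υ kk'))
           (y ▹ (t ⨾ υ))
           (∷-cases _ (⊢-≡ (pull-sub Δ (θ s (here refl)) ρ (t ⨾ υ) (σ ⨾ (τ ⨾ υ)) y) (cut dy' ∧-elimˡ))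
             (λ s x → ⊢-≡ (sub-sub-ext _ υ (∷-cases _ refl (λ s' x' →
                 trans (subT-sub (σ ⨾ τ) υ (ρ s' x')) (subT-ext (λ s″ x″ → subT-sub τ υ (σ s″ x″)) (ρ s' x'))))
                     (θ s (there x)))
               (instantiate (ts s x) υ kk')))
           (cut dy' ∧-elimʳ))

  -- Each quantifier is guarded by its own single-valued θ, whose parameters avoid the other bound
  -- variables, so uniqueness can be checked one quantifier at a time.
  pull-cart : ∀ Δ {Γ Ξ} (θ : Fam (λ s → Formula Sg (s ∷ Γ)) Δ) (ρ : Subst Γ Ξ) (φ : Formula Sg (Δ ++ Ξ)) →
              (∀ s x → Cart T (θ s x)) → (∀ s x → SingleValued (θ s x)) → Cart T φ → Cart T (pull Δ θ ρ φ)
  pull-cart []      θ ρ φ ct u c = c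
  pull-cart (s ∷ Δ) θ ρ φ ct u c = pull-cart Δ (tail θ) ρ _ (λ s x → ct s (there x)) (λ s x → u s (there x))
    (∃-cart′ (∧-cart (cart-sub (ct s (here refl)) _) c) λ k σ t v p q → u s (here refl) k (τ ⨾ σ) t v
      (⊢-≡ (eq σ t) (cut p ∧-elimˡ)) (⊢-≡ (eq σ v) (cut q ∧-elimˡ)))
    where
      τ : Subst _ _
      τ = ρ ⨾ vars (inr Δ)
      eq : ∀ {Ξ'} (σ : Subst _ Ξ') t → θ s (here refl) [ var (here refl) ▹
          (ρ ⨾ vars (λ x → there (inr Δ x))) ] [ t ▹ σ ]
           ≡ θ s (here refl) [ t ▹ (τ ⨾ σ) ]
      eq σ t = sub-sub-ext _ (t ▹ σ) (∷-cases _ refl (λ s x →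
        trans (subT-sub (vars (λ x → there (inr Δ x))) (t ▹ σ) (ρ s x)) (sym (subT-sub (vars (inr Δ)) σ (ρ s x)))))
            (θ s (here refl))

  module Canon (A : SynObj T) where
    private
      Γ = octx A
      h = ofml A

    record El (s : Sort Sg) : Set where
      no-eta-equality
      field
        θ      : Formula Sg (s ∷ Γ)
        cart   : Cart T θ
        typed  : θ ⊢ wk h
        total  : h ⊢ ∃ᶠ s θ
        single : SingleValued θ

      typed′ : ∀ {Ξ} {k : Formula Sg Ξ} {t : Term Sg Ξ s} {σ : Subst Γ Ξ} → k ⊢ θ [ t ▹ σ ] → k ⊢ h [ σ ]
      typed′ {t = t} {σ} d = ⊢-≡ (ren-sub-ext there (t ▹ σ) (λ _ _ → refl) h) (instantiate typed (t ▹ σ) d)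
    open El

    Realises : ∀ {Δ Ξ} → Formula Sg Ξ → Fam El Δ → Subst Δ Ξ → Subst Γ Ξ → Set
    Realises k e t σ = ∀ s x → k ⊢ θ (e s x) [ t s x ▹ σ ]

    -- Says that φ of the elements `e` follows from `h`, without writing the formula that quantifies
    -- over their values: in any world, over any point σ of A, φ holds of whatever terms realise
    -- `e`.
    Forces : ∀ {Δ} → Formula Sg Δ → Fam El Δ → Set
    Forces {Δ} φ e = ∀ {Ξ} (k : Formula Sg Ξ) (σ : Subst Γ Ξ) (t : Subst Δ Ξ) → k ⊢ h [ σ ] → Realises k e t σ →
        k ⊢ φ [ t ]

    realises-sub : ∀ {Δ Ξ Ξ'} {k : Formula Sg Ξ} {k' : Formula Sg Ξ'} (e : Fam El Δ) {t σ} (τ : Subst Ξ Ξ') →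
                   k' ⊢ k [ τ ] → Realises k e t σ → Realises k' e (t ⨾ τ) (σ ⨾ τ)
    realises-sub e τ kk r s x = ⊢-≡ (sub-sub-ext _ τ (∷-cases _ refl (λ _ _ → refl)) (θ (e s x)))
        (instantiate (r s x) τ kk)

    realises-unique : ∀ {Δ Ξ} {k : Formula Sg Ξ} (e : Fam El Δ) {t u σ} → Realises k e t σ → Realises k e u σ →
                      ∀ s x → k ⊢ t s x ≐ u s x
    realises-unique {k = k} e {t} {u} {σ} p q s x = single (e s x) k σ (t s x) (u s x) (p s x) (q s x)

    realise : ∀ {Δ Ξ} (e : Fam El Δ) {k χ : Formula Sg Ξ} {σ : Subst Γ Ξ} → k ⊢ h [ σ ] →
              (∀ {Ξ'} (k' : Formula Sg Ξ') (τ : Subst Ξ Ξ') → k' ⊢ k [ τ ] → (t : Subst Δ Ξ') →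
                Realises k' e t (σ ⨾ τ) → k' ⊢ χ [ τ ]) → k ⊢ χ
    realise {[]} e {k} {χ} d c = ⊢-≡ (sub-id χ) (c k ids (⊢-≡ (sym (sub-id k)) identity) ε (λ s ()))
    realise {s ∷ Δ} e {k} {χ} {σ} d c = realise {Δ} (tail e) {k} {χ} {σ} d λ k' τ kk t r →
      ∃-use (θ (e s (here refl))) (σ ⨾ τ) (instantiate (total (e s (here refl))) (σ ⨾ τ)
          (⊢-≡ (sub-sub σ τ h) (instantiate d τ kk))) λ k″ υ kk' y dy →
        ⊢-≡ (sym (sub-sub τ υ χ)) (c k″ (τ ⨾ υ) (⊢-≡ (sub-sub τ υ k) (instantiate kk υ kk')) (y ▹ (t ⨾ υ))
          (∷-cases _ (⊢-≡ (sub-ext (∷-cases _ refl (λ s x → subT-sub τ υ (σ s x))) (θ (e s (here refl)))) dy)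
            (λ s x → ⊢-≡ (sub-ext (∷-cases _ refl (λ s x → subT-sub τ υ (σ s x))) (θ (e s (there x))))
                       (realises-sub (tail e) υ kk' r s x))))

    infix 4 _≈ᵉ_
    record _≈ᵉ_ {s} (a b : El s) : Set where
      no-eta-equality
      pattern
      constructor _⇄_
      field
        forth : θ a ⊢ θ b
        back  : θ b ⊢ θ a
    open _≈ᵉ_

    -- One inclusion between total relations on the same domain suffices: over a value of b there is
    -- by totality a value of a; it is a value of b too, and b is single-valued.
    ≈ᵉ-intro : ∀ {s} (a b : El s) → (∀ {Ξ} (k : Formula Sg Ξ) (σ : Subst Γ Ξ) y → k ⊢ θ a [ y ▹ σ ] →
        k ⊢ θ b [ y ▹ σ ]) → a ≈ᵉ b
    ≈ᵉ-intro {s} a b p = ⊢-≡ (eq b) (p (θ a) (vars there) (var (here refl)) (⊢-≡ (sym (eq a)) identity)) ⇄ b⊢a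
      where
        eq : ∀ (c : El s) → θ c [ var (here refl) ▹ vars there ] ≡ θ c
        eq c = trans (sub-ext (∷-cases _ refl (λ _ _ → refl)) (θ c)) (sub-id (θ c))
        b⊢a : θ b ⊢ θ a
        b⊢a = realise (a ▹ ε) {σ = vars there} (⊢-≡ (ren-sub there h) (typed b)) λ k' τ kk t r →
          let ta = r _ (here refl)
              tb = p k' _ _ ta
              bb = ⊢-≡ (sub-ext (∷-cases _ refl (λ _ _ → refl)) (θ b)) kk
              e  = single b k' _ _ _ tb bb
          in ⊢-≡ (sub-ext (∷-cases _ refl (λ _ _ → refl)) (θ a)) (≐-leibniz (θ a) _ e ta)

    ≈ᵉ-use : ∀ {s} {a b : El s} → a ≈ᵉ b → ∀ {Ξ} {k : Formula Sg Ξ} {σ : Subst Γ Ξ} {y} → k ⊢ θ a [ y ▹ σ ] →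
        k ⊢ θ b [ y ▹ σ ]
    ≈ᵉ-use p {σ = σ} {y} d = instantiate (forth p) (y ▹ σ) d

    module Desc {Δ s} (φ : Formula Sg (s ∷ Δ)) (e : Fam El Δ) where
      -- The conjunct `h` makes the described relation live over A even when Δ is empty and no θ
      -- enforces it.
      body : Formula Sg (Δ ++ (s ∷ Γ))
      body = h [ vars (λ x → inr Δ (there x)) ] ∧ᶠ φ [ var (inr Δ (here refl)) ▹ vars inl ]

      desc-θ : Formula Sg (s ∷ Γ)
      desc-θ = pull Δ (λ s x → θ (e s x)) (vars there) body

      body-φ : ∀ {Ξ} (t : Subst Δ Ξ) (y : Term Sg Ξ s) (σ : Subst Γ Ξ) (υ : Subst (s ∷ Γ) Ξ) →
          (∀ s x → υ s x ≡ (y ▹ σ) s x) →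
               φ [ var (inr Δ (here refl)) ▹ vars inl ] [ cat Δ t υ ] ≡ φ [ y ▹ t ]
      body-φ t y σ υ p = sub-sub-ext _ (cat Δ t υ) (∷-cases _
          (trans (cat-inr Δ t υ s (here refl)) (p s (here refl))) (cat-inl Δ t υ)) φ

      body-h : ∀ {Ξ} (t : Subst Δ Ξ) (y : Term Sg Ξ s) (σ : Subst Γ Ξ) (υ : Subst (s ∷ Γ) Ξ) →
          (∀ s x → υ s x ≡ (y ▹ σ) s x) →
               h [ vars (λ x → inr Δ (there x)) ] [ cat Δ t υ ] ≡ h [ σ ]
      body-h t y σ υ p = sub-sub-ext _ (cat Δ t υ) (λ s x → trans (cat-inr Δ t υ s (there x)) (p s (there x))) h

      desc-use : ∀ {Ξ} {k : Formula Sg Ξ} {t σ y} → k ⊢ desc-θ [ y ▹ σ ] → Realises k e t σ → k ⊢ φ [ y ▹ t ]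
      desc-use {t = t} {σ} {y} d r = pull-elim Δ _ _ body (y ▹ σ) d λ k' τ kk t' r' b →
        let υ = (y ▹ σ) ⨾ τ
            b' = ⊢-≡ (body-φ t' (y [ τ ]ᵗ) (σ ⨾ τ) υ (∷-cases _ refl (λ _ _ → refl))) (cut b ∧-elimʳ)
            rr = realises-sub e τ kk r
        in ⊢-≡ (sym (sub-sub-ext _ τ (∷-cases _ refl (λ _ _ → refl)) φ))
             (leibniz φ (y [ τ ]ᵗ ▹ t') (y [ τ ]ᵗ ▹ (t ⨾ τ))
               (∷-cases _ (≐-refl _) (realises-unique e
                 (λ s x → ⊢-≡ (sub-ext (∷-cases _ refl (λ _ _ → refl)) (θ (e s x))) (r' s x)) rr)) b')

      desc-make : ∀ {Ξ} {k : Formula Sg Ξ} {t σ y} → k ⊢ h [ σ ] → Realises k e t σ → k ⊢ φ [ y ▹ t ] →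
          k ⊢ desc-θ [ y ▹ σ ]
      desc-make {t = t} {σ} {y} kh r d = pull-intro Δ _ _ body t (y ▹ σ)
        (λ s x → ⊢-≡ (sub-ext (∷-cases _ refl (λ _ _ → refl)) (θ (e s x))) (r s x))
        (∧-intro (⊢-≡ (sym (body-h t y σ (y ▹ σ) (λ _ _ → refl))) kh)
            (⊢-≡ (sym (body-φ t y σ (y ▹ σ) (λ _ _ → refl))) d))

      desc-h : ∀ {Ξ} {k : Formula Sg Ξ} {σ y} → k ⊢ desc-θ [ y ▹ σ ] → k ⊢ h [ σ ]
      desc-h {σ = σ} {y} d = pull-elim Δ _ _ body (y ▹ σ) d λ k' τ kk t' r' b →
        ⊢-≡ (trans (body-h t' (y [ τ ]ᵗ) (σ ⨾ τ) ((y ▹ σ) ⨾ τ) (∷-cases _ refl (λ _ _ → refl)))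
            (sym (sub-sub σ τ h))) (cut b ∧-elimˡ)

      -- Definite description, needed twice: with the graph of a function symbol it interprets that
      -- symbol, and with a forced existential it supplies the witness.
      desc : Cart T φ → SingleValued φ → Forces (∃ᶠ s φ) e → El s
      desc c u f .θ = desc-θ
      desc c u f .cart = pull-cart Δ _ _ body (λ s x → cart (e s x)) (λ s x → single (e s x))
          (∧-cart (cart-sub (ocart A) _) (cart-sub c _))
      desc c u f .typed = ⊢-≡ (sym (ren-sub there h)) (desc-h {y = var (here refl)}
        (⊢-≡ (sym (trans (sub-ext (∷-cases _ refl (λ _ _ → refl)) desc-θ) (sub-id desc-θ))) identity))
      desc c u f .total = realise e {k = h} {σ = ids} (⊢-≡ (sym (sub-id h)) identity) λ k' τ kk t r →
        ∃-use φ t (f k' (ids ⨾ τ) t kk r) λ k″ υ kk' y dy →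
          ⊢-≡ (sym (sub-sub-ext τ υ (λ _ _ → refl) (∃ᶠ s desc-θ)))
            (∃-intro desc-θ y (τ ⨾ υ) (desc-make (⊢-≡ (sub-sub τ υ h) (instantiate kk υ kk'))
                (realises-sub e υ kk' r) dy))
      desc c u f .single k σ t v p q = realise e {k = k} {χ = t ≐ v} {σ = σ} (desc-h p) λ k' τ kk t' r →
        u k' t' _ _ (desc-use (moved τ kk p) r) (desc-use (moved τ kk q) r)
        where
          moved : ∀ {Ξ} {k' : Formula Sg Ξ} τ {y} → k' ⊢ k [ τ ] → k ⊢ desc-θ [ y ▹ σ ] → k' ⊢ desc-θ [ (y [ τ ]ᵗ) ▹
              (σ ⨾ τ) ]
          moved τ kk d = ⊢-≡ (sub-sub-ext _ τ (∷-cases _ refl (λ _ _ → refl)) desc-θ) (instantiate d τ kk)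

    open Desc using (desc; desc-use; desc-make; desc-h; desc-θ)

    graphF : ∀ {ss s} → Fun Sg ss s → Formula Sg (s ∷ ss)
    graphF f = app f (varsOf there) ≐ var (here refl)

    graphF-sub : ∀ {ss s Ξ} (f : Fun Sg ss s) (y : Term Sg Ξ s) (t : Subst ss Ξ) → graphF f [ y ▹ t ] ≡
        (app f (famTerms t) ≐ y)
    graphF-sub f y t = cong (λ ts → app f ts ≐ y) (trans (varsOf-sub there (y ▹ t)) (famTerms-ext (λ _ _ → refl)))

    appEl : ∀ {ss s} → Fun Sg ss s → Fam El ss → El s
    appEl f e = desc (graphF f) e ≐-cart
      (λ k σ t u p q → ≐-trans (≐-sym (⊢-≡ (graphF-sub f t σ) p)) (⊢-≡ (graphF-sub f u σ) q))
      (λ k σ t kh r → ∃-intro (graphF f) (app f (famTerms t)) t (⊢-≡ (sym (graphF-sub f _ t)) (≐-refl _)))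

    canonStr : Structure Sg
    canonStr .Structure.Car = El
    canonStr .Structure._≈_ = _≈ᵉ_
    canonStr .Structure.≈-refl = identity ⇄ identity
    canonStr .Structure.≈-sym (p ⇄ q) = q ⇄ p
    canonStr .Structure.≈-trans (p ⇄ q) (p' ⇄ q') = cut p p' ⇄ cut q' q
    canonStr .Structure.fun = appEl
    canonStr .Structure.fun-cong f {d} {e} p = ≈ᵉ-intro (appEl f d) (appEl f e) λ k σ y dy →
      realise d {σ = σ} (desc-h (graphF f) d dy) λ k' τ kk t r →
        let dy' = ⊢-≡ (sub-sub-ext _ τ (∷-cases _ refl (λ _ _ → refl)) (θ (appEl f d))) (instantiate dy τ kk)
        in ⊢-≡ (sym (sub-sub-ext _ τ (∷-cases _ refl (λ _ _ → refl)) (θ (appEl f e))))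
          (desc-make (graphF f) e (desc-h (graphF f) d dy') (λ s x → ≈ᵉ-use {a = d s x} {e s x} (p s x) (r s x))
              (desc-use (graphF f) d dy' r))
    canonStr .Structure.rl R e = Forces (rel R (varsOf (λ x → x))) e
    canonStr .Structure.rl-cong R {d} {e} p f k σ t kh r =
      f k σ t kh (λ s x → ≈ᵉ-use {a = e s x} {d s x} (back (p s x) ⇄ forth (p s x)) (r s x))

    mutual
      evalT-realises : ∀ {Δ s Ξ} (t : Term Sg Δ s) (e : Fam El Δ) {k : Formula Sg Ξ} {τ σ} → k ⊢ h [ σ ] →
          Realises k e τ σ →
                       k ⊢ θ (evalT canonStr t e) [ t [ τ ]ᵗ ▹ σ ]
      evalT-realises (var x)    e kh r = r _ x
      evalT-realises (app f ts) e {τ = τ} kh r = desc-make (graphF f) (evalTs canonStr ts e) kh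
          (evalTs-realises ts e kh r)
        (⊢-≡ (sym (trans (graphF-sub f _ _) (cong (λ us → app f us ≐ (app f ts [ τ ]ᵗ))
            (famTerms-termsFam (ts [ τ ]ᵗˢ))))) (≐-refl _))

      evalTs-realises : ∀ {Δ ss Ξ} (ts : Terms Sg Δ ss) (e : Fam El Δ) {k : Formula Sg Ξ} {τ σ} → k ⊢ h [ σ ] →
          Realises k e τ σ →
                        Realises k (evalTs canonStr ts e) (termsFam (ts [ τ ]ᵗˢ)) σ
      evalTs-realises (t ∷ₜ ts) e kh r _ (here refl) = evalT-realises t e kh r
      evalTs-realises (t ∷ₜ ts) e kh r s (there x)   = evalTs-realises ts e kh r s x

    rel-sub : ∀ {ss Ξ} (R : Rel Sg ss) (t : Subst ss Ξ) → rel R (varsOf (λ x → x)) [ t ] ≡ rel R (famTerms t)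
    rel-sub R t = cong (rel R) (varsOf-sub (λ x → x) t)

    mutual
      -- One half of the truth lemma. At an existential, the witnessing element is total over A, so
      -- it has a value in some extension of every world.
      truth : ∀ {Δ} {φ : Formula Sg Δ} → Cart T φ → (e : Fam El Δ) → Sat canonStr φ e → Forces φ e
      truth ⊤-cart e q k σ t kh r = ⊤-intro
      truth (∧-cart c d) e (p , q) k σ t kh r = ∧-intro (truth c e p k σ t kh r) (truth d e q k σ t kh r)
      truth (≐-cart {t = t} {u}) e p k σ τ kh r = single (evalT canonStr u e) k σ _ _
        (≈ᵉ-use {a = evalT canonStr t e} {evalT canonStr u e} p (evalT-realises t e kh r)) (evalT-realises u e kh r)
      truth (rel-cart {R = R} {ts}) e p k σ τ kh r =
        ⊢-≡ (trans (rel-sub R _) (cong (rel R) (famTerms-termsFam (ts [ τ ]ᵗˢ))))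
            (p k σ _ kh (evalTs-realises ts e kh r))
      truth (∃-cart {φ = φ} c u) e (a , q) k σ t kh r =
        ∃-use (θ a) σ (instantiate (total a) σ kh) λ k' τ kk y dy →
          ⊢-≡ (sym (sub-sub t τ (∃ᶠ _ φ))) (∃-intro φ y (t ⨾ τ)
            (truth c (a ▹ e) q k' (σ ⨾ τ) (y ▹ (t ⨾ τ)) (⊢-≡ (sub-sub σ τ h) (instantiate kh τ kk))
              (∷-cases _ dy (λ s x → realises-sub e τ kk r s x))))

      -- The converse half, where cartesianness is essential: a forced existential only has
      -- witnesses world by world, and their provable uniqueness glues them into one definable
      -- element.
      force : ∀ {Δ} {φ : Formula Sg Δ} → Cart T φ → (e : Fam El Δ) → Forces φ e → Sat canonStr φ e
      force ⊤-cart e f = tt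
      force (∧-cart c d) e f = force c e (λ k σ t kh r → cut (f k σ t kh r) ∧-elimˡ) , force d e
          (λ k σ t kh r → cut (f k σ t kh r) ∧-elimʳ)
      force (≐-cart {t = t} {u}) e f = ≈ᵉ-intro (evalT canonStr t e) (evalT canonStr u e) λ k σ y dy →
        realise e {σ = σ} (typed′ (evalT canonStr t e) dy) λ k' τ kk v r →
          let kh = ⊢-≡ (sub-sub σ τ h) (instantiate (typed′ (evalT canonStr t e) dy) τ kk)
              eq = f k' (σ ⨾ τ) v kh r
              dy' = ⊢-≡ (sub-sub-ext _ τ (∷-cases _ refl (λ _ _ → refl)) (θ (evalT canonStr t e)))
                  (instantiate dy τ kk)
              eq' = single (evalT canonStr t e) k' (σ ⨾ τ) _ _ (evalT-realises t e kh r) dy'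
          in ⊢-≡ (sym (sub-sub-ext _ τ (∷-cases _ refl (λ _ _ → refl)) (θ (evalT canonStr u e))))
               (≐-leibniz (θ (evalT canonStr u e)) (σ ⨾ τ) (≐-trans (≐-sym eq) eq') (evalT-realises u e kh r))
      force (rel-cart {R = R} {ts}) e f k σ t kh r = realise e {σ = σ} kh λ k' τ kk v rv →
        let kh' = ⊢-≡ (sub-sub σ τ h) (instantiate kh τ kk)
            d   = ⊢-≡ (sym (trans (rel-sub R (termsFam (ts [ v ]ᵗˢ)))
                (cong (rel R) (famTerms-termsFam (ts [ v ]ᵗˢ))))) (f k' (σ ⨾ τ) v kh' rv)
        in ⊢-≡ (sym (sub-sub-ext _ τ (λ _ _ → refl) (rel R (varsOf (λ x → x)))))
             (leibniz (rel R (varsOf (λ x → x))) _ _ (realises-unique (evalTs canonStr ts e)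
                 (evalTs-realises ts e kh' rv)
               (realises-sub (evalTs canonStr ts e) τ kk r)) d)
      force (∃-cart {φ = φ} c u) e f = desc φ e c (unique⇒single u) f ,
        force c _ λ k σ t kh r → ⊢-≡ (sub-ext (∷-cases _ refl (λ _ _ → refl)) φ)
          (desc-use φ e {y = t _ (here refl)} (r _ (here refl)) (λ s x → r s (there x)))

    genEl : ∀ {s} → s ∈ Γ → El s
    genEl x .θ = (var (here refl) ≐ var (there x)) ∧ᶠ wk h
    genEl x .cart = ∧-cart ≐-cart (cart-ren (ocart A) there)
    genEl x .typed = ∧-elimʳ
    genEl x .total = ⊢-≡ (sub-id _) (∃-intro ((var (here refl) ≐ var (there x)) ∧ᶠ wk h) (var x) ids
      (∧-intro (≐-refl _) (⊢-≡ (sym (trans (ren-sub-ext there (var x ▹ ids) (λ _ _ → refl) h)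
          (sub-id h))) identity)))
    genEl x .single k σ t u p q = ≐-trans (cut p ∧-elimˡ) (≐-sym (cut q ∧-elimˡ))

    gen : Fam El Γ
    gen s x = genEl x

    gen-Sat : Sat canonStr h gen
    gen-Sat = force (ocart A) gen λ k σ t kh r → leibniz h σ t (λ s x → ≐-sym (cut (r s x) ∧-elimˡ)) kh

    -- An element is an arrow out of A, hence its own value at the generic point. Evaluation at the
    -- generic point is therefore the identity.
    El-gen : ∀ {s} (a : El s) → Sat canonStr (θ a) (a ▹ gen)
    El-gen a = force (cart a) (a ▹ gen) λ k σ t kh r →
      ⊢-≡ (sub-ext (∷-cases _ refl (λ _ _ → refl)) (θ a))
        (leibniz (θ a) (t _ (here refl) ▹ σ) (t _ (here refl) ▹ tail t)
          (∷-cases _ (≐-refl _) (λ s x → ≐-sym (cut (r s (there x)) ∧-elimˡ))) (r _ (here refl)))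

    gen-derives : ∀ {ψ : Formula Sg Γ} → Cart T ψ → Sat canonStr ψ gen → h ⊢ ψ
    gen-derives {ψ} c q = ⊢-≡ (sub-id ψ) (truth c gen q h ids ids (⊢-≡ (sym (sub-id h)) identity)
      (λ s x → ∧-intro (≐-refl _) (⊢-≡ (sym (trans (ren-sub-ext there (var x ▹ ids) (λ _ _ → refl) h)
          (sub-id h))) identity)))

    module _ (cax : CartAx T) where
      canonModel : Model T
      canonModel .Model.str = canonStr
      canonModel .Model.valid a e q with axiom T a | cax a | axiom-rule {T = T} a
      ... | seq Δ φ ψ | c , d | ar = force d e λ k σ t kh r → instantiate ar t (truth c e q k σ t kh r)

    module Eval (M : Model T) (p : Env (str M) Γ) (ph : Sat (str M) h p) where
      private module M = Model M

      evalEl : ∀ {s} → El s → Car (str M) s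
      evalEl a = proj₁ (sound M (total a) p ph)

      evalEl-Sat : ∀ {s} (a : El s) → Sat (str M) (θ a) (evalEl a ▹ p)
      evalEl-Sat a = proj₂ (sound M (total a) p ph)

      evalEl-unique : ∀ {s} (a : El s) {y} → Sat (str M) (θ a) (y ▹ p) → y M.≈ evalEl a
      evalEl-unique a {y} q = sound M (single⇒unique {φ = θ a} (single a)) (y ▹ evalEl a ▹ p)
        (M.Sat-unsub (θ a) _ (∷-cases _ M.≈-refl (λ _ _ → M.≈-refl)) q ,
         M.Sat-unsub (θ a) _ (∷-cases _ M.≈-refl (λ _ _ → M.≈-refl)) (evalEl-Sat a))

      forces-Sat : ∀ {Δ} (φ : Formula Sg Δ) (e : Fam El Δ) → Forces φ e → Sat (str M) φ (λ s x → evalEl (e s x))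
      forces-Sat {Δ} φ e f = M.Sat-sub φ (vars inl) (λ s x → M.≈-≡ (cat-inl Δ _ p s x))
          (sound M (f k (vars (inr Δ)) (vars inl) ∧-elimʳ (bigAnd-elim Δ F ∧-elimˡ))
              (cat Δ (λ s x → evalEl (e s x)) p)
            (M.Sat-bigAnd-intro Δ F (λ s x → M.Sat-unsub (θ (e s x)) _
               (∷-cases _ (M.≈-≡ (cat-inl Δ _ p s x)) (λ s x → M.≈-≡ (cat-inr Δ _ p s x))) (evalEl-Sat (e s x)))
            , M.Sat-unsub h _ (λ s x → M.≈-≡ (cat-inr Δ _ p s x)) ph))
        where
          F : ∀ s → s ∈ Δ → Formula Sg (Δ ++ Γ)
          F s x = θ (e s x) [ var (inl x) ▹ vars (inr Δ) ]
          k = bigAnd Δ (λ {s} → F s) ∧ᶠ h [ vars (inr Δ) ]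

      evalHom : Hom canonStr (str M)
      evalHom .fn = evalEl
      evalHom .fn-cong {a = a} {b} q = evalEl-unique b (sound M (forth q) _ (evalEl-Sat a))
      evalHom .Hom.fn-fun f e = M.≈-trans (M.≈-sym (forces-Sat (graphF f) (appEl f e ▹ e) λ k σ t kh r →
          ⊢-≡ (sub-ext (∷-cases _ refl (λ _ _ → refl)) (graphF f))
            (desc-use (graphF f) e {y = t _ (here refl)} (r _ (here refl)) (λ s x → r s (there x)))))
        (M.fun-cong f (λ s x → M.evalTs-varsOf there _ s x))
      evalHom .Hom.fn-rel R e f = M.rl-cong R (λ s x → M.evalTs-varsOf (λ x → x) _ s x) (forces-Sat _ e f)

      eval-gen : ∀ s x → evalEl (gen s x) M.≈ p s x
      eval-gen s x = M.≈-sym (evalEl-unique (gen s x) (M.≈-refl , M.Sat-unren h there (λ _ _ → M.≈-refl) ph))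

  -- It is enough to test the sequent at the generic point of the canonical model of {Γ. φ}.
  completeness : CartAx T → ∀ {Γ} {φ ψ : Formula Sg Γ} → Cart T φ → Cart T ψ →
                 ((M : Model T) (e : Env (str M) Γ) → Sat (str M) φ e → Sat (str M) ψ e) → φ ⊢ ψ
  completeness cax {Γ} {φ} c d v = Canon.gen-derives ⟨ Γ ∣ φ , c ⟩ d
    (v (Canon.canonModel ⟨ Γ ∣ φ , c ⟩ cax) (Canon.gen ⟨ Γ ∣ φ , c ⟩) (Canon.gen-Sat ⟨ Γ ∣ φ , c ⟩))

cat-split : ∀ {Sg} (M : Structure Sg) Δ {Γ} (e : Env M (Δ ++ Γ)) →
            Structure._≋_ M e (cat Δ (λ s x → e s (inl x)) (λ s x → e s (inr Δ x)))
cat-split M Δ e = ++-cases Δ _ (λ s x → Structure.≈-≡ M (sym (cat-inl Δ _ _ s x)))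
  (λ s x → Structure.≈-≡ M (sym (cat-inr Δ (λ s x → e s (inl x)) _ s x)))

-- Points of objects and the action of arrows on them

record Pt {Sg : Signature} {T : Theory Sg} (M : Structure Sg) (A : SynObj T) : Set where
  no-eta-equality
  field
    env : Env M (octx A)
    sat : Sat M (ofml A) env
open Pt using (env; sat)

record EqPt {Sg : Signature} {T : Theory Sg} {M : Structure Sg} {A : SynObj T} (p q : Pt M A) : Set where
  no-eta-equality
  constructor mk≈
  field
    at : Structure._≋_ M (env p) (env q)
open EqPt using (at)

module _ {Sg : Signature} {T : Theory Sg} where
  mkPt : {M : Structure Sg} {A : SynObj T} (e : Env M (octx A)) → Sat M (ofml A) e → Pt M A
  mkPt e q .env = e
  mkPt e q .sat = q

  module _ {M : Structure Sg} {A : SynObj T} where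
    pt-refl : {p : Pt M A} → EqPt p p
    pt-refl .at s x = Structure.≈-refl M

    pt-sym : {p q : Pt M A} → EqPt p q → EqPt q p
    pt-sym e .at s x = Structure.≈-sym M (at e s x)

    pt-trans : {p q r : Pt M A} → EqPt p q → EqPt q r → EqPt p r
    pt-trans e f .at s x = Structure.≈-trans M (at e s x) (at f s x)

  mapPt : {M N : Structure Sg} {A : SynObj T} → Hom M N → Pt M A → Pt N A
  mapPt m p .env s x = fn m (env p s x)
  mapPt {A = A} m p .sat = Hom.fn-Sat m (ofml A) (env p) (sat p)

  mapPt-cong : {M N : Structure Sg} {A : SynObj T} (m : Hom M N) {p q : Pt M A} → EqPt p q → EqPt (mapPt m p)
      (mapPt m q)
  mapPt-cong m e .at s x = fn-cong m (at e s x)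

  module _ {A B : SynObj T} where
    private
      Γ = octx A
      Δ = octx B

    Graph : SynRaw T A B → (M : Structure Sg) → Pt M A → Pt M B → Set
    Graph r M p q = Sat M (SynRaw.fml r) (cat Δ (env q) (env p))

    module Apply (f : SynHom T A B) (M : Model T) (p : Pt (str M) A) where
      private
        module M = Model M
        open IsFunctionalRel (proj₂ f) using (typed; total; single)
        θ = SynRaw.fml (proj₁ f)
      value : Σ (M.Env Δ) λ d → M.Sat θ (cat Δ d (env p))
      value = M.Sat-∃* Δ θ (sound M total (env p) (sat p))

      ap : Pt (str M) B
      ap .env = proj₁ value
      ap .sat = M.Sat-ren (ofml B) inl (λ s x → M.≈-≡ (cat-inl Δ _ (env p) s x))
          (proj₂ (sound M typed _ (proj₂ value)))

      ap-graph : Graph (proj₁ f) (str M) p ap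
      ap-graph = proj₂ value

      ap-unique : (q : Pt (str M) B) → Graph (proj₁ f) (str M) p q → EqPt q ap
      ap-unique q g .at s x =
          M.≈-trans (M.≈-sym (M.≈-≡ (cat-inl Δ (env q) e' s x))) (M.≈-trans
            (M.Sat-allEq Δ (λ s x → var (inl x)) (λ s x → var (inr Δ (inl x)))
              (sound M single (cat Δ (env q) e')
                (M.Sat-unren θ _ (λ s x → M.≈-trans (M.≈-≡ (r₁ s x)) M.≈-refl) g ,
                 M.Sat-unren θ _ (λ s x → M.≈-≡ (r₂ s x)) (proj₂ value))) s x)
            (M.≈-trans (M.≈-≡ (cat-inr Δ (env q) e' s (inl x))) (M.≈-≡ (cat-inl Δ (proj₁ value) (env p) s x))))
        where
          e' = cat Δ (proj₁ value) (env p)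
          r₁ : ∀ s x → cat Δ (env q) e' s (++-elim Δ inl (λ x → inr Δ (inr Δ x)) x) ≡ cat Δ (env q) (env p) s x
          r₁ = ++-cases Δ _
            (λ s x → trans (cong (cat Δ (env q) e' s) (++-elim-inl Δ inl (λ x → inr Δ (inr Δ x)) s x))
                       (trans (cat-inl Δ (env q) e' s x) (sym (cat-inl Δ (env q) (env p) s x))))
            (λ s x → trans (cong (cat Δ (env q) e' s) (++-elim-inr Δ inl (λ x → inr Δ (inr Δ x)) s x))
                       (trans (cat-inr Δ (env q) e' s (inr Δ x))
                           (trans (cat-inr Δ (proj₁ value) (env p) s x) (sym (cat-inr Δ (env q) (env p) s x)))))
          r₂ : ∀ s x → cat Δ (env q) e' s (++-elim Δ (λ x → inr Δ (inl x)) (λ x → inr Δ (inr Δ x)) x) ≡ e' s x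
          r₂ = ++-cases Δ _
            (λ s x → trans (cong (cat Δ (env q) e' s) (++-elim-inl Δ (λ x → inr Δ (inl x))
                (λ x → inr Δ (inr Δ x)) s x))
                       (cat-inr Δ (env q) e' s (inl x)))
            (λ s x → trans (cong (cat Δ (env q) e' s) (++-elim-inr Δ (λ x → inr Δ (inl x))
                (λ x → inr Δ (inr Δ x)) s x))
                       (cat-inr Δ (env q) e' s (inr Δ x)))

    abstract
      ap : SynHom T A B → {M : Model T} → Pt (str M) A → Pt (str M) B
      ap f {M} p = Apply.ap f M p

      ap-graph : (f : SynHom T A B) {M : Model T} (p : Pt (str M) A) → Graph (proj₁ f) (str M) p (ap f {M} p)
      ap-graph f {M} p = Apply.ap-graph f M p

      ap-unique : (f : SynHom T A B) {M : Model T} (p : Pt (str M) A) (q : Pt (str M) B) →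
                  Graph (proj₁ f) (str M) p q → EqPt q (ap f {M} p)
      ap-unique f {M} p = Apply.ap-unique f M p

    graph-cong : (f : SynRaw T A B) (M : Structure Sg) {p p' : Pt M A} {q q' : Pt M B} → EqPt p p' → EqPt q q' →
        Graph f M p q → Graph f M p' q'
    graph-cong f M e d = Structure.Sat-cong M (SynRaw.fml f) (Structure.cat-cong M Δ (at d) (at e))

    ap-cong : (f : SynHom T A B) {M : Model T} {p q : Pt (str M) A} → EqPt p q → EqPt (ap f {M} p) (ap f {M} q)
    ap-cong f {M} {p} {q} e = ap-unique f {M} q (ap f {M} p) (graph-cong (proj₁ f) (str M) {p} {q}
        {ap f {M} p} e pt-refl (ap-graph f {M} p))

    -- Homomorphisms preserve the graph formula, and the value of f is the only point on the graph.
    ap-natural : (f : SynHom T A B) {M N : Model T} (m : Hom (str M) (str N)) (p : Pt (str M) A) →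
                 EqPt (mapPt m (ap f {M} p)) (ap f {N} (mapPt m p))
    ap-natural f {M} {N} m p = ap-unique f {N} (mapPt m p) (mapPt m (ap f {M} p))
      (Model.Sat-cong N (SynRaw.fml (proj₁ f)) (++-cases Δ _
         (λ s x → N.≈-≡ (trans (cong (fn m) (cat-inl Δ (env (ap f {M} p)) (env p) s x)) (sym (cat-inl Δ _ _ s x))))
         (λ s x → N.≈-≡ (trans (cong (fn m) (cat-inr Δ (env (ap f {M} p)) (env p) s x)) (sym (cat-inr Δ _ _ s x)))))
        (Hom.fn-Sat m (SynRaw.fml (proj₁ f)) _ (ap-graph f {M} p)))
      where module N = Model N

    ≈ₛ⇒ap : (f g : SynHom T A B) → _≈ₛ_ T (proj₁ f) (proj₁ g) → {M : Model T} (p : Pt (str M) A) → EqPt (ap f {M} p)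
        (ap g {M} p)
    ≈ₛ⇒ap f g e {M} p = ap-unique g {M} p (ap f {M} p) (sound M (proj₁ e) _ (ap-graph f {M} p))

  allEq-cart : ∀ {Ξ} Δ (f g : Substitution.Subst Sg Δ Ξ) → Cart T (allEq Δ (λ {s} → f s) (λ {s} → g s))
  allEq-cart []      f g = ⊤-cart
  allEq-cart (_ ∷ Δ) f g = ∧-cart ≐-cart (allEq-cart Δ (tail f) (tail g))

-- Arrows constructed and compared through their action on points

module Complete {Sg : Signature} {T : Theory Sg} (cax : CartAx T) where
  open Deduction T
  open Substitution Sg
  open Canon using (El; evalTs-realises)

  K : SynObj T → Model T
  K A = Canon.canonModel A cax

  JointlyUnique : ∀ Δ {Γ} → Formula Sg (Δ ++ Γ) → Set₁
  JointlyUnique Δ {Γ} θ = (M : Model T) (e : Env (str M) Γ) (d d' : Env (str M) Δ) →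
    Sat (str M) θ (cat Δ d e) → Sat (str M) θ (cat Δ d' e) → Structure._≋_ (str M) d d'

  unique-sem : ∀ {Γ s} {φ : Formula Sg (s ∷ Γ)} → Cart T φ →
               ((M : Model T) (e : Env (str M) Γ) (a b : Car (str M) s) → Sat (str M) φ (a ▹ e) → Sat (str M) φ
                   (b ▹ e) → Model._≈_ M a b) →
               Unique T φ
  unique-sem {φ = φ} c u = completeness cax (∧-cart (cart-sub c _) (cart-sub c _)) ≐-cart λ M e q →
    u M (λ s x → e s (there (there x))) _ _
      (Model.Sat-sub M φ _ (∷-cases _ (Model.≈-refl M) (λ _ _ → Model.≈-refl M)) (proj₁ q))
      (Model.Sat-sub M φ _ (∷-cases _ (Model.≈-refl M) (λ _ _ → Model.≈-refl M)) (proj₂ q))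

  -- At the innermost quantifier the remaining variables of Δ are still free; joint uniqueness,
  -- applied to two tuples that agree in them, gives uniqueness of the bound variable.
  ∃*-cart : ∀ Δ {Γ} {θ : Formula Sg (Δ ++ Γ)} → Cart T θ → JointlyUnique Δ θ → Cart T (∃* Δ θ)
  ∃*-cart []      c u = c
  ∃*-cart (s ∷ Δ) {θ = θ} c u = ∃*-cart Δ (∃-cart c (unique-sem c λ M e a b p q →
      u M (λ s x → e s (inr Δ x)) (a ▹ (λ s x → e s (inl x))) (b ▹ (λ s x → e s (inl x)))
        (Model.Sat-cong M θ (∷-cases _ (Model.≈-refl M) (cat-split (str M) Δ e)) p)
        (Model.Sat-cong M θ (∷-cases _ (Model.≈-refl M) (cat-split (str M) Δ e)) q) s (here refl)))
    (λ M e d d' p q s x → u M e (proj₁ p ▹ d) (proj₁ q ▹ d') (proj₂ p) (proj₂ q) s (there x))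

  -- The clauses of `IsFunctionalRel` read in all models. Completeness turns them into derivations,
  -- so identities, composites and the arrows coming from points are built semantically.
  record SemFun (A B : SynObj T) (θ : Formula Sg (octx B ++ octx A)) : Set₁ where
    no-eta-equality
    field
      cart   : Cart T θ
      typed  : (M : Model T) (e : Env (str M) (octx A)) (d : Env (str M) (octx B)) → Sat (str M) θ
          (cat (octx B) d e) →
               Sat (str M) (ofml A) e × Sat (str M) (ofml B) d
      total  : (M : Model T) (p : Pt (str M) A) → Σ (Env (str M) (octx B)) λ d → Sat (str M) θ
          (cat (octx B) d (env p))
      single : JointlyUnique (octx B) θ

  module _ {A B : SynObj T} where
    private
      Γ = octx A
      Δ = octx B

    abstract
      semIsFun : {θ : Formula Sg (Δ ++ Γ)} → SemFun A B θ → IsFunctionalRel T A B (raw θ)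
      semIsFun {θ} F = record
        { cart = cart
        ; typed = completeness cax cart (∧-cart (cart-ren (ocart A) (inr Δ)) (cart-ren (ocart B) inl)) λ M e q →
            let r = typed M _ _ (Model.Sat-cong M θ (cat-split (str M) Δ e) q)
            in Model.Sat-unren M (ofml A) (inr Δ) (λ _ _ → Model.≈-refl M) (proj₁ r) ,
               Model.Sat-unren M (ofml B) inl (λ _ _ → Model.≈-refl M) (proj₂ r)
        ; total = completeness cax (ocart A) (∃*-cart Δ cart single) λ M e q →
            let r = total M (mkPt e q) in Model.Sat-∃*-intro M Δ θ (proj₁ r) (proj₂ r)
        ; single = completeness cax (∧-cart (cart-ren cart _) (cart-ren cart _)) (allEq-cart Δ _ _) λ M e q →
            Model.Sat-allEq-intro M Δ (λ s x → var (inl x)) (λ s x → var (inr Δ (inl x)))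
              (single M (λ s x → e s (inr Δ (inr Δ x))) (λ s x → e s (inl x)) (λ s x → e s (inr Δ (inl x)))
                (Model.Sat-ren M θ _ (++-cases Δ _
                  (λ s x → Model.≈-≡ M (trans (cong (e s) (++-elim-inl Δ inl (λ x → inr Δ (inr Δ x)) s x))
                      (sym (cat-inl Δ _ _ s x))))
                  (λ s x → Model.≈-≡ M (trans (cong (e s) (++-elim-inr Δ inl (λ x → inr Δ (inr Δ x)) s x))
                      (sym (cat-inr Δ (λ s x → e s (inl x)) _ s x)))))
                  (proj₁ q))
                (Model.Sat-ren M θ _ (++-cases Δ _
                  (λ s x → Model.≈-≡ M (trans (cong (e s) (++-elim-inl Δ (λ x → inr Δ (inl x))
                      (λ x → inr Δ (inr Δ x)) s x)) (sym (cat-inl Δ _ _ s x))))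
                  (λ s x → Model.≈-≡ M (trans (cong (e s) (++-elim-inr Δ (λ x → inr Δ (inl x))
                      (λ x → inr Δ (inr Δ x)) s x)) (sym (cat-inr Δ (λ s x → e s (inr Δ (inl x))) _ s x)))))
                  (proj₂ q)))
        }
        where open SemFun F

    semHom : {θ : Formula Sg (Δ ++ Γ)} → SemFun A B θ → SynHom T A B
    semHom {θ} F = raw θ , semIsFun F

    ap-semHom : {θ : Formula Sg (Δ ++ Γ)} (F : SemFun A B θ) {M : Model T} (p : Pt (str M) A) (q : Pt (str M) B) →
                Sat (str M) θ (cat Δ (env q) (env p)) → EqPt q (ap (semHom F) {M} p)
    ap-semHom F {M} p q = ap-unique (semHom F) {M} p q

    private
      graph⇒ : (f g : SynHom T A B) → ({M : Model T} (p : Pt (str M) A) → EqPt (ap f {M} p) (ap g {M} p)) →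
               SynRaw.fml (proj₁ f) ⊢ SynRaw.fml (proj₁ g)
      graph⇒ f g E = completeness cax (IsFunctionalRel.cart (proj₂ f)) (IsFunctionalRel.cart (proj₂ g)) λ M e q →
        let ty = sound M (IsFunctionalRel.typed (proj₂ f)) e q
            p  = mkPt {M = str M} {A = A} (λ s x → e s (inr Δ x))
                (Model.Sat-ren M (ofml A) (inr Δ) (λ _ _ → Model.≈-refl M) (proj₁ ty))
            q' = mkPt {M = str M} {A = B} (λ s x → e s (inl x))
                (Model.Sat-ren M (ofml B) inl (λ _ _ → Model.≈-refl M) (proj₂ ty))
            u  = ap-unique f {M} p q' (Model.Sat-cong M (SynRaw.fml (proj₁ f)) (cat-split (str M) Δ e) q)
        in Model.Sat-cong M (SynRaw.fml (proj₁ g)) (λ s x → Model.≈-sym M (cat-split (str M) Δ e s x))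
             (graph-cong (proj₁ g) (str M) {p} {p} pt-refl (pt-sym (pt-trans u (E p))) (ap-graph g {M} p))

    -- Two graphs with the same points in all models entail each other by completeness.
    ap⇒≈ₛ : (f g : SynHom T A B) → ({M : Model T} (p : Pt (str M) A) → EqPt (ap f {M} p) (ap g {M} p)) → _≈ₛ_ T
        (proj₁ f) (proj₁ g)
    ap⇒≈ₛ f g E = graph⇒ f g E , graph⇒ g f (λ p → pt-sym (E p))

  module _ (A : SynObj T) where
    private
      Γ = octx A
      F : SemFun A A (SynRaw.fml (synId T A))
      F .SemFun.cart = ∧-cart (cart-ren (ocart A) _) (allEq-cart Γ _ _)
      F .SemFun.typed M e d (q , r) = q' , Model.Sat-cong M (ofml A) eq q'
        where
          q' = Model.Sat-ren M (ofml A) (inr Γ) (λ s x → Model.≈-≡ M (cat-inr Γ d e s x)) q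
          eq : ∀ s x → Model._≈_ M (e s x) (d s x)
          eq s x = Model.≈-trans M (Model.≈-≡ M (sym (cat-inr Γ d e s x))) (Model.≈-trans M
            (Model.≈-sym M (Model.Sat-allEq M Γ (λ s x → var (inl x)) (λ s x → var (inr Γ x)) r s x))
                (Model.≈-≡ M (cat-inl Γ d e s x)))
      F .SemFun.total M p = env p , Model.Sat-unren M (ofml A) (inr Γ) (λ s x → Model.≈-≡ M (cat-inr Γ _ _ s x))
          (sat p) ,
        Model.Sat-allEq-intro M Γ (λ s x → var (inl x)) (λ s x → var (inr Γ x)) (λ s x →
          Model.≈-≡ M (trans (cat-inl Γ (env p) (env p) s x) (sym (cat-inr Γ (env p) (env p) s x))))
      F .SemFun.single M e d d' (_ , q) (_ , r) s x =
        Model.≈-trans M (eq d q) (Model.≈-sym M (eq d' r))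
        where
          eq : ∀ d → Sat (str M) (allEq Γ (λ x → var (inl x)) (λ x → var (inr Γ x))) (cat Γ d e) → Model._≈_ M
              (d s x) (e s x)
          eq d q = Model.≈-trans M (Model.≈-≡ M (sym (cat-inl Γ d e s x))) (Model.≈-trans M
            (Model.Sat-allEq M Γ (λ s x → var (inl x)) (λ s x → var (inr Γ x)) q s x)
                (Model.≈-≡ M (cat-inr Γ d e s x)))

    idH : SynHom T A A
    idH = semHom F

    ap-id : {M : Model T} (p : Pt (str M) A) → EqPt (ap idH {M} p) p
    ap-id {M} p = pt-sym (ap-semHom F {M} p p (proj₂ (SemFun.total F M p)))

  module _ {A B C : SynObj T} (g : SynHom T B C) (f : SynHom T A B) where
    private
      Γ = octx A
      Δ = octx B
      Ξ = octx C
      θ = SynRaw.fml (proj₁ f)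
      η = SynRaw.fml (proj₁ g)
      both : Formula Sg (Δ ++ (Ξ ++ Γ))
      both = renF (++-elim Δ inl (λ x → inr Δ (inr Ξ x))) θ ∧ᶠ renF (++-elim Ξ (λ x → inr Δ (inl x)) inl) η
      module _ (M : Model T) (e : Env (str M) Γ) (d : Env (str M) Δ) (c : Env (str M) Ξ) where
        private E = cat Δ d (cat Ξ c e)
        eqθ : ∀ s x → E s (++-elim Δ inl (λ x → inr Δ (inr Ξ x)) x) ≡ cat Δ d e s x
        eqθ = ++-cases Δ _
          (λ s x → trans (cong (E s) (++-elim-inl Δ inl (λ x → inr Δ (inr Ξ x)) s x))
              (trans (cat-inl Δ d _ s x) (sym (cat-inl Δ d e s x))))
          (λ s x → trans (cong (E s) (++-elim-inr Δ inl (λ x → inr Δ (inr Ξ x)) s x))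
            (trans (cat-inr Δ d _ s (inr Ξ x)) (trans (cat-inr Ξ c e s x) (sym (cat-inr Δ d e s x)))))
        eqη : ∀ s x → E s (++-elim Ξ (λ x → inr Δ (inl x)) inl x) ≡ cat Ξ c d s x
        eqη = ++-cases Ξ _
          (λ s x → trans (cong (E s) (++-elim-inl Ξ (λ x → inr Δ (inl x)) inl s x))
            (trans (cat-inr Δ d _ s (inl x)) (trans (cat-inl Ξ c e s x) (sym (cat-inl Ξ c d s x)))))
          (λ s x → trans (cong (E s) (++-elim-inr Ξ (λ x → inr Δ (inl x)) inl s x))
              (trans (cat-inl Δ d _ s x) (sym (cat-inr Ξ c d s x))))
        split : Sat (str M) both E →
                Sat (str M) θ (cat Δ d e) × Sat (str M) η (cat Ξ c d)
        split (q , r) = Model.Sat-ren M θ _ (λ s x → Model.≈-≡ M (eqθ s x)) q , Model.Sat-ren M η _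
            (λ s x → Model.≈-≡ M (eqη s x)) r
        join : Sat (str M) θ (cat Δ d e) → Sat (str M) η (cat Ξ c d) →
               Sat (str M) both E
        join q r = Model.Sat-unren M θ _ (λ s x → Model.≈-≡ M (eqθ s x)) q , Model.Sat-unren M η _
            (λ s x → Model.≈-≡ M (eqη s x)) r
      graphs-sat : {X Y : SynObj T} (f : SynHom T X Y) (M : Model T) (e : Env (str M) (octx X))
          (d : Env (str M) (octx Y)) →
                   Sat (str M) (SynRaw.fml (proj₁ f)) (cat (octx Y) d e) → Sat (str M) (ofml X) e × Sat (str M)
                       (ofml Y) d
      graphs-sat {X} {Y} f M e d q =
        let r = sound M (IsFunctionalRel.typed (proj₂ f)) _ q
        in Model.Sat-ren M (ofml X) (inr (octx Y)) (λ s x → Model.≈-≡ M (cat-inr (octx Y) d e s x)) (proj₁ r) ,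
           Model.Sat-ren M (ofml Y) inl (λ s x → Model.≈-≡ M (cat-inl (octx Y) d e s x)) (proj₂ r)
      θ-unique : (M : Model T) (e : Env (str M) Γ) (d d' : Env (str M) Δ) → Sat (str M) θ (cat Δ d e) → Sat
          (str M) θ (cat Δ d' e) → Structure._≋_ (str M) d d'
      θ-unique M e d d' q r s x =
        let a = graphs-sat f M e d q ; b = graphs-sat f M e d' r
            p = mkPt {M = str M} {A = A} e (proj₁ a)
        in Model.≈-trans M (at (ap-unique f {M} p (mkPt d (proj₂ a)) q) s x)
            (Model.≈-sym M (at (ap-unique f {M} p (mkPt d' (proj₂ b)) r) s x))
      F : SemFun A C (SynRaw.fml (synComp T (proj₁ g) (proj₁ f)))
      F .SemFun.cart = ∃*-cart Δ (∧-cart (cart-ren (IsFunctionalRel.cart (proj₂ f)) _)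
          (cart-ren (IsFunctionalRel.cart (proj₂ g)) _))
        λ M e d d' q r → θ-unique M (λ s x → e s (inr Ξ x)) d d'
            (proj₁ (split M (λ s x → e s (inr Ξ x)) d (λ s x → e s (inl x)) (spl M e d q)))
            (proj₁ (split M (λ s x → e s (inr Ξ x)) d' (λ s x → e s (inl x)) (spl M e d' r)))
        where
          spl : ∀ (M : Model T) (e : Env (str M) (Ξ ++ Γ)) d → Sat (str M) both (cat Δ d e) → Sat (str M) both
              (cat Δ d (cat Ξ (λ s x → e s (inl x)) (λ s x → e s (inr Ξ x))))
          spl M e d = Model.Sat-cong M both (Model.cat-cong M Δ (λ _ _ → Model.≈-refl M) (cat-split (str M) Ξ e))
      F .SemFun.typed M e c q =
        let r = Model.Sat-∃* M Δ _ q
            z = split M e (proj₁ r) c (proj₂ r)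
        in proj₁ (graphs-sat f M e (proj₁ r) (proj₁ z)) , proj₂ (graphs-sat g M (proj₁ r) c (proj₂ z))
      F .SemFun.total M p = env (ap g {M} (ap f {M} p)) , Model.Sat-∃*-intro M Δ _ (env (ap f {M} p))
        (join M _ _ _ (ap-graph f {M} p) (ap-graph g {M} (ap f {M} p)))
      F .SemFun.single M e c c' q q' s x =
        let r = Model.Sat-∃* M Δ _ q ; r' = Model.Sat-∃* M Δ _ q'
            z = split M e (proj₁ r) c (proj₂ r) ; z' = split M e (proj₁ r') c' (proj₂ r')
            u = θ-unique M e _ _ (proj₁ z) (proj₁ z')
            y = graphs-sat g M _ c (proj₂ z) ; y' = graphs-sat g M _ c' (proj₂ z')
            b = mkPt {M = str M} {A = B} (proj₁ r) (proj₁ y) ; b' = mkPt {M = str M} {A = B} (proj₁ r') (proj₁ y')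
        in Model.≈-trans M (at (ap-unique g {M} b (mkPt c (proj₂ y)) (proj₂ z)) s x)
             (Model.≈-trans M (at (ap-cong g {M} {b} {b'} (mk≈ u)) s x)
               (Model.≈-sym M (at (ap-unique g {M} b' (mkPt c' (proj₂ y')) (proj₂ z')) s x)))

    infixr 9 _∙_
    _∙_ : SynHom T A C
    _∙_ = semHom F

    ap-∙ : {M : Model T} (p : Pt (str M) A) → EqPt (ap _∙_ {M} p) (ap g {M} (ap f {M} p))
    ap-∙ {M} p = pt-sym (ap-semHom F {M} p (ap g {M} (ap f {M} p)) (proj₂ (SemFun.total F M p)))

  evalAt : {A : SynObj T} {M : Model T} → Pt (str M) A → Hom (str (K A)) (str M)
  evalAt {A} {M} p = Canon.Eval.evalHom A M (env p) (sat p)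

  genPt : (A : SynObj T) → Pt (str (K A)) A
  genPt A .env = Canon.gen A
  genPt A .sat = Canon.gen-Sat A

  evalAt-gen : {A : SynObj T} {M : Model T} (p : Pt (str M) A) → EqPt (mapPt (evalAt {M = M} p) (genPt A)) p
  evalAt-gen {A} {M} p .at = Canon.Eval.eval-gen A M (env p) (sat p)

  evalAt-natural : {A : SynObj T} {M N : Model T} (m : Hom (str M) (str N)) (p : Pt (str M) A) →
                   m ∘ʰ evalAt {M = M} p ≗ʰ evalAt {M = N} (mapPt m p)
  evalAt-natural {A} {M} {N} m p a = Canon.Eval.evalEl-unique A N _ _ a
    (Model.Sat-cong N (El.θ a) (∷-cases _ (Model.≈-refl N) (λ _ _ → Model.≈-refl N))
        (Hom.fn-Sat m (El.θ a) _ (Canon.Eval.evalEl-Sat A M (env p) (sat p) a)))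

  evalAt-cong : {A : SynObj T} {M : Model T} {p q : Pt (str M) A} → EqPt p q → evalAt {M = M} p ≗ʰ evalAt {M = M} q
  evalAt-cong {A} {M} {p} {q} e a = Canon.Eval.evalEl-unique A M _ (sat q) a
    (Model.Sat-cong M (El.θ a) (∷-cases _ (Model.≈-refl M) (at e)) (Canon.Eval.evalEl-Sat A M (env p) (sat p) a))

  module _ {A B : SynObj T} (q : Pt (str (K A)) B) where
    private
      Γ = octx A
      Δ = octx B
      G : ∀ s → s ∈ Δ → Formula Sg (Δ ++ Γ)
      G s x = El.θ (env q s x) [ var (inl x) ▹ vars (inr Δ) ]
      θ : Formula Sg (Δ ++ Γ)
      θ = renF (inr Δ) (ofml A) ∧ᶠ bigAnd Δ (λ {s} → G s)
      component : (M : Model T) (p : Pt (str M) A) (d : Env (str M) Δ) → Sat (str M) θ (cat Δ d (env p)) →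
                  Structure._≋_ (str M) d (env (mapPt (evalAt {M = M} p) q))
      component M p d (_ , r) s x = Canon.Eval.evalEl-unique A M (env p) (sat p) (env q s x)
        (Model.Sat-sub M (El.θ (env q s x)) _ (∷-cases _ (Model.≈-≡ M (cat-inl Δ d (env p) s x))
            (λ s x → Model.≈-≡ M (cat-inr Δ d (env p) s x)))
          (Model.Sat-bigAnd M Δ G r s x))
      at-point : (M : Model T) (e : Env (str M) Γ) (d : Env (str M) Δ) → Sat (str M) θ (cat Δ d e) → Pt (str M) A
      at-point M e d r = mkPt e (Model.Sat-ren M (ofml A) (inr Δ) (λ s x → Model.≈-≡ M (cat-inr Δ d e s x))
          (proj₁ r))
      F : SemFun A B θ
      F .SemFun.cart = ∧-cart (cart-ren (ocart A) _) (bigAnd-cart Δ G (λ s x → cart-sub (El.cart (env q s x)) _))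
      F .SemFun.typed M e d r = sat p , Model.Sat-cong M (ofml B) (λ s x → Model.≈-sym M (component M p d r s x))
          (sat (mapPt (evalAt {M = M} p) q))
        where p = at-point M e d r
      F .SemFun.total M p = env q' , Model.Sat-unren M (ofml A) (inr Δ) (λ s x → Model.≈-≡ M (cat-inr Δ _ _ s x))
          (sat p) ,
          Model.Sat-bigAnd-intro M Δ G (λ s x → Model.Sat-unsub M (El.θ (env q s x)) _
            (∷-cases _ (Model.≈-≡ M (cat-inl Δ (env q') (env p) s x))
                (λ s x → Model.≈-≡ M (cat-inr Δ (env q') (env p) s x)))
            (Canon.Eval.evalEl-Sat A M (env p) (sat p) (env q s x)))
        where q' = mapPt (evalAt {M = M} p) q
      F .SemFun.single M e d d' r r' s x = Model.≈-trans M (component M p d r s x)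
          (Model.≈-sym M (component M p d' r' s x))
        where p = at-point M e d r

    -- A point of B in `K A` is a tuple of functional relations out of A; its arrow has their
    -- conjunction as graph. This is the inverse of evaluating an arrow at the generic point.
    homOf : SynHom T A B
    homOf = semHom F

    ap-homOf : {M : Model T} (p : Pt (str M) A) → EqPt (ap homOf {M} p) (mapPt (evalAt {M = M} p) q)
    ap-homOf {M} p = pt-sym (ap-semHom F {M} p (mapPt (evalAt {M = M} p) q) (proj₂ (SemFun.total F M p)))

  module Pullback {A B C : SynObj T} (f : SynHom T A C) (g : SynHom T B C) where
    private
      Γ = octx A
      Δ = octx B
      Ξ = octx C
      θf = SynRaw.fml (proj₁ f)
      θg = SynRaw.fml (proj₁ g)
      ρf : Ren (Ξ ++ Γ) (Ξ ++ (Γ ++ Δ))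
      ρf = ++-elim Ξ inl (λ x → inr Ξ (inl x))
      ρg : Ren (Ξ ++ Δ) (Ξ ++ (Γ ++ Δ))
      ρg = ++-elim Ξ inl (λ x → inr Ξ (inr Γ x))
      common : Formula Sg (Ξ ++ (Γ ++ Δ))
      common = renF ρf θf ∧ᶠ renF ρg θg
      module _ (M : Model T) (e : Env (str M) (Γ ++ Δ)) (c : Env (str M) Ξ) where
        private E = cat Ξ c e
        eqf : ∀ s x → E s (ρf x) ≡ cat Ξ c (λ s x → e s (inl x)) s x
        eqf = ++-cases Ξ _
          (λ s x → trans (cong (E s) (++-elim-inl Ξ inl (λ x → inr Ξ (inl x)) s x))
              (trans (cat-inl Ξ c e s x) (sym (cat-inl Ξ c _ s x))))
          (λ s x → trans (cong (E s) (++-elim-inr Ξ inl (λ x → inr Ξ (inl x)) s x))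
              (trans (cat-inr Ξ c e s (inl x)) (sym (cat-inr Ξ c (λ s x → e s (inl x)) s x))))
        eqg : ∀ s x → E s (ρg x) ≡ cat Ξ c (λ s x → e s (inr Γ x)) s x
        eqg = ++-cases Ξ _
          (λ s x → trans (cong (E s) (++-elim-inl Ξ inl (λ x → inr Ξ (inr Γ x)) s x))
              (trans (cat-inl Ξ c e s x) (sym (cat-inl Ξ c _ s x))))
          (λ s x → trans (cong (E s) (++-elim-inr Ξ inl (λ x → inr Ξ (inr Γ x)) s x))
              (trans (cat-inr Ξ c e s (inr Γ x)) (sym (cat-inr Ξ c (λ s x → e s (inr Γ x)) s x))))
      common-at : (M : Model T) (e : Env (str M) (Γ ++ Δ)) (c : Env (str M) Ξ) → Sat (str M) common (cat Ξ c e) →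
                  (a : Pt (str M) A) → (∀ s x → Model._≈_ M (e s (inl x)) (env a s x)) → (b : Pt (str M) B) →
                      (∀ s x → Model._≈_ M (e s (inr Γ x)) (env b s x)) →
                  Structure._≋_ (str M) c (env (ap f {M} a)) × Structure._≋_ (str M) c (env (ap g {M} b))
      common-at M e c (q , r) a ea b eb = at (ap-unique f {M} a c' qf) , at (ap-unique g {M} b c' qg)
        where
          qf = Model.Sat-ren M θf ρf (λ s x → Model.≈-trans M (Model.≈-≡ M (eqf M e c s x))
              (Model.cat-cong M Ξ (λ _ _ → Model.≈-refl M) ea s x)) q
          qg = Model.Sat-ren M θg ρg (λ s x → Model.≈-trans M (Model.≈-≡ M (eqg M e c s x))
              (Model.cat-cong M Ξ (λ _ _ → Model.≈-refl M) eb s x)) r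
          c' : Pt (str M) C
          c' = mkPt c (Model.Sat-ren M (ofml C) inl (λ s x → Model.≈-≡ M (cat-inl Ξ c (env a) s x))
              (proj₂ (sound M (IsFunctionalRel.typed (proj₂ f)) _ qf)))
      unique : JointlyUnique Ξ common
      unique M e c c' q r s x = Model.≈-trans M (proj₁ (common-at M e c q a ea b eb) s x)
          (Model.≈-sym M (proj₁ (common-at M e c' r a ea b eb) s x))
        where
          pf = sound M (IsFunctionalRel.typed (proj₂ f)) _ (Model.Sat-ren M θf ρf
              (λ s x → Model.≈-≡ M (eqf M e c s x)) (proj₁ q))
          pg = sound M (IsFunctionalRel.typed (proj₂ g)) _ (Model.Sat-ren M θg ρg
              (λ s x → Model.≈-≡ M (eqg M e c s x)) (proj₂ q))
          a = mkPt {M = str M} {A = A} (λ s x → e s (inl x)) (Model.Sat-ren M (ofml A) (inr Ξ)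
              (λ s x → Model.≈-≡ M (cat-inr Ξ c _ s x)) (proj₁ pf))
          b = mkPt {M = str M} {A = B} (λ s x → e s (inr Γ x))
              (Model.Sat-ren M (ofml B) (inr Ξ) (λ s x → Model.≈-≡ M (cat-inr Ξ c _ s x)) (proj₁ pg))
          ea = λ s x → Model.≈-refl M
          eb = λ s x → Model.≈-refl M
      -- That two points have the same image is expressed by a common value in C. Since f is
      -- single-valued that value is determined by the A-part, which makes the existential
      -- cartesian.
      formula : Formula Sg (Γ ++ Δ)
      formula = renF inl (ofml A) ∧ᶠ renF (inr Γ) (ofml B) ∧ᶠ ∃* Ξ common

    abstract
      formula-cart : Cart T formula
      formula-cart = ∧-cart (cart-ren (ocart A) _) (∧-cart (cart-ren (ocart B) _)
        (∃*-cart Ξ (∧-cart (cart-ren (IsFunctionalRel.cart (proj₂ f)) _)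
            (cart-ren (IsFunctionalRel.cart (proj₂ g)) _)) unique))

    PB : SynObj T
    PB = ⟨ Γ ++ Δ ∣ formula , formula-cart ⟩

    module _ {M : Model T} where
      abstract
        fst : Pt (str M) PB → Pt (str M) A
        fst p = mkPt (λ s x → env p s (inl x)) (Model.Sat-ren M (ofml A) inl (λ _ _ → Model.≈-refl M)
            (proj₁ (sat p)))

        snd : Pt (str M) PB → Pt (str M) B
        snd p = mkPt (λ s x → env p s (inr Γ x)) (Model.Sat-ren M (ofml B) (inr Γ) (λ _ _ → Model.≈-refl M)
            (proj₁ (proj₂ (sat p))))

        commutes : (p : Pt (str M) PB) → EqPt (ap f {M} (fst p)) (ap g {M} (snd p))
        commutes p .at s x =
          let r = Model.Sat-∃* M Ξ common (proj₂ (proj₂ (sat p)))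
              z = common-at M (env p) (proj₁ r) (proj₂ r) (fst p) (λ _ _ → Model.≈-refl M) (snd p)
                  (λ _ _ → Model.≈-refl M)
          in Model.≈-trans M (Model.≈-sym M (proj₁ z s x)) (proj₂ z s x)

        pair : (a : Pt (str M) A) (b : Pt (str M) B) → EqPt (ap f {M} a) (ap g {M} b) → Pt (str M) PB
        pair a b e .env = cat Γ (env a) (env b)
        pair a b e .sat = Model.Sat-unren M (ofml A) inl (λ s x → Model.≈-≡ M (cat-inl Γ _ _ s x)) (sat a) ,
          Model.Sat-unren M (ofml B) (inr Γ) (λ s x → Model.≈-≡ M (cat-inr Γ (env a) _ s x)) (sat b) ,
          Model.Sat-∃*-intro M Ξ common (env (ap f {M} a))
            (Model.Sat-unren M θf ρf (λ s x → Model.≈-trans M (Model.≈-≡ M (eqf M _ _ s x))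
               (Model.cat-cong M Ξ (λ _ _ → Model.≈-refl M) (λ s x → Model.≈-≡ M
                   (cat-inl Γ (env a) (env b) s x)) s x)) (ap-graph f {M} a) ,
             Model.Sat-unren M θg ρg (λ s x → Model.≈-trans M (Model.≈-≡ M (eqg M _ _ s x))
               (Model.cat-cong M Ξ (at e) (λ s x → Model.≈-≡ M (cat-inr Γ (env a) (env b) s x)) s x))
                   (ap-graph g {M} b))

        fst-pair : (a : Pt (str M) A) (b : Pt (str M) B) (e : EqPt (ap f {M} a) (ap g {M} b)) → EqPt
            (fst (pair a b e)) a
        fst-pair a b e .at s x = Model.≈-≡ M (cat-inl Γ (env a) (env b) s x)

        snd-pair : (a : Pt (str M) A) (b : Pt (str M) B) (e : EqPt (ap f {M} a) (ap g {M} b)) → EqPt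
            (snd (pair a b e)) b
        snd-pair a b e .at s x = Model.≈-≡ M (cat-inr Γ (env a) (env b) s x)

        jointly-injective : (p q : Pt (str M) PB) → EqPt (fst p) (fst q) → EqPt (snd p) (snd q) → EqPt p q
        jointly-injective p q e d .at = ++-cases Γ _ (at e) (at d)

        fst-cong : {p q : Pt (str M) PB} → EqPt p q → EqPt (fst p) (fst q)
        fst-cong e .at s x = at e s (inl x)

        snd-cong : {p q : Pt (str M) PB} → EqPt p q → EqPt (snd p) (snd q)
        snd-cong e .at s x = at e s (inr Γ x)

    module _ {M N : Model T} (m : Hom (str M) (str N)) where
      abstract
        fst-natural : (p : Pt (str M) PB) → EqPt (mapPt m (fst {M} p)) (fst {N} (mapPt m p))
        fst-natural p .at s x = Model.≈-refl N

        snd-natural : (p : Pt (str M) PB) → EqPt (mapPt m (snd {M} p)) (snd {N} (mapPt m p))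
        snd-natural p .at s x = Model.≈-refl N

  -- The formula ∃ a. f(a) = x, cartesian because f is injective.
  module Image {A B : SynObj T} (f : SynHom T A B)
               (inj : {M : Model T} (p q : Pt (str M) A) → EqPt (ap f {M} p) (ap f {M} q) → EqPt p q) where
    private
      Γ = octx A
      Δ = octx B
      θ = SynRaw.fml (proj₁ f)
      ρ : Ren (Δ ++ Γ) (Γ ++ Δ)
      ρ = ++-elim Δ (inr Γ) inl
      swap : (M : Model T) (a : Env (str M) Γ) (b : Env (str M) Δ) → ∀ s x → Model._≈_ M (cat Γ a b s (ρ x))
          (cat Δ b a s x)
      swap M a b = ++-cases Δ _
        (λ s x → Model.≈-≡ M (trans (cong (cat Γ a b s) (++-elim-inl Δ (inr Γ) inl s x))
            (trans (cat-inr Γ a b s x) (sym (cat-inl Δ b a s x)))))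
        (λ s x → Model.≈-≡ M (trans (cong (cat Γ a b s) (++-elim-inr Δ (inr Γ) inl s x))
            (trans (cat-inl Γ a b s x) (sym (cat-inr Δ b a s x)))))
      unswap : (M : Model T) (a : Env (str M) Γ) (b : Env (str M) Δ) → Sat (str M) (renF ρ θ) (cat Γ a b) →
               Σ (Pt (str M) A) λ p → (∀ s x → Model._≈_ M (env p s x) (a s x)) × Structure._≋_ (str M) b
                   (env (ap f {M} p))
      unswap M a b q = p , (λ _ _ → Model.≈-refl M) , at (ap-unique f {M} p
          (mkPt b (Model.Sat-ren M (ofml B) inl (λ s x → Model.≈-≡ M (cat-inl Δ b a s x)) (proj₂ ty))) q')
        where
          q' = Model.Sat-ren M θ ρ (swap M a b) q
          ty = sound M (IsFunctionalRel.typed (proj₂ f)) _ q'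
          p = mkPt a (Model.Sat-ren M (ofml A) (inr Δ) (λ s x → Model.≈-≡ M (cat-inr Δ b a s x)) (proj₁ ty))

    image : Formula Sg Δ
    image = ∃* Γ (renF ρ θ)

    abstract
      image-cart : Cart T image
      image-cart = ∃*-cart Γ (cart-ren (IsFunctionalRel.cart (proj₂ f)) ρ) λ M b a a' q q' →
        let r = unswap M a b q ; r' = unswap M a' b q'
            e = inj {M} (proj₁ r) (proj₁ r') (mk≈ λ s x → Model.≈-trans M (Model.≈-sym M (proj₂ (proj₂ r) s x))
                (proj₂ (proj₂ r') s x))
        in λ s x → Model.≈-trans M (Model.≈-sym M (proj₁ (proj₂ r) s x))
            (Model.≈-trans M (at e s x) (proj₁ (proj₂ r') s x))

      image-preimage : {M : Model T} (b : Env (str M) Δ) → Sat (str M) image b → Σ (Pt (str M) A) λ p →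
          Structure._≋_ (str M) b (env (ap f {M} p))
      image-preimage {M} b q = let r = Model.Sat-∃* M Γ _ q ; u = unswap M (proj₁ r) b (proj₂ r) in proj₁ u , proj₂ (proj₂ u)

      image-intro : {M : Model T} (b : Env (str M) Δ) (p : Pt (str M) A) → Structure._≋_ (str M) b
          (env (ap f {M} p)) → Sat (str M) image b
      image-intro {M} b p e = Model.Sat-∃*-intro M Γ _ (env p) (Model.Sat-unren M θ ρ (swap M (env p) b)
        (Model.Sat-cong M θ (Model.cat-cong M Δ (λ s x → Model.≈-sym M (e s x)) (λ _ _ → Model.≈-refl M))
            (ap-graph f {M} p)))

-- Set-valued functors on models and their representability

-- Carries the action and its congruence; preservation of composites is demanded separately, in
-- `CanonTr`, for the targets of transformations that are extended from canonical models.
record Fct {Sg : Signature} (T : Theory Sg) : Set₁ where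
  no-eta-equality
  field
    Obj : Model T → Set
    Eq  : (M : Model T) → Obj M → Obj M → Set
    eq-refl′ : ∀ {M} {x : Obj M} → Eq M x x
    eq-sym   : ∀ {M} {x y : Obj M} → Eq M x y → Eq M y x
    eq-trans : ∀ {M} {x y z : Obj M} → Eq M x y → Eq M y z → Eq M x z
    act : ∀ {M N} → Hom (str M) (str N) → Obj M → Obj N
    act-cong : ∀ {M N} (m : Hom (str M) (str N)) {x y : Obj M} → Eq M x y → Eq N (act {M} {N} m x) (act {M} {N} m y)

module _ {Sg : Signature} {T : Theory Sg} where
  record NatTr (X Y : Fct T) : Set₁ where
    no-eta-equality
    private
      module X = Fct X
      module Y = Fct Y
    field
      tr : (M : Model T) → X.Obj M → Y.Obj M
      tr-cong : (M : Model T) {x y : X.Obj M} → X.Eq M x y → Y.Eq M (tr M x) (tr M y)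
      tr-natural : {M N : Model T} (m : Hom (str M) (str N)) (x : X.Obj M) → Y.Eq N (Y.act {M} {N} m (tr M x))
          (tr N (X.act {M} {N} m x))
  open NatTr public

  record NatIso (X Y : Fct T) : Set₁ where
    no-eta-equality
    private
      module X = Fct X
      module Y = Fct Y
    field
      fwd : NatTr X Y
      bwd : (M : Model T) → Y.Obj M → X.Obj M
      bwd-cong : (M : Model T) {x y : Y.Obj M} → Y.Eq M x y → X.Eq M (bwd M x) (bwd M y)
      bwd-fwd : (M : Model T) (x : X.Obj M) → X.Eq M (bwd M (tr fwd M x)) x
      fwd-bwd : (M : Model T) (y : Y.Obj M) → Y.Eq M (tr fwd M (bwd M y)) y

    bwdT : NatTr Y X
    bwdT .tr = bwd
    bwdT .tr-cong = bwd-cong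
    bwdT .tr-natural {M} {N} m y = X.eq-trans (X.eq-sym (bwd-fwd N _))
      (bwd-cong N (Y.eq-trans (Y.eq-sym (tr-natural fwd m (bwd M y))) (Y.act-cong m (fwd-bwd M y))))
  open NatIso public

  infixr 9 _⊙_
  _⊙_ : {X Y Z : Fct T} → NatTr Y Z → NatTr X Y → NatTr X Z
  (β ⊙ α) .tr M x = tr β M (tr α M x)
  (β ⊙ α) .tr-cong M e = tr-cong β M (tr-cong α M e)
  _⊙_ {Z = Z} β α .tr-natural {M} {N} m x = Fct.eq-trans Z (tr-natural β m _) (tr-cong β N (tr-natural α m x))

  idIso : (X : Fct T) → NatIso X X
  idIso X .fwd .tr M x = x
  idIso X .fwd .tr-cong M e = e
  idIso X .fwd .tr-natural m x = Fct.eq-refl′ X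
  idIso X .bwd M x = x
  idIso X .bwd-cong M e = e
  idIso X .bwd-fwd M x = Fct.eq-refl′ X
  idIso X .fwd-bwd M x = Fct.eq-refl′ X

  infixr 9 _⊙ⁱ_
  _⊙ⁱ_ : {X Y Z : Fct T} → NatIso Y Z → NatIso X Y → NatIso X Z
  (j ⊙ⁱ i) .fwd = fwd j ⊙ fwd i
  (j ⊙ⁱ i) .bwd M z = bwd i M (bwd j M z)
  (j ⊙ⁱ i) .bwd-cong M e = bwd-cong i M (bwd-cong j M e)
  _⊙ⁱ_ {X} j i .bwd-fwd M x = Fct.eq-trans X (bwd-cong i M (bwd-fwd j M _)) (bwd-fwd i M x)
  _⊙ⁱ_ {Z = Z} j i .fwd-bwd M z = Fct.eq-trans Z (tr-cong (fwd j) M (fwd-bwd i M _)) (fwd-bwd j M z)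

  symIso : {X Y : Fct T} → NatIso X Y → NatIso Y X
  symIso i .fwd = bwdT i
  symIso i .bwd = tr (fwd i)
  symIso i .bwd-cong = tr-cong (fwd i)
  symIso i .bwd-fwd = fwd-bwd i
  symIso i .fwd-bwd = bwd-fwd i

  PtF : SynObj T → Fct T
  PtF A .Fct.Obj M = Pt (str M) A
  PtF A .Fct.Eq M = EqPt
  PtF A .Fct.eq-refl′ = pt-refl
  PtF A .Fct.eq-sym = pt-sym
  PtF A .Fct.eq-trans = pt-trans
  PtF A .Fct.act = mapPt
  PtF A .Fct.act-cong = mapPt-cong

  apF : {A B : SynObj T} → SynHom T A B → NatTr (PtF A) (PtF B)
  apF f .tr M p = ap f {M} p
  apF f .tr-cong M = ap-cong f {M}
  apF f .tr-natural {M} {N} m p = ap-natural f {M} {N} m p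

  SortF : Sort Sg → Fct T
  SortF s .Fct.Obj M = Car (str M) s
  SortF s .Fct.Eq M = Model._≈_ M
  SortF s .Fct.eq-refl′ {M} = Model.≈-refl M
  SortF s .Fct.eq-sym {M} = Model.≈-sym M
  SortF s .Fct.eq-trans {M} = Model.≈-trans M
  SortF s .Fct.act m = fn m
  SortF s .Fct.act-cong m = fn-cong m

  relObj : ∀ {ss} → Rel Sg ss → SynObj T
  relObj {ss} R = ⟨ ss ∣ rel R (varsOf (λ x → x)) , rel-cart ⟩

  sortObj : Sort Sg → SynObj T
  sortObj s = ⟨ s ∷ [] ∣ ⊤ᶠ , ⊤-cart ⟩

  ctxObj : List (Sort Sg) → SynObj T
  ctxObj Γ = ⟨ Γ ∣ ⊤ᶠ , ⊤-cart ⟩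

  sortPtIso : ∀ s → NatIso (PtF (sortObj s)) (SortF s)
  sortPtIso s .fwd .tr M p = env p s (here refl)
  sortPtIso s .fwd .tr-cong M e = at e s (here refl)
  sortPtIso s .fwd .tr-natural {N = N} m x = Model.≈-refl N
  sortPtIso s .bwd M a = mkPt (a ▹ ε) tt
  sortPtIso s .bwd-cong M e .at = ∷-cases _ e (λ _ ())
  sortPtIso s .bwd-fwd M p .at = ∷-cases _ (Model.≈-refl M) (λ _ ())
  sortPtIso s .fwd-bwd M a = Model.≈-refl M

  module _ {X Y Z : Fct T} (α : NatTr X Z) (β : NatTr Y Z) where
    private
      module X = Fct X
      module Y = Fct Y
      module Z = Fct Z

    PullF : Fct T
    PullF .Fct.Obj M = Σ (X.Obj M) λ x → Σ (Y.Obj M) λ y → Z.Eq M (tr α M x) (tr β M y)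
    PullF .Fct.Eq M (x , y , _) (x' , y' , _) = X.Eq M x x' × Y.Eq M y y'
    PullF .Fct.eq-refl′ = X.eq-refl′ , Y.eq-refl′
    PullF .Fct.eq-sym (p , q) = X.eq-sym p , Y.eq-sym q
    PullF .Fct.eq-trans (p , q) (p' , q') = X.eq-trans p p' , Y.eq-trans q q'
    PullF .Fct.act {M} {N} m (x , y , e) = X.act {M} {N} m x , Y.act {M} {N} m y ,
      Z.eq-trans (Z.eq-sym (tr-natural α m x)) (Z.eq-trans (Z.act-cong m e) (tr-natural β m y))
    PullF .Fct.act-cong m (p , q) = X.act-cong m p , Y.act-cong m q

  record Rep (X : Fct T) : Set₁ where
    no-eta-equality
    field
      robj : SynObj T
      riso : NatIso (PtF robj) X
  open Rep public

  Rep-iso : {X Y : Fct T} → NatIso X Y → Rep X → Rep Y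
  Rep-iso i r .robj = robj r
  Rep-iso i r .riso = i ⊙ⁱ riso r

  Rep-Pt : (A : SynObj T) → Rep (PtF A)
  Rep-Pt A .robj = A
  Rep-Pt A .riso = idIso (PtF A)

  Rep-sort : ∀ s → Rep (SortF s)
  Rep-sort s .robj = sortObj s
  Rep-sort s .riso = sortPtIso s

-- The Yoneda lemma and pullbacks of representable functors

module Yoneda {Sg : Signature} {T : Theory Sg} (cax : CartAx T) where
  open Complete cax

  abstract
    natHom : {A B : SynObj T} → NatTr (PtF A) (PtF B) → SynHom T A B
    natHom {A} τ = homOf (tr τ (K A) (genPt A))

    ap-natHom : {A B : SynObj T} (τ : NatTr (PtF A) (PtF B)) {M : Model T} (p : Pt (str M) A) → EqPt
        (ap (natHom τ) {M} p) (tr τ M p)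
    ap-natHom {A} τ {M} p = pt-trans (ap-homOf (tr τ (K A) (genPt A)) {M} p)
      (pt-trans (tr-natural τ {K A} {M} (evalAt {M = M} p) (genPt A)) (tr-cong τ M (evalAt-gen {M = M} p)))

  -- Transported to the representing objects, the cospan consists of arrows by Yoneda, and their
  -- syntactic pullback represents the pullback of functors.
  Rep-pull : {X Y Z : Fct T} (α : NatTr X Z) (β : NatTr Y Z) → Rep X → Rep Y → Rep Z → Rep (PullF α β)
  Rep-pull {X} {Y} {Z} α β rx ry rz = record { robj = PB ; riso = iso }
    where
      module X = Fct X
      module Y = Fct Y
      module Z = Fct Z
      α' = bwdT (riso rz) ⊙ α ⊙ fwd (riso rx)
      β' = bwdT (riso rz) ⊙ β ⊙ fwd (riso ry)
      f = natHom α'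
      g = natHom β'
      open Pullback f g
      agree : (M : Model T) (a : Pt (str M) (robj rx)) (b : Pt (str M) (robj ry)) → EqPt (ap f {M} a) (ap g {M} b) →
              Z.Eq M (tr α M (tr (fwd (riso rx)) M a)) (tr β M (tr (fwd (riso ry)) M b))
      agree M a b e = Z.eq-trans (Z.eq-sym (fwd-bwd (riso rz) M _)) (Z.eq-trans
        (tr-cong (fwd (riso rz)) M (pt-trans (pt-sym (ap-natHom α' {M} a)) (pt-trans e (ap-natHom β' {M} b))))
            (fwd-bwd (riso rz) M _))
      agree⁻¹ : (M : Model T) (x : X.Obj M) (y : Y.Obj M) → Z.Eq M (tr α M x) (tr β M y) →
                EqPt (ap f {M} (bwd (riso rx) M x)) (ap g {M} (bwd (riso ry) M y))
      agree⁻¹ M x y e = pt-trans (ap-natHom α' {M} _) (pt-trans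
          (bwd-cong (riso rz) M (Z.eq-trans (tr-cong α M (fwd-bwd (riso rx) M x))
        (Z.eq-trans e (Z.eq-sym (tr-cong β M (fwd-bwd (riso ry) M y)))))) (pt-sym (ap-natHom β' {M} _)))
      iso : NatIso (PtF PB) (PullF α β)
      iso .fwd .tr M p = tr (fwd (riso rx)) M (fst {M} p) , tr (fwd (riso ry)) M (snd {M} p) , agree M (fst {M} p)
          (snd {M} p) (commutes {M} p)
      iso .fwd .tr-cong M e = tr-cong (fwd (riso rx)) M (fst-cong {M} e) , tr-cong (fwd (riso ry)) M
          (snd-cong {M} e)
      iso .fwd .tr-natural {M} {N} m p =
        X.eq-trans (tr-natural (fwd (riso rx)) m (fst {M} p))
            (tr-cong (fwd (riso rx)) N (fst-natural {M} {N} m p)) ,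
        Y.eq-trans (tr-natural (fwd (riso ry)) m (snd {M} p)) (tr-cong (fwd (riso ry)) N (snd-natural {M} {N} m p))
      iso .bwd M (x , y , e) = pair {M} (bwd (riso rx) M x) (bwd (riso ry) M y) (agree⁻¹ M x y e)
      iso .bwd-cong M {x , y , e} {x' , y' , e'} (p , q) = jointly-injective {M} _ _
        (pt-trans (fst-pair {M} _ _ _) (pt-trans (bwd-cong (riso rx) M p) (pt-sym (fst-pair {M} _ _ _))))
        (pt-trans (snd-pair {M} _ _ _) (pt-trans (bwd-cong (riso ry) M q) (pt-sym (snd-pair {M} _ _ _))))
      iso .bwd-fwd M p = jointly-injective {M} _ _
        (pt-trans (fst-pair {M} _ _ _) (bwd-fwd (riso rx) M (fst {M} p)))
        (pt-trans (snd-pair {M} _ _ _) (bwd-fwd (riso ry) M (snd {M} p)))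
      iso .fwd-bwd M (x , y , e) =
        X.eq-trans (tr-cong (fwd (riso rx)) M (fst-pair {M} _ _ _)) (fwd-bwd (riso rx) M x) ,
        Y.eq-trans (tr-cong (fwd (riso ry)) M (snd-pair {M} _ _ _)) (fwd-bwd (riso ry) M y)

-- Functors between categories of models

module _ {Sg Sg' : Signature} (T : Theory Sg) (T' : Theory Sg') where
  record MFun : Set₁ where
    no-eta-equality
    field
      mob : Model T → Model T'
      mhom : {M N : Model T} → Hom (str M) (str N) → Hom (str (mob M)) (str (mob N))
      mhom-ext : {M N : Model T} {m n : Hom (str M) (str N)} → m ≗ʰ n → mhom {M} {N} m ≗ʰ mhom {M} {N} n
      mhom-id : {M : Model T} → mhom {M} {M} (idHom (str M)) ≗ʰ idHom (str (mob M))
      mhom-∘ : {M N O : Model T} (n : Hom (str N) (str O)) (m : Hom (str M) (str N)) →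
               mhom {M} {O} (n ∘ʰ m) ≗ʰ mhom {N} {O} n ∘ʰ mhom {M} {N} m

module _ {Sg Sg' : Signature} {T : Theory Sg} {T' : Theory Sg'} where
  module _ (R : MFun T T') where
    open MFun R

    CompF : Fct T' → Fct T
    CompF X .Fct.Obj M = Fct.Obj X (mob M)
    CompF X .Fct.Eq M = Fct.Eq X (mob M)
    CompF X .Fct.eq-refl′ = Fct.eq-refl′ X
    CompF X .Fct.eq-sym = Fct.eq-sym X
    CompF X .Fct.eq-trans = Fct.eq-trans X
    CompF X .Fct.act {M} {N} m = Fct.act X {mob M} {mob N} (mhom {M} {N} m)
    CompF X .Fct.act-cong {M} {N} m = Fct.act-cong X {mob M} {mob N} (mhom {M} {N} m)

    whisker : {X Y : Fct T'} → NatTr X Y → NatTr (CompF X) (CompF Y)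
    whisker α .tr M = tr α (mob M)
    whisker α .tr-cong M = tr-cong α (mob M)
    whisker α .tr-natural {M} {N} m = tr-natural α {mob M} {mob N} (mhom {M} {N} m)

    whiskerIso : {X Y : Fct T'} → NatIso X Y → NatIso (CompF X) (CompF Y)
    whiskerIso i .fwd = whisker (fwd i)
    whiskerIso i .bwd M = bwd i (mob M)
    whiskerIso i .bwd-cong M = bwd-cong i (mob M)
    whiskerIso i .bwd-fwd M = bwd-fwd i (mob M)
    whiskerIso i .fwd-bwd M = fwd-bwd i (mob M)

    CompF-Pull : {X Y Z : Fct T'} (α : NatTr X Z) (β : NatTr Y Z) → NatIso (PullF (whisker α) (whisker β))
        (CompF (PullF α β))
    CompF-Pull α β .fwd .tr M x = x
    CompF-Pull α β .fwd .tr-cong M e = e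
    CompF-Pull {X} {Y} α β .fwd .tr-natural m x = Fct.eq-refl′ X , Fct.eq-refl′ Y
    CompF-Pull α β .bwd M x = x
    CompF-Pull α β .bwd-cong M e = e
    CompF-Pull {X} {Y} α β .bwd-fwd M x = Fct.eq-refl′ X , Fct.eq-refl′ Y
    CompF-Pull {X} {Y} α β .fwd-bwd M x = Fct.eq-refl′ X , Fct.eq-refl′ Y

-- Each object is a finite limit of sorts and relations: {Γ. ∃s φ} ≅ {s,Γ. φ} since φ is single-valued.

module _ {Sg : Signature} {T : Theory Sg} where
  forget : ∀ {Γ} {φ : Formula Sg Γ} {c : Cart T φ} → NatTr (PtF {T = T} ⟨ Γ ∣ φ , c ⟩) (PtF (ctxObj Γ))
  forget .tr M p = mkPt (env p) tt
  forget .tr-cong M e .at = at e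
  forget .tr-natural {N = N} m p .at s x = Model.≈-refl N

  mapCtx : ∀ {Γ Δ} → Substitution.Subst Sg Δ Γ → NatTr (PtF {T = T} (ctxObj Γ)) (PtF (ctxObj Δ))
  mapCtx σ .tr M p = mkPt (λ s x → evalT (str M) (σ s x) (env p)) tt
  mapCtx σ .tr-cong M e .at s x = Model.evalT-cong M (σ s x) (at e)
  mapCtx σ .tr-natural m p .at s x = Hom.fn-evalT m (σ s x) (env p)

  to[] : ∀ {A : SynObj T} → NatTr (PtF A) (PtF (ctxObj []))
  to[] .tr M p = mkPt ε tt
  to[] .tr-cong M e .at s ()
  to[] .tr-natural m p .at s ()

  -- A binary product is written as a pullback over the terminal object `ctxObj []`, so pullbacks
  -- and this object are the only limits used in decomposing objects.
  ∷-pull : ∀ s Γ → NatIso (PullF (to[] {sortObj s}) (to[] {ctxObj Γ})) (PtF (ctxObj (s ∷ Γ)))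
  ∷-pull s Γ .fwd .tr M (a , e , _) = mkPt (env a s (here refl) ▹ env e) tt
  ∷-pull s Γ .fwd .tr-cong M (p , q) .at = Model.▹-cong M (at p s (here refl)) (at q)
  ∷-pull s Γ .fwd .tr-natural {N = N} m _ .at = ∷-cases _ (Model.≈-refl N) (λ _ _ → Model.≈-refl N)
  ∷-pull s Γ .bwd M p = mkPt (env p s (here refl) ▹ ε) tt , mkPt (tail (env p)) tt , mk≈ (λ s ())
  ∷-pull s Γ .bwd-cong M e = mk≈ (∷-cases _ (at e s (here refl)) (λ _ ())) , mk≈ (λ t x → at e t (there x))
  ∷-pull s Γ .bwd-fwd M _ = mk≈ (∷-cases _ (Model.≈-refl M) (λ _ ())) , mk≈ (λ _ _ → Model.≈-refl M)
  ∷-pull s Γ .fwd-bwd M p .at = ∷-cases _ (Model.≈-refl M) (λ _ _ → Model.≈-refl M)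

  module _ {Γ : List (Sort Sg)} where
    ∧-pull : {φ ψ : Formula Sg Γ} (c : Cart T φ) (d : Cart T ψ) →
             NatIso (PullF (forget {c = c}) (forget {c = d})) (PtF ⟨ Γ ∣ φ ∧ᶠ ψ , ∧-cart c d ⟩)
    ∧-pull {φ} {ψ} c d .fwd .tr M (p , q , e) = mkPt (env p) (sat p , Model.Sat-cong M ψ
        (λ s x → Model.≈-sym M (at e s x)) (sat q))
    ∧-pull c d .fwd .tr-cong M (e , _) = mk≈ (at e)
    ∧-pull c d .fwd .tr-natural {N = N} m _ .at s x = Model.≈-refl N
    ∧-pull c d .bwd M p = mkPt (env p) (proj₁ (sat p)) , mkPt (env p) (proj₂ (sat p)) , mk≈ (λ _ _ → Model.≈-refl M)
    ∧-pull c d .bwd-cong M e = mk≈ (at e) , mk≈ (at e)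
    ∧-pull c d .bwd-fwd M (p , q , e) = mk≈ (λ _ _ → Model.≈-refl M) , mk≈ (at e)
    ∧-pull c d .fwd-bwd M p .at s x = Model.≈-refl M

    module _ {s} (t u : Term Sg Γ s) where
      private
        v : Term Sg (s ∷ []) s
        v = var (here refl)
      termPair : NatTr (PtF {T = T} (ctxObj Γ)) (PtF (ctxObj (s ∷ s ∷ [])))
      termPair = mapCtx (t ▹ u ▹ ε)
      diagonal : NatTr (PtF {T = T} (sortObj s)) (PtF (ctxObj (s ∷ s ∷ [])))
      diagonal = mapCtx (v ▹ v ▹ ε)
      ≐-pull : NatIso (PullF termPair diagonal) (PtF ⟨ Γ ∣ t ≐ u , ≐-cart ⟩)
      ≐-pull .fwd .tr M (p , a , e) = mkPt (env p) (Model.≈-trans M (at e s (here refl))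
          (Model.≈-sym M (at e s (there (here refl)))))
      ≐-pull .fwd .tr-cong M (e , _) = mk≈ (at e)
      ≐-pull .fwd .tr-natural {N = N} m _ .at s x = Model.≈-refl N
      ≐-pull .bwd M p = mkPt (env p) tt , mkPt (evalT (str M) t (env p) ▹ ε) tt ,
        mk≈ (∷-cases _ (Model.≈-refl M) (∷-cases _ (Model.≈-sym M (sat p)) (λ _ ())))
      ≐-pull .bwd-cong M e = mk≈ (at e) , mk≈ (∷-cases _ (Model.evalT-cong M t (at e)) (λ _ ()))
      ≐-pull .bwd-fwd M (p , a , e) = mk≈ (λ _ _ → Model.≈-refl M) , mk≈ (∷-cases _ (at e s (here refl)) (λ _ ()))
      ≐-pull .fwd-bwd M p .at s x = Model.≈-refl M

    module _ {ss} (R : Rel Sg ss) (ts : Terms Sg Γ ss) where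
      open Substitution Sg
      private
        evals : (M : Model T) (e : Env (str M) Γ) → ∀ s x → Model._≈_ M (evalT (str M) (termsFam ts s x) e)
            (evalTs (str M) ts e s x)
        evals M e s x = Model.≈-trans M (Model.≈-sym M (Model.evalTs-fam M (termsFam ts) e s x))
          (Model.≈-≡ M (cong (λ us → evalTs (str M) us e s x) (famTerms-termsFam ts)))
      rel-pull : NatIso (PullF (mapCtx (termsFam ts)) (forget {φ = rel R (varsOf (λ x → x))} {c = rel-cart}))
          (PtF ⟨ Γ ∣ rel R ts , rel-cart ⟩)
      rel-pull .fwd .tr M (p , q , e) = mkPt (env p) (Model.rl-cong M R
          (λ s x → Model.≈-trans M (Model.evalTs-varsOf M (λ x → x) (env q) s x)
        (Model.≈-trans M (Model.≈-sym M (at e s x)) (evals M (env p) s x))) (sat q))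
      rel-pull .fwd .tr-cong M (e , _) = mk≈ (at e)
      rel-pull .fwd .tr-natural {N = N} m _ .at s x = Model.≈-refl N
      rel-pull .bwd M p = mkPt (env p) tt ,
        mkPt (evalTs (str M) ts (env p)) (Model.rl-cong M R (λ s x → Model.≈-sym M
            (Model.evalTs-varsOf M (λ x → x) _ s x)) (sat p)) ,
        mk≈ (evals M (env p))
      rel-pull .bwd-cong M e = mk≈ (at e) , mk≈ (Model.evalTs-cong M ts (at e))
      rel-pull .bwd-fwd M (p , q , e) = mk≈ (λ _ _ → Model.≈-refl M) ,
        mk≈ (λ s x → Model.≈-trans M (Model.≈-sym M (evals M (env p) s x)) (at e s x))
      rel-pull .fwd-bwd M p .at s x = Model.≈-refl M

    ∃-total : ∀ {s} {φ : Formula Sg (s ∷ Γ)} (c : Cart T φ) (u : Unique T φ) →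
              NatIso (PtF ⟨ s ∷ Γ ∣ φ , c ⟩) (PtF ⟨ Γ ∣ ∃ᶠ s φ , ∃-cart c u ⟩)
    ∃-total {s} {φ} c u .fwd .tr M p = mkPt (tail (env p)) (env p s (here refl) , Model.Sat-cong M φ
        (∷-cases _ (Model.≈-refl M) (λ _ _ → Model.≈-refl M)) (sat p))
    ∃-total c u .fwd .tr-cong M e .at s x = at e s (there x)
    ∃-total c u .fwd .tr-natural {N = N} m p .at s x = Model.≈-refl N
    ∃-total c u .bwd M p = mkPt (proj₁ (sat p) ▹ env p) (proj₂ (sat p))
    ∃-total {s} {φ} c u .bwd-cong M {p} {q} e .at = ∷-cases _
      (sound M u (proj₁ (sat p) ▹ proj₁ (sat q) ▹ env q)
        (Model.Sat-unsub M φ _ (∷-cases _ (Model.≈-refl M) (λ s x → Model.≈-sym M (at e s x))) (proj₂ (sat p)) ,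
         Model.Sat-unsub M φ _ (∷-cases _ (Model.≈-refl M) (λ _ _ → Model.≈-refl M)) (proj₂ (sat q)))) (at e)
    ∃-total c u .bwd-fwd M p .at = ∷-cases _ (Model.≈-refl M) (λ _ _ → Model.≈-refl M)
    ∃-total c u .fwd-bwd M p .at s x = Model.≈-refl M

-- Function symbols get no clause of their own: their interpretations are already natural maps
-- between functors of points. Relations do, because a subfunctor of a representable functor is not
-- automatically representable.
record RepFun {Sg Sg' : Signature} (T : Theory Sg) (T' : Theory Sg') : Set₁ where
  no-eta-equality
  field
    mfun  : MFun T T'
    sorts : ∀ s → Rep (CompF mfun (SortF s))
    rels  : ∀ {ss} (R : Rel Sg' ss) → Rep (CompF mfun (PtF (relObj R)))
  open MFun mfun public

module _ {Sg Sg' : Signature} {T : Theory Sg} {T' : Theory Sg'} (cax : CartAx T) (R : RepFun T T') where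
  open RepFun R
  open Yoneda cax

  repCtx : ∀ Γ → Rep (CompF mfun (PtF (ctxObj Γ)))
  repCtx []      = record { robj = ctxObj [] ; riso = record
    { fwd = record { tr = λ M p → mkPt ε tt ; tr-cong = λ M e → mk≈ (λ _ ()) ; tr-natural = λ m p → mk≈ (λ _ ()) }
    ; bwd = λ M p → mkPt ε tt ; bwd-cong = λ M e → mk≈ (λ _ ()) ; bwd-fwd = λ M p → mk≈ (λ _ ()) ; fwd-bwd = λ M p →
        mk≈ (λ _ ()) } }
  repCtx (s ∷ Γ) = Rep-iso (whiskerIso mfun (∷-pull s Γ) ⊙ⁱ CompF-Pull mfun to[] to[])
    (Rep-pull _ _ (Rep-iso (whiskerIso mfun (symIso (sortPtIso s))) (sorts s)) (repCtx Γ) (repCtx []))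

  -- Restriction along `mfun` commutes with pullbacks of functors, so the decomposition of an object
  -- of T' into sorts and relations is represented step by step over T.
  repCart : ∀ {Γ} {φ : Formula Sg' Γ} (c : Cart T' φ) → Rep (CompF mfun (PtF ⟨ Γ ∣ φ , c ⟩))
  repCart {Γ} ⊤-cart = repCtx Γ
  repCart {Γ} (∧-cart c d) = Rep-iso (whiskerIso mfun (∧-pull c d) ⊙ⁱ CompF-Pull mfun (forget {c = c})
      (forget {c = d})) (Rep-pull _ _ (repCart c) (repCart d) (repCtx Γ))
  repCart {Γ} (≐-cart {s = s} {t} {u}) = Rep-iso (whiskerIso mfun (≐-pull t u) ⊙ⁱ CompF-Pull mfun (termPair t u)
      (diagonal t u)) (Rep-pull _ _ (repCtx Γ) (repCtx (s ∷ [])) (repCtx (s ∷ s ∷ [])))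
  repCart {Γ} (rel-cart {ss = ss} {R} {ts}) = Rep-iso (whiskerIso mfun (rel-pull R ts) ⊙ⁱ CompF-Pull mfun (mapCtx _)
      (forget {c = rel-cart})) (Rep-pull _ _ (repCtx Γ) (rels R) (repCtx ss))
  repCart (∃-cart c u) = Rep-iso (whiskerIso mfun (∃-total c u)) (repCart c)

  repObj : (B : SynObj T') → Rep (CompF mfun (PtF B))
  repObj ⟨ Γ ∣ φ , c ⟩ = repCart c

-- Equivalences between categories of models with representable components

module _ {Sg Sg' : Signature} {T : Theory Sg} {T' : Theory Sg'} (R : MFun T T') where
  open MFun R

  mapIso : {M N : Model T} → Iso (str M) (str N) → Iso (str (mob M)) (str (mob N))
  mapIso {M} {N} i .Iso.to = mhom {M} {N} (Iso.to i)
  mapIso {M} {N} i .Iso.from = mhom {N} {M} (Iso.from i)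
  mapIso {M} {N} i .Iso.from-to a = Model.≈-trans (mob M) (Model.≈-sym (mob M)
      (mhom-∘ {M} {N} {M} (Iso.from i) (Iso.to i) a))
    (Model.≈-trans (mob M) (mhom-ext {M} {M} {Iso.from i ∘ʰ Iso.to i} {idHom (str M)} (Iso.from-to i) a)
        (mhom-id {M} a))
  mapIso {M} {N} i .Iso.to-from a = Model.≈-trans (mob N) (Model.≈-sym (mob N)
      (mhom-∘ {N} {M} {N} (Iso.to i) (Iso.from i) a))
    (Model.≈-trans (mob N) (mhom-ext {N} {N} {Iso.to i ∘ʰ Iso.from i} {idHom (str N)} (Iso.to-from i) a)
        (mhom-id {N} a))

idMF : {Sg : Signature} (T : Theory Sg) → MFun T T
idMF T .MFun.mob M = M
idMF T .MFun.mhom m = m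
idMF T .MFun.mhom-ext e = e
idMF T .MFun.mhom-id {M} a = Model.≈-refl M
idMF T .MFun.mhom-∘ {O = O} n m a = Model.≈-refl O

module _ {Sg Sg' Sg″ : Signature} {T : Theory Sg} {T' : Theory Sg'} {T″ : Theory Sg″} where
  compMF : MFun T' T″ → MFun T T' → MFun T T″
  compMF S R .MFun.mob M = MFun.mob S (MFun.mob R M)
  compMF S R .MFun.mhom {M} {N} m = MFun.mhom S {MFun.mob R M} {MFun.mob R N} (MFun.mhom R {M} {N} m)
  compMF S R .MFun.mhom-ext {M} {N} {m} {n} e = MFun.mhom-ext S {MFun.mob R M} {MFun.mob R N}
      {MFun.mhom R {M} {N} m} {MFun.mhom R {M} {N} n} (MFun.mhom-ext R {M} {N} {m} {n} e)
  compMF S R .MFun.mhom-id {M} a = Model.≈-trans (MFun.mob S (MFun.mob R M))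
    (MFun.mhom-ext S {MFun.mob R M} {MFun.mob R M} {MFun.mhom R {M} {M} (idHom (str M))} {idHom _}
        (MFun.mhom-id R {M}) a) (MFun.mhom-id S {MFun.mob R M} a)
  compMF S R .MFun.mhom-∘ {M} {N} {O} n m a = Model.≈-trans (MFun.mob S (MFun.mob R O))
    (MFun.mhom-ext S {MFun.mob R M} {MFun.mob R O} {MFun.mhom R {M} {O} (n ∘ʰ m)}
        {MFun.mhom R {N} {O} n ∘ʰ MFun.mhom R {M} {N} m} (MFun.mhom-∘ R {M} {N} {O} n m) a)
    (MFun.mhom-∘ S {MFun.mob R M} {MFun.mob R N} {MFun.mob R O} (MFun.mhom R {N} {O} n) (MFun.mhom R {M} {N} m) a)

  CompF-comp : (S : MFun T' T″) (R : MFun T T') (X : Fct T″) → NatIso (CompF R (CompF S X)) (CompF (compMF S R) X)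
  CompF-comp S R X .fwd .tr M x = x
  CompF-comp S R X .fwd .tr-cong M e = e
  CompF-comp S R X .fwd .tr-natural m x = Fct.eq-refl′ X
  CompF-comp S R X .bwd M x = x
  CompF-comp S R X .bwd-cong M e = e
  CompF-comp S R X .bwd-fwd M x = Fct.eq-refl′ X
  CompF-comp S R X .fwd-bwd M x = Fct.eq-refl′ X

  compRF : CartAx T → RepFun T' T″ → RepFun T T' → RepFun T T″
  compRF cax S R .RepFun.mfun = compMF (RepFun.mfun S) (RepFun.mfun R)
  compRF cax S R .RepFun.sorts s = Rep-iso (CompF-comp _ _ (SortF s) ⊙ⁱ whiskerIso (RepFun.mfun R)
      (riso (RepFun.sorts S s))) (repObj cax R (robj (RepFun.sorts S s)))
  compRF cax S R .RepFun.rels r = Rep-iso (CompF-comp _ _ (PtF (relObj r)) ⊙ⁱ whiskerIso (RepFun.mfun R)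
      (riso (RepFun.rels S r))) (repObj cax R (robj (RepFun.rels S r)))

record Unit {Sg Sg' : Signature} {T : Theory Sg} {T' : Theory Sg'} (R : MFun T T') (R' : MFun T' T) : Set₁ where
  no-eta-equality
  private
    module R = MFun R
    module R' = MFun R'
  field
    at-model : (M : Model T) → Iso (str M) (str (R'.mob (R.mob M)))
    unit-natural : {M N : Model T} (m : Hom (str M) (str N)) →
      Iso.to (at-model N) ∘ʰ m ≗ʰ R'.mhom {R.mob M} {R.mob N} (R.mhom {M} {N} m) ∘ʰ Iso.to (at-model M)

record ModEquiv {Sg Sg' : Signature} (T : Theory Sg) (T' : Theory Sg') : Set₁ where
  no-eta-equality
  field
    right : RepFun T T'
    left  : RepFun T' T
    unit   : Unit (RepFun.mfun right) (RepFun.mfun left)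
    counit : Unit (RepFun.mfun left) (RepFun.mfun right)

ModEquiv-refl : {Sg : Signature} (T : Theory Sg) → ModEquiv T T
ModEquiv-refl T = record { right = I ; left = I ; unit = u ; counit = u }
  where
    I : RepFun T T
    I .RepFun.mfun = idMF T
    I .RepFun.sorts s = Rep-iso (strict (SortF s)) (Rep-sort s)
      where
        strict : (X : Fct T) → NatIso X (CompF (idMF T) X)
        strict X .fwd .tr M x = x
        strict X .fwd .tr-cong M e = e
        strict X .fwd .tr-natural m x = Fct.eq-refl′ X
        strict X .bwd M x = x
        strict X .bwd-cong M e = e
        strict X .bwd-fwd M x = Fct.eq-refl′ X
        strict X .fwd-bwd M x = Fct.eq-refl′ X
    I .RepFun.rels r .robj = relObj r
    I .RepFun.rels r .riso .fwd .tr M x = x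
    I .RepFun.rels r .riso .fwd .tr-cong M e = e
    I .RepFun.rels r .riso .fwd .tr-natural m x = pt-refl
    I .RepFun.rels r .riso .bwd M x = x
    I .RepFun.rels r .riso .bwd-cong M e = e
    I .RepFun.rels r .riso .bwd-fwd M x = pt-refl
    I .RepFun.rels r .riso .fwd-bwd M x = pt-refl
    u : Unit (idMF T) (idMF T)
    u .Unit.at-model M = iso-refl (str M)
    u .Unit.unit-natural {N = N} m a = Model.≈-refl N

ModEquiv-sym : {Sg Sg' : Signature} {T : Theory Sg} {T' : Theory Sg'} → ModEquiv T T' → ModEquiv T' T
ModEquiv-sym E = record { right = left ; left = right ; unit = counit ; counit = unit }
  where open ModEquiv E

module _ {Sg Sg' Sg″ : Signature} {T : Theory Sg} {T' : Theory Sg'} {T″ : Theory Sg″} where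
  unit-comp : {R : MFun T T'} {R' : MFun T' T} {S : MFun T' T″} {S' : MFun T″ T'} → Unit R R' → Unit S S' →
              Unit (compMF S R) (compMF R' S')
  unit-comp {R} {R'} {S} {S'} u v .Unit.at-model M =
    iso-trans (Unit.at-model u M) (mapIso R' {MFun.mob R M} {MFun.mob S' (MFun.mob S (MFun.mob R M))}
        (Unit.at-model v (MFun.mob R M)))
  unit-comp {R} {R'} {S} {S'} u v .Unit.unit-natural {M} {N} m a =
      X.≈-trans (R'.mhom-cong (Unit.unit-natural u {M} {N} m a))
          (X.≈-trans (X.≈-sym (MFun.mhom-∘ R' {RM} {RN} {VN} (Iso.to (Unit.at-model v RN))
          (MFun.mhom R {M} {N} m) _))
        (X.≈-trans (MFun.mhom-ext R' {RM} {VN} {Iso.to (Unit.at-model v RN) ∘ʰ MFun.mhom R {M} {N} m}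
              {MFun.mhom S' {MFun.mob S RM} {MFun.mob S RN} (MFun.mhom S {RM} {RN}
                  (MFun.mhom R {M} {N} m)) ∘ʰ Iso.to (Unit.at-model v RM)}
              (Unit.unit-natural v {RM} {RN} (MFun.mhom R {M} {N} m)) _)
          (MFun.mhom-∘ R' {RM} {VM} {VN} _ (Iso.to (Unit.at-model v RM)) _)))
    where
      RM = MFun.mob R M
      RN = MFun.mob R N
      VM = MFun.mob S' (MFun.mob S RM)
      VN = MFun.mob S' (MFun.mob S RN)
      module X = Model (MFun.mob R' VN)
      module R' where
        mhom-cong : ∀ {s} {x y : Car (str (MFun.mob R' RN)) s} → Model._≈_ (MFun.mob R' RN) x y →
          fn (MFun.mhom R' {RN} {VN} (Iso.to (Unit.at-model v RN))) x X.≈ fn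
              (MFun.mhom R' {RN} {VN} (Iso.to (Unit.at-model v RN))) y
        mhom-cong e = fn-cong (MFun.mhom R' {RN} {VN} (Iso.to (Unit.at-model v RN))) e

ModEquiv-trans : {Sg Sg' Sg″ : Signature} {T : Theory Sg} {T' : Theory Sg'} {T″ : Theory Sg″} →
                 CartAx T → CartAx T″ → ModEquiv T T' → ModEquiv T' T″ → ModEquiv T T″
ModEquiv-trans cax cax″ E D = record
  { right = compRF cax (ModEquiv.right D) (ModEquiv.right E)
  ; left = compRF cax″ (ModEquiv.left E) (ModEquiv.left D)
  ; unit = unit-comp (ModEquiv.unit E) (ModEquiv.unit D)
  ; counit = unit-comp (ModEquiv.counit D) (ModEquiv.counit E) }

-- From equivalences of models to equivalences of syntactic categories

module Star {Sg Sg' : Signature} {T : Theory Sg} {T' : Theory Sg'} (cax : CartAx T) (cax' : CartAx T') (R : RepFun T T') where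
  open RepFun R
  open Yoneda cax
  open Complete cax
  private module C' = Complete cax'

  -- Reverses direction: a functor R from models of T to models of T' sends an object B of T' to the
  -- object of T that represents M ↦ B(R M).
  star₀ : SynObj T' → SynObj T
  star₀ B = robj (repObj cax R B)

  iso : (B : SynObj T') → NatIso (PtF (star₀ B)) (CompF mfun (PtF B))
  iso B = riso (repObj cax R B)

  star₁ : {A B : SynObj T'} → SynHom T' A B → SynHom T (star₀ A) (star₀ B)
  star₁ {A} {B} f = natHom (bwdT (iso B) ⊙ whisker mfun (apF f) ⊙ fwd (iso A))

  ap-star : {A B : SynObj T'} (f : SynHom T' A B) {M : Model T} (p : Pt (str M) (star₀ A)) →
            EqPt (ap (star₁ f) {M} p) (bwd (iso B) M (ap f {mob M} (tr (fwd (iso A)) M p)))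
  ap-star {A} {B} f {M} p = ap-natHom (bwdT (iso B) ⊙ whisker mfun (apF f) ⊙ fwd (iso A)) {M} p

  star : Functor (SyntacticCategory T') (SyntacticCategory T)
  star = record
    { F₀ = star₀ ; F₁ = star₁
    ; resp = λ {A} {B} f g e → ap⇒≈ₛ (star₁ f) (star₁ g) λ {M} p → pt-trans (ap-star f {M} p)
        (pt-trans (bwd-cong (iso B) M (≈ₛ⇒ap f g e {mob M} _)) (pt-sym (ap-star g {M} p)))
    ; pres-id = λ {A} f e → ap⇒≈ₛ (star₁ f) (idH (star₀ A)) λ {M} p → pt-trans (ap-star f {M} p)
        (pt-trans (bwd-cong (iso A) M (pt-trans (≈ₛ⇒ap f (C'.idH A) e {mob M} _) (C'.ap-id A {mob M} _)))
          (pt-trans (bwd-fwd (iso A) M p) (pt-sym (ap-id (star₀ A) {M} p))))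
    ; pres-∘ = λ {A} {B} {C} f g h e → ap⇒≈ₛ (star₁ h) (_∙_ (star₁ g) (star₁ f)) λ {M} p → pt-trans (ap-star h {M} p)
        (pt-trans (bwd-cong (iso C) M (pt-trans (≈ₛ⇒ap h (C'._∙_ g f) e {mob M} _) (pt-trans (C'.ap-∙ g f {mob M} _)
            (ap-cong g {mob M} (pt-sym (fwd-bwd (iso B) M _))))))
          (pt-trans (pt-sym (ap-star g {M} _)) (pt-trans (ap-cong (star₁ g) {M} (pt-sym (ap-star f {M} p)))
              (pt-sym (ap-∙ (star₁ g) (star₁ f) {M} p)))))
    }

module _ {Sg : Signature} {T : Theory Sg} (cax : CartAx T) where
  open Yoneda cax
  open Complete cax

  inverse-homs : {A B : SynObj T} (i : NatIso (PtF A) (PtF B)) → _≈ₛ_ T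
      (synComp T (proj₁ (natHom (bwdT i))) (proj₁ (natHom (fwd i)))) (synId T A)
  inverse-homs {A} {B} i = ap⇒≈ₛ (_∙_ (natHom (bwdT i)) (natHom (fwd i))) (idH A) λ {M} p →
    pt-trans (ap-∙ (natHom (bwdT i)) (natHom (fwd i)) {M} p) (pt-trans (ap-natHom (bwdT i) {M} _)
      (pt-trans (bwd-cong i M (ap-natHom (fwd i) {M} p)) (pt-trans (bwd-fwd i M p) (pt-sym (ap-id A {M} p)))))

  inverse-homs′ : {A B : SynObj T} (i : NatIso (PtF A) (PtF B)) → _≈ₛ_ T
      (synComp T (proj₁ (natHom (fwd i))) (proj₁ (natHom (bwdT i)))) (synId T B)
  inverse-homs′ {A} {B} i = ap⇒≈ₛ (_∙_ (natHom (fwd i)) (natHom (bwdT i))) (idH B) λ {M} p →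
    pt-trans (ap-∙ (natHom (fwd i)) (natHom (bwdT i)) {M} p) (pt-trans (ap-natHom (fwd i) {M} _)
      (pt-trans (tr-cong (fwd i) M (ap-natHom (bwdT i) {M} p)) (pt-trans (fwd-bwd i M p) (pt-sym (ap-id B {M} p)))))

module _ {Sg Sg' : Signature} {T : Theory Sg} {T' : Theory Sg'} (R : MFun T T') (R' : MFun T' T) (u : Unit R R') where
  unitIso : (A : SynObj T) → NatIso (PtF A) (CompF R (CompF R' (PtF A)))
  unitIso A .fwd .tr M p = mapPt (Iso.to (Unit.at-model u M)) p
  unitIso A .fwd .tr-cong M e = mapPt-cong (Iso.to (Unit.at-model u M)) e
  unitIso A .fwd .tr-natural {M} {N} m p .at s x = Model.≈-sym (MFun.mob R' (MFun.mob R N))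
      (Unit.unit-natural u {M} {N} m (env p s x))
  unitIso A .bwd M p = mapPt (Iso.from (Unit.at-model u M)) p
  unitIso A .bwd-cong M e = mapPt-cong (Iso.from (Unit.at-model u M)) e
  unitIso A .bwd-fwd M p .at s x = Iso.from-to (Unit.at-model u M) (env p s x)
  unitIso A .fwd-bwd M p .at s x = Iso.to-from (Unit.at-model u M) (env p s x)

module _ {Sg Sg' : Signature} {T : Theory Sg} {T' : Theory Sg'} (cax : CartAx T) (cax' : CartAx T') (R : RepFun T T') (R' : RepFun T' T)
         (u : Unit (RepFun.mfun R) (RepFun.mfun R')) where
  private
    module R = RepFun R
    module R' = RepFun R'
    module G = Star cax cax' R
    module F = Star cax' cax R'
  open Yoneda cax
  open Complete cax

  -- Both functors are identified with M ↦ A(R' (R M)): the left one by the unit, the right one by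
  -- unfolding the two representations.
  roundTrip : (A : SynObj T) → NatIso (PtF A) (PtF (G.star₀ (F.star₀ A)))
  roundTrip A = symIso (G.iso (F.star₀ A)) ⊙ⁱ whiskerIso R.mfun (symIso (F.iso A)) ⊙ⁱ unitIso R.mfun R'.mfun u A

  roundTrip-natural : {A B : SynObj T} (f : SynHom T A B) (M : Model T) (p : Pt (str M) A) →
    EqPt (ap (G.star₁ (F.star₁ f)) {M} (tr (fwd (roundTrip A)) M p)) (tr (fwd (roundTrip B)) M (ap f {M} p))
  roundTrip-natural {A} {B} f M p = pt-trans (G.ap-star (F.star₁ f) {M} _) (bwd-cong (G.iso (F.star₀ B)) M
    (pt-trans (ap-cong (F.star₁ f) {R.mob M} (fwd-bwd (G.iso (F.star₀ A)) M _))
        (pt-trans (F.ap-star f {R.mob M} _) (bwd-cong (F.iso B) (R.mob M)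
      (pt-trans (ap-cong f {R'.mob (R.mob M)} (fwd-bwd (F.iso A) (R.mob M) _))
        (pt-sym (ap-natural f {M} {R'.mob (R.mob M)} (Iso.to (Unit.at-model u M)) p)))))))

  η-square : {A B : SynObj T} (f : SynHom T A B) →
    _≈ₛ_ T (synComp T (proj₁ (G.star₁ (F.star₁ f))) (proj₁ (natHom (fwd (roundTrip A)))))
        (synComp T (proj₁ (natHom (fwd (roundTrip B)))) (proj₁ f))
  η-square {A} {B} f = ap⇒≈ₛ (_∙_ (G.star₁ (F.star₁ f)) (natHom (fwd (roundTrip A)))) (_∙_ (natHom (fwd (roundTrip B))) f) λ {M} p →
    pt-trans (ap-∙ (G.star₁ (F.star₁ f)) (natHom (fwd (roundTrip A))) {M} p)
      (pt-trans (ap-cong (G.star₁ (F.star₁ f)) {M} (ap-natHom (fwd (roundTrip A)) {M} p))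
          (pt-trans (roundTrip-natural f M p)
        (pt-trans (pt-sym (ap-natHom (fwd (roundTrip B)) {M} _))
            (pt-sym (ap-∙ (natHom (fwd (roundTrip B))) f {M} p)))))

  ε-square : {A B : SynObj T} (f : SynHom T A B) →
    _≈ₛ_ T (synComp T (proj₁ f) (proj₁ (natHom (bwdT (roundTrip A)))))
        (synComp T (proj₁ (natHom (bwdT (roundTrip B)))) (proj₁ (G.star₁ (F.star₁ f))))
  ε-square {A} {B} f = ap⇒≈ₛ (_∙_ f (natHom (bwdT (roundTrip A)))) (_∙_ (natHom (bwdT (roundTrip B))) (G.star₁ (F.star₁ f))) λ {M} p →
    pt-trans (ap-∙ f (natHom (bwdT (roundTrip A))) {M} p)
      (pt-trans (pt-sym (bwd-fwd (roundTrip B) M _)) (pt-trans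
          (bwd-cong (roundTrip B) M (pt-trans (pt-sym (roundTrip-natural f M _))
          (ap-cong (G.star₁ (F.star₁ f)) {M} (pt-trans (tr-cong (fwd (roundTrip A)) M
              (ap-natHom (bwdT (roundTrip A)) {M} p)) (fwd-bwd (roundTrip A) M p)))))
        (pt-trans (pt-sym (ap-natHom (bwdT (roundTrip B)) {M} _))
            (pt-sym (ap-∙ (natHom (bwdT (roundTrip B))) (G.star₁ (F.star₁ f)) {M} p)))))

ModEquiv⇒Equivalence : {Sg Sg' : Signature} {T : Theory Sg} {T' : Theory Sg'} → CartAx T → CartAx T' →
    ModEquiv T T' →
                       Equivalence (SyntacticCategory T) (SyntacticCategory T')
ModEquiv⇒Equivalence cax cax' E = record
  { F = F.star ; G = G.star
  ; η = λ A → natHom (fwd (rt A)) ; η⁻¹ = λ A → natHom (bwdT (rt A))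
  ; η-isoˡ = λ A → inverse-homs cax (rt A) ; η-isoʳ = λ A → inverse-homs′ cax (rt A)
  ; η-natural = η-square cax cax' right left unit
  ; ε = λ B → Yoneda.natHom cax' (bwdT (rt' B)) ; ε⁻¹ = λ B → Yoneda.natHom cax' (fwd (rt' B))
  ; ε-isoˡ = λ B → inverse-homs′ cax' (rt' B) ; ε-isoʳ = λ B → inverse-homs cax' (rt' B)
  ; ε-natural = ε-square cax' cax left right counit }
  where
    open ModEquiv E
    open Yoneda cax
    module G = Star cax cax' right
    module F = Star cax' cax left
    rt = roundTrip cax cax' right left unit
    rt' = roundTrip cax' cax left right counit

-- Reducts along signature morphisms

module _ {S S' : Set} (f : S → S') where
  mapFam : ∀ {P : S' → Set} {ss} → Fam (λ s → P (f s)) ss → Fam P (map f ss)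
  mapFam {ss = s ∷ ss} e _ (here refl) = e s (here refl)
  mapFam {ss = s ∷ ss} e t (there x)   = mapFam (tail e) t x

  mapFam-mapVar : ∀ {P : S' → Set} {ss} (e : Fam (λ s → P (f s)) ss) s (x : s ∈ ss) → mapFam {P} e (f s)
      (mapVar f x) ≡ e s x
  mapFam-mapVar e s (here refl) = refl
  mapFam-mapVar e s (there x)   = mapFam-mapVar (tail e) s x

  map-cases : ∀ {ss} (Q : ∀ t → t ∈ map f ss → Set) → (∀ s (x : s ∈ ss) → Q (f s) (mapVar f x)) → ∀ t x → Q t x
  map-cases {s ∷ ss} Q q _ (here refl) = q s (here refl)
  map-cases {s ∷ ss} Q q t (there x)   = map-cases (λ t y → Q t (there y)) (λ s y → q s (there y)) t x

module _ {A B : Signature} (m : SigMor A B) where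
  open SigMor m

  module _ (N : Structure B) where
    private module N = Structure N

    unmap : ∀ {ss} → N.Env (map sortMap ss) → Fam (λ s → N.Car (sortMap s)) ss
    unmap e s x = e (sortMap s) (mapVar sortMap x)

    mapFam-unmap : ∀ {ss} (e : N.Env (map sortMap ss)) → mapFam sortMap {P = N.Car} (unmap e) N.≋ e
    mapFam-unmap e = map-cases sortMap _ (λ s x → N.≈-≡ (mapFam-mapVar sortMap (unmap e) s x))

    mapFam-cong : ∀ {ss} {d e : Fam (λ s → N.Car (sortMap s)) ss} → (∀ s x → d s x N.≈ e s x) →
                  mapFam sortMap {P = N.Car} d N.≋ mapFam sortMap {P = N.Car} e
    mapFam-cong {d = d} {e} p = map-cases sortMap _ (λ s x → N.≈-trans (N.≈-≡ (mapFam-mapVar sortMap d s x))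
      (N.≈-trans (p s x) (N.≈-≡ (sym (mapFam-mapVar sortMap e s x)))))

    reduct : Structure A
    reduct .Structure.Car s = N.Car (sortMap s)
    reduct .Structure._≈_ = N._≈_
    reduct .Structure.≈-refl = N.≈-refl
    reduct .Structure.≈-sym = N.≈-sym
    reduct .Structure.≈-trans = N.≈-trans
    reduct .Structure.fun f e = N.fun (funMap f) (mapFam sortMap e)
    reduct .Structure.fun-cong f p = N.fun-cong (funMap f) (mapFam-cong p)
    reduct .Structure.rl R e = N.rl (relMap R) (mapFam sortMap e)
    reduct .Structure.rl-cong R p = N.rl-cong (relMap R) (mapFam-cong p)

    private module Rd = Structure reduct

    mutual
      evalT-tr : ∀ {Γ s} (t : Term A Γ s) {e : N.Env (map sortMap Γ)} {d : Rd.Env Γ} →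
          (∀ s x → unmap e s x N.≈ d s x) →
                 N.evalT (trT m t) e N.≈ Rd.evalT t d
      evalT-tr (var x)    p = p _ x
      evalT-tr (app f ts) {e} p = N.fun-cong (funMap f) (λ s x → N.≈-trans
          (N.≈-sym (mapFam-unmap (N.evalTs (trTs m ts) e) s x))
        (mapFam-cong {d = unmap (N.evalTs (trTs m ts) e)} (evalTs-tr ts p) s x))

      evalTs-tr : ∀ {Γ ss} (ts : Terms A Γ ss) {e : N.Env (map sortMap Γ)} {d : Rd.Env Γ} →
          (∀ s x → unmap e s x N.≈ d s x) →
                  ∀ s x → unmap (N.evalTs (trTs m ts) e) s x N.≈ Rd.evalTs ts d s x
      evalTs-tr (t ∷ₜ ts) p _ (here refl) = evalT-tr t p
      evalTs-tr (t ∷ₜ ts) p s (there x)   = evalTs-tr ts p s x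

    private
      rel-env : ∀ {Γ ss} (ts : Terms A Γ ss) {e : N.Env (map sortMap Γ)} {d : Rd.Env Γ} →
          (∀ s x → unmap e s x N.≈ d s x) →
                N.evalTs (trTs m ts) e N.≋ mapFam sortMap {P = N.Car} (Rd.evalTs ts d)
      rel-env ts {e} p s x = N.≈-trans (N.≈-sym (mapFam-unmap (N.evalTs (trTs m ts) e) s x))
          (mapFam-cong {d = unmap (N.evalTs (trTs m ts) e)} (evalTs-tr ts p) s x)

    mutual
      Sat-tr : ∀ {Γ} (φ : Formula A Γ) {e : N.Env (map sortMap Γ)} {d : Rd.Env Γ} →
          (∀ s x → unmap e s x N.≈ d s x) →
               N.Sat (trF m φ) e → Rd.Sat φ d
      Sat-tr ⊤ᶠ         p q       = tt
      Sat-tr (φ ∧ᶠ ψ)   p (q , r) = Sat-tr φ p q , Sat-tr ψ p r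
      Sat-tr (t ≐ u)    p q       = N.≈-trans (N.≈-sym (evalT-tr t p)) (N.≈-trans q (evalT-tr u p))
      Sat-tr (rel R ts) p q       = N.rl-cong (relMap R) (rel-env ts p) q
      Sat-tr (∃ᶠ s φ)   p (a , q) = a , Sat-tr φ (∷-cases _ N.≈-refl p) q

      Sat-untr : ∀ {Γ} (φ : Formula A Γ) {e : N.Env (map sortMap Γ)} {d : Rd.Env Γ} →
          (∀ s x → unmap e s x N.≈ d s x) →
                 Rd.Sat φ d → N.Sat (trF m φ) e
      Sat-untr ⊤ᶠ         p q       = tt
      Sat-untr (φ ∧ᶠ ψ)   p (q , r) = Sat-untr φ p q , Sat-untr ψ p r
      Sat-untr (t ≐ u)    p q       = N.≈-trans (evalT-tr t p) (N.≈-trans q (N.≈-sym (evalT-tr u p)))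
      Sat-untr (rel R ts) p q       = N.rl-cong (relMap R) (λ s x → N.≈-sym (rel-env ts p s x)) q
      Sat-untr (∃ᶠ s φ)   p (a , q) = a , Sat-untr φ (∷-cases _ N.≈-refl p) q

    valid-reduct : (σ : Sequent A) → Valid N (trSeq m σ) → Valid reduct σ
    valid-reduct (seq Γ φ ψ) v e q = Sat-tr ψ (λ s x → N.≈-≡ (mapFam-mapVar sortMap e s x))
      (v (mapFam sortMap e) (Sat-untr φ (λ s x → N.≈-≡ (mapFam-mapVar sortMap e s x)) q))

    valid-tr : (σ : Sequent A) → Valid reduct σ → Valid N (trSeq m σ)
    valid-tr (seq Γ φ ψ) v e q = Sat-untr ψ (λ _ _ → N.≈-refl) (v (unmap e) (Sat-tr φ (λ _ _ → N.≈-refl) q))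

  reductHom : {N O : Structure B} → Hom N O → Hom (reduct N) (reduct O)
  reductHom h .fn a = fn h a
  reductHom h .fn-cong p = fn-cong h p
  reductHom {N} {O} h .Hom.fn-fun f e = O.≈-trans (Hom.fn-fun h (funMap f) _)
      (O.fun-cong (funMap f) (map-cases sortMap _ λ s x →
      O.≈-≡ (trans (cong (fn h) (mapFam-mapVar sortMap e s x))
          (sym (mapFam-mapVar sortMap (λ s x → fn h (e s x)) s x)))))
    where module O = Structure O
  reductHom {N} {O} h .Hom.fn-rel R e q = O.rl-cong (relMap R) (map-cases sortMap _ λ s x →
      O.≈-≡ (trans (cong (fn h) (mapFam-mapVar sortMap e s x))
          (sym (mapFam-mapVar sortMap (λ s x → fn h (e s x)) s x)))) (Hom.fn-rel h (relMap R) _ q)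
    where module O = Structure O

  module _ {T : Theory A} {U : Theory B} (ok : (N : Model U) (a : Ax T) → Valid (reduct (str N)) (axiom T a)) where
    reductMF : MFun U T
    reductMF .MFun.mob N .Model.str = reduct (str N)
    reductMF .MFun.mob N .Model.valid = ok N
    reductMF .MFun.mhom h = reductHom h
    reductMF .MFun.mhom-ext e a = e a
    reductMF .MFun.mhom-id {M} a = Model.≈-refl M
    reductMF .MFun.mhom-∘ {O = O} n m a = Model.≈-refl O

    reductRF : RepFun U T
    reductRF .RepFun.mfun = reductMF
    reductRF .RepFun.sorts s .robj = sortObj (sortMap s)
    reductRF .RepFun.sorts s .riso .fwd .tr N p = env p (sortMap s) (here refl)
    reductRF .RepFun.sorts s .riso .fwd .tr-cong N e = at e (sortMap s) (here refl)
    reductRF .RepFun.sorts s .riso .fwd .tr-natural {N = O} m p = Model.≈-refl O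
    reductRF .RepFun.sorts s .riso .bwd N a = mkPt (a ▹ ε) tt
    reductRF .RepFun.sorts s .riso .bwd-cong N e .at = ∷-cases _ e (λ _ ())
    reductRF .RepFun.sorts s .riso .bwd-fwd N p .at = ∷-cases _ (Model.≈-refl N) (λ _ ())
    reductRF .RepFun.sorts s .riso .fwd-bwd N p = Model.≈-refl N
    reductRF .RepFun.rels R .robj = relObj (relMap R)
    reductRF .RepFun.rels R .riso .fwd .tr N p = mkPt (unmap (str N) (env p))
      (Model.rl-cong N (relMap R) (λ s x → Model.≈-trans N (Model.evalTs-varsOf N (λ x → x) (env p) s x)
        (Model.≈-trans N (Model.≈-sym N (mapFam-unmap (str N) (env p) s x))
            (mapFam-cong (str N) (λ s x → Model.≈-sym N (Structure.evalTs-varsOf (reduct (str N))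
            (λ x → x) _ s x)) s x))) (sat p))
    reductRF .RepFun.rels R .riso .fwd .tr-cong N e .at s x = at e _ _
    reductRF .RepFun.rels R .riso .fwd .tr-natural {N = O} m p .at s x = Model.≈-refl O
    reductRF .RepFun.rels R .riso .bwd N p = mkPt (mapFam sortMap (env p))
      (Model.rl-cong N (relMap R) (λ s x → Model.≈-trans N (mapFam-cong (str N)
          (λ s x → Structure.evalTs-varsOf (reduct (str N)) (λ x → x) (env p) s x) s x)
        (Model.≈-sym N (Model.evalTs-varsOf N (λ x → x) _ s x))) (sat p))
    reductRF .RepFun.rels R .riso .bwd-cong N e .at = mapFam-cong (str N) (at e)
    reductRF .RepFun.rels R .riso .bwd-fwd N p .at = mapFam-unmap (str N) (env p)
    reductRF .RepFun.rels R .riso .fwd-bwd N p .at s x = Model.≈-≡ N (mapFam-mapVar sortMap (env p) s x)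

-- Translation of derivations

module _ {A B : Signature} (m : SigMor A B) where
  open SigMor m
  private
    module SA = Substitution A
    module SB = Substitution B

  mutual
    trT-sub : ∀ {Γ Δ s} (t : Term A Γ s) {σ : SA.Subst Γ Δ} {σ' : SB.Subst (map sortMap Γ) (map sortMap Δ)} →
              (∀ s x → trT m (σ s x) ≡ σ' (sortMap s) (mapVar sortMap x)) → trT m (t SA.[ σ ]ᵗ) ≡ trT m t SB.[ σ' ]ᵗ
    trT-sub (var x)    p = p _ x
    trT-sub (app f ts) p = cong (app (funMap f)) (trTs-sub ts p)

    trTs-sub : ∀ {Γ Δ ss} (ts : Terms A Γ ss) {σ : SA.Subst Γ Δ} {σ' : SB.Subst (map sortMap Γ) (map sortMap Δ)} →
               (∀ s x → trT m (σ s x) ≡ σ' (sortMap s) (mapVar sortMap x)) → trTs m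
                   (ts SA.[ σ ]ᵗˢ) ≡ trTs m ts SB.[ σ' ]ᵗˢ
    trTs-sub []ₜ       p = refl
    trTs-sub (t ∷ₜ ts) p = cong₂ _∷ₜ_ (trT-sub t p) (trTs-sub ts p)

  trT-wk : ∀ {Γ s t} (u : Term A Γ s) → trT m (renT (there {x = t}) u) ≡ renT there (trT m u)
  trT-wk u = trans (cong (trT m) (SA.renT-sub there u)) (trans
      (trT-sub u {SA.vars there} {SB.vars there} (λ _ _ → refl)) (sym (SB.renT-sub there (trT m u))))

  trF-sub : ∀ {Γ Δ} (φ : Formula A Γ) {σ : SA.Subst Γ Δ} {σ' : SB.Subst (map sortMap Γ) (map sortMap Δ)} →
            (∀ s x → trT m (σ s x) ≡ σ' (sortMap s) (mapVar sortMap x)) → trF m (φ SA.[ σ ]) ≡ trF m φ SB.[ σ' ]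
  trF-sub ⊤ᶠ         p = refl
  trF-sub (φ ∧ᶠ ψ)   p = cong₂ _∧ᶠ_ (trF-sub φ p) (trF-sub ψ p)
  trF-sub (t ≐ u)    p = cong₂ _≐_ (trT-sub t p) (trT-sub u p)
  trF-sub (rel R ts) p = cong (rel (relMap R)) (trTs-sub ts p)
  trF-sub (∃ᶠ s φ) {σ} {σ'} p = cong (∃ᶠ (sortMap s)) (trF-sub φ {SA.liftˢ σ} {SB.liftˢ σ'} lifted)
    where
      lifted : ∀ t x → trT m (SA.liftˢ {s = s} σ t x) ≡ SB.liftˢ σ' (sortMap t) (mapVar sortMap x)
      lifted t (here refl) = refl
      lifted t (there x)   = trans (trT-wk (σ t x)) (cong (renT there) (p t x))

  trF-wk : ∀ {Γ t} (φ : Formula A Γ) → trF m (wk {s = t} φ) ≡ wk (trF m φ)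
  trF-wk φ = trans (cong (trF m) (SA.ren-sub there φ)) (trans
      (trF-sub φ {SA.vars there} {SB.vars there} (λ _ _ → refl)) (sym (SB.ren-sub there (trF m φ))))

  trF-at₀ : ∀ {Γ s} (φ : Formula A (s ∷ Γ)) → trF m (at₀ φ) ≡ at₀ (trF m φ)
  trF-at₀ φ = trF-sub φ (∷-cases _ refl (λ _ _ → refl))

  trF-at₁ : ∀ {Γ s} (φ : Formula A (s ∷ Γ)) → trF m (at₁ φ) ≡ at₁ (trF m φ)
  trF-at₁ φ = trF-sub φ (∷-cases _ refl (λ _ _ → refl))

  module _ {T : Theory A} {U : Theory B} (ok : ∀ a → Derivable U (trSeq m (axiom T a))) where
    trDeriv : ∀ {Γ φ ψ} → Deriv T Γ φ ψ → Deriv U (map sortMap Γ) (trF m φ) (trF m ψ)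
    trDeriv (axiom-rule a) = ok a
    trDeriv identity = identity
    trDeriv (cut d e) = cut (trDeriv d) (trDeriv e)
    trDeriv (substitution {φ = φ} {ψ} σ d) =
      subst (Deriv U _ (trF m (subF σ φ))) (sym (trF-sub ψ {λ s → σ {s}} {σ'} eq))
          (subst (λ χ → Deriv U _ χ (trF m ψ SB.[ σ' ])) (sym (trF-sub φ {λ s → σ {s}} {σ'} eq))
        (substitution (λ {s} → σ' s) (trDeriv d)))
      where
        σ' = mapFam sortMap {P = Term B _} (λ s x → trT m (σ x))
        eq : ∀ s x → trT m (σ x) ≡ σ' (sortMap s) (mapVar sortMap x)
        eq s x = sym (mapFam-mapVar sortMap {P = Term B _} (λ s x → trT m (σ x)) s x)
    trDeriv eq-refl = eq-refl
    trDeriv (eq-subst φ) = subst (Deriv U _ _) (sym (trF-at₁ φ))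
        (subst (λ χ → Deriv U _ (_ ∧ᶠ χ) (at₁ (trF m φ))) (sym (trF-at₀ φ)) (eq-subst (trF m φ)))
    trDeriv ⊤-intro = ⊤-intro
    trDeriv ∧-elimˡ = ∧-elimˡ
    trDeriv ∧-elimʳ = ∧-elimʳ
    trDeriv (∧-intro d e) = ∧-intro (trDeriv d) (trDeriv e)
    trDeriv (∃-elim {ψ = ψ} d) = ∃-elim (subst (Deriv U _ _) (trF-wk ψ) (trDeriv d))
    trDeriv (∃-elim⁻¹ {ψ = ψ} d) = subst (Deriv U _ _) (sym (trF-wk ψ)) (∃-elim⁻¹ (trDeriv d))
    trDeriv (frobenius {s = s} {φ} {ψ}) = subst (λ χ → Deriv U _ (trF m φ ∧ᶠ trF m (∃ᶠ s ψ)) (∃ᶠ _ (χ ∧ᶠ trF m ψ)))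
        (sym (trF-wk φ)) frobenius

    trCart : ∀ {Γ} {φ : Formula A Γ} → Cart T φ → Cart U (trF m φ)
    trCart ⊤-cart = ⊤-cart
    trCart (∧-cart c d) = ∧-cart (trCart c) (trCart d)
    trCart ≐-cart = ≐-cart
    trCart rel-cart = rel-cart
    trCart (∃-cart {φ = φ} c u) = ∃-cart (trCart c) (subst (λ χ → Deriv U _ χ (v₀ ≐ v₁))
        (cong₂ _∧ᶠ_ (trF-at₀ φ) (trF-at₁ φ)) (trDeriv u))

-- Morita extensions

open MoritaSpec

module Extension {Sg : Signature} {T : Theory Sg} (S : MoritaSpec T) where
  T⁺ : Theory (ExtSig S)
  T⁺ = ExtTheory S

  private
    m : SigMor Sg (ExtSig S)
    m = inclusion S
    open Substitution (ExtSig S)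

    bigAnd-sub : ∀ {Ξ Ξ'} {I : Set} (Δ : List I) (F : ∀ s → s ∈ Δ → Formula (ExtSig S) Ξ) (σ : Subst Ξ Ξ') →
                 bigAnd Δ (λ {s} → F s) [ σ ] ≡ bigAnd Δ (λ {s} x → F s x [ σ ])
    bigAnd-sub []      F σ = refl
    bigAnd-sub (_ ∷ Δ) F σ = cong (_ ∧ᶠ_) (bigAnd-sub Δ (λ s x → F s (there x)) σ)

  -- Old formulas stay cartesian under translation. The existentials in the defining sequents are
  -- unique by the companion axioms `prodUniq`, `subInj` and `oneUniq` of the extension itself.
  ext-cartAx : CartAx T → CartAx T⁺
  ext-cartAx cax (inj₁ a) = trCart m (λ b → axiom-rule (inj₁ b)) (proj₁ (cax a)) , trCart m
      (λ b → axiom-rule (inj₁ b)) (proj₂ (cax a))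
  ext-cartAx cax (inj₂ (fun→ f)) = ≐-cart , trCart m (λ b → axiom-rule (inj₁ b)) (fCart S f)
  ext-cartAx cax (inj₂ (fun← f)) = trCart m (λ b → axiom-rule (inj₁ b)) (fCart S f) , ≐-cart
  ext-cartAx cax (inj₂ (rel→ r)) = rel-cart , trCart m (λ b → axiom-rule (inj₁ b)) (rCart S r)
  ext-cartAx cax (inj₂ (rel← r)) = trCart m (λ b → axiom-rule (inj₁ b)) (rCart S r) , rel-cart
  ext-cartAx cax (inj₂ (prodEx p)) = ⊤-cart , ∃-cart (bigAnd-cart (factors S p) _ (λ _ _ → ≐-cart))
    (subst (λ χ → Deriv T⁺ _ χ (v₀ ≐ v₁)) (sym (cong₂ _∧ᶠ_ (bigAnd-sub (factors S p) _ _)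
        (bigAnd-sub (factors S p) _ _)))
      (axiom-rule (inj₂ (prodUniq p))))
  ext-cartAx cax (inj₂ (prodUniq p)) = ∧-cart (bigAnd-cart (factors S p) _ (λ _ _ → ≐-cart))
      (bigAnd-cart (factors S p) _ (λ _ _ → ≐-cart)) , ≐-cart
  ext-cartAx cax (inj₂ (sub→ i)) = trCart m (λ b → axiom-rule (inj₁ b)) (subCart S i) ,
      ∃-cart′ ≐-cart λ k σ t u p q →
      instantiate (axiom-rule (inj₂ (subInj i))) (t ▹ u ▹ ε) (≐-trans p (≐-sym q))
    where open Deduction T⁺
  ext-cartAx cax (inj₂ (sub← i)) = proj₂ (ext-cartAx cax (inj₂ (sub→ i))) , proj₁ (ext-cartAx cax (inj₂ (sub→ i)))
  ext-cartAx cax (inj₂ (subInj i)) = ≐-cart , ≐-cart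
  ext-cartAx cax (inj₂ (oneEx o)) = ⊤-cart , ∃-cart′ ⊤-cart λ k σ t u p q → instantiate
      (axiom-rule (inj₂ (oneUniq o))) (t ▹ u ▹ ε) ⊤-intro
    where open Deduction T⁺
  ext-cartAx cax (inj₂ (oneUniq o)) = ⊤-cart , ≐-cart

  -- The axioms of the extension with witnesses named and arguments indexed by old contexts. `isExt`
  -- and `ext-valid` show it equivalent to validity, so later work on extended models never meets
  -- the sequents themselves.
  record IsExt (N : Structure (ExtSig S)) : Set where
    no-eta-equality
    private
      module N = Structure N
      module Rd = Structure (reduct m N)
    field
      base : ∀ a → Valid (reduct m N) (axiom T a)
      def-fun : ∀ f (e : Rd.Env (fArgs S f)) → Rd.Sat (fDef S f) (N.fun (defF f) (mapFam inj₁ e) ▹ e)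
      def-rel : ∀ r (e : Rd.Env (rArgs S r)) → N.rl (defR r) (mapFam inj₁ e) → Rd.Sat (rDef S r) e
      def-rel⁻¹ : ∀ r (e : Rd.Env (rArgs S r)) → Rd.Sat (rDef S r) e → N.rl (defR r) (mapFam inj₁ e)
      tuple : ∀ p (e : Rd.Env (factors S p)) → N.Car (inj₂ (prodS p))
      proj-tuple : ∀ p e s i → N.fun (proj p i) (tuple p e ▹ ε) N.≈ e s i
      proj-injective : ∀ p (a b : N.Car (inj₂ (prodS p))) → (∀ s (i : s ∈ factors S p) → N.fun (proj p i)
          (a ▹ ε) N.≈ N.fun (proj p i) (b ▹ ε)) → a N.≈ b
      incl-sat : ∀ i a → Rd.Sat (subDef S i) (N.fun (incl i) (a ▹ ε) ▹ ε)
      restrict : ∀ i x → Rd.Sat (subDef S i) (x ▹ ε) → N.Car (inj₂ (subS i))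
      incl-restrict : ∀ i x q → N.fun (incl i) (restrict i x q ▹ ε) N.≈ x
      incl-injective : ∀ i (a b : N.Car (inj₂ (subS i))) → N.fun (incl i) (a ▹ ε) N.≈ N.fun (incl i) (b ▹ ε) →
          a N.≈ b
      point : ∀ o → N.Car (inj₂ (oneS o))
      point-unique : ∀ o (a b : N.Car (inj₂ (oneS o))) → a N.≈ b

  module _ (N : Structure (ExtSig S)) where
    private
      module N = Structure N
      module Rd = Structure (reduct m N)
      single : ∀ {s} {a : N.Car s} (e : N.Env (s ∷ [])) → e s (here refl) N.≈ a → e N.≋ (a ▹ ε)
      single e q = ∷-cases _ q (λ _ ())
      F : ∀ {Ξ} p (t : Term (ExtSig S) Ξ (inj₂ (prodS p))) (ρ : Ren (map inj₁ (factors S p)) Ξ) s →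
          s ∈ factors S p → Formula (ExtSig S) Ξ
      F p t ρ s i = app (proj p i) (t ∷ₜ []ₜ) ≐ var (ρ (mapVar inj₁ i))
      varsThere : ∀ {s Γ} (a : N.Car s) (e : N.Env Γ) → N.evalTs (varsOf there) (a ▹ e) N.≋ e
      varsThere a e s x = N.evalTs-varsOf there (a ▹ e) s x

    isExt : (∀ a → Valid N (axiom T⁺ a)) → IsExt N
    isExt v .IsExt.base a = valid-reduct m N (axiom T a) (v (inj₁ a))
    isExt v .IsExt.def-fun f e = Sat-tr m N (fDef S f) (∷-cases _ N.≈-refl
        (λ s x → N.≈-≡ (mapFam-mapVar inj₁ e s x)))
      (v (inj₂ (fun→ f)) (N.fun (defF f) (mapFam inj₁ e) ▹ mapFam inj₁ e) (N.fun-cong (defF f) (varsThere _ _)))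
    isExt v .IsExt.def-rel r e q = Sat-tr m N (rDef S r) (λ s x → N.≈-≡ (mapFam-mapVar inj₁ e s x))
      (v (inj₂ (rel→ r)) (mapFam inj₁ e) (N.rl-cong (defR r) (λ s x → N.≈-sym (N.evalTs-varsOf (λ x → x) _ s x)) q))
    isExt v .IsExt.def-rel⁻¹ r e q = N.rl-cong (defR r) (λ s x → N.evalTs-varsOf (λ x → x) _ s x)
      (v (inj₂ (rel← r)) (mapFam inj₁ e) (Sat-untr m N (rDef S r) (λ s x → N.≈-≡ (mapFam-mapVar inj₁ e s x)) q))
    isExt v .IsExt.tuple p e = proj₁ (v (inj₂ (prodEx p)) (mapFam inj₁ e) tt)
    isExt v .IsExt.proj-tuple p e s i = N.≈-trans (N.fun-cong (proj p i)
        (λ t x → N.≈-sym (single (N.evalTs (var (here refl) ∷ₜ []ₜ) (a ▹ mapFam inj₁ e)) N.≈-refl t x)))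
        (N.≈-trans (N.Sat-bigAnd (factors S p) (F p (var (here refl)) there)
            (proj₂ (v (inj₂ (prodEx p)) (mapFam inj₁ e) tt)) s i) (N.≈-≡ (mapFam-mapVar inj₁ e s i)))
      where a = proj₁ (v (inj₂ (prodEx p)) (mapFam inj₁ e) tt)
    isExt v .IsExt.proj-injective p a b q = v (inj₂ (prodUniq p)) E
        (N.Sat-bigAnd-intro (factors S p) (F p v₀ (λ x → there (there x)))
            (λ s i → N.≈-trans (N.fun-cong (proj p i) (single _ N.≈-refl))
            (N.≈-≡ (sym (mapFam-mapVar inj₁ e s i)))) ,
         N.Sat-bigAnd-intro (factors S p) (F p v₁ (λ x → there (there x)))
             (λ s i → N.≈-trans (N.fun-cong (proj p i) (single _ N.≈-refl))
           (N.≈-trans (N.≈-sym (q s i)) (N.≈-≡ (sym (mapFam-mapVar inj₁ e s i))))))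
      where
        e : Rd.Env (factors S p)
        e s i = N.fun (proj p i) (a ▹ ε)
        E = a ▹ b ▹ mapFam inj₁ e
    isExt v .IsExt.incl-sat i a = Sat-tr m N (subDef S i) (∷-cases _ N.≈-refl (λ _ ()))
      (v (inj₂ (sub← i)) (N.fun (incl i) (a ▹ ε) ▹ ε) (a , N.fun-cong (incl i) (single _ N.≈-refl)))
    isExt v .IsExt.restrict i x q = proj₁ (v (inj₂ (sub→ i)) (x ▹ ε)
        (Sat-untr m N (subDef S i) (∷-cases _ N.≈-refl (λ _ ())) q))
    isExt v .IsExt.incl-restrict i x q = N.≈-trans (N.fun-cong (incl i)
        (λ t y → N.≈-sym (single (N.evalTs (var (here refl) ∷ₜ []ₜ) (_ ▹ x ▹ ε)) N.≈-refl t y)))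
      (proj₂ (v (inj₂ (sub→ i)) (x ▹ ε) (Sat-untr m N (subDef S i) (∷-cases _ N.≈-refl (λ _ ())) q)))
    isExt v .IsExt.incl-injective i a b q = v (inj₂ (subInj i)) (a ▹ b ▹ ε)
      (N.≈-trans (N.fun-cong (incl i) (single _ N.≈-refl)) (N.≈-trans q
          (N.≈-sym (N.fun-cong (incl i) (single _ N.≈-refl)))))
    isExt v .IsExt.point o = proj₁ (v (inj₂ (oneEx o)) ε tt)
    isExt v .IsExt.point-unique o a b = v (inj₂ (oneUniq o)) (a ▹ b ▹ ε) tt

    module _ (X : IsExt N) where
      private
        module X = IsExt X
        M : Model T
        M .Model.str = reduct m N
        M .Model.valid = X.base

      def-unique : ∀ f (e : Rd.Env (fArgs S f)) y → Rd.Sat (fDef S f) (y ▹ e) → N.fun (defF f) (mapFam inj₁ e) N.≈ y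
      def-unique f e y q = sound M (proj₂ (fFunc S f)) (N.fun (defF f) (mapFam inj₁ e) ▹ y ▹ e)
        (Rd.Sat-unsub (fDef S f) _ (∷-cases _ N.≈-refl (λ _ _ → N.≈-refl)) (X.def-fun f e) ,
         Rd.Sat-unsub (fDef S f) _ (∷-cases _ N.≈-refl (λ _ _ → N.≈-refl)) q)

      ext-valid : ∀ a → Valid N (axiom T⁺ a)
      ext-valid (inj₁ a) = valid-tr m N (axiom T a) (X.base a)
      ext-valid (inj₂ (fun→ f)) e q = Sat-untr m N (fDef S f) (∷-cases _ q' (λ _ _ → N.≈-refl))
          (X.def-fun f (unmap m N (tail e)))
        where q' = N.≈-trans (N.≈-sym q) (N.fun-cong (defF f) (λ s x → N.≈-trans (N.evalTs-varsOf there e s x) (N.≈-sym (mapFam-unmap m N (tail e) s x))))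
      ext-valid (inj₂ (fun← f)) e q = N.≈-trans (N.fun-cong (defF f)
          (λ s x → N.≈-trans (N.evalTs-varsOf there e s x) (N.≈-sym (mapFam-unmap m N (tail e) s x))))
        (def-unique f (unmap m N (tail e)) (e _ (here refl)) (Sat-tr m N (fDef S f)
            (∷-cases _ N.≈-refl (λ _ _ → N.≈-refl)) q))
      ext-valid (inj₂ (rel→ r)) e q = Sat-untr m N (rDef S r) (λ _ _ → N.≈-refl) (X.def-rel r (unmap m N e)
        (N.rl-cong (defR r) (λ s x → N.≈-trans (N.evalTs-varsOf (λ x → x) e s x)
            (N.≈-sym (mapFam-unmap m N e s x))) q))
      ext-valid (inj₂ (rel← r)) e q = N.rl-cong (defR r) (λ s x → N.≈-trans (mapFam-unmap m N e s x)
          (N.≈-sym (N.evalTs-varsOf (λ x → x) e s x)))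
        (X.def-rel⁻¹ r (unmap m N e) (Sat-tr m N (rDef S r) (λ _ _ → N.≈-refl) q))
      ext-valid (inj₂ (prodEx p)) e q = X.tuple p (unmap m N e) , N.Sat-bigAnd-intro (factors S p)
          (F p (var (here refl)) there)
        (λ s i → N.≈-trans (N.fun-cong (proj p i) (single _ N.≈-refl)) (X.proj-tuple p (unmap m N e) s i))
      ext-valid (inj₂ (prodUniq p)) e (q , r) = X.proj-injective p _ _ λ s i →
        N.≈-trans (N.fun-cong (proj p i) (λ t x → N.≈-sym (single (N.evalTs (v₀ ∷ₜ []ₜ) e) N.≈-refl t x)))
          (N.≈-trans (N.Sat-bigAnd (factors S p) (F p v₀ (λ x → there (there x))) q s i)
            (N.≈-trans (N.≈-sym (N.Sat-bigAnd (factors S p) (F p v₁ (λ x → there (there x))) r s i))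
                (N.fun-cong (proj p i) (single _ N.≈-refl))))
      ext-valid (inj₂ (sub→ i)) e q = X.restrict i (e _ (here refl)) q' , N.≈-trans
          (N.fun-cong (incl i) (single _ N.≈-refl)) (X.incl-restrict i _ q')
        where q' = Sat-tr m N (subDef S i) (∷-cases _ N.≈-refl (λ _ ())) q
      ext-valid (inj₂ (sub← i)) e (a , q) = Sat-untr m N (subDef S i)
          (∷-cases _ (N.≈-trans (N.≈-sym q) (N.fun-cong (incl i) (single _ N.≈-refl))) (λ _ ())) (X.incl-sat i a)
      ext-valid (inj₂ (subInj i)) e q = X.incl-injective i _ _
        (N.≈-trans (N.fun-cong (incl i) (λ t x → N.≈-sym (single (N.evalTs (v₀ ∷ₜ []ₜ) e) N.≈-refl t x)))
            (N.≈-trans q (N.fun-cong (incl i) (single _ N.≈-refl))))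
      ext-valid (inj₂ (oneEx o)) e q = X.point o , tt
      ext-valid (inj₂ (oneUniq o)) e q = X.point-unique o _ _

  base-ok : (N : Model T⁺) (a : Ax T) → Valid (reduct m (str N)) (axiom T a)
  base-ok N a = IsExt.base (isExt (str N) (Model.valid N)) a

  reductE : RepFun T⁺ T
  reductE = reductRF m base-ok

  module _ (M : Model T) where
    private module M = Model M

    CarE : ExtSort S → Set
    CarE (inj₁ s) = M.Car s
    CarE (inj₂ (prodS p)) = M.Env (factors S p)
    CarE (inj₂ (subS i)) = Σ (M.Car (subBase S i)) λ x → M.Sat (subDef S i) (x ▹ ε)
    CarE (inj₂ (oneS o)) = ⊤

    EqE : ∀ s → CarE s → CarE s → Set
    EqE (inj₁ s) = M._≈_
    EqE (inj₂ (prodS p)) = M._≋_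
    EqE (inj₂ (subS i)) a b = proj₁ a M.≈ proj₁ b
    EqE (inj₂ (oneS o)) a b = ⊤

    reflE : ∀ s {a} → EqE s a a
    reflE (inj₁ s) = M.≈-refl
    reflE (inj₂ (prodS p)) s i = M.≈-refl
    reflE (inj₂ (subS i)) = M.≈-refl
    reflE (inj₂ (oneS o)) = tt

    symE : ∀ s {a b} → EqE s a b → EqE s b a
    symE (inj₁ s) = M.≈-sym
    symE (inj₂ (prodS p)) q s i = M.≈-sym (q s i)
    symE (inj₂ (subS i)) = M.≈-sym
    symE (inj₂ (oneS o)) _ = tt

    transE : ∀ s {a b c} → EqE s a b → EqE s b c → EqE s a c
    transE (inj₁ s) = M.≈-trans
    transE (inj₂ (prodS p)) q r s i = M.≈-trans (q s i) (r s i)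
    transE (inj₂ (subS i)) = M.≈-trans
    transE (inj₂ (oneS o)) _ _ = tt

    old : ∀ {ss} → Fam CarE (map inj₁ ss) → M.Env ss
    old e s x = e (inj₁ s) (mapVar inj₁ x)

    valueE : ∀ f (e : M.Env (fArgs S f)) → Σ (M.Car (fCod S f)) λ y → M.Sat (fDef S f) (y ▹ e)
    valueE f e = sound M (proj₁ (fFunc S f)) e tt

    valueE-unique : ∀ f (e d : M.Env (fArgs S f)) y → e M.≋ d → M.Sat (fDef S f) (y ▹ d) → proj₁ (valueE f e) M.≈ y
    valueE-unique f e d y p q = sound M (proj₂ (fFunc S f)) (proj₁ (valueE f e) ▹ y ▹ d)
      (M.Sat-unsub (fDef S f) _ (∷-cases _ M.≈-refl (λ s x → M.≈-sym (p s x))) (proj₂ (valueE f e)) ,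
       M.Sat-unsub (fDef S f) _ (∷-cases _ M.≈-refl (λ _ _ → M.≈-refl)) q)

    funE : ∀ {ss s} → ExtFun S ss s → Fam CarE ss → CarE s
    funE (oldF f) e = M.fun f (old e)
    funE (defF f) e = proj₁ (valueE f (old e))
    funE (proj p {s} i) e = e _ (here refl) s i
    funE (incl i) e = proj₁ (e _ (here refl))

    relE : ∀ {ss} → ExtRel S ss → Fam CarE ss → Set
    relE (oldR R) e = M.rl R (old e)
    relE (defR r) e = M.Sat (rDef S r) (old e)

    funE-cong : ∀ {ss s} (f : ExtFun S ss s) {d e : Fam CarE ss} → (∀ s x → EqE s (d s x) (e s x)) → EqE s
        (funE f d) (funE f e)
    funE-cong (oldF f) q = M.fun-cong f (λ s x → q (inj₁ s) (mapVar inj₁ x))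
    funE-cong (defF f) {d} {e} q = valueE-unique f (old d) (old e) _ (λ s x → q (inj₁ s) (mapVar inj₁ x))
        (proj₂ (valueE f (old e)))
    funE-cong (proj p {s} i) q = q _ (here refl) s i
    funE-cong (incl i) q = q _ (here refl)

    relE-cong : ∀ {ss} (R : ExtRel S ss) {d e : Fam CarE ss} → (∀ s x → EqE s (d s x) (e s x)) → relE R d → relE R e
    relE-cong (oldR R) q = M.rl-cong R (λ s x → q (inj₁ s) (mapVar inj₁ x))
    relE-cong (defR r) q = M.Sat-cong (rDef S r) (λ s x → q (inj₁ s) (mapVar inj₁ x))

    expandStr : Structure (ExtSig S)
    expandStr .Structure.Car = CarE
    expandStr .Structure._≈_ {s} = EqE s
    expandStr .Structure.≈-refl {s} = reflE s
    expandStr .Structure.≈-sym {s} = symE s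
    expandStr .Structure.≈-trans {s} = transE s
    expandStr .Structure.fun = funE
    expandStr .Structure.fun-cong = funE-cong
    expandStr .Structure.rl = relE
    expandStr .Structure.rl-cong = relE-cong

    private
      old-map : ∀ {ss} (e : M.Env ss) → old (mapFam inj₁ e) M.≋ e
      old-map e s x = M.≈-≡ (mapFam-mapVar inj₁ e s x)

    expand-reduct : Iso (str M) (reduct m expandStr)
    expand-reduct .Iso.to .fn a = a
    expand-reduct .Iso.to .fn-cong p = p
    expand-reduct .Iso.to .Hom.fn-fun f e = M.fun-cong f (λ s x → M.≈-sym (old-map e s x))
    expand-reduct .Iso.to .Hom.fn-rel R e = M.rl-cong R (λ s x → M.≈-sym (old-map e s x))
    expand-reduct .Iso.from .fn a = a
    expand-reduct .Iso.from .fn-cong p = p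
    expand-reduct .Iso.from .Hom.fn-fun f e = M.fun-cong f (old-map e)
    expand-reduct .Iso.from .Hom.fn-rel R e = M.rl-cong R (old-map e)
    expand-reduct .Iso.from-to a = M.≈-refl
    expand-reduct .Iso.to-from a = M.≈-refl

    private
      module Rd = Structure (reduct m expandStr)
      there-and : ∀ {Γ} (φ : Formula Sg Γ) (e : M.Env Γ) → M.Sat φ e → Rd.Sat φ e
      there-and φ e = Hom.fn-Sat (Iso.to expand-reduct) φ e
      and-back : ∀ {Γ} (φ : Formula Sg Γ) (e : M.Env Γ) → Rd.Sat φ e → M.Sat φ e
      and-back φ e = Hom.fn-Sat (Iso.from expand-reduct) φ e

    expand-isExt : IsExt expandStr
    expand-isExt .IsExt.base a = iso-valid expand-reduct (axiom T a) (M.valid a)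
    expand-isExt .IsExt.def-fun f e = there-and (fDef S f) _ (M.Sat-cong (fDef S f) (∷-cases _ M.≈-refl (old-map e))
        (proj₂ (valueE f (old (mapFam inj₁ e)))))
    expand-isExt .IsExt.def-rel r e q = there-and (rDef S r) e (M.Sat-cong (rDef S r) (old-map e) q)
    expand-isExt .IsExt.def-rel⁻¹ r e q = M.Sat-cong (rDef S r) (λ s x → M.≈-sym (old-map e s x))
        (and-back (rDef S r) e q)
    expand-isExt .IsExt.tuple p e = e
    expand-isExt .IsExt.proj-tuple p e s i = M.≈-refl
    expand-isExt .IsExt.proj-injective p a b q = q
    expand-isExt .IsExt.incl-sat i a = Rd.Sat-cong (subDef S i) (∷-cases _ M.≈-refl (λ _ ()))
        (there-and (subDef S i) _ (proj₂ a))
    expand-isExt .IsExt.restrict i x q = x , M.Sat-cong (subDef S i) (∷-cases _ M.≈-refl (λ _ ()))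
        (and-back (subDef S i) _ q)
    expand-isExt .IsExt.incl-restrict i x q = M.≈-refl
    expand-isExt .IsExt.incl-injective i a b q = q
    expand-isExt .IsExt.point o = tt
    expand-isExt .IsExt.point-unique o a b = tt

    expand : Model T⁺
    expand .Model.str = expandStr
    expand .Model.valid = ext-valid expandStr expand-isExt

  module _ {M N : Model T} (h : Hom (str M) (str N)) where
    private module N = Model N

    expandFn : ∀ s → CarE M s → CarE N s
    expandFn (inj₁ s) a = fn h a
    expandFn (inj₂ (prodS p)) e s i = fn h (e s i)
    expandFn (inj₂ (subS i)) (x , q) = fn h x , N.Sat-cong (subDef S i) (∷-cases _ N.≈-refl (λ _ ()))
        (Hom.fn-Sat h (subDef S i) _ q)
    expandFn (inj₂ (oneS o)) a = tt

    expandFn-cong : ∀ s {a b} → EqE M s a b → EqE N s (expandFn s a) (expandFn s b)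
    expandFn-cong (inj₁ s) q = fn-cong h q
    expandFn-cong (inj₂ (prodS p)) q s i = fn-cong h (q s i)
    expandFn-cong (inj₂ (subS i)) q = fn-cong h q
    expandFn-cong (inj₂ (oneS o)) q = tt

    -- For an explicitly defined function, the homomorphism preserves the defining formula, whose
    -- value in the target is unique.
    expandFn-fun : ∀ {ss s} (f : ExtFun S ss s) e → EqE N s (expandFn s (funE M f e))
        (funE N f (λ s x → expandFn s (e s x)))
    expandFn-fun (oldF f) e = Hom.fn-fun h f _
    expandFn-fun (defF f) e = N.≈-sym (valueE-unique N f _ _ _ (λ _ _ → N.≈-refl)
      (N.Sat-cong (fDef S f) (∷-cases _ N.≈-refl (λ _ _ → N.≈-refl))
          (Hom.fn-Sat h (fDef S f) _ (proj₂ (valueE M f (old M e))))))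
    expandFn-fun (proj p i) e = N.≈-refl
    expandFn-fun (incl i) e = N.≈-refl

    expandFn-rel : ∀ {ss} (R : ExtRel S ss) e → relE M R e → relE N R (λ s x → expandFn s (e s x))
    expandFn-rel (oldR R) e = Hom.fn-rel h R _
    expandFn-rel (defR r) e = Hom.fn-Sat h (rDef S r) _

    expandHom : Hom (expandStr M) (expandStr N)
    expandHom .fn {s} = expandFn s
    expandHom .fn-cong {s} = expandFn-cong s
    expandHom .Hom.fn-fun = expandFn-fun
    expandHom .Hom.fn-rel = expandFn-rel

  expandMF : MFun T T⁺
  expandMF .MFun.mob = expand
  expandMF .MFun.mhom {M} {N} h = expandHom {M} {N} h
  expandMF .MFun.mhom-ext {M} {N} {h} {k} e {s} = go s
    where
      go : ∀ s a → EqE N s (expandFn {M} {N} h s a) (expandFn {M} {N} k s a)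
      go (inj₁ s) a = e a
      go (inj₂ (prodS p)) a s i = e (a s i)
      go (inj₂ (subS i)) a = e (proj₁ a)
      go (inj₂ (oneS o)) a = tt
  expandMF .MFun.mhom-id {M} {s} = go s
    where
      go : ∀ s a → EqE M s (expandFn {M} {M} (idHom (str M)) s a) a
      go (inj₁ s) a = Model.≈-refl M
      go (inj₂ (prodS p)) a s i = Model.≈-refl M
      go (inj₂ (subS i)) a = Model.≈-refl M
      go (inj₂ (oneS o)) a = tt
  expandMF .MFun.mhom-∘ {M} {N} {O} h k {s} = go s
    where
      go : ∀ s a → EqE O s (expandFn {M} {O} (h ∘ʰ k) s a) (expandFn {N} {O} h s (expandFn {M} {N} k s a))
      go (inj₁ s) a = Model.≈-refl O
      go (inj₂ (prodS p)) a s i = Model.≈-refl O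
      go (inj₂ (subS i)) a = Model.≈-refl O
      go (inj₂ (oneS o)) a = tt

  expandRF : RepFun T T⁺
  expandRF .RepFun.mfun = expandMF
  expandRF .RepFun.sorts (inj₁ s) .robj = sortObj s
  expandRF .RepFun.sorts (inj₁ s) .riso .fwd .tr M p = env p s (here refl)
  expandRF .RepFun.sorts (inj₁ s) .riso .fwd .tr-cong M e = at e s (here refl)
  expandRF .RepFun.sorts (inj₁ s) .riso .fwd .tr-natural {N = N} m p = Model.≈-refl N
  expandRF .RepFun.sorts (inj₁ s) .riso .bwd M a = mkPt (a ▹ ε) tt
  expandRF .RepFun.sorts (inj₁ s) .riso .bwd-cong M e .at = ∷-cases _ e (λ _ ())
  expandRF .RepFun.sorts (inj₁ s) .riso .bwd-fwd M p .at = ∷-cases _ (Model.≈-refl M) (λ _ ())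
  expandRF .RepFun.sorts (inj₁ s) .riso .fwd-bwd M p = Model.≈-refl M
  expandRF .RepFun.sorts (inj₂ (prodS p)) .robj = ctxObj (factors S p)
  expandRF .RepFun.sorts (inj₂ (prodS p)) .riso .fwd .tr M q = env q
  expandRF .RepFun.sorts (inj₂ (prodS p)) .riso .fwd .tr-cong M e = at e
  expandRF .RepFun.sorts (inj₂ (prodS p)) .riso .fwd .tr-natural {N = N} m q s x = Model.≈-refl N
  expandRF .RepFun.sorts (inj₂ (prodS p)) .riso .bwd M a = mkPt a tt
  expandRF .RepFun.sorts (inj₂ (prodS p)) .riso .bwd-cong M e .at = e
  expandRF .RepFun.sorts (inj₂ (prodS p)) .riso .bwd-fwd M q .at s x = Model.≈-refl M
  expandRF .RepFun.sorts (inj₂ (prodS p)) .riso .fwd-bwd M q s x = Model.≈-refl M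
  expandRF .RepFun.sorts (inj₂ (subS i)) .robj = ⟨ subBase S i ∷ [] ∣ subDef S i , subCart S i ⟩
  expandRF .RepFun.sorts (inj₂ (subS i)) .riso .fwd .tr M q = env q _ (here refl) , Model.Sat-cong M (subDef S i)
      (∷-cases _ (Model.≈-refl M) (λ _ ())) (sat q)
  expandRF .RepFun.sorts (inj₂ (subS i)) .riso .fwd .tr-cong M e = at e _ (here refl)
  expandRF .RepFun.sorts (inj₂ (subS i)) .riso .fwd .tr-natural {N = N} m q = Model.≈-refl N
  expandRF .RepFun.sorts (inj₂ (subS i)) .riso .bwd M a = mkPt (proj₁ a ▹ ε) (proj₂ a)
  expandRF .RepFun.sorts (inj₂ (subS i)) .riso .bwd-cong M e .at = ∷-cases _ e (λ _ ())
  expandRF .RepFun.sorts (inj₂ (subS i)) .riso .bwd-fwd M q .at = ∷-cases _ (Model.≈-refl M) (λ _ ())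
  expandRF .RepFun.sorts (inj₂ (subS i)) .riso .fwd-bwd M q = Model.≈-refl M
  expandRF .RepFun.sorts (inj₂ (oneS o)) .robj = ctxObj []
  expandRF .RepFun.sorts (inj₂ (oneS o)) .riso .fwd .tr M q = tt
  expandRF .RepFun.sorts (inj₂ (oneS o)) .riso .fwd .tr-cong M e = tt
  expandRF .RepFun.sorts (inj₂ (oneS o)) .riso .fwd .tr-natural m q = tt
  expandRF .RepFun.sorts (inj₂ (oneS o)) .riso .bwd M a = mkPt ε tt
  expandRF .RepFun.sorts (inj₂ (oneS o)) .riso .bwd-cong M e .at _ ()
  expandRF .RepFun.sorts (inj₂ (oneS o)) .riso .bwd-fwd M q .at _ ()
  expandRF .RepFun.sorts (inj₂ (oneS o)) .riso .fwd-bwd M q = tt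
  expandRF .RepFun.rels (oldR R) .robj = relObj R
  expandRF .RepFun.rels (oldR R) .riso .fwd .tr M q = mkPt (mapFam inj₁ (env q))
      (Model.rl-cong M R (λ s x → Model.≈-trans M (Model.evalTs-varsOf M (λ x → x) _ s x)
    (Model.≈-trans M (Model.≈-sym M (Model.≈-≡ M (mapFam-mapVar inj₁ (env q) s x)))
        (Model.≈-sym M (Structure.evalTs-varsOf (expandStr M) (λ x → x) _ (inj₁ s) (mapVar inj₁ x))))) (sat q))
  expandRF .RepFun.rels (oldR R) .riso .fwd .tr-cong M {p} {q} e .at = mapFam-cong m (expandStr M) (at e)
  expandRF .RepFun.rels (oldR R) .riso .fwd .tr-natural {M} {N} h q .at = map-cases inj₁ _ λ s x →
    Model.≈-≡ N (trans (cong (fn h) (mapFam-mapVar inj₁ (env q) s x))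
        (sym (mapFam-mapVar inj₁ (λ s x → fn h (env q s x)) s x)))
  expandRF .RepFun.rels (oldR R) .riso .bwd M q = mkPt (old M (env q))
      (Model.rl-cong M R (λ s x → Model.≈-trans M (Structure.evalTs-varsOf (expandStr M) (λ x → x) _ (inj₁ s)
      (mapVar inj₁ x))
    (Model.≈-sym M (Model.evalTs-varsOf M (λ x → x) _ s x))) (sat q))
  expandRF .RepFun.rels (oldR R) .riso .bwd-cong M e .at s x = at e (inj₁ s) (mapVar inj₁ x)
  expandRF .RepFun.rels (oldR R) .riso .bwd-fwd M q .at s x = Model.≈-≡ M (mapFam-mapVar inj₁ (env q) s x)
  expandRF .RepFun.rels (oldR R) .riso .fwd-bwd M q .at = mapFam-unmap m (expandStr M) (env q)
  expandRF .RepFun.rels (defR r) .robj = ⟨ rArgs S r ∣ rDef S r , rCart S r ⟩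
  expandRF .RepFun.rels (defR r) .riso .fwd .tr M q = mkPt (mapFam inj₁ (env q))
      (Model.Sat-cong M (rDef S r) (λ s x →
    (Model.≈-trans M (Model.≈-sym M (Model.≈-≡ M (mapFam-mapVar inj₁ (env q) s x)))
        (Model.≈-sym M (Structure.evalTs-varsOf (expandStr M) (λ x → x) _ (inj₁ s) (mapVar inj₁ x))))) (sat q))
  expandRF .RepFun.rels (defR r) .riso .fwd .tr-cong M {p} {q} e .at = mapFam-cong m (expandStr M) (at e)
  expandRF .RepFun.rels (defR r) .riso .fwd .tr-natural {M} {N} h q .at = map-cases inj₁ _ λ s x →
    Model.≈-≡ N (trans (cong (fn h) (mapFam-mapVar inj₁ (env q) s x))
        (sym (mapFam-mapVar inj₁ (λ s x → fn h (env q s x)) s x)))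
  expandRF .RepFun.rels (defR r) .riso .bwd M q = mkPt (old M (env q))
      (Model.Sat-cong M (rDef S r) (λ s x → Structure.evalTs-varsOf (expandStr M) (λ x → x) _ (inj₁ s)
      (mapVar inj₁ x)) (sat q))
  expandRF .RepFun.rels (defR r) .riso .bwd-cong M e .at s x = at e (inj₁ s) (mapVar inj₁ x)
  expandRF .RepFun.rels (defR r) .riso .bwd-fwd M q .at s x = Model.≈-≡ M (mapFam-mapVar inj₁ (env q) s x)
  expandRF .RepFun.rels (defR r) .riso .fwd-bwd M q .at = mapFam-unmap m (expandStr M) (env q)

  expandUnit : Unit expandMF (RepFun.mfun reductE)
  expandUnit .Unit.at-model M = expand-reduct M
  expandUnit .Unit.unit-natural {N = N} h a = Model.≈-refl N

  module _ (N : Model T⁺) where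
    private
      module N = Model N
      X = isExt (str N) N.valid
      module X = IsExt X
      M : Model T
      M = RepFun.mob reductE N

    splitFn : ∀ s → N.Car s → CarE M s
    splitFn (inj₁ s) a = a
    splitFn (inj₂ (prodS p)) a s i = N.fun (proj p i) (a ▹ ε)
    splitFn (inj₂ (subS i)) a = N.fun (incl i) (a ▹ ε) , X.incl-sat i a
    splitFn (inj₂ (oneS o)) a = tt

    glueFn : ∀ s → CarE M s → N.Car s
    glueFn (inj₁ s) a = a
    glueFn (inj₂ (prodS p)) e = X.tuple p e
    glueFn (inj₂ (subS i)) (x , q) = X.restrict i x q
    glueFn (inj₂ (oneS o)) a = X.point o

    splitFn-cong : ∀ s {a b} → a N.≈ b → EqE M s (splitFn s a) (splitFn s b)
    splitFn-cong (inj₁ s) q = q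
    splitFn-cong (inj₂ (prodS p)) q s i = N.fun-cong (proj p i) (∷-cases _ q (λ _ ()))
    splitFn-cong (inj₂ (subS i)) q = N.fun-cong (incl i) (∷-cases _ q (λ _ ()))
    splitFn-cong (inj₂ (oneS o)) q = tt

    splitFn-inj : ∀ s {a b} → EqE M s (splitFn s a) (splitFn s b) → a N.≈ b
    splitFn-inj (inj₁ s) q = q
    splitFn-inj (inj₂ (prodS p)) q = X.proj-injective p _ _ q
    splitFn-inj (inj₂ (subS i)) q = X.incl-injective i _ _ q
    splitFn-inj (inj₂ (oneS o)) q = X.point-unique o _ _

    split-glue : ∀ s a → EqE M s (splitFn s (glueFn s a)) a
    split-glue (inj₁ s) a = N.≈-refl
    split-glue (inj₂ (prodS p)) a = X.proj-tuple p a
    split-glue (inj₂ (subS i)) a = X.incl-restrict i (proj₁ a) (proj₂ a)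
    split-glue (inj₂ (oneS o)) a = tt

    splitFn-fun : ∀ {ss s} (f : ExtFun S ss s) e → EqE M s (splitFn s (N.fun f e))
        (funE M f (λ s x → splitFn s (e s x)))
    splitFn-fun (oldF f) e = N.fun-cong (oldF f) (λ s x → N.≈-sym (mapFam-unmap m (str N) e s x))
    splitFn-fun (defF f) e = N.≈-trans (N.fun-cong (defF f) (λ s x → N.≈-sym (mapFam-unmap m (str N) e s x)))
      (def-unique (str N) X f (unmap m (str N) e) _ (proj₂ (valueE M f (unmap m (str N) e))))
    splitFn-fun (proj p i) e = N.fun-cong (proj p i) (∷-cases _ N.≈-refl (λ _ ()))
    splitFn-fun (incl i) e = N.fun-cong (incl i) (∷-cases _ N.≈-refl (λ _ ()))

    splitFn-rel : ∀ {ss} (R : ExtRel S ss) e → N.rl R e → relE M R (λ s x → splitFn s (e s x))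
    splitFn-rel (oldR R) e = N.rl-cong (oldR R) (λ s x → N.≈-sym (mapFam-unmap m (str N) e s x))
    splitFn-rel (defR r) e q = X.def-rel r _ (N.rl-cong (defR r) (λ s x → N.≈-sym (mapFam-unmap m (str N) e s x)) q)

    splitFn-rel⁻¹ : ∀ {ss} (R : ExtRel S ss) e → relE M R (λ s x → splitFn s (e s x)) → N.rl R e
    splitFn-rel⁻¹ (oldR R) e = N.rl-cong (oldR R) (mapFam-unmap m (str N) e)
    splitFn-rel⁻¹ (defR r) e q = N.rl-cong (defR r) (mapFam-unmap m (str N) e) (X.def-rel⁻¹ r _ q)

    -- Elements of new sorts are determined by their projections or inclusions, so `splitFn` is
    -- injective with section `glueFn`; the homomorphism laws of the inverse are checked after
    -- applying `splitFn`.
    reduct-expand : Iso (str N) (expandStr M)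
    reduct-expand .Iso.to .fn {s} = splitFn s
    reduct-expand .Iso.to .fn-cong {s} = splitFn-cong s
    reduct-expand .Iso.to .Hom.fn-fun = splitFn-fun
    reduct-expand .Iso.to .Hom.fn-rel = splitFn-rel
    reduct-expand .Iso.from .fn {s} = glueFn s
    reduct-expand .Iso.from .fn-cong {s} {a} {b} q = splitFn-inj s
        (transE M s (split-glue s a) (transE M s q (symE M s (split-glue s b))))
    reduct-expand .Iso.from .Hom.fn-fun {ss} {s} f e = splitFn-inj s (transE M s (split-glue s _) (symE M s
      (transE M s (splitFn-fun f _) (funE-cong M f (λ t x → split-glue t (e t x))))))
    reduct-expand .Iso.from .Hom.fn-rel R e q = splitFn-rel⁻¹ R _
        (relE-cong M R (λ t x → symE M t (split-glue t (e t x))) q)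
    reduct-expand .Iso.from-to {s} a = splitFn-inj s (split-glue s (splitFn s a))
    reduct-expand .Iso.to-from {s} a = split-glue s a

  reductUnit : Unit (RepFun.mfun reductE) expandMF
  reductUnit .Unit.at-model = reduct-expand
  reductUnit .Unit.unit-natural {M} {N} h {s} = go s
    where
      go : ∀ s a → EqE (RepFun.mob reductE N) s (splitFn N s (fn h a))
          (expandFn {RepFun.mob reductE M} {RepFun.mob reductE N} (RepFun.mhom reductE {M} {N} h) s (splitFn M s a))
      go (inj₁ s) a = Model.≈-refl N
      go (inj₂ (prodS p)) a s i = Model.≈-trans N (Model.fun-cong N (proj p i)
          (∷-cases _ (Model.≈-refl N) (λ _ ()))) (Model.≈-sym N (Hom.fn-fun h (proj p i) (a ▹ ε)))
      go (inj₂ (subS i)) a = Model.≈-trans N (Model.fun-cong N (incl i) (∷-cases _ (Model.≈-refl N) (λ _ ())))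
          (Model.≈-sym N (Hom.fn-fun h (incl i) (a ▹ ε)))
      go (inj₂ (oneS o)) a = tt

  extEquiv : ModEquiv T T⁺
  extEquiv = record { right = expandRF ; left = reductE ; unit = expandUnit ; counit = reductUnit }

chain-cartAx : ∀ {Sg T Sg' T'} → MoritaChain Sg T Sg' T' → CartAx T → CartAx T'
chain-cartAx done c = c
chain-cartAx (step S ch) c = chain-cartAx ch (Extension.ext-cartAx S c)

chainEquiv : ∀ {Sg T Sg' T'} → MoritaChain Sg T Sg' T' → CartAx T → ModEquiv T T'
chainEquiv {T = T} done c = ModEquiv-refl T
chainEquiv (step S ch) c = ModEquiv-trans c (chain-cartAx ch (Extension.ext-cartAx S c)) (Extension.extEquiv S)
    (chainEquiv ch (Extension.ext-cartAx S c))

-- Isomorphic signatures and logically equivalent theories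

-- Symbols are transported along different proofs of the same equation between sorts or arities;
-- this identifies the results.
uip : ∀ {ℓ} {A : Set ℓ} {x y : A} (p q : x ≡ y) → p ≡ q
uip refl refl = refl

subst₂′ : ∀ {ℓ ℓ' ℓ″} {A : Set ℓ} {B : Set ℓ'} (P : A → B → Set ℓ″) {a a' b b'} → a ≡ a' → b ≡ b' → P a b → P a' b'
subst₂′ P refl refl x = x

bijective-iso : {Sg : Signature} {M N : Structure Sg} (h : Hom M N) (g : ∀ {s} → Car N s → Car M s) →
                (∀ {s} (b : Car N s) → Structure._≈_ N (fn h (g b)) b) →
                (∀ {s} {a a' : Car M s} → Structure._≈_ N (fn h a) (fn h a') → Structure._≈_ M a a') →
                (∀ {ss} (R : Rel Sg ss) (e : Env M ss) → Structure.rl N R (λ s x → fn h (e s x)) →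
                    Structure.rl M R e) → Iso M N
bijective-iso {M = M} {N} h g hg inj refl-rel = record
  { to = h
  ; from = record { fn = g
      ; fn-cong = λ q → inj (N.≈-trans (hg _) (N.≈-trans q (N.≈-sym (hg _))))
      ; fn-fun = λ f e → inj (N.≈-trans (hg _) (N.≈-sym (N.≈-trans (Hom.fn-fun h f _)
          (N.fun-cong f (λ s x → hg (e s x))))))
      ; fn-rel = λ R e q → refl-rel R _ (N.rl-cong R (λ s x → N.≈-sym (hg (e s x))) q) }
  ; from-to = λ a → inj (hg (fn h a))
  ; to-from = hg }
  where module N = Structure N

module _ {A B : Signature} (a : SigMor A B) (b : SigMor B A) where
  private
    module a = SigMor a
    module b = SigMor b

  module RoundTrip (q : ∀ s → s ≡ b.sortMap (a.sortMap s)) where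
    qs : ∀ ss → ss ≡ map b.sortMap (map a.sortMap ss)
    qs []       = refl
    qs (s ∷ ss) = cong₂ _∷_ (q s) (qs ss)

    module _ (hf : ∀ {ss s} (f : Fun A ss s) → b.funMap (a.funMap f) ≡ subst₂′ (Fun A) (qs ss) (q s) f)
             (hr : ∀ {ss} (R : Rel A ss) → b.relMap (a.relMap R) ≡ subst (Rel A) (qs ss) R) (M : Structure A) where
      private
        module M = Structure M
        N = reduct a (reduct b M)

        c : ∀ {s} → M.Car s → M.Car (b.sortMap (a.sortMap s))
        c {s} x = subst M.Car (q s) x

        envs : ∀ {ss} (e : M.Env ss) → mapFam b.sortMap {P = M.Car}
            (mapFam a.sortMap {P = λ s → M.Car (b.sortMap s)} (λ s x → c (e s x))) M.≋ subst M.Env (qs ss) e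
        envs {[]}     e = λ s ()
        envs {s ∷ ss} e = λ t x → M.≈-trans (split t x) (M.≈-sym (cons-subst (q s) (qs ss) e t x))
          where
            cons-subst : ∀ {s s' ss ss'} (p : s ≡ s') (ps : ss ≡ ss') (e : M.Env (s ∷ ss)) →
                   subst M.Env (cong₂ _∷_ p ps) e M.≋ (subst M.Car p (e s (here refl)) ▹ subst M.Env ps (tail e))
            cons-subst refl refl e = ∷-cases _ M.≈-refl (λ _ _ → M.≈-refl)
            split = ∷-cases (λ t x → mapFam b.sortMap {P = M.Car}
                (mapFam a.sortMap {P = λ s → M.Car (b.sortMap s)} (λ s x → c (e s x))) t x
                M.≈ (c (e s (here refl)) ▹ subst M.Env (qs ss) (tail e)) t x) M.≈-refl (envs (tail e))

        fun-subst : ∀ {ss ss' s s'} (p : ss ≡ ss') (r : s ≡ s') (f : Fun A ss s) (e : M.Env ss) →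
                    M.fun (subst₂′ (Fun A) p r f) (subst M.Env p e) M.≈ subst M.Car r (M.fun f e)
        fun-subst refl refl f e = M.≈-refl

        rel-subst : ∀ {ss ss'} (p : ss ≡ ss') (R : Rel A ss) (e : M.Env ss) → M.rl R e → M.rl (subst (Rel A) p R)
            (subst M.Env p e)
        rel-subst refl R e r = r

        rel-unsubst : ∀ {ss ss'} (p : ss ≡ ss') (R : Rel A ss) (e : M.Env ss) → M.rl (subst (Rel A) p R)
            (subst M.Env p e) → M.rl R e
        rel-unsubst refl R e r = r

        subst-cong : ∀ {s s'} (p : s ≡ s') {x y : M.Car s} → x M.≈ y → subst M.Car p x M.≈ subst M.Car p y
        subst-cong refl e = e

        subst-inj : ∀ {s s'} (p : s ≡ s') {x y : M.Car s} → subst M.Car p x M.≈ subst M.Car p y → x M.≈ y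
        subst-inj refl e = e

        subst-sym : ∀ {s s'} (p : s ≡ s') (x : M.Car s') → subst M.Car p (subst M.Car (sym p) x) M.≈ x
        subst-sym refl x = M.≈-refl

        h : Hom M N
        h .fn = c
        h .fn-cong {s} e = subst-cong (q s) e
        h .Hom.fn-fun {ss} {s} f e = M.≈-trans (M.≈-sym (fun-subst (qs ss) (q s) f e))
            (M.≈-trans (M.fun-cong _ (λ t x → M.≈-sym (envs e t x)))
          (M.≈-≡ (cong (λ g → M.fun g _) (sym (hf f)))))
        h .Hom.fn-rel {ss} R e r = subst (λ S → M.rl S _) (sym (hr R))
            (M.rl-cong _ (λ t x → M.≈-sym (envs e t x)) (rel-subst (qs ss) R e r))

      -- Going to the other signature and back returns each sort only up to the propositional
      -- equality `q`, so the isomorphism is transport along `q`.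
      round-iso : Iso M N
      round-iso = bijective-iso h (λ {s} y → subst M.Car (sym (q s)) y) (λ {s} y → subst-sym (q s) y) (λ {s} → subst-inj (q s))
        (λ {ss} R e r → rel-unsubst (qs ss) R e (M.rl-cong _ (envs e) (subst (λ S → M.rl S _) (hr R) r)))

    module _ (hf : ∀ {ss s} (f : Fun A ss s) → b.funMap (a.funMap f) ≡ subst₂′ (Fun A) (qs ss) (q s) f)
             (hr : ∀ {ss} (R : Rel A ss) → b.relMap (a.relMap R) ≡ subst (Rel A) (qs ss) R) {M N : Structure A}
                 (m : Hom M N) where
      round-natural : Iso.to (round-iso hf hr N) ∘ʰ m ≗ʰ reductHom a (reductHom b m) ∘ʰ Iso.to (round-iso hf hr M)
      round-natural {s} x = go (q s) x
        where
          go : ∀ {s s'} (p : s ≡ s') (x : Car M s) → Structure._≈_ N (subst (Car N) p (fn m x))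
              (fn m (subst (Car M) p x))
          go refl x = Structure.≈-refl N

module SigIsoEquiv {A B : Signature} (ι : SigIso A B) {T : Theory A} {U : Theory B} (LE : LogEquiv (trTheory (SigIso.asMor ι) T) U) where
  open SigIso ι
  private
    from : Sort B → Sort A
    from = Inverse.from sortIso
    q : ∀ s → s ≡ from (sortTo s)
    q s = sym (Inverse.strictlyInverseʳ sortIso s)
    q' : ∀ s → s ≡ sortTo (from s)
    q' s = sym (Inverse.strictlyInverseˡ sortIso s)
    qs' : ∀ ss → ss ≡ map sortTo (map from ss)
    qs' []       = refl
    qs' (s ∷ ss) = cong₂ _∷_ (q' s) (qs' ss)
    -- The inverse morphism. `funIso` is indexed by arities over A, so a symbol over B is first
    -- transported along `qs'` to an arity of the form `map sortTo` before it can be inverted.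
    n : SigMor B A
    n = record { sortMap = from
      ; funMap = λ {ss} {s} f → Inverse.from (funIso (map from ss) (from s)) (subst₂′ (Fun B) (qs' ss) (q' s) f)
      ; relMap = λ {ss} R → Inverse.from (relIso (map from ss)) (subst (Rel B) (qs' ss) R) }
    module AB = RoundTrip asMor n q
    module BA = RoundTrip n asMor q'

    qs'-eq : ∀ ss → qs' ss ≡ BA.qs ss
    qs'-eq ss = uip _ _

    hfB : ∀ {ss s} (f : Fun B ss s) → SigMor.funMap asMor (SigMor.funMap n f) ≡ subst₂′ (Fun B) (BA.qs ss) (q' s) f
    hfB {ss} {s} f = trans (Inverse.strictlyInverseˡ (funIso (map from ss) (from s)) _)
        (cong (λ p → subst₂′ (Fun B) p (q' s) f) (qs'-eq ss))

    hrB : ∀ {ss} (R : Rel B ss) → SigMor.relMap asMor (SigMor.relMap n R) ≡ subst (Rel B) (BA.qs ss) R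
    hrB {ss} R = trans (Inverse.strictlyInverseˡ (relIso (map from ss)) _)
        (cong (λ p → subst (Rel B) p R) (qs'-eq ss))

    to-subst : ∀ {ss ss' s s'} (p : ss ≡ ss') (r : s ≡ s') (f : Fun A ss s) →
               Inverse.to (funIso ss' s') (subst₂′ (Fun A) p r f) ≡ subst₂′ (Fun B) (cong (map sortTo) p)
                   (cong sortTo r) (Inverse.to (funIso ss s) f)
    to-subst refl refl f = refl

    rto-subst : ∀ {ss ss'} (p : ss ≡ ss') (R : Rel A ss) →
                Inverse.to (relIso ss') (subst (Rel A) p R) ≡ subst (Rel B) (cong (map sortTo) p)
                    (Inverse.to (relIso ss) R)
    rto-subst refl R = refl

    hfA : ∀ {ss s} (f : Fun A ss s) → SigMor.funMap n (SigMor.funMap asMor f) ≡ subst₂′ (Fun A) (AB.qs ss) (q s) f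
    hfA {ss} {s} f = trans (cong (Inverse.from (funIso (map from (map sortTo ss)) (from (sortTo s))))
        (sym (trans (to-subst (AB.qs ss) (q s) f) (cong₂ (λ p r → subst₂′ (Fun B) p r (Inverse.to (funIso ss s) f))
            (uip _ _) (uip _ _)))))
      (Inverse.strictlyInverseʳ (funIso (map from (map sortTo ss)) (from (sortTo s))) _)

    hrA : ∀ {ss} (R : Rel A ss) → SigMor.relMap n (SigMor.relMap asMor R) ≡ subst (Rel A) (AB.qs ss) R
    hrA {ss} R = trans (cong (Inverse.from (relIso (map from (map sortTo ss))))
        (sym (trans (rto-subst (AB.qs ss) R) (cong (λ p → subst (Rel B) p (Inverse.to (relIso ss) R)) (uip _ _)))))
      (Inverse.strictlyInverseʳ (relIso (map from (map sortTo ss))) _)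

    okT : (N : Model U) (a : Ax T) → Valid (reduct asMor (str N)) (axiom T a)
    okT N a = valid-reduct asMor (str N) (axiom T a) (sound N (proj₁ LE a))

    -- `LogEquiv` speaks of the translated theory over B. The B-structure made from M is a model of
    -- it because its reduct back to A is a copy of M.
    trModel : (M : Model T) → Model (trTheory asMor T)
    trModel M .Model.str = reduct n (str M)
    trModel M .Model.valid a = valid-tr asMor (reduct n (str M)) (axiom T a)
        (iso-valid (AB.round-iso hfA hrA (str M)) (axiom T a) (Model.valid M a))

    okU : (M : Model T) (b : Ax U) → Valid (reduct n (str M)) (axiom U b)
    okU M b = sound (trModel M) (proj₂ LE b)

  sigIsoEquiv : ModEquiv T U
  sigIsoEquiv = record
    { right = reductRF n okU ; left = reductRF asMor okT
    ; unit = record { at-model = λ M → AB.round-iso hfA hrA (str M) ; unit-natural = λ {M} {N} m → AB.round-natural hfA hrA {str M} {str N} m }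
    ; counit = record { at-model = λ N → BA.round-iso hfB hrB (str N) ; unit-natural = λ {M} {N} m → BA.round-natural hfB hrB {str M} {str N} m } }

-- T-Morita equivalence implies J-Morita equivalence

module _ {Sg : Signature} {T : Theory Sg} {P : Ax T → Set} where
  subtheory-deriv : ∀ {Γ φ ψ} → Deriv (subtheory T P) Γ φ ψ → Deriv T Γ φ ψ
  subtheory-deriv (axiom-rule a) = axiom-rule (proj₁ a)
  subtheory-deriv identity = identity
  subtheory-deriv (cut d e) = cut (subtheory-deriv d) (subtheory-deriv e)
  subtheory-deriv (substitution σ d) = substitution σ (subtheory-deriv d)
  subtheory-deriv eq-refl = eq-refl
  subtheory-deriv (eq-subst φ) = eq-subst φ
  subtheory-deriv ⊤-intro = ⊤-intro
  subtheory-deriv ∧-elimˡ = ∧-elimˡ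
  subtheory-deriv ∧-elimʳ = ∧-elimʳ
  subtheory-deriv (∧-intro d e) = ∧-intro (subtheory-deriv d) (subtheory-deriv e)
  subtheory-deriv (∃-elim d) = ∃-elim (subtheory-deriv d)
  subtheory-deriv (∃-elim⁻¹ d) = ∃-elim⁻¹ (subtheory-deriv d)
  subtheory-deriv frobenius = frobenius

  subtheory-cart : ∀ {Γ} {φ : Formula Sg Γ} → Cart (subtheory T P) φ → Cart T φ
  subtheory-cart ⊤-cart = ⊤-cart
  subtheory-cart (∧-cart c d) = ∧-cart (subtheory-cart c) (subtheory-cart d)
  subtheory-cart ≐-cart = ≐-cart
  subtheory-cart rel-cart = rel-cart
  subtheory-cart (∃-cart c u) = ∃-cart (subtheory-cart c) (subtheory-deriv u)

cartTheory-cartAx : (T : CartTheory) → CartAx (CartTheory.theory T)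
cartTheory-cartAx T a = let (_ , _ , _ , c) = CartTheory.cartesian T in subtheory-cart (proj₁ (c a)) , subtheory-cart (proj₂ (c a))

PreTMorita⇒ModEquiv : (T T' : CartTheory) → PreTMorita T T' → ModEquiv (CartTheory.theory T) (CartTheory.theory T')
PreTMorita⇒ModEquiv T T' (S₁ , U₁ , S₂ , U₂ , ch₁ , ch₂ , ι , LE) =
  ModEquiv-trans c (cartTheory-cartAx T') (ModEquiv-trans c (chain-cartAx ch₂ (cartTheory-cartAx T'))
      (chainEquiv ch₁ c) (SigIsoEquiv.sigIsoEquiv ι LE))
    (ModEquiv-sym (chainEquiv ch₂ (cartTheory-cartAx T')))
  where c = cartTheory-cartAx T

TMorita⇒ModEquiv : (T T' : CartTheory) → TMorita T T' → ModEquiv (CartTheory.theory T) (CartTheory.theory T')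
TMorita⇒ModEquiv T T' [ p ]⁺ = PreTMorita⇒ModEquiv T T' p
TMorita⇒ModEquiv T T' (_∷⁺_ {y = U} p ps) =
  ModEquiv-trans (cartTheory-cartAx T) (cartTheory-cartAx T') (PreTMorita⇒ModEquiv T U p) (TMorita⇒ModEquiv U T' ps)

TMorita⇒JMorita : (T T' : CartTheory) → TMorita T T' → JMorita T T'
TMorita⇒JMorita T T' e = ModEquiv⇒Equivalence (cartTheory-cartAx T) (cartTheory-cartAx T') (TMorita⇒ModEquiv T T' e)

-- From an equivalence of syntactic categories to an equivalence of models

module Arrows {Sg : Signature} {T : Theory Sg} (cax : CartAx T) where
  open Complete cax
  open Yoneda cax

  infix 4 _≃_
  -- Equality of arrows tested on points. It coincides with `_≈ₛ_`, and the category laws become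
  -- immediate.
  record _≃_ {A B : SynObj T} (f g : SynHom T A B) : Set₁ where
    no-eta-equality
    constructor mk≃
    field
      pt : (M : Model T) (p : Pt (str M) A) → EqPt (ap f {M} p) (ap g {M} p)
  open _≃_ public

  module _ {A B : SynObj T} where
    ≃-refl : {f : SynHom T A B} → f ≃ f
    ≃-refl .pt M p = pt-refl

    ≃-sym : {f g : SynHom T A B} → f ≃ g → g ≃ f
    ≃-sym e .pt M p = pt-sym (pt e M p)

    ≃-trans : {f g h : SynHom T A B} → f ≃ g → g ≃ h → f ≃ h
    ≃-trans e d .pt M p = pt-trans (pt e M p) (pt d M p)

    of-≈ₛ : {f g : SynHom T A B} → _≈ₛ_ T (proj₁ f) (proj₁ g) → f ≃ g
    of-≈ₛ {f} {g} e .pt M p = ≈ₛ⇒ap f g e {M} p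

    to-≈ₛ : {f g : SynHom T A B} → f ≃ g → _≈ₛ_ T (proj₁ f) (proj₁ g)
    to-≈ₛ {f} {g} e = ap⇒≈ₛ f g (λ {M} p → pt e M p)

    idˡ : {f : SynHom T A B} → _∙_ (idH B) f ≃ f
    idˡ {f} .pt M p = pt-trans (ap-∙ (idH B) f {M} p) (ap-id B {M} _)

    idʳ : {f : SynHom T A B} → _∙_ f (idH A) ≃ f
    idʳ {f} .pt M p = pt-trans (ap-∙ f (idH A) {M} p) (ap-cong f {M} (ap-id A {M} p))

  ∙-cong : {A B C : SynObj T} {g g' : SynHom T B C} {f f' : SynHom T A B} → g ≃ g' → f ≃ f' → _∙_ g f ≃ _∙_ g' f'
  ∙-cong {g = g} {g'} {f} {f'} d e .pt M p = pt-trans (ap-∙ g f {M} p)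
      (pt-trans (ap-cong g {M} (pt e M p)) (pt-trans (pt d M _) (pt-sym (ap-∙ g' f' {M} p))))

  assoc : {A B C D : SynObj T} {h : SynHom T C D} {g : SynHom T B C} {f : SynHom T A B} → _∙_ (_∙_ h g) f ≃ _∙_ h
      (_∙_ g f)
  assoc {h = h} {g} {f} .pt M p = pt-trans (ap-∙ (_∙_ h g) f {M} p) (pt-trans (ap-∙ h g {M} _)
    (pt-sym (pt-trans (ap-∙ h (_∙_ g f) {M} p) (ap-cong h {M} (ap-∙ g f {M} p)))))

  cancelʳ : {A B C : SynObj T} {h : SynHom T B C} {g : SynHom T A B} {f : SynHom T B A} → _∙_ g f ≃ idH B → _∙_
      (_∙_ h g) f ≃ h
  cancelʳ e = ≃-trans assoc (≃-trans (∙-cong ≃-refl e) idʳ)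

  cancelˡ : {A B C : SynObj T} {h : SynHom T C B} {g : SynHom T A B} {f : SynHom T B A} → _∙_ g f ≃ idH B → _∙_ g
      (_∙_ f h) ≃ h
  cancelˡ e = ≃-trans (≃-sym assoc) (≃-trans (∙-cong e ≃-refl) idˡ)

  ptOf : {A B : SynObj T} → SynHom T A B → Pt (str (K A)) B
  ptOf {A} f = ap f {K A} (genPt A)

  evalAt-genPt : (A : SynObj T) → evalAt {M = K A} (genPt A) ≗ʰ idHom (str (K A))
  evalAt-genPt A a = Structure.≈-sym (str (K A)) (Canon.Eval.evalEl-unique A (K A) (Canon.gen A) (Canon.gen-Sat A) a
      (Canon.El-gen A a))

  ptOf-homOf : {A B : SynObj T} (q : Pt (str (K A)) B) → EqPt (ptOf (homOf q)) q
  ptOf-homOf {A} q = pt-trans (ap-homOf q {K A} (genPt A)) (mk≈ (λ s x → evalAt-genPt A (env q s x)))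

  eval-ptOf : {A B : SynObj T} (f : SynHom T A B) {M : Model T} (p : Pt (str M) A) → EqPt
      (mapPt (evalAt {M = M} p) (ptOf f)) (ap f {M} p)
  eval-ptOf {A} f {M} p = pt-trans (ap-natural f {K A} {M} (evalAt {M = M} p) (genPt A))
      (ap-cong f {M} (evalAt-gen {M = M} p))

  homOf-ptOf : {A B : SynObj T} (f : SynHom T A B) → homOf (ptOf f) ≃ f
  homOf-ptOf f .pt M p = pt-trans (ap-homOf (ptOf f) {M} p) (eval-ptOf f {M} p)

  homOf-cong : {A B : SynObj T} {p q : Pt (str (K A)) B} → EqPt p q → homOf p ≃ homOf q
  homOf-cong {p = p} {q} e .pt M a = pt-trans (ap-homOf p {M} a)
      (pt-trans (mapPt-cong (evalAt {M = M} a) e) (pt-sym (ap-homOf q {M} a)))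

  ptOf-cong : {A B : SynObj T} {f g : SynHom T A B} → f ≃ g → EqPt (ptOf f) (ptOf g)
  ptOf-cong {A} e = pt e (K A) (genPt A)

  homOf-ap : {A B C : SynObj T} (v : SynHom T B C) (q : Pt (str (K A)) B) → homOf (ap v {K A} q) ≃ _∙_ v (homOf q)
  homOf-ap {A} v q .pt M p = pt-trans (ap-homOf (ap v {K A} q) {M} p)
      (pt-trans (ap-natural v {K A} {M} (evalAt {M = M} p) q)
    (pt-trans (ap-cong v {M} (pt-sym (ap-homOf q {M} p))) (pt-sym (ap-∙ v (homOf q) {M} p))))

  -- Precomposition with u : A → A' as a homomorphism of canonical models.
  pre : {A A' : SynObj T} → SynHom T A A' → Hom (str (K A')) (str (K A))
  pre {A} u = evalAt {M = K A} (ptOf u)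

  homOf-pre : {A A' B : SynObj T} (u : SynHom T A A') (q : Pt (str (K A')) B) → homOf (mapPt (pre u) q) ≃ _∙_
      (homOf q) u
  homOf-pre {A} u q .pt M p = pt-trans (ap-homOf (mapPt (pre u) q) {M} p)
      (pt-trans lem (pt-trans (pt-sym (ap-homOf q {M} (ap u {M} p))) (pt-sym (ap-∙ (homOf q) u {M} p))))
    where
      lem : EqPt (mapPt (evalAt {M = M} p) (mapPt (pre u) q)) (mapPt (evalAt {M = M} (ap u {M} p)) q)
      lem .at s x = Model.≈-trans M (evalAt-natural {M = K A} {M} (evalAt {M = M} p) (ptOf u) (env q s x))
          (evalAt-cong {M = M} (eval-ptOf u {M} p) (env q s x))

  pre-∙ : {A B C : SynObj T} (g : SynHom T B C) (f : SynHom T A B) → pre (_∙_ g f) ≗ʰ pre f ∘ʰ pre g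
  pre-∙ {A} {B} g f a = Model.≈-sym (K A) (Model.≈-trans (K A) (evalAt-natural {M = K B} {K A} (pre f) (ptOf g) a)
    (evalAt-cong {M = K A} (pt-trans (ap-natural g {K B} {K A} (pre f) (genPt B))
        (pt-trans (ap-cong g {K A} (evalAt-gen {M = K A} (ptOf f))) (pt-sym (ap-∙ g f {K A} (genPt A))))) a))

  pre-cong : {A B : SynObj T} {f g : SynHom T A B} → f ≃ g → pre f ≗ʰ pre g
  pre-cong {A} e = evalAt-cong {M = K A} (ptOf-cong e)

  pre-homOf : {A B : SynObj T} (q : Pt (str (K A)) B) → pre (homOf q) ≗ʰ evalAt {M = K A} q
  pre-homOf {A} q = evalAt-cong {M = K A} (ptOf-homOf q)

  pre-id : (A : SynObj T) → pre (idH A) ≗ʰ idHom (str (K A))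
  pre-id A a = Model.≈-trans (K A) (evalAt-cong {M = K A} (ap-id A {K A} (genPt A)) a) (evalAt-genPt A a)

  pre-iso : {A B : SynObj T} (f : SynHom T A B) (g : SynHom T B A) → _∙_ g f ≃ idH A → _∙_ f g ≃ idH B → Iso
      (str (K A)) (str (K B))
  pre-iso f g gf fg .Iso.to = pre g
  pre-iso f g gf fg .Iso.from = pre f
  pre-iso {A} f g gf fg .Iso.from-to a = Model.≈-trans (K A) (Model.≈-sym (K A) (pre-∙ g f a))
      (Model.≈-trans (K A) (pre-cong gf a) (pre-id A a))
  pre-iso {A} {B} f g gf fg .Iso.to-from a = Model.≈-trans (K B) (Model.≈-sym (K B) (pre-∙ f g a))
      (Model.≈-trans (K B) (pre-cong fg a) (pre-id B a))

  FamF : {S : Set} (C : S → SynObj T) (ss : List S) → Fct T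
  FamF C ss .Fct.Obj M = Fam (λ s → Pt (str M) (C s)) ss
  FamF C ss .Fct.Eq M d e = ∀ s x → EqPt (d s x) (e s x)
  FamF C ss .Fct.eq-refl′ s x = pt-refl
  FamF C ss .Fct.eq-sym p s x = pt-sym (p s x)
  FamF C ss .Fct.eq-trans p q s x = pt-trans (p s x) (q s x)
  FamF C ss .Fct.act m e s x = mapPt m (e s x)
  FamF C ss .Fct.act-cong m p s x = mapPt-cong m (p s x)

  private
    to-one : (X : Fct T) → NatTr X (PtF (ctxObj []))
    to-one X .tr M p = mkPt ε tt
    to-one X .tr-cong M e .at s ()
    to-one X .tr-natural m p .at s ()

  prodRep : {S : Set} (C : S → SynObj T) (ss : List S) → Rep (FamF C ss)
  prodRep C [] .robj = ctxObj []
  prodRep C [] .riso .fwd .tr M p s ()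
  prodRep C [] .riso .fwd .tr-cong M e s ()
  prodRep C [] .riso .fwd .tr-natural m p s ()
  prodRep C [] .riso .bwd M e = mkPt ε tt
  prodRep C [] .riso .bwd-cong M e .at s ()
  prodRep C [] .riso .bwd-fwd M e .at s ()
  prodRep C [] .riso .fwd-bwd M e s ()
  prodRep C (s ∷ ss) = Rep-iso iso (Rep-pull (to-one (PtF (C s))) (to-one (FamF C ss)) (Rep-Pt (C s)) (prodRep C ss)
      (Rep-Pt (ctxObj [])))
    where
      iso : NatIso (PullF (to-one (PtF (C s))) (to-one (FamF C ss))) (FamF C (s ∷ ss))
      iso .fwd .tr M (p , e , _) = p ▹ e
      iso .fwd .tr-cong M (p , q) = ∷-cases _ p q
      iso .fwd .tr-natural m _ = ∷-cases _ pt-refl (λ _ _ → pt-refl)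
      iso .bwd M e = e s (here refl) , tail e , mk≈ (λ _ ())
      iso .bwd-cong M p = p s (here refl) , λ t x → p t (there x)
      iso .bwd-fwd M _ = pt-refl , λ _ _ → pt-refl
      iso .fwd-bwd M e = ∷-cases _ pt-refl (λ _ _ → pt-refl)

  component : (B : SynObj T) → ∀ s → s ∈ octx B → NatTr (PtF B) (PtF (sortObj s))
  component B s x .tr M p = mkPt (env p s x ▹ ε) tt
  component B s x .tr-cong M e .at = ∷-cases _ (at e s x) (λ _ ())
  component B s x .tr-natural {N = N} m p .at = ∷-cases _ (Model.≈-refl N) (λ _ ())

  prj : (B : SynObj T) → ∀ s → s ∈ octx B → SynHom T B (sortObj s)
  prj B s x = natHom (component B s x)

-- The functor on models induced by an equivalence of syntactic categories

module Half {Sg Sg' : Signature} {T : Theory Sg} {T' : Theory Sg'} (cax : CartAx T) (cax' : CartAx T')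
            (E : Equivalence (SyntacticCategory T) (SyntacticCategory T')) where
  open Arrows cax
  open Complete cax
  open Yoneda cax
  private
    module D = Arrows cax'
    module C' = Complete cax'
    module Y' = Yoneda cax'
    module E = Equivalence E
    module F = Functor E.F
    module G = Functor E.G
  K' : SynObj T' → Model T'
  K' = C'.K

  private
    infixr 9 _∘_ _∘'_
    _∘_ : {X Y Z : SynObj T} → SynHom T Y Z → SynHom T X Y → SynHom T X Z
    g ∘ f = _∙_ g f
    _∘'_ : {X Y Z : SynObj T'} → SynHom T' Y Z → SynHom T' X Y → SynHom T' X Z
    g ∘' f = C'._∙_ g f

    F-cong : {X Y : SynObj T} {f g : SynHom T X Y} → f ≃ g → F.F₁ f D.≃ F.F₁ g
    F-cong {f = f} {g} e = D.of-≈ₛ (F.resp f g (to-≈ₛ e))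
    G-cong : {X Y : SynObj T'} {f g : SynHom T' X Y} → f D.≃ g → G.F₁ f ≃ G.F₁ g
    G-cong {f = f} {g} e = of-≈ₛ (G.resp f g (D.to-≈ₛ e))
    G-∘ : {X Y Z : SynObj T'} (g : SynHom T' Y Z) (f : SynHom T' X Y) → G.F₁ (g ∘' f) ≃ G.F₁ g ∘ G.F₁ f
    G-∘ g f = of-≈ₛ (G.pres-∘ f g (g ∘' f) (identity , identity))

    η-nat : {X Y : SynObj T} (f : SynHom T X Y) → G.F₁ (F.F₁ f) ∘ E.η X ≃ E.η Y ∘ f
    η-nat {X} {Y} f = of-≈ₛ (E.η-natural f)
    ε-nat : {X Y : SynObj T'} (g : SynHom T' X Y) → g ∘' E.ε X D.≃ E.ε Y ∘' F.F₁ (G.F₁ g)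
    ε-nat g = D.of-≈ₛ (E.ε-natural g)
    ηˡ : ∀ X → E.η⁻¹ X ∘ E.η X ≃ idH X
    ηˡ X = of-≈ₛ (E.η-isoˡ X)
    ηʳ : ∀ X → E.η X ∘ E.η⁻¹ X ≃ idH _
    ηʳ X = of-≈ₛ (E.η-isoʳ X)
    εˡ : ∀ X → E.ε⁻¹ X ∘' E.ε X D.≃ C'.idH _
    εˡ X = D.of-≈ₛ (E.ε-isoˡ X)
    εʳ : ∀ X → E.ε X ∘' E.ε⁻¹ X D.≃ C'.idH X
    εʳ X = D.of-≈ₛ (E.ε-isoʳ X)

    F-faithful : {X Y : SynObj T} {f g : SynHom T X Y} → F.F₁ f D.≃ F.F₁ g → f ≃ g
    F-faithful {X} {Y} {f} {g} e = ≃-trans (≃-sym (cancelˡ (ηˡ Y))) (≃-trans (∙-cong ≃-refl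
      (≃-trans (≃-sym (η-nat f)) (≃-trans (∙-cong (G-cong e) ≃-refl) (η-nat g)))) (cancelˡ (ηˡ Y)))

    G-faithful : {X Y : SynObj T'} {f g : SynHom T' X Y} → G.F₁ f ≃ G.F₁ g → f D.≃ g
    G-faithful {X} {Y} {f} {g} e = D.≃-trans (D.≃-sym (D.cancelʳ (εʳ X))) (D.≃-trans (D.∙-cong
      (D.≃-trans (ε-nat f) (D.≃-trans (D.∙-cong D.≃-refl (F-cong e)) (D.≃-sym (ε-nat g)))) D.≃-refl)
          (D.cancelʳ (εʳ X)))

    lamH : {A : SynObj T} {B : SynObj T'} → SynHom T' (F.F₀ A) B → SynHom T A (G.F₀ B)
    lamH {A} f = G.F₁ f ∘ E.η A

    -- No triangle identity is assumed, so the usual formula by ε and F₁ g need not invert `lamH`.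
    -- Fullness of G is used instead: the image under F of g ∘ η⁻¹ is conjugated by ε, and
    -- faithfulness of F shows that G takes the result back to g ∘ η⁻¹.
    lamH⁻¹ : {A : SynObj T} {B : SynObj T'} → SynHom T A (G.F₀ B) → SynHom T' (F.F₀ A) B
    lamH⁻¹ {A} {B} g = E.ε B ∘' (F.F₁ (g ∘ E.η⁻¹ A) ∘' E.ε⁻¹ (F.F₀ A))

    lamH-injective : {A : SynObj T} {B : SynObj T'} {f g : SynHom T' (F.F₀ A) B} → lamH f ≃ lamH g → f D.≃ g
    lamH-injective {A} e = G-faithful (≃-trans (≃-sym (cancelʳ (ηʳ A)))
        (≃-trans (∙-cong e ≃-refl) (cancelʳ (ηʳ A))))

    lamH-lamH⁻¹ : {A : SynObj T} {B : SynObj T'} (g : SynHom T A (G.F₀ B)) → lamH (lamH⁻¹ g) ≃ g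
    lamH-lamH⁻¹ {A} {B} g = ≃-trans (∙-cong (F-faithful FGf) ≃-refl) (cancelʳ (ηˡ A))
      where
        f = lamH⁻¹ g
        h = g ∘ E.η⁻¹ A
        FGf : F.F₁ (G.F₁ f) D.≃ F.F₁ h
        FGf = D.≃-trans (D.≃-sym (D.cancelˡ (εˡ B))) (D.≃-trans
            (D.∙-cong D.≃-refl (D.≃-trans (D.≃-sym (ε-nat f)) D.assoc))
          (D.≃-trans (D.cancelˡ (εˡ B)) (D.cancelʳ (εˡ (F.F₀ A)))))

  F₀ : SynObj T → SynObj T'
  F₀ = F.F₀
  G₀ : SynObj T' → SynObj T
  G₀ = G.F₀
  F₁ : {X Y : SynObj T} → SynHom T X Y → SynHom T' (F₀ X) (F₀ Y)
  F₁ = F.F₁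

  abstract
    -- Transposition seen on canonical models: points of B in `K' (F₀ A)` are arrows F₀ A → B, hence
    -- arrows A → G₀ B, hence points of G₀ B in `K A`.
    lam : {A : SynObj T} {B : SynObj T'} → Pt (str (K' (F₀ A))) B → Pt (str (K A)) (G₀ B)
    lam q = ptOf (lamH (C'.homOf q))

    lam⁻¹ : {A : SynObj T} {B : SynObj T'} → Pt (str (K A)) (G₀ B) → Pt (str (K' (F₀ A))) B
    lam⁻¹ p = D.ptOf (lamH⁻¹ (homOf p))

    lam-cong : {A : SynObj T} {B : SynObj T'} {p q : Pt (str (K' (F₀ A))) B} → EqPt p q → EqPt (lam {A} p)
        (lam {A} q)
    lam-cong e = ptOf-cong (∙-cong (G-cong (D.homOf-cong e)) ≃-refl)

    lam-injective : {A : SynObj T} {B : SynObj T'} {p q : Pt (str (K' (F₀ A))) B} → EqPt (lam {A} p) (lam {A} q) →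
        EqPt p q
    lam-injective {p = p} {q} e = pt-trans (pt-sym (D.ptOf-homOf p)) (pt-trans (D.ptOf-cong (lamH-injective
      (≃-trans (≃-sym (homOf-ptOf _)) (≃-trans (homOf-cong e) (homOf-ptOf _))))) (D.ptOf-homOf q))

    lam-lam⁻¹ : {A : SynObj T} {B : SynObj T'} (p : Pt (str (K A)) (G₀ B)) → EqPt (lam {A} (lam⁻¹ p)) p
    lam-lam⁻¹ p = pt-trans (ptOf-cong (≃-trans (∙-cong (G-cong (D.homOf-ptOf _)) ≃-refl) (lamH-lamH⁻¹ (homOf p))))
        (ptOf-homOf p)

    lam-ap : {A : SynObj T} {B B' : SynObj T'} (v : SynHom T' B B') (q : Pt (str (K' (F₀ A))) B) →
             EqPt (lam {A} (ap v {K' (F₀ A)} q)) (ap (G.F₁ v) {K A} (lam {A} q))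
    lam-ap {A} v q = pt-trans (ptOf-cong (≃-trans (∙-cong (≃-trans (G-cong (D.homOf-ap v q))
        (G-∘ v (C'.homOf q))) ≃-refl) assoc))
      (ap-∙ (G.F₁ v) (lamH (C'.homOf q)) {K A} (genPt A))

    lam-pre : {A A' : SynObj T} {B : SynObj T'} (u : SynHom T A A') (q : Pt (str (K' (F₀ A'))) B) →
              EqPt (lam {A} (mapPt (D.pre (F₁ u)) q)) (mapPt (pre u) (lam {A'} q))
    lam-pre {A} {A'} u q = pt-trans (ptOf-cong (≃-trans (∙-cong
        (≃-trans (G-cong (D.homOf-pre (F₁ u) q)) (G-∘ (C'.homOf q) (F₁ u))) ≃-refl)
        (≃-trans assoc (≃-trans (∙-cong ≃-refl (η-nat u)) (≃-sym assoc)))))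
      (pt-trans (ap-∙ (lamH (C'.homOf q)) u {K A} (genPt A)) (pt-sym
          (eval-ptOf (lamH (C'.homOf q)) {K A} (ptOf u))))

  Gs : Sort Sg' → SynObj T
  Gs s = G₀ (sortObj s)

  up : {A : SynObj T} {s : Sort Sg'} → Car (str (K' (F₀ A))) s → Pt (str (K A)) (Gs s)
  up {A} {s} a = lam {A} {sortObj s} (mkPt (a ▹ ε) tt)

  down : {A : SynObj T} {s : Sort Sg'} → Pt (str (K A)) (Gs s) → Car (str (K' (F₀ A))) s
  down {A} {s} p = env (lam⁻¹ {A} {sortObj s} p) s (here refl)

  up-cong : {A : SynObj T} {s : Sort Sg'} {a b : Car (str (K' (F₀ A))) s} → Model._≈_ (K' (F₀ A)) a b → EqPt
      (up {A} a) (up {A} b)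
  up-cong {A} e = lam-cong {A} (mk≈ (∷-cases _ e (λ _ ())))

  up-injective : {A : SynObj T} {s : Sort Sg'} {a b : Car (str (K' (F₀ A))) s} → EqPt (up {A} a) (up {A} b) →
      Model._≈_ (K' (F₀ A)) a b
  up-injective {A} e = at (lam-injective {A} e) _ (here refl)

  up-down : {A : SynObj T} {s : Sort Sg'} (p : Pt (str (K A)) (Gs s)) → EqPt (up {A} (down {A} p)) p
  up-down {A} p = pt-trans (lam-cong {A} (mk≈ (∷-cases _ (Model.≈-refl (K' (F₀ A))) (λ _ ())))) (lam-lam⁻¹ {A} p)

  up-pre : {A A' : SynObj T} (u : SynHom T A A') {s : Sort Sg'} (a : Car (str (K' (F₀ A'))) s) →
           EqPt (up {A} (fn (D.pre (F₁ u)) a)) (mapPt (pre u) (up {A'} a))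
  up-pre {A} u a = pt-trans (lam-cong {A} (mk≈ (∷-cases _ (Model.≈-refl (K' (F₀ A))) (λ _ ()))))
      (lam-pre u (mkPt (a ▹ ε) tt))

  prod : List (Sort Sg') → SynObj T
  prod ss = robj (prodRep Gs ss)

  tuple : ∀ ss → NatIso (PtF (prod ss)) (FamF Gs ss)
  tuple ss = riso (prodRep Gs ss)

  private
    generic : ∀ ss → Fam (λ s → Pt (str (K (prod ss))) (Gs s)) ss
    generic ss = tr (fwd (tuple ss)) (K (prod ss)) (genPt (prod ss))

  abstract
    -- f is interpreted at the generic tuple alone: its coordinates are transposed into
    -- `K' (F₀ (prod ss))`, where f is applied, and the transposed result is an arrow. Acting with
    -- this arrow defines f in every model.
    opHom : ∀ {ss s} → Fun Sg' ss s → SynHom T (prod ss) (Gs s)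
    opHom {ss} {s} f = homOf (up {prod ss} (Model.fun (K' (F₀ (prod ss))) f
        (λ t x → down {prod ss} (generic ss t x))))

    ap-opHom : ∀ {ss s} (f : Fun Sg' ss s) {M : Model T} (p : Pt (str M) (prod ss)) →
      EqPt (ap (opHom f) {M} p) (mapPt (evalAt {M = M} p) (up {prod ss}
          (Model.fun (K' (F₀ (prod ss))) f (λ t x → down {prod ss} (generic ss t x)))))
    ap-opHom {ss} f {M} p = ap-homOf _ {M} p

  comps : (B : SynObj T') → NatTr (PtF (G₀ B)) (FamF Gs (octx B))
  comps B .tr M p s x = ap (G.F₁ (D.prj B s x)) {M} p
  comps B .tr-cong M e s x = ap-cong (G.F₁ (D.prj B s x)) {M} e
  comps B .tr-natural {M} {N} m p s x = ap-natural (G.F₁ (D.prj B s x)) {M} {N} m p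

  module _ (M : Model T) where
    funR : ∀ {ss s} → Fun Sg' ss s → Fam (λ s → Pt (str M) (Gs s)) ss → Pt (str M) (Gs s)
    funR {ss} f e = ap (opHom f) {M} (bwd (tuple ss) M e)

    strR : Structure Sg'
    strR .Structure.Car s = Pt (str M) (Gs s)
    strR .Structure._≈_ = EqPt
    strR .Structure.≈-refl = pt-refl
    strR .Structure.≈-sym = pt-sym
    strR .Structure.≈-trans = pt-trans
    strR .Structure.fun = funR
    strR .Structure.fun-cong {ss} f p = ap-cong (opHom f) {M} (bwd-cong (tuple ss) M p)
    strR .Structure.rl R e = Σ (Pt (str M) (G₀ (relObj R))) λ p → ∀ s x → EqPt (tr (comps (relObj R)) M p s x)
        (e s x)
    strR .Structure.rl-cong R q (p , r) = p , λ s x → pt-trans (r s x) (q s x)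

  homR : {M N : Model T} → Hom (str M) (str N) → Hom (strR M) (strR N)
  homR m .fn p = mapPt m p
  homR m .fn-cong e = mapPt-cong m e
  homR {M} {N} m .Hom.fn-fun {ss} f e = pt-trans (ap-natural (opHom f) {M} {N} m _)
      (ap-cong (opHom f) {N} (tr-natural (bwdT (tuple ss)) {M} {N} m e))
  homR {M} {N} m .Hom.fn-rel R e (p , r) = mapPt m p , λ s x → pt-trans
      (pt-sym (tr-natural (comps (relObj R)) {M} {N} m p s x)) (mapPt-cong m (r s x))

  upHom : (A : SynObj T) → Hom (str (K' (F₀ A))) (strR (K A))
  upHom A .fn a = up {A} a
  upHom A .fn-cong e = up-cong {A} e
  upHom A .Hom.fn-fun {ss} {s} f e = pt-sym (pt-trans (ap-opHom f {K A} z)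
      (pt-trans shift (pt-trans (pt-sym (up-pre u _))
      (up-cong {A} (Model.≈-trans (K' (F₀ A)) (Hom.fn-fun (D.pre (F₁ u)) f _)
          (Model.fun-cong (K' (F₀ A)) f args))))))
    where
      -- The arguments form a point z of the product in `K A`, that is, an arrow u from A to the
      -- product. The value of f at these arguments is the generic value pulled back along u.
      z = bwd (tuple ss) (K A) (λ t x → up {A} (e t x))
      u = homOf z
      shift : ∀ {B} {q : Pt (str (K (prod ss))) B} → EqPt (mapPt (evalAt {M = K A} z) q) (mapPt (pre u) q)
      shift {q = q} .at t x = Model.≈-sym (K A) (pre-homOf z (env q t x))
      args : ∀ t x → Model._≈_ (K' (F₀ A)) (fn (D.pre (F₁ u)) (down {prod ss} (generic ss t x))) (e t x)
      args t x = up-injective {A} (pt-trans (up-pre u _) (pt-trans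
          (mapPt-cong (pre u) (up-down {prod ss} (generic ss t x)))
        (pt-trans (pt-sym shift) (pt-trans (tr-natural (fwd (tuple ss)) {K (prod ss)} {K A} (evalAt {M = K A} z)
            (genPt (prod ss)) t x)
          (pt-trans (tr-cong (fwd (tuple ss)) (K A) (evalAt-gen {M = K A} z) t x)
              (fwd-bwd (tuple ss) (K A) (λ t x → up {A} (e t x)) t x))))))
  upHom A .Hom.fn-rel R e q = lam {A} p , λ s x → pt-trans (pt-sym (lam-ap {A} (D.prj (relObj R) s x) p))
      (lam-cong {A} (Y'.ap-natHom (D.component (relObj R) s x) {K' (F₀ A)} p))
    where
      p : Pt (str (K' (F₀ A))) (relObj R)
      p = mkPt e (Model.rl-cong (K' (F₀ A)) R (λ s x → Model.≈-sym (K' (F₀ A))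
          (Model.evalTs-varsOf (K' (F₀ A)) (λ x → x) e s x)) q)

  upIso : (A : SynObj T) → Iso (str (K' (F₀ A))) (strR (K A))
  upIso A = bijective-iso (upHom A) (λ p → down {A} p) (λ p → up-down {A} p) (λ e → up-injective {A} e) λ R e
      (p , r) →
    let q = lam⁻¹ {A} p
        eq : ∀ s x → Model._≈_ (K' (F₀ A)) (env q s x) (e s x)
        eq s x = at (lam-injective {A} (pt-trans (lam-cong {A}
            (pt-sym (Y'.ap-natHom (D.component (relObj R) s x) {K' (F₀ A)} q)))
          (pt-trans (lam-ap {A} (D.prj (relObj R) s x) q) (pt-trans
              (ap-cong (G.F₁ (D.prj (relObj R) s x)) {K A} (lam-lam⁻¹ {A} p)) (r s x))))) s (here refl)
    in Model.rl-cong (K' (F₀ A)) R (λ s x → Model.≈-trans (K' (F₀ A))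
        (Model.evalTs-varsOf (K' (F₀ A)) (λ x → x) (env q) s x) (eq s x)) (sat q)

  -- Satisfying environments together with their existential witnesses form a representable functor, for every regular formula.
  record Realisers {Γ : List (Sort Sg')} (φ : Formula Sg' Γ) : Set₁ where
    no-eta-equality
    field
      X : Fct T
      rep : Rep X
      envOf : NatTr X (FamF Gs Γ)
      realises : (M : Model T) (x : Fct.Obj X M) → Sat (strR M) φ (tr envOf M x)
      realiser : (M : Model T) (e : Env (strR M) Γ) → Sat (strR M) φ e → Σ (Fct.Obj X M) λ x → ∀ s y → EqPt
          (tr envOf M x s y) (e s y)

  private
    evalsF : ∀ {Γ ss} (ts : Terms Sg' Γ ss) → NatTr (FamF Gs Γ) (FamF Gs ss)
    evalsF ts .tr M e = evalTs (strR M) ts e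
    evalsF ts .tr-cong M p = Structure.evalTs-cong (strR M) ts p
    evalsF ts .tr-natural {M} {N} m e = Hom.fn-evalTs (homR {M} {N} m) ts e

    fstF : {X Y Z : Fct T} (α : NatTr X Z) (β : NatTr Y Z) → NatTr (PullF α β) X
    fstF α β .tr M (x , _) = x
    fstF α β .tr-cong M (p , _) = p
    fstF {X} α β .tr-natural m _ = Fct.eq-refl′ X

  realisers : ∀ {Γ} (φ : Formula Sg' Γ) → Realisers φ
  realisers {Γ} ⊤ᶠ = record { X = FamF Gs Γ ; rep = prodRep Gs Γ ; envOf = fwd (idIso _) ; realises = λ M x → tt ;
      realiser = λ M e _ → e , λ _ _ → pt-refl }
  realisers {Γ} (φ ∧ᶠ ψ) = record
    { X = PullF a.envOf b.envOf ; rep = Rep-pull _ _ a.rep b.rep (prodRep Gs Γ) ;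
        envOf = a.envOf ⊙ fstF a.envOf b.envOf
    ; realises = λ M (x , y , e) → a.realises M x , Structure.Sat-cong (strR M) ψ (λ s z → pt-sym (e s z))
        (b.realises M y)
    ; realiser = λ M e (p , q) → let x = a.realiser M e p ; y = b.realiser M e q in
        (proj₁ x , proj₁ y , λ s z → pt-trans (proj₂ x s z) (pt-sym (proj₂ y s z))) , proj₂ x }
    where
      module a = Realisers (realisers φ)
      module b = Realisers (realisers ψ)
  realisers {Γ} (_≐_ {s} t u) = record
    { X = PullF terms diag ; rep = Rep-pull terms diag (prodRep Gs Γ) (Rep-Pt (Gs s)) (prodRep Gs (s ∷ s ∷ [])) ;
        envOf = fstF terms diag
    ; realises = λ M (x , a , e) → pt-trans (e s (here refl)) (pt-sym (e s (there (here refl))))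
    ; realiser = λ M e q → (e , evalT (strR M) t e , ∷-cases _ pt-refl (∷-cases _ (pt-sym q) (λ _ ()))) , λ _ _ →
        pt-refl }
    where
      terms : NatTr (FamF Gs Γ) (FamF Gs (s ∷ s ∷ []))
      terms = evalsF (t ∷ₜ (u ∷ₜ []ₜ))
      diag : NatTr (PtF (Gs s)) (FamF Gs (s ∷ s ∷ []))
      diag .tr M a = a ▹ a ▹ ε
      diag .tr-cong M p = ∷-cases _ p (∷-cases _ p (λ _ ()))
      diag .tr-natural m a = ∷-cases _ pt-refl (∷-cases _ pt-refl (λ _ ()))
  realisers {Γ} (rel {ss} R ts) = record
    { X = PullF (evalsF ts) (comps (relObj R)) ; rep = Rep-pull _ _ (prodRep Gs Γ) (Rep-Pt (G₀ (relObj R)))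
        (prodRep Gs ss) ; envOf = fstF (evalsF ts) (comps (relObj R))
    ; realises = λ M (x , p , e) → p , λ s y → pt-sym (e s y)
    ; realiser = λ M e (p , r) → (e , p , λ s x → pt-sym (r s x)) , λ _ _ → pt-refl }
  -- The same functor is kept and only the environment forgets the witness, so uniqueness of the
  -- witness does not enter.
  realisers {Γ} (∃ᶠ s φ) = record
    { X = a.X ; rep = a.rep ; envOf = rest ⊙ a.envOf
    ; realises = λ M x → tr a.envOf M x s (here refl) , Structure.Sat-cong (strR M) φ
        (∷-cases _ pt-refl (λ _ _ → pt-refl)) (a.realises M x)
    ; realiser = λ M e (b , q) → let x = a.realiser M (b ▹ e) q in proj₁ x , λ t y → proj₂ x t (there y) }
    where
      module a = Realisers (realisers φ)
      rest : NatTr (FamF Gs (s ∷ Γ)) (FamF Gs Γ)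
      rest .tr M e = tail e
      rest .tr-cong M p t x = p t (there x)
      rest .tr-natural m e t x = pt-refl

  validR : (M : Model T) (a : Ax T') → Valid (strR M) (axiom T' a)
  validR M a = go (axiom T' a) (λ A → iso-valid (upIso A) (axiom T' a) (Model.valid (K' (F₀ A)) a))
    where
      go : (σ : Sequent Sg') → (∀ A → Valid (strR (K A)) σ) → Valid (strR M) σ
      go (seq Γ φ ψ) v e q = Structure.Sat-cong (strR M) ψ (λ s z →
            pt-trans (tr-natural envOf {K A} {M} (evalAt {M = M} α) x₀ s z)
                (pt-trans (tr-cong envOf M back s z) (proj₂ x s z)))
          (Hom.fn-Sat (homR {K A} {M} (evalAt {M = M} α)) ψ _ (v A (tr envOf (K A) x₀) (realises (K A) x₀)))
        where
          open Realisers (realisers φ)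
          x = realiser M e q
          A = robj rep
          α = bwd (riso rep) M (proj₁ x)
          x₀ = tr (fwd (riso rep)) (K A) (genPt A)
          back : Fct.Eq X M (Fct.act X {K A} {M} (evalAt {M = M} α) x₀) (proj₁ x)
          back = Fct.eq-trans X (tr-natural (fwd (riso rep)) {K A} {M} (evalAt {M = M} α) (genPt A))
            (Fct.eq-trans X (tr-cong (fwd (riso rep)) M (evalAt-gen {M = M} α)) (fwd-bwd (riso rep) M (proj₁ x)))

  -- p and q give a point of the kernel pair of comps, over whose canonical model the two projections agree.
  comps-injective : (B : SynObj T') (M : Model T) (p q : Pt (str M) (G₀ B)) →
      (∀ s x → EqPt (tr (comps B) M p s x) (tr (comps B) M q s x)) → EqPt p q
  comps-injective B M p q e = pt-trans (pt-sym (leg fstT M d p (fst-pair {M} p q agree)))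
      (pt-trans (mapPt-cong (evalAt {M = M} d) same) (leg sndT M d q (snd-pair {M} p q agree)))
    where
      X = octx B
      c : NatTr (PtF (G₀ B)) (PtF (prod X))
      c = bwdT (tuple X) ⊙ comps B
      f = natHom c
      open Pullback f f
      agree : EqPt (ap f {M} p) (ap f {M} q)
      agree = pt-trans (ap-natHom c {M} p) (pt-trans (bwd-cong (tuple X) M e) (pt-sym (ap-natHom c {M} q)))
      d = pair {M} p q agree
      fstT sndT : NatTr (PtF PB) (PtF (G₀ B))
      fstT .tr M p = fst {M} p
      fstT .tr-cong M e = fst-cong {M} e
      fstT .tr-natural {M} {N} m p = fst-natural {M} {N} m p
      sndT .tr M p = snd {M} p
      sndT .tr-cong M e = snd-cong {M} e
      sndT .tr-natural {M} {N} m p = snd-natural {M} {N} m p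
      leg : (τ : NatTr (PtF PB) (PtF (G₀ B))) (M : Model T) (d : Pt (str M) PB) (p : Pt (str M) (G₀ B)) → EqPt
          (tr τ M d) p →
            EqPt (mapPt (evalAt {M = M} d) (tr τ (K PB) (genPt PB))) p
      leg τ M d p e = pt-trans (tr-natural τ {K PB} {M} (evalAt {M = M} d) (genPt PB))
          (pt-trans (tr-cong τ M (evalAt-gen {M = M} d)) e)
      u = fst {K PB} (genPt PB)
      v = snd {K PB} (genPt PB)
      uv : ∀ s x → EqPt (tr (comps B) (K PB) u s x) (tr (comps B) (K PB) v s x)
      uv s x = pt-trans (pt-sym (fwd-bwd (tuple X) (K PB) (tr (comps B) (K PB) u) s x))
          (pt-trans (tr-cong (fwd (tuple X)) (K PB)
        (pt-trans (pt-sym (ap-natHom c {K PB} u)) (pt-trans (commutes {K PB} (genPt PB))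
            (ap-natHom c {K PB} v))) s x) (fwd-bwd (tuple X) (K PB) (tr (comps B) (K PB) v) s x))
      -- Transposed to `K' (F₀ PB)`, u and v become points of B itself, and these are determined by
      -- their components.
      same : EqPt u v
      same = pt-trans (pt-sym (lam-lam⁻¹ {PB} u)) (pt-trans (lam-cong {PB}
          (mk≈ λ s x → at (lam-injective {PB} (at-comp s x)) s (here refl))) (lam-lam⁻¹ {PB} v))
        where
          to-comp : ∀ s x (u : Pt (str (K PB)) (G₀ B)) → EqPt
              (lam {PB} (tr (D.component B s x) (K' (F₀ PB)) (lam⁻¹ {PB} u))) (tr (comps B) (K PB) u s x)
          to-comp s x u = pt-trans (lam-cong {PB} (pt-sym (Y'.ap-natHom (D.component B s x) {K' (F₀ PB)}
              (lam⁻¹ {PB} u))))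
            (pt-trans (lam-ap {PB} (D.prj B s x) (lam⁻¹ {PB} u))
                (ap-cong (G.F₁ (D.prj B s x)) {K PB} (lam-lam⁻¹ {PB} u)))
          at-comp : ∀ s x → EqPt (lam {PB} (tr (D.component B s x) (K' (F₀ PB)) (lam⁻¹ {PB} u)))
              (lam {PB} (tr (D.component B s x) (K' (F₀ PB)) (lam⁻¹ {PB} v)))
          at-comp s x = pt-trans (to-comp s x u) (pt-trans (uv s x) (pt-sym (to-comp s x v)))

  right : RepFun T T'
  right .RepFun.mfun .MFun.mob M .Model.str = strR M
  right .RepFun.mfun .MFun.mob M .Model.valid = validR M
  right .RepFun.mfun .MFun.mhom {M} {N} m = homR {M} {N} m
  right .RepFun.mfun .MFun.mhom-ext e p .at s x = e (env p s x)
  right .RepFun.mfun .MFun.mhom-id {M} p .at s x = Model.≈-refl M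
  right .RepFun.mfun .MFun.mhom-∘ {O = O} n m p .at s x = Model.≈-refl O
  right .RepFun.sorts s .robj = Gs s
  right .RepFun.sorts s .riso .fwd .tr M p = p
  right .RepFun.sorts s .riso .fwd .tr-cong M e = e
  right .RepFun.sorts s .riso .fwd .tr-natural m p = pt-refl
  right .RepFun.sorts s .riso .bwd M p = p
  right .RepFun.sorts s .riso .bwd-cong M e = e
  right .RepFun.sorts s .riso .bwd-fwd M p = pt-refl
  right .RepFun.sorts s .riso .fwd-bwd M p = pt-refl
  right .RepFun.rels R .robj = G₀ (relObj R)
  right .RepFun.rels R .riso .fwd .tr M p = mkPt (tr (comps (relObj R)) M p)
      (p , λ s x → pt-sym (Structure.evalTs-varsOf (strR M) (λ x → x) _ s x))
  right .RepFun.rels R .riso .fwd .tr-cong M e .at = tr-cong (comps (relObj R)) M e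
  right .RepFun.rels R .riso .fwd .tr-natural {M} {N} m p .at = tr-natural (comps (relObj R)) {M} {N} m p
  right .RepFun.rels R .riso .bwd M q = proj₁ (sat q)
  -- Evidence that a tuple satisfies R is a point of `G₀ (relObj R)`. By injectivity the tuple
  -- determines it, so the object represents the relation and not merely its evidence.
  right .RepFun.rels R .riso .bwd-cong M {p} {q} e = comps-injective (relObj R) M _ _ λ s x → pt-trans
      (proj₂ (sat p) s x) (pt-trans (Structure.evalTs-varsOf (strR M) (λ x → x) _ s x)
    (pt-trans (at e s x) (pt-sym (pt-trans (proj₂ (sat q) s x)
        (Structure.evalTs-varsOf (strR M) (λ x → x) _ s x)))))
  right .RepFun.rels R .riso .bwd-fwd M p = pt-refl
  right .RepFun.rels R .riso .fwd-bwd M q .at s x = pt-trans (proj₂ (sat q) s x)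
      (Structure.evalTs-varsOf (strR M) (λ x → x) _ s x)

-- A natural isomorphism on canonical models extends to all models, each of which is a filtered colimit of canonical ones.

module _ {Sg : Signature} {T : Theory Sg} (cax : CartAx T) where
  open Complete cax

  record CanonTr (X Y : Fct T) : Set₁ where
    no-eta-equality
    private
      module X = Fct X
      module Y = Fct Y
    field
      rep : Rep X
      act-ext : {M N : Model T} {m n : Hom (str M) (str N)} → m ≗ʰ n → (y : Y.Obj M) → Y.Eq N (Y.act {M} {N} m y)
          (Y.act {M} {N} n y)
      act-∘ : {M N O : Model T} (n : Hom (str N) (str O)) (m : Hom (str M) (str N)) (y : Y.Obj M) →
              Y.Eq O (Y.act {M} {O} (n ∘ʰ m) y) (Y.act {N} {O} n (Y.act {M} {N} m y))
      canon : (A : SynObj T) → X.Obj (K A) → Y.Obj (K A)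
      canon-cong : (A : SynObj T) {x y : X.Obj (K A)} → X.Eq (K A) x y → Y.Eq (K A) (canon A x) (canon A y)
      canon-natural : {A A' : SynObj T} (p : Pt (str (K A)) A') (x : X.Obj (K A')) →
        Y.Eq (K A) (canon A (X.act {K A'} {K A} (evalAt {M = K A} p) x))
            (Y.act {K A'} {K A} (evalAt {M = K A} p) (canon A' x))

    private
      A₀ = robj rep
      x₀ = tr (fwd (riso rep)) (K A₀) (genPt A₀)

    code : (M : Model T) → X.Obj M → Pt (str M) A₀
    code = bwd (riso rep)

    decode : (M : Model T) (x : X.Obj M) → X.Eq M (X.act {K A₀} {M} (evalAt {M = M} (code M x)) x₀) x
    decode M x = X.eq-trans (tr-natural (fwd (riso rep)) {K A₀} {M} (evalAt {M = M} (code M x)) (genPt A₀))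
      (X.eq-trans (tr-cong (fwd (riso rep)) M (evalAt-gen {M = M} (code M x))) (fwd-bwd (riso rep) M x))

    -- Representability of X replaces an actual colimit: each x in X(M) is the image of the generic
    -- element `x₀` under evaluation at the point coding x, and naturality then dictates the value.
    extend : (M : Model T) → X.Obj M → Y.Obj M
    extend M x = Y.act {K A₀} {M} (evalAt {M = M} (code M x)) (canon A₀ x₀)

    extend-cong : (M : Model T) {x y : X.Obj M} → X.Eq M x y → Y.Eq M (extend M x) (extend M y)
    extend-cong M e = act-ext {K A₀} {M} (evalAt-cong {M = M} (bwd-cong (riso rep) M e)) (canon A₀ x₀)

    private
      moved : {M N : Model T} (m : Hom (str M) (str N)) (x : X.Obj M) → m ∘ʰ evalAt {M = M} (code M x) ≗ʰ evalAt
          {M = N} (code N (X.act {M} {N} m x))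
      moved {M} {N} m x a = Model.≈-trans N (evalAt-natural {M = M} {N} m (code M x) a)
          (evalAt-cong {M = N} (tr-natural (bwdT (riso rep)) {M} {N} m x) a)

    extend-natural : {M N : Model T} (m : Hom (str M) (str N)) (x : X.Obj M) → Y.Eq N (Y.act {M} {N} m (extend M x))
        (extend N (X.act {M} {N} m x))
    extend-natural {M} {N} m x = Y.eq-trans (Y.eq-sym (act-∘ {K A₀} {M} {N} m (evalAt {M = M} (code M x))
        (canon A₀ x₀)))
      (act-ext {K A₀} {N} {m ∘ʰ evalAt {M = M} (code M x)} (moved {M} {N} m x) (canon A₀ x₀))

    -- Independence of the presentation: the value may be computed from any canonical model that
    -- maps to M, which lets several elements be treated over a common one.
    extend-canon : {M : Model T} {B : SynObj T} (b : Pt (str M) B) (y : X.Obj (K B)) →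
                   Y.Eq M (extend M (X.act {K B} {M} (evalAt {M = M} b) y))
                       (Y.act {K B} {M} (evalAt {M = M} b) (canon B y))
    extend-canon {M} {B} b y = Y.eq-trans (Y.eq-sym (extend-natural {K B} {M} (evalAt {M = M} b) y))
      (Y.act-cong {K B} {M} (evalAt {M = M} b) (Y.eq-trans (Y.eq-sym (canon-natural (code (K B) y) x₀))
          (canon-cong B (decode (K B) y))))

  module ExtendIso (S : RepFun T T) (i : (A : SynObj T) → Iso (str (K A)) (str (RepFun.mob S (K A))))
      (i-natural : {A A' : SynObj T} (p : Pt (str (K A)) A') →
        Iso.to (i A) ∘ʰ evalAt {M = K A} p ≗ʰ RepFun.mhom S {K A'} {K A} (evalAt {M = K A} p) ∘ʰ Iso.to
            (i A')) where
    private
      module S = RepFun S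
      S* : {M : Model T} {A : SynObj T} → Pt (str M) A → Hom (str (S.mob (K A))) (str (S.mob M))
      S* {M} {A} a = S.mhom {K A} {M} (evalAt {M = M} a)

    to′ : ∀ t → CanonTr (SortF t) (CompF S.mfun (SortF t))
    to′ t .CanonTr.rep = Rep-sort t
    to′ t .CanonTr.act-ext {M} {N} {m} {n} e y = S.mhom-ext {M} {N} {m} {n} e y
    to′ t .CanonTr.act-∘ {M} {N} {O} n m y = S.mhom-∘ {M} {N} {O} n m y
    to′ t .CanonTr.canon A = fn (Iso.to (i A))
    to′ t .CanonTr.canon-cong A = fn-cong (Iso.to (i A))
    to′ t .CanonTr.canon-natural p x = i-natural p x

    from′ : ∀ t → CanonTr (CompF S.mfun (SortF t)) (SortF t)
    from′ t .CanonTr.rep = S.sorts t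
    from′ t .CanonTr.act-ext e y = e y
    from′ t .CanonTr.act-∘ {O = O} n m y = Model.≈-refl O
    from′ t .CanonTr.canon A = fn (Iso.from (i A))
    from′ t .CanonTr.canon-cong A = fn-cong (Iso.from (i A))
    from′ t .CanonTr.canon-natural {A} {A'} p x = Model.≈-trans (K A)
        (fn-cong (Iso.from (i A)) (Model.≈-trans (S.mob (K A))
        (fn-cong (S* p) (Model.≈-sym (S.mob (K A')) (Iso.to-from (i A') x)))
            (Model.≈-sym (S.mob (K A)) (i-natural p _))))
      (Iso.from-to (i A) _)

    module _ (M : Model T) where
      private
        module M = Model M
        module SM = Model (S.mob M)

      h : ∀ {t} → M.Car t → SM.Car t
      h {t} = CanonTr.extend (to′ t) M

      g : ∀ {t} → SM.Car t → M.Car t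
      g {t} = CanonTr.extend (from′ t) M

      private
        at-env : ∀ {B : SynObj T} (b : Pt (str M) B) s x → SM._≈_ (h (env b s x))
            (fn (S* {M} b) (fn (Iso.to (i B)) (Canon.gen B s x)))
        at-env b s x = SM.≈-trans (CanonTr.extend-cong (to′ s) M (M.≈-sym (at (evalAt-gen {M = M} b) s x)))
            (CanonTr.extend-canon (to′ s) {M} b (Canon.gen _ s x))

        hHom : Hom (str M) (str (S.mob M))
        hHom .fn = h
        hHom .fn-cong {t} = CanonTr.extend-cong (to′ t) M
        -- The whole tuple of arguments is the image of the generic point of one canonical model,
        -- that of the context `ss`, and there `i` commutes with f.
        hHom .Hom.fn-fun {ss} {s} f e = SM.≈-trans (CanonTr.extend-cong (to′ s) M
            (M.≈-sym (M.≈-trans (Hom.fn-fun (evalAt {M = M} b) f _)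
              (M.fun-cong f (at (evalAt-gen {M = M} b)))))) (SM.≈-trans (CanonTr.extend-canon (to′ s) {M} b _)
            (SM.≈-trans (fn-cong (S* {M} b) (Hom.fn-fun (Iso.to (i B)) f _)) (SM.≈-trans (Hom.fn-fun (S* {M} b) f _)
              (SM.fun-cong f (λ t x → SM.≈-sym (at-env b t x))))))
          where
            B = ctxObj ss
            b : Pt (str M) B
            b = mkPt e tt
        hHom .Hom.fn-rel {ss} R e q = SM.rl-cong R (λ t x → SM.≈-sym (at-env b t x))
            (Hom.fn-rel (S* {M} b) R _ (Hom.fn-rel (Iso.to (i B)) R _
            (Model.rl-cong (K B) R (λ t x → Model.evalTs-varsOf (K B) (λ x → x) _ t x) (Canon.gen-Sat B))))
          where
            B = relObj R
            b : Pt (str M) B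
            b = mkPt e (M.rl-cong R (λ t x → M.≈-sym (M.evalTs-varsOf (λ x → x) e t x)) q)

        hg : ∀ {t} (z : SM.Car t) → h (g z) SM.≈ z
        hg {t} z = SM.≈-trans (CanonTr.extend-canon (to′ t) {M} (CanonTr.code (from′ t) M z) _)
          (SM.≈-trans (fn-cong (S* {M} (CanonTr.code (from′ t) M z)) (Iso.to-from (i _) _))
              (CanonTr.decode (from′ t) M z))

        gh : ∀ {t} (x : M.Car t) → g (h x) M.≈ x
        gh {t} x = M.≈-trans (CanonTr.extend-canon (from′ t) {M} (CanonTr.code (to′ t) M x) _)
          (M.≈-trans (fn-cong (evalAt {M = M} (CanonTr.code (to′ t) M x)) (Iso.from-to (i _) _))
              (CanonTr.decode (to′ t) M x))

        -- A tuple related in S(M) is the image of the generic related tuple over the object A that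
        -- represents R composed with S. The inverse of `i A` brings that tuple into `K A`, and
        -- evaluation carries it to M.
        reflect : ∀ {ss} (R : Rel Sg ss) (e : M.Env ss) → SM.rl R (λ s x → h (e s x)) → M.rl R e
        reflect {ss} R e q = M.rl-cong R eq (Hom.fn-rel (evalAt {M = M} a) R
            (λ s x → fn (Iso.from (i A)) (env p₀ s x)) (Hom.fn-rel (Iso.from (i A)) R _
            (Model.rl-cong (S.mob (K A)) R (λ t x → Model.evalTs-varsOf (S.mob (K A)) (λ x → x) _ t x) (sat p₀))))
          where
            r = S.rels R
            A = robj r
            p : Pt (str (S.mob M)) (relObj R)
            p = mkPt (λ s x → h (e s x)) (SM.rl-cong R (λ t x → SM.≈-sym (SM.evalTs-varsOf (λ x → x) _ t x)) q)
            a = bwd (riso r) M p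
            p₀ = tr (fwd (riso r)) (K A) (genPt A)
            back : EqPt (mapPt (S* {M} a) p₀) p
            back = pt-trans (tr-natural (fwd (riso r)) {K A} {M} (evalAt {M = M} a) (genPt A))
                (pt-trans (tr-cong (fwd (riso r)) M (evalAt-gen {M = M} a)) (fwd-bwd (riso r) M p))
            eq : ∀ s x → fn (evalAt {M = M} a) (fn (Iso.from (i A)) (env p₀ s x)) M.≈ e s x
            eq s x = M.≈-trans (M.≈-sym (CanonTr.extend-canon (from′ s) {M} a (env p₀ s x)))
                (M.≈-trans (CanonTr.extend-cong (from′ s) M (at back s x)) (gh (e s x)))

      extendIso : Iso (str M) (str (S.mob M))
      extendIso = bijective-iso hHom g hg (λ {t} {x} {y} e → M.≈-trans (M.≈-sym (gh x)) (M.≈-trans (CanonTr.extend-cong (from′ t) M e) (gh y))) reflect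

    extendIso-natural : {M N : Model T} (m : Hom (str M) (str N)) → Iso.to (extendIso N) ∘ʰ m ≗ʰ S.mhom {M}
        {N} m ∘ʰ Iso.to (extendIso M)
    extendIso-natural {M} {N} m {s} x = Model.≈-sym (S.mob N) (CanonTr.extend-natural (to′ s) {M} {N} m x)

-- An equivalence with naturality of both units and of their inverses, so that taking opposites is strictly involutive.
record BiEquivalence (C D : Category) : Set where
  private
    module C = Category C
    module D = Category D
  field
    F : Functor C D
    G : Functor D C
  open Functor F
  open Functor G renaming (F₀ to G₀; F₁ to G₁)
  field
    η    : ∀ A → C.Hom A (G₀ (F₀ A))
    η⁻¹  : ∀ A → C.Hom (G₀ (F₀ A)) A
    η-isoˡ : ∀ A → C.⌊ η⁻¹ A ⌋ C.∘ C.⌊ η A ⌋ C.≈ C.id A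
    η-isoʳ : ∀ A → C.⌊ η A ⌋ C.∘ C.⌊ η⁻¹ A ⌋ C.≈ C.id (G₀ (F₀ A))
    η-natural : ∀ {A B} (f : C.Hom A B) → C.⌊ G₁ (F₁ f) ⌋ C.∘ C.⌊ η A ⌋ C.≈ C.⌊ η B ⌋ C.∘ C.⌊ f ⌋
    η⁻¹-natural : ∀ {A B} (f : C.Hom A B) → C.⌊ f ⌋ C.∘ C.⌊ η⁻¹ A ⌋ C.≈ C.⌊ η⁻¹ B ⌋ C.∘ C.⌊ G₁ (F₁ f) ⌋
    κ    : ∀ B → D.Hom (F₀ (G₀ B)) B
    κ⁻¹  : ∀ B → D.Hom B (F₀ (G₀ B))
    κ-isoˡ : ∀ B → D.⌊ κ⁻¹ B ⌋ D.∘ D.⌊ κ B ⌋ D.≈ D.id (F₀ (G₀ B))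
    κ-isoʳ : ∀ B → D.⌊ κ B ⌋ D.∘ D.⌊ κ⁻¹ B ⌋ D.≈ D.id B
    κ-natural : ∀ {A B} (g : D.Hom A B) → D.⌊ g ⌋ D.∘ D.⌊ κ A ⌋ D.≈ D.⌊ κ B ⌋ D.∘ D.⌊ F₁ (G₁ g) ⌋
    κ⁻¹-natural : ∀ {A B} (g : D.Hom A B) → D.⌊ F₁ (G₁ g) ⌋ D.∘ D.⌊ κ⁻¹ A ⌋ D.≈ D.⌊ κ⁻¹ B ⌋ D.∘ D.⌊ g ⌋

  equivalence : Equivalence C D
  equivalence = record { F = F ; G = G ; η = η ; η⁻¹ = η⁻¹ ; η-isoˡ = η-isoˡ ; η-isoʳ = η-isoʳ ;
      η-natural = η-natural
    ; ε = κ ; ε⁻¹ = κ⁻¹ ; ε-isoˡ = κ-isoˡ ; ε-isoʳ = κ-isoʳ ; ε-natural = κ-natural }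

op : {C D : Category} → BiEquivalence C D → BiEquivalence D C
op B = record { F = G ; G = F ; η = κ⁻¹ ; η⁻¹ = κ ; η-isoˡ = κ-isoʳ ; η-isoʳ = κ-isoˡ ; η-natural = κ⁻¹-natural ;
    η⁻¹-natural = κ-natural
  ; κ = η⁻¹ ; κ⁻¹ = η ; κ-isoˡ = η-isoʳ ; κ-isoʳ = η-isoˡ ; κ-natural = η⁻¹-natural ; κ⁻¹-natural = η-natural }
  where open BiEquivalence B

module _ {Sg Sg' : Signature} {T : Theory Sg} {T' : Theory Sg'} (cax : CartAx T) (cax' : CartAx T') where
  private
    module A = Arrows cax
    module A' = Arrows cax'
    module C = Complete cax
    module C' = Complete cax'

  biEquivalence : Equivalence (SyntacticCategory T) (SyntacticCategory T') → BiEquivalence (SyntacticCategory T)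
      (SyntacticCategory T')
  biEquivalence E = record { F = F ; G = G ; η = η ; η⁻¹ = η⁻¹ ; η-isoˡ = η-isoˡ ; η-isoʳ = η-isoʳ ;
      η-natural = η-natural
      ; η⁻¹-natural = λ {X} {Y} f → A.to-≈ₛ {f = C._∙_ f (η⁻¹ X)} {g = C._∙_ (η⁻¹ Y) (G₁ (F₁ f))} (A.≃-trans (A.≃-sym (A.cancelˡ {g = η⁻¹ Y} {f = η Y} (A.of-≈ₛ (η-isoˡ Y))))
          (A.∙-cong A.≃-refl (A.≃-trans (A.≃-sym A.assoc) (A.≃-trans
              (A.∙-cong (A.≃-sym (A.of-≈ₛ {f = C._∙_ (G₁ (F₁ f)) (η X)} {g = C._∙_ (η Y) f}
              (η-natural f))) A.≃-refl)
            (A.cancelʳ {g = η X} {f = η⁻¹ X} (A.of-≈ₛ (η-isoʳ X)))))))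
      ; κ = κ ; κ⁻¹ = κ⁻¹ ; κ-isoˡ = κ-isoˡ ; κ-isoʳ = κ-isoʳ ; κ-natural = κ-natural
      ; κ⁻¹-natural = λ {X} {Y} g → A'.to-≈ₛ {f = C'._∙_ (F₁ (G₁ g)) (κ⁻¹ X)} {g = C'._∙_ (κ⁻¹ Y) g} (A'.≃-trans (A'.∙-cong (A'.≃-sym (A'.cancelˡ {g = κ⁻¹ Y} {f = κ Y} (A'.of-≈ₛ (κ-isoˡ Y)))) A'.≃-refl)
          (A'.≃-trans (A'.∙-cong (A'.∙-cong A'.≃-refl (A'.≃-sym
              (A'.of-≈ₛ {f = C'._∙_ g (κ X)} {g = C'._∙_ (κ Y) (F₁ (G₁ g))} (κ-natural g)))) A'.≃-refl)
            (A'.≃-trans A'.assoc (A'.∙-cong A'.≃-refl (A'.cancelʳ {g = κ X} {f = κ⁻¹ X} (A'.of-≈ₛ (κ-isoʳ X)))))))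
      }
    where
      open Equivalence E renaming (ε to κ; ε⁻¹ to κ⁻¹; ε-isoˡ to κ-isoˡ; ε-isoʳ to κ-isoʳ; ε-natural to κ-natural)
      open Functor F
      open Functor G renaming (F₀ to G₀; F₁ to G₁)

-- The unit of the equivalence between categories of models

module UnitOf {Sg Sg' : Signature} {T : Theory Sg} {T' : Theory Sg'} (cax : CartAx T) (cax' : CartAx T')
              (B : BiEquivalence (SyntacticCategory T) (SyntacticCategory T')) where
  open Arrows cax
  open Complete cax
  private
    module B = BiEquivalence B
    module H = Half cax cax' B.equivalence
    module H' = Half cax' cax (BiEquivalence.equivalence (op B))
    module D = Arrows cax'
    R = H.right
    R' = H'.right
    module R = RepFun R
    module R' = RepFun R'
    S = compRF cax R' R
    F₀ = H.F₀
    G₀ = H'.F₀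

    RK : SynObj T → Model T'
    RK A = R.mob (K A)

    -- Composite of K A ≅ K (G₀ (F₀ A)) along η with K (G₀ (F₀ A)) ≅ R' (K' (F₀ A)) ≅ R' (R (K A));
    -- the last two come from the transpositions of the two halves.
    i : (A : SynObj T) → Iso (str (K A)) (str (RepFun.mob S (K A)))
    i A = iso-trans (pre-iso (B.η A) (B.η⁻¹ A) (of-≈ₛ (B.η-isoˡ A)) (of-≈ₛ (B.η-isoʳ A)))
      (iso-trans (H'.upIso (F₀ A)) (mapIso R'.mfun {H.K' (F₀ A)} {RK A} (H.upIso A)))

    -- Each factor of `i` is natural: the first by the square for η⁻¹, the other two by `up-pre`.
    i-pre : {A A' : SynObj T} (u : SynHom T A A') → Iso.to (i A) ∘ʰ pre u ≗ʰ RepFun.mhom S {K A'} {K A}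
        (pre u) ∘ʰ Iso.to (i A')
    i-pre {A} {A'} u a = X.≈-trans (fn-cong R'up (X.≈'-trans (H'.up-cong {F₀ A} commute) (H'.up-pre (H.F₁ u) a')))
        (X.≈-trans (X.≈-sym (R'.mhom-∘ {H.K' (F₀ A')} {H.K' (F₀ A)} {RK A} (Iso.to (H.upIso A)) (D.pre (H.F₁ u))
            (H'.up {F₀ A'} a')))
          (X.≈-trans (R'.mhom-ext {H.K' (F₀ A')} {RK A} {Iso.to (H.upIso A) ∘ʰ D.pre (H.F₁ u)}
              {R.mhom {K A'} {K A} (pre u) ∘ʰ Iso.to (H.upIso A')} (λ b → H.up-pre u b) (H'.up {F₀ A'} a'))
            (R'.mhom-∘ {H.K' (F₀ A')} {RK A'} {RK A} (R.mhom {K A'} {K A} (pre u)) (Iso.to (H.upIso A'))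
                (H'.up {F₀ A'} a'))))
      where
        a' = fn (pre (B.η⁻¹ A')) a
        R'up = R'.mhom {H.K' (F₀ A)} {RK A} (Iso.to (H.upIso A))
        module X where
          open Model (R'.mob (RK A)) public using (≈-trans; ≈-sym)
          open Model (R'.mob (H.K' (F₀ A))) public using () renaming (≈-trans to ≈'-trans)
        commute : Model._≈_ (K (G₀ (F₀ A))) (fn (pre (B.η⁻¹ A)) (fn (pre u) a)) (fn (pre (H'.F₁ (H.F₁ u))) a')
        commute = Model.≈-trans (K _) (Model.≈-sym (K _) (pre-∙ u (B.η⁻¹ A) a))
            (Model.≈-trans (K _) (pre-cong {f = _∙_ u (B.η⁻¹ A)} {g = _∙_ (B.η⁻¹ A') (H'.F₁ (H.F₁ u))}
            (of-≈ₛ (B.η⁻¹-natural u)) a) (pre-∙ (B.η⁻¹ A') (H'.F₁ (H.F₁ u)) a))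

    -- Every evaluation between canonical models is precomposition with the arrow `homOf p`.
    i-natural : {A A' : SynObj T} (p : Pt (str (K A)) A') → Iso.to (i A) ∘ʰ evalAt {M = K A} p ≗ʰ RepFun.mhom S
        {K A'} {K A} (evalAt {M = K A} p) ∘ʰ Iso.to (i A')
    i-natural {A} {A'} p a = Model.≈-trans (RepFun.mob S (K A))
        (fn-cong (Iso.to (i A)) (Model.≈-sym (K A) (pre-homOf p a)))
      (Model.≈-trans (RepFun.mob S (K A)) (i-pre (homOf p) a)
          (RepFun.mhom-ext S {K A'} {K A} {pre (homOf p)} {evalAt {M = K A} p} (pre-homOf p)
          (fn (Iso.to (i A')) a)))

  unit : Unit (RepFun.mfun H.right) (RepFun.mfun H'.right)
  unit .Unit.at-model = ExtendIso.extendIso cax S i i-natural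
  unit .Unit.unit-natural {M} {N} m = ExtendIso.extendIso-natural cax S i i-natural {M} {N} m

Equivalence⇒ModEquiv : {Sg Sg' : Signature} {T : Theory Sg} {T' : Theory Sg'} → CartAx T → CartAx T' →
                       Equivalence (SyntacticCategory T) (SyntacticCategory T') → ModEquiv T T'
Equivalence⇒ModEquiv cax cax' E = record
  { right = Half.right cax cax' (BiEquivalence.equivalence B) ; left = Half.right cax' cax
      (BiEquivalence.equivalence (op B))
  ; unit = UnitOf.unit cax cax' B ; counit = UnitOf.unit cax' cax (op B) }
  where B = biEquivalence cax cax' E

-- Adjoint equivalences of categories of models

module _ {Sg Sg' : Signature} {T : Theory Sg} {T' : Theory Sg'} {R : MFun T T'} {R' : MFun T' T} (h : Unit R R') where
  private
    S = compMF R' R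
    module S = MFun S
    to : (M : Model T) → Hom (str M) (str (S.mob M))
    to M = Iso.to (Unit.at-model h M)
    from : (M : Model T) → Hom (str (S.mob M)) (str M)
    from M = Iso.from (Unit.at-model h M)

  unit-injective : (M : Model T) {t : Sort Sg} {a b : Car (str M) t} → Model._≈_ (S.mob M) (fn (to M) a)
      (fn (to M) b) → Model._≈_ M a b
  unit-injective M {a = a} {b} e = Model.≈-trans M (Model.≈-sym M (Iso.from-to (Unit.at-model h M) a))
    (Model.≈-trans M (fn-cong (from M) e) (Iso.from-to (Unit.at-model h M) b))

  -- Holds for any natural isomorphism from the identity to S: naturality at the component `to M`
  -- itself, with the invertible `to M` cancelled on the right.
  unit-S : (M : Model T) → to (S.mob M) ≗ʰ S.mhom {M} {S.mob M} (to M)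
  unit-S M a = X.≈-trans (fn-cong (to (S.mob M)) (Model.≈-sym (S.mob M) (Iso.to-from (Unit.at-model h M) a)))
    (X.≈-trans (Unit.unit-natural h {M} {S.mob M} (to M) (fn (from M) a))
        (fn-cong (S.mhom {M} {S.mob M} (to M)) (Iso.to-from (Unit.at-model h M) a)))
    where module X = Model (S.mob (S.mob M))

  unit-from-natural : {M N : Model T} (m : Hom (str M) (str N)) → from N ∘ʰ S.mhom {M} {N} m ≗ʰ m ∘ʰ from M
  unit-from-natural {M} {N} m a = unit-injective N (SN.≈-trans (Iso.to-from (Unit.at-model h N) _)
    (SN.≈-sym (SN.≈-trans (Unit.unit-natural h {M} {N} m _) (fn-cong (S.mhom {M} {N} m)
        (Iso.to-from (Unit.at-model h M) a)))))
    where module SN = Model (S.mob N)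

  unit-faithful : {M N : Model T} {m n : Hom (str M) (str N)} → MFun.mhom R {M} {N} m ≗ʰ MFun.mhom R {M} {N} n →
      m ≗ʰ n
  unit-faithful {M} {N} {m} {n} e a = unit-injective N (SN.≈-trans (Unit.unit-natural h {M} {N} m a)
    (SN.≈-trans (MFun.mhom-ext R' {MFun.mob R M} {MFun.mob R N} {MFun.mhom R {M} {N} m} {MFun.mhom R {M} {N} n} e _)
        (SN.≈-sym (Unit.unit-natural h {M} {N} n a))))
    where module SN = Model (S.mob N)

record AdjEquiv {Sg Sg' : Signature} (T : Theory Sg) (T' : Theory Sg') : Set₁ where
  field
    right : RepFun T T'
    left  : RepFun T' T
    unit   : Unit (RepFun.mfun right) (RepFun.mfun left)
    counit : Unit (RepFun.mfun left) (RepFun.mfun right)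
    triangle  : (M : Model T) → RepFun.mhom right {M} {RepFun.mob left (RepFun.mob right M)}
        (Iso.to (Unit.at-model unit M)) ≗ʰ Iso.to (Unit.at-model counit (RepFun.mob right M))
    triangle′ : (N : Model T') → RepFun.mhom left {N} {RepFun.mob right (RepFun.mob left N)}
        (Iso.to (Unit.at-model counit N)) ≗ʰ Iso.to (Unit.at-model unit (RepFun.mob left N))

AdjEquiv-sym : {Sg Sg' : Signature} {T : Theory Sg} {T' : Theory Sg'} → AdjEquiv T T' → AdjEquiv T' T
AdjEquiv-sym E = record { right = left ; left = right ; unit = counit ; counit = unit ; triangle = triangle′ ;
    triangle′ = triangle }
  where open AdjEquiv E

-- The counit is replaced by N → RR'N → RR'RR'N → RR'N, the classical way to make an equivalence adjoint.
module Adjointify {Sg Sg' : Signature} {T : Theory Sg} {T' : Theory Sg'} (R : MFun T T') (R' : MFun T' T) (h : Unit R R') (k : Unit R' R) where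
  private
    module R = MFun R
    module R' = MFun R'
    P = compMF R R'
    module P = MFun P
    hI = Unit.at-model h
    kI = Unit.at-model k

  counit-iso : (N : Model T') → Iso (str N) (str (P.mob N))
  counit-iso N = iso-trans (kI N) (iso-trans (mapIso R {R'.mob N} {R'.mob (P.mob N)} (hI (R'.mob N)))
      (iso-sym (mapIso P {N} {P.mob N} (kI N))))

  counit′ : Unit R' R
  counit′ .Unit.at-model = counit-iso
  counit′ .Unit.unit-natural {N} {O} n a =
      PO.≈-trans (fn-cong kO⁻¹ (fn-cong hO (Unit.unit-natural k {N} {O} n a)))
        (PO.≈-trans (fn-cong kO⁻¹ step₂) (step₃ _))
    where
      module PO = Model (P.mob O)
      module PPO = Model (P.mob (P.mob O))
      kO⁻¹ = P.mhom {P.mob O} {O} (Iso.from (kI O))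
      hO = R.mhom {R'.mob O} {R'.mob (P.mob O)} (Iso.to (hI (R'.mob O)))
      hN = R.mhom {R'.mob N} {R'.mob (P.mob N)} (Iso.to (hI (R'.mob N)))
      a₁ = fn (Iso.to (kI N)) a
      step₂ : fn hO (fn (P.mhom {N} {O} n) a₁) PPO.≈ fn (P.mhom {P.mob N} {P.mob O} (P.mhom {N} {O} n)) (fn hN a₁)
      step₂ = PPO.≈-trans (PPO.≈-sym (R.mhom-∘ {R'.mob N} {R'.mob O} {R'.mob (P.mob O)} (Iso.to (hI (R'.mob O)))
          (R'.mhom {N} {O} n) a₁))
        (PPO.≈-trans (R.mhom-ext {R'.mob N} {R'.mob (P.mob O)} {Iso.to (hI (R'.mob O)) ∘ʰ R'.mhom {N} {O} n}
            {R'.mhom {P.mob N} {P.mob O} (P.mhom {N} {O} n) ∘ʰ Iso.to (hI (R'.mob N))}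
                (Unit.unit-natural h {R'.mob N} {R'.mob O} (R'.mhom {N} {O} n)) a₁)
          (R.mhom-∘ {R'.mob N} {R'.mob (P.mob N)} {R'.mob (P.mob O)}
              (R'.mhom {P.mob N} {P.mob O} (P.mhom {N} {O} n)) (Iso.to (hI (R'.mob N))) a₁))
      step₃ : kO⁻¹ ∘ʰ P.mhom {P.mob N} {P.mob O} (P.mhom {N} {O} n) ≗ʰ P.mhom {N} {O} n ∘ʰ P.mhom {P.mob N} {N}
          (Iso.from (kI N))
      step₃ b = PO.≈-trans (PO.≈-sym (P.mhom-∘ {P.mob N} {P.mob O} {O} (Iso.from (kI O)) (P.mhom {N} {O} n) b))
        (PO.≈-trans (P.mhom-ext {P.mob N} {O} {Iso.from (kI O) ∘ʰ P.mhom {N} {O} n} {n ∘ʰ Iso.from (kI N)}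
            (unit-from-natural k {N} {O} n) b)
          (P.mhom-∘ {P.mob N} {N} {O} n (Iso.from (kI N)) b))

  -- Writing N = R M and P = R ∘ R', `unit-S` for h rewrites the middle factor of the new counit as
  -- P (R h). Naturality of k moves it to the right, `unit-S` for k turns the component at P N into
  -- P k, and this cancels against the final inverse.
  triangle : (M : Model T) → R.mhom {M} {R'.mob (R.mob M)} (Iso.to (hI M)) ≗ʰ Iso.to (counit-iso (R.mob M))
  triangle M a = X.≈-sym (X.≈-trans (fn-cong kN⁻¹ (Y.≈-trans
        (R.mhom-ext {R'.mob N} {R'.mob (P.mob N)} {Iso.to (hI (R'.mob N))}
            {R'.mhom {N} {P.mob N} (R.mhom {M} {R'.mob N} (Iso.to (hI M)))} (unit-S h M) (fn (Iso.to (kI N)) a))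
        (Y.≈-trans (Y.≈-sym (Unit.unit-natural k {N} {P.mob N} Rh a)) (unit-S k N _))))
      (Iso.from-to (mapIso P {N} {P.mob N} (kI N)) (fn Rh a)))
    where
      N = R.mob M
      Rh = R.mhom {M} {R'.mob N} (Iso.to (hI M))
      module X = Model (P.mob N)
      module Y = Model (P.mob (P.mob N))
      kN⁻¹ = P.mhom {P.mob N} {N} (Iso.from (kI N))

  -- Since R is faithful the claim may be tested after applying R, where it follows from the first
  -- triangle and `unit-S` for the new counit.
  triangle′ : (N : Model T') → R'.mhom {N} {P.mob N} (Iso.to (counit-iso N)) ≗ʰ Iso.to (hI (R'.mob N))
  triangle′ N = unit-faithful h {R'.mob N} {R'.mob (P.mob N)} {R'.mhom {N} {P.mob N} (Iso.to (counit-iso N))}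
      {Iso.to (hI (R'.mob N))} λ a →
    X.≈-trans (X.≈-sym (unit-S counit′ N a)) (X.≈-sym (triangle (R'.mob N) a))
    where module X = Model (P.mob (P.mob N))

adjointify : {Sg Sg' : Signature} {T : Theory Sg} {T' : Theory Sg'} → ModEquiv T T' → AdjEquiv T T'
adjointify E = record { right = right ; left = left ; unit = unit ; counit = A.counit′ ; triangle = A.triangle ;
    triangle′ = A.triangle′ }
  where
    open ModEquiv E
    module A = Adjointify (RepFun.mfun right) (RepFun.mfun left) unit counit

-- Corresponding pairs of models, with the correspondence given by explicit coordinates.

model : {Sg : Signature} (T : Theory Sg) (M : Structure Sg) → (∀ a → Valid M (axiom T a)) → Model T
model T M v .Model.str = M
model T M v .Model.valid = v

module Pairs {Sg Sg' : Signature} {T : Theory Sg} {T' : Theory Sg'} (E : AdjEquiv T T') where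
  open AdjEquiv E
  module R = RepFun right
  module R' = RepFun left

  dom : Sort Sg' → SynObj T
  dom s = robj (R.sorts s)

  dom′ : Sort Sg → SynObj T'
  dom′ t = robj (R'.sorts t)

  coord : (M : Model T) {s : Sort Sg'} → Car (str (R.mob M)) s → Pt (str M) (dom s)
  coord M {s} = bwd (riso (R.sorts s)) M

  coord′ : (N : Model T') {t : Sort Sg} → Car (str (R'.mob N)) t → Pt (str N) (dom′ t)
  coord′ N {t} = bwd (riso (R'.sorts t)) N

  -- By `compat`, v is the unit followed by the inverse of R' u, so u determines v. Both
  -- isomorphisms and both compatibilities are recorded, which makes exchanging T and T' a mere
  -- reordering of fields.
  record Pair (M : Model T) (N : Model T') (c : ∀ s → Car (str N) s → Env (str M) (octx (dom s)))
              (d : ∀ t → Car (str M) t → Env (str N) (octx (dom′ t))) : Set where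
    no-eta-equality
    field
      u : Iso (str N) (str (R.mob M))
      v : Iso (str M) (str (R'.mob N))
      u-coord : ∀ s (b : Car (str N) s) → Model._≋_ M (env (coord M (fn (Iso.to u) b))) (c s b)
      v-coord : ∀ t (a : Car (str M) t) → Model._≋_ N (env (coord′ N (fn (Iso.to v) a))) (d t a)
      compat  : R'.mhom {N} {R.mob M} (Iso.to u) ∘ʰ Iso.to v ≗ʰ Iso.to (Unit.at-model unit M)
      compat′ : R.mhom {M} {R'.mob N} (Iso.to v) ∘ʰ Iso.to u ≗ʰ Iso.to (Unit.at-model counit N)

Pair-sym : {Sg Sg' : Signature} {T : Theory Sg} {T' : Theory Sg'} (E : AdjEquiv T T') {M : Model T} {N : Model T'}
    {c : _} {d : _} →
           Pairs.Pair E M N c d → Pairs.Pair (AdjEquiv-sym E) N M d c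
Pair-sym E P = record { u = v ; v = u ; u-coord = v-coord ; v-coord = u-coord ; compat = compat′ ;
    compat′ = compat }
  where open Pairs.Pair P

Pair-unsym : {Sg Sg' : Signature} {T : Theory Sg} {T' : Theory Sg'} (E : AdjEquiv T T') {M : Model T} {N : Model T'}
    {c : _} {d : _} →
             Pairs.Pair (AdjEquiv-sym E) N M d c → Pairs.Pair E M N c d
Pair-unsym E P = record { u = v ; v = u ; u-coord = v-coord ; v-coord = u-coord ; compat = compat′ ;
    compat′ = compat }
  where open Pairs.Pair P

module _ {Sg Sg' : Signature} {T : Theory Sg} {T' : Theory Sg'} (E : AdjEquiv T T') where
  open AdjEquiv E
  open Pairs E

  -- Naturality of coordinates and of the units moves every clause. Along identity isomorphisms it
  -- replaces one proof of validity by another on the same structure.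
  Pair-transport : {X₁ X₂ : Model T} {Y₁ Y₂ : Model T'} {c₁ : _} {d₁ : _} {c₂ : _} {d₂ : _}
      (α : Iso (str X₁) (str X₂)) (β : Iso (str Y₁) (str Y₂)) →
    (∀ s b → Model._≋_ X₂ (λ t x → fn (Iso.to α) (c₁ s (fn (Iso.from β) b) t x)) (c₂ s b)) →
    (∀ t a → Model._≋_ Y₂ (λ s x → fn (Iso.to β) (d₁ t (fn (Iso.from α) a) s x)) (d₂ t a)) →
    Pair X₁ Y₁ c₁ d₁ → Pair X₂ Y₂ c₂ d₂
  Pair-transport {X₁} {X₂} {Y₁} {Y₂} {c₁} {d₁} {c₂} {d₂} α β cc dd P = Q
    where
      open Pair P
      Rα = mapIso R.mfun {X₁} {X₂} α
      R'β = mapIso R'.mfun {Y₁} {Y₂} β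
      u₂ = iso-trans (iso-sym β) (iso-trans u Rα)
      v₂ = iso-trans (iso-sym α) (iso-trans v R'β)
      Q : Pair X₂ Y₂ c₂ d₂
      Q .Pair.u = u₂
      Q .Pair.v = v₂
      Q .Pair.u-coord s b t x = M.≈-trans (M.≈-sym (at (tr-natural (bwdT (riso (R.sorts s))) {X₁} {X₂}
          (Iso.to α) _) t x))
          (M.≈-trans (fn-cong (Iso.to α) (u-coord s _ t x)) (cc s b t x))
        where module M = Model X₂
      Q .Pair.v-coord s b t x = N.≈-trans (N.≈-sym (at (tr-natural (bwdT (riso (R'.sorts s))) {Y₁} {Y₂}
          (Iso.to β) _) t x))
          (N.≈-trans (fn-cong (Iso.to β) (v-coord s _ t x)) (dd s b t x))
        where module N = Model Y₂
      Q .Pair.compat a = Z.≈-trans (Z.≈-sym (R'.mhom-∘ {Y₁} {Y₂} {R.mob X₂} (Iso.to u₂) (Iso.to β) _))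
          (Z.≈-trans (R'.mhom-ext {Y₁} {R.mob X₂} {Iso.to u₂ ∘ʰ Iso.to β} {Iso.to Rα ∘ʰ Iso.to u}
              (λ b → fn-cong (Iso.to Rα) (fn-cong (Iso.to u) (Iso.from-to β b))) _)
            (Z.≈-trans (R'.mhom-∘ {Y₁} {R.mob X₁} {R.mob X₂} (Iso.to Rα) (Iso.to u) _)
              (Z.≈-trans (fn-cong (R'.mhom {R.mob X₁} {R.mob X₂} (Iso.to Rα)) (compat _))
                (Z.≈-trans (Z.≈-sym (Unit.unit-natural unit {X₁} {X₂} (Iso.to α) _))
                    (fn-cong (Iso.to (Unit.at-model unit X₂)) (Iso.to-from α a))))))
        where module Z = Model (R'.mob (R.mob X₂))
      Q .Pair.compat′ a = Z.≈-trans (Z.≈-sym (R.mhom-∘ {X₁} {X₂} {R'.mob Y₂} (Iso.to v₂) (Iso.to α) _))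
          (Z.≈-trans (R.mhom-ext {X₁} {R'.mob Y₂} {Iso.to v₂ ∘ʰ Iso.to α} {Iso.to R'β ∘ʰ Iso.to v}
              (λ b → fn-cong (Iso.to R'β) (fn-cong (Iso.to v) (Iso.from-to α b))) _)
            (Z.≈-trans (R.mhom-∘ {X₁} {R'.mob Y₁} {R'.mob Y₂} (Iso.to R'β) (Iso.to v) _)
              (Z.≈-trans (fn-cong (R.mhom {R'.mob Y₁} {R'.mob Y₂} (Iso.to R'β)) (compat′ _))
                (Z.≈-trans (Z.≈-sym (Unit.unit-natural counit {Y₁} {Y₂} (Iso.to β) _))
                    (fn-cong (Iso.to (Unit.at-model counit Y₂)) (Iso.to-from β a))))))
        where module Z = Model (R.mob (R'.mob Y₂))

  -- Transporting the unit along u makes the second compatibility a consequence of the triangle identity.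
  module Induced (X : Model T) (N : Structure Sg') (u : Iso N (str (R.mob X))) where
    Y : Model T'
    Y = model T' N (λ a → iso-valid (iso-sym u) (axiom T' a) (Model.valid (R.mob X) a))

    private R'u = mapIso R'.mfun {Y} {R.mob X} u

    induced : Iso (str X) (str (R'.mob Y))
    induced = iso-trans (Unit.at-model unit X) (iso-sym R'u)

    inducedPair : {c : _} {d : _} → (∀ s b → Model._≋_ X (env (coord X (fn (Iso.to u) b))) (c s b)) →
                  (∀ t a → Structure._≋_ N (env (coord′ Y (fn (Iso.to induced) a))) (d t a)) → Pair X Y c d
    inducedPair uc vd .Pair.u = u
    inducedPair uc vd .Pair.v = induced
    inducedPair uc vd .Pair.u-coord = uc
    inducedPair uc vd .Pair.v-coord = vd
    inducedPair uc vd .Pair.compat a = Iso.to-from R'u _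
    inducedPair uc vd .Pair.compat′ b = Z.≈-trans (R.mhom-∘ {X} {R'.mob (R.mob X)} {R'.mob Y} (Iso.from R'u)
        (Iso.to (Unit.at-model unit X)) _)
        (Z.≈-trans (fn-cong RR'u⁻¹ (triangle X (fn (Iso.to u) b)))
          (Z.≈-trans (Z.≈-sym (Unit.unit-natural counit {R.mob X} {Y} (Iso.from u) _))
              (fn-cong (Iso.to (Unit.at-model counit Y)) (Iso.from-to u b))))
      where
        module Z = Model (R.mob (R'.mob Y))
        RR'u⁻¹ = R.mhom {R'.mob (R.mob X)} {R'.mob Y} (Iso.from R'u)

-- The common Morita extension, built from the side of T

module FunctionDefinition {Sg : Signature} {T : Theory Sg} (cax : CartAx T) {args : List (Sort Sg)} {cod : Sort Sg}
                          (τ : NatTr {T = T} (PtF (ctxObj args)) (PtF (sortObj cod))) where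
  open Yoneda cax
  private
    f = natHom τ
    point : (N : Model T) → Env (str N) args → Pt {T = T} (str N) (ctxObj args)
    point N e = mkPt e tt

  value : (N : Model T) → Env (str N) args → Car (str N) cod
  value N e = env (tr τ N (point N e)) cod (here refl)

  -- The graph of an arrow lists target variables first, so the graph of an arrow from `args` to one
  -- sort has exactly the context that an explicit definition asks for.
  formula : Formula Sg (cod ∷ args)
  formula = SynRaw.fml (proj₁ f)

  formula-cart : Cart T formula
  formula-cart = IsFunctionalRel.cart (proj₂ f)

  formula-value : (N : Model T) (e : Env (str N) args) (y : Car (str N) cod) → Sat (str N) formula (y ▹ e) →
      Model._≈_ N y (value N e)
  formula-value N e y q = Model.≈-trans N (at (ap-unique f {N} (point N e) (mkPt (y ▹ ε) tt) q) cod (here refl))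
      (at (ap-natHom τ {N} (point N e)) cod (here refl))

  value-formula : (N : Model T) (e : Env (str N) args) (y : Car (str N) cod) → Model._≈_ N y (value N e) → Sat
      (str N) formula (y ▹ e)
  value-formula N e y q = Model.Sat-cong N formula (∷-cases _
      (Model.≈-trans N (at (ap-natHom τ {N} (point N e)) cod (here refl)) (Model.≈-sym N q))
      (λ _ _ → Model.≈-refl N)) (ap-graph f {N} (point N e))

  formula-functional : Functional T formula
  formula-functional = IsFunctionalRel.total (proj₂ f) , Complete.unique-sem cax formula-cart λ N e a b p q →
    Model.≈-trans N (formula-value N e a p) (Model.≈-sym N (formula-value N e b q))

module Chain {Sg Sg' : Signature} {T : Theory Sg} {T' : Theory Sg'} (E : AdjEquiv T T') (cax : CartAx T) where
  open AdjEquiv E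
  open Pairs E

  -- Subsorts are cut out of a single sort, so the whole context of `dom s` is first made one sort.
  -- For an empty context the product of no sorts acts as a singleton.
  S₁ : MoritaSpec T
  S₁ = record
    { FunIx = ⊥ ; fArgs = λ () ; fCod = λ () ; fDef = λ () ; fCart = λ () ; fFunc = λ ()
    ; RelIx = ⊥ ; rArgs = λ () ; rDef = λ () ; rCart = λ ()
    ; ProdIx = Sort Sg' ; factors = λ s → octx (dom s)
    ; SubIx = ⊥ ; subBase = λ () ; subDef = λ () ; subCart = λ () ; OneIx = ⊥ }

  T₁ : Theory (ExtSig S₁)
  T₁ = ExtTheory S₁
  module X₁ = Extension S₁
  cax₁ : CartAx T₁
  cax₁ = X₁.ext-cartAx cax
  module red₁ = RepFun X₁.reductE

  module At₁ (N : Model T₁) where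
    open X₁.IsExt (X₁.isExt (str N) (Model.valid N)) public

  prodSort : Sort Sg' → ExtSort S₁
  prodSort s = inj₂ (prodS s)

  tupleF : ∀ s → NatTr (CompF red₁.mfun (PtF (dom s))) (PtF (sortObj (prodSort s)))
  tupleF s .tr N p = mkPt (At₁.tuple N s (env p) ▹ ε) tt
  tupleF s .tr-cong N {p} {q} e .at = ∷-cases _ (At₁.proj-injective N s _ _ λ t x → Model.≈-trans N
      (At₁.proj-tuple N s (env p) t x)
    (Model.≈-trans N (at e t x) (Model.≈-sym N (At₁.proj-tuple N s (env q) t x)))) (λ _ ())
  tupleF s .tr-natural {M} {N} m p .at = ∷-cases _ (At₁.proj-injective N s _ _ λ t x →
      N.≈-trans (N.fun-cong (proj s x) (∷-cases _ N.≈-refl (λ _ ())))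
          (N.≈-trans (N.≈-sym (Hom.fn-fun m (proj s x) _))
        (N.≈-trans (fn-cong m (At₁.proj-tuple M s (env p) t x)) (N.≈-sym (At₁.proj-tuple N s _ t x))))) (λ _ ())
    where module N = Model N

  module Domain (s : Sort Sg') where
    open Yoneda cax₁
    -- `dom s` is an object of T. The object of T₁ with the same points on the reduct is taken from
    -- representability instead of translating the formula.
    rep = repObj cax₁ X₁.reductE (dom s)
    into = tupleF s ⊙ fwd (riso rep)
    f = natHom into
    inj : {N : Model T₁} (p q : Pt (str N) (robj rep)) → EqPt (ap f {N} p) (ap f {N} q) → EqPt p q
    inj {N} p q e = pt-trans (pt-sym (bwd-fwd (riso rep) N p)) (pt-trans (bwd-cong (riso rep) N (mk≈ λ t x →
        N.≈-trans (N.≈-sym (At₁.proj-tuple N s _ t x)) (N.≈-trans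
            (N.fun-cong (proj s x) (∷-cases _ (at e' _ (here refl)) (λ _ ()))) (At₁.proj-tuple N s _ t x))))
            (bwd-fwd (riso rep) N q))
      where
        module N = Model N
        e' = pt-trans (pt-sym (ap-natHom into {N} p)) (pt-trans e (ap-natHom into {N} q))
    open Complete.Image cax₁ f (λ {N} → inj {N}) public

    member : (N : Model T₁) (a : Car (str N) (prodSort s)) → Sat (str N) image (a ▹ ε) →
             Σ (Pt (str (red₁.mob N)) (dom s)) λ p → ∀ t x → Model._≈_ N (Model.fun N (proj s x) (a ▹ ε))
                 (env p t x)
    member N a q = let (p , e) = image-preimage {N} (a ▹ ε) q in tr (fwd (riso rep)) N p , λ t x →
      Model.≈-trans N (Model.fun-cong N (proj s x) (∷-cases _
          (Model.≈-trans N (e _ (here refl)) (at (ap-natHom into {N} p) _ (here refl))) (λ _ ())))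
          (At₁.proj-tuple N s _ t x)

    member-intro : (N : Model T₁) (a : Car (str N) (prodSort s)) (p : Pt (str (red₁.mob N)) (dom s)) →
             (∀ t x → Model._≈_ N (Model.fun N (proj s x) (a ▹ ε)) (env p t x)) → Sat (str N) image (a ▹ ε)
    member-intro N a p e = image-intro {N} (a ▹ ε) (bwd (riso rep) N p)
        (∷-cases _ (N.≈-trans (At₁.proj-injective N s _ _ λ t x →
        N.≈-trans (e t x) (N.≈-trans (N.≈-sym (at (fwd-bwd (riso rep) N p) t x))
            (N.≈-sym (At₁.proj-tuple N s _ t x))))
          (N.≈-sym (at (ap-natHom into {N} (bwd (riso rep) N p)) _ (here refl)))) (λ _ ()))
      where module N = Model N

  S₂ : MoritaSpec T₁
  S₂ = record
    { FunIx = ⊥ ; fArgs = λ () ; fCod = λ () ; fDef = λ () ; fCart = λ () ; fFunc = λ ()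
    ; RelIx = ⊥ ; rArgs = λ () ; rDef = λ () ; rCart = λ ()
    ; ProdIx = ⊥ ; factors = λ ()
    ; SubIx = Sort Sg' ; subBase = prodSort ; subDef = λ s → Domain.image s ; subCart = λ s → Domain.image-cart s ;
        OneIx = ⊥ }

  T₂ : Theory (ExtSig S₂)
  T₂ = ExtTheory S₂
  module X₂ = Extension S₂
  cax₂ : CartAx T₂
  cax₂ = X₂.ext-cartAx cax₁
  module red₂ = RepFun X₂.reductE

  module At₂ (N : Model T₂) where
    open X₂.IsExt (X₂.isExt (str N) (Model.valid N)) public

  ν : Sort Sg' → ExtSort S₂
  ν s = inj₂ (subS s)

  base₂ : RepFun T₂ T
  base₂ = compRF cax₂ X₁.reductE X₂.reductE
  module base₂ = RepFun base₂

  inclF : ∀ s (N : Model T₂) → Car (str N) (ν s) → Car (str (red₂.mob N)) (prodSort s)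
  inclF s N a = Model.fun N (incl s) (a ▹ ε)

  projF : ∀ s {t} (x : t ∈ octx (dom s)) (N : Model T₁) → Car (str N) (prodSort s) → Car (str N) (inj₁ t)
  projF s x N a = Model.fun N (proj s x) (a ▹ ε)

  cut₂ : ∀ s → NatIso (SortF (ν s)) (CompF base₂.mfun (PtF (dom s)))
  cut₂ s .fwd .tr N a = mkPt (λ t x → projF s x (red₂.mob N) (inclF s N a))
    (let (p , e) = Domain.member s (red₂.mob N) (inclF s N a) (At₂.incl-sat N s a)
     in Model.Sat-cong (base₂.mob N) (ofml (dom s)) (λ t x → Model.≈-sym N (e t x)) (sat p))
  cut₂ s .fwd .tr-cong N e .at t x = Model.fun-cong (red₂.mob N) (proj s x)
      (∷-cases _ (Model.fun-cong N (incl s) (∷-cases _ e (λ _ ()))) (λ _ ()))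
  cut₂ s .fwd .tr-natural {M} {N} m a .at t x = N.≈-trans (Hom.fn-fun (red₂.mhom {M} {N} m) (proj s x) _)
      (Model.fun-cong (red₂.mob N) (proj s x) (∷-cases _ (N.≈-trans (Hom.fn-fun m (incl s) _)
          (N.fun-cong (incl s) (∷-cases _ N.≈-refl (λ _ ())))) (λ _ ())))
    where module N = Model N
  cut₂ s .bwd N p = At₂.restrict N s (At₁.tuple (red₂.mob N) s (env p))
      (Domain.member-intro s (red₂.mob N) _ p (λ t x → At₁.proj-tuple (red₂.mob N) s (env p) t x))
  cut₂ s .bwd-cong N {p} {q} e = At₂.incl-injective N s _ _ (N.≈-trans (At₂.incl-restrict N s _ _) (N.≈-trans
      (At₁.proj-injective (red₂.mob N) s _ _ λ t x → N.≈-trans (At₁.proj-tuple (red₂.mob N) s (env p) t x)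
          (N.≈-trans (at e t x) (N.≈-sym (At₁.proj-tuple (red₂.mob N) s (env q) t x))))
      (N.≈-sym (At₂.incl-restrict N s _ _))))
    where module N = Model N
  cut₂ s .bwd-fwd N a = At₂.incl-injective N s _ _ (Model.≈-trans N (At₂.incl-restrict N s _ _)
      (At₁.proj-injective (red₂.mob N) s _ _ λ t x →
    At₁.proj-tuple (red₂.mob N) s _ t x))
  cut₂ s .fwd-bwd N p .at t x = Model.≈-trans N (Model.fun-cong (red₂.mob N) (proj s x)
      (∷-cases _ (At₂.incl-restrict N s _ _) (λ _ ()))) (At₁.proj-tuple (red₂.mob N) s (env p) t x)

  abstract
    -- The elements of the subsort are the points of `dom s`, and these represent the elements of
    -- sort s in R of the base model. All symbols of T' are transported along this identification.
    U₂ : ∀ s → NatIso (SortF (ν s)) (CompF base₂.mfun (CompF R.mfun (SortF s)))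
    U₂ s = whiskerIso base₂.mfun (riso (R.sorts s)) ⊙ⁱ cut₂ s

    U₂-coord : ∀ s (N : Model T₂) (a : Car (str N) (ν s)) →
               Model._≋_ (base₂.mob N) (env (coord (base₂.mob N) (tr (fwd (U₂ s)) N a)))
                   (λ t x → projF s x (red₂.mob N) (inclF s N a))
    U₂-coord s N a = at (bwd-fwd (riso (R.sorts s)) (base₂.mob N) (tr (fwd (cut₂ s)) N a))

  RM : Model T₂ → Model T'
  RM N = R.mob (base₂.mob N)

  RM-hom : {M N : Model T₂} → Hom (str M) (str N) → Hom (str (RM M)) (str (RM N))
  RM-hom {M} {N} m = R.mhom {base₂.mob M} {base₂.mob N} (base₂.mhom {M} {N} m)

  toR : (N : Model T₂) {s : Sort Sg'} → Car (str N) (ν s) → Car (str (RM N)) s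
  toR N {s} = tr (fwd (U₂ s)) N

  fromR : (N : Model T₂) {s : Sort Sg'} → Car (str (RM N)) s → Car (str N) (ν s)
  fromR N {s} = bwd (U₂ s) N

  envR : (N : Model T₂) {ss : List (Sort Sg')} → Env (str N) (map ν ss) → Env (str (RM N)) ss
  envR N e t x = toR N (e (ν t) (mapVar ν x))

  unenvR : (N : Model T₂) {ss : List (Sort Sg')} → Env (str (RM N)) ss → Env (str N) (map ν ss)
  unenvR N e = mapFam ν {P = Car (str N)} (λ t x → fromR N (e t x))

  envR-unenvR : (N : Model T₂) {ss : List (Sort Sg')} (e : Env (str (RM N)) ss) → Model._≋_ (RM N)
      (envR N (unenvR N e)) e
  envR-unenvR N e t x = Model.≈-trans (RM N) (Model.≈-≡ (RM N)
      (cong (toR N) (mapFam-mapVar ν {P = Car (str N)} (λ t x → fromR N (e t x)) t x))) (fwd-bwd (U₂ t) N (e t x))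

  unenvR-cong : (N : Model T₂) {ss : List (Sort Sg')} {d e : Env (str (RM N)) ss} → Model._≋_ (RM N) d e →
      Model._≋_ N (unenvR N d) (unenvR N e)
  unenvR-cong N {d = d} {e} p = map-cases ν _ λ t x → Model.≈-trans N
      (Model.≈-≡ N (mapFam-mapVar ν {P = Car (str N)} (λ t x → fromR N (d t x)) t x))
    (Model.≈-trans N (bwd-cong (U₂ t) N (p t x)) (Model.≈-≡ N
        (sym (mapFam-mapVar ν {P = Car (str N)} (λ t x → fromR N (e t x)) t x))))

  unenvR-envR : (N : Model T₂) {ss : List (Sort Sg')} (e : Env (str N) (map ν ss)) → Model._≋_ N
      (unenvR N (envR N e)) e
  unenvR-envR N e = map-cases ν _ λ t x → Model.≈-trans N (Model.≈-≡ N
      (mapFam-mapVar ν {P = Car (str N)} (λ t x → fromR N (envR N e t x)) t x)) (bwd-fwd (U₂ t) N _)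

  unenvR-natural : {M N : Model T₂} (m : Hom (str M) (str N)) {ss : List (Sort Sg')} (e : Env (str (RM M)) ss) →
    ∀ s x → Model._≈_ N (fn m (unenvR M e s x)) (unenvR N (λ t y → fn (RM-hom {M} {N} m) (e t y)) s x)
  unenvR-natural {M} {N} m e = map-cases ν _ λ t x → Model.≈-trans N
      (Model.≈-≡ N (cong (fn m) (mapFam-mapVar ν {P = Car (str M)} (λ t x → fromR M (e t x)) t x)))
    (Model.≈-trans N (tr-natural (bwdT (U₂ t)) {M} {N} m (e t x))
        (Model.≈-≡ N (sym (mapFam-mapVar ν {P = Car (str N)} (λ t x → fromR N
        (fn (RM-hom {M} {N} m) (e t x))) t x))))

  opF : ∀ {ss s} → Fun Sg' ss s → NatTr (PtF {T = T₂} (ctxObj (map ν ss))) (PtF (sortObj (ν s)))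
  opF f .tr N p = mkPt (fromR N (Model.fun (RM N) f (envR N (env p))) ▹ ε) tt
  opF {s = s} f .tr-cong N e .at = ∷-cases _ (bwd-cong (U₂ s) N
      (Model.fun-cong (RM N) f (λ t x → tr-cong (fwd (U₂ t)) N (at e (ν t) (mapVar ν x))))) (λ _ ())
  opF {s = s} f .tr-natural {M} {N} m p .at = ∷-cases _ (Model.≈-trans N (tr-natural (bwdT (U₂ s)) {M} {N} m _)
    (bwd-cong (U₂ s) N (Model.≈-trans (RM N) (Hom.fn-fun (RM-hom {M} {N} m) f _)
        (Model.fun-cong (RM N) f (λ t x → tr-natural (fwd (U₂ t)) {M} {N} m (env p (ν t) (mapVar ν x))))))) (λ _ ())

  module Op {ss s} (f : Fun Sg' ss s) = FunctionDefinition cax₂ (opF f)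

  module RelDef {ss} (r : Rel Sg' ss) where
    open Yoneda cax₂
    C = robj (R.rels r)
    rep = repObj cax₂ base₂ C
    satEnv : (N : Model T₂) → Pt (str (base₂.mob N)) C → Pt (str (RM N)) (relObj r)
    satEnv N = tr (fwd (riso (R.rels r))) (base₂.mob N)
    -- A relation of T' arrives as an object C of T, not as a formula on the new sorts. It becomes
    -- such a formula as the image of the injective map sending a point of C to the tuple it stands
    -- for.
    relF : NatTr (CompF base₂.mfun (PtF C)) (PtF (ctxObj (map ν ss)))
    relF .tr N p = mkPt (unenvR N (env (satEnv N p))) tt
    relF .tr-cong N e .at = unenvR-cong N (at (tr-cong (fwd (riso (R.rels r))) (base₂.mob N) e))
    relF .tr-natural {M} {N} m p .at s x = Model.≈-trans N (unenvR-natural {M} {N} m (env (satEnv M p)) s x)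
      (unenvR-cong N (at (tr-natural (fwd (riso (R.rels r))) {base₂.mob M} {base₂.mob N}
          (base₂.mhom {M} {N} m) p)) s x)
    into = relF ⊙ fwd (riso rep)
    f = natHom into
    inj : {N : Model T₂} (p q : Pt (str N) (robj rep)) → EqPt (ap f {N} p) (ap f {N} q) → EqPt p q
    inj {N} p q e = pt-trans (pt-sym (bwd-fwd (riso rep) N p)) (pt-trans (bwd-cong (riso rep) N
        (pt-trans (pt-sym (bwd-fwd (riso (R.rels r)) (base₂.mob N) _))
            (pt-trans (bwd-cong (riso (R.rels r)) (base₂.mob N) (mk≈ λ t x →
          X.≈-trans (X.≈-sym (envR-unenvR N _ t x)) (X.≈-trans (tr-cong (fwd (U₂ t)) N (at e' (ν t) (mapVar ν x)))
              (envR-unenvR N _ t x))))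
        (bwd-fwd (riso (R.rels r)) (base₂.mob N) _)))) (bwd-fwd (riso rep) N q))
      where
        module X = Model (RM N)
        e' = pt-trans (pt-sym (ap-natHom into {N} p)) (pt-trans e (ap-natHom into {N} q))
    open Complete.Image cax₂ f (λ {N} → inj {N}) public

    member : (N : Model T₂) (e : Env (str N) (map ν ss)) → Sat (str N) image e → Model.rl (RM N) r (envR N e)
    member N e q = let (p , eq) = image-preimage {N} e q
                       z = satEnv N (tr (fwd (riso rep)) N p)
      in X.rl-cong r (λ t x → X.≈-trans (X.evalTs-varsOf (λ x → x) (env z) t x)
          (X.≈-trans (X.≈-sym (envR-unenvR N (env z) t x))
           (tr-cong (fwd (U₂ t)) N (Model.≈-sym N (Model.≈-trans N (eq (ν t) (mapVar ν x))
               (at (ap-natHom into {N} p) (ν t) (mapVar ν x))))))) (sat z)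
      where module X = Model (RM N)

    member-intro : (N : Model T₂) (e : Env (str N) (map ν ss)) → Model.rl (RM N) r (envR N e) → Sat (str N) image e
    member-intro N e q = image-intro {N} e p λ s x → Model.≈-sym N (Model.≈-trans N (at (ap-natHom into {N} p) s x)
        (Model.≈-trans N (unenvR-cong N (at (pt-trans (tr-cong (fwd (riso (R.rels r))) (base₂.mob N)
            (fwd-bwd (riso rep) N _)) (fwd-bwd (riso (R.rels r)) (base₂.mob N) z))) s x) (unenvR-envR N e s x)))
      where
        module X = Model (RM N)
        z : Pt (str (RM N)) (relObj r)
        z = mkPt (envR N e) (X.rl-cong r (λ t x → X.≈-sym (X.evalTs-varsOf (λ x → x) _ t x)) q)
        p = bwd (riso rep) N (bwd (riso (R.rels r)) (base₂.mob N) z)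

  -- Besides the symbols of T', this adds the products of new sorts that will receive the sorts of
  -- T; their factors `ν s` exist only after the previous step.
  S₃ : MoritaSpec T₂
  S₃ = record
    { FunIx = Σ (List (Sort Sg')) λ ss → Σ (Sort Sg') λ s → Fun Sg' ss s
    ; fArgs = λ f → map ν (proj₁ f) ; fCod = λ f → ν (proj₁ (proj₂ f))
    ; fDef = λ f → Op.formula (proj₂ (proj₂ f)) ; fCart = λ f → Op.formula-cart (proj₂ (proj₂ f)) ; fFunc = λ f →
        Op.formula-functional (proj₂ (proj₂ f))
    ; RelIx = Σ (List (Sort Sg')) λ ss → Rel Sg' ss
    ; rArgs = λ r → map ν (proj₁ r) ; rDef = λ r → RelDef.image (proj₂ r) ; rCart = λ r → RelDef.image-cart
        (proj₂ r)
    ; ProdIx = Sort Sg ; factors = λ t → map ν (octx (dom′ t))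
    ; SubIx = ⊥ ; subBase = λ () ; subDef = λ () ; subCart = λ () ; OneIx = ⊥ }

  T₃ : Theory (ExtSig S₃)
  T₃ = ExtTheory S₃
  module X₃ = Extension S₃
  cax₃ : CartAx T₃
  cax₃ = X₃.ext-cartAx cax₂
  module red₃ = RepFun X₃.reductE

  module At₃ (N : Model T₃) where
    open X₃.IsExt (X₃.isExt (str N) (Model.valid N)) public

  base₃ : Model T₃ → Model T
  base₃ N = base₂.mob (red₃.mob N)

  -- The unit sends an element a of M to R' (R M), whose elements of sort t are points of `dom′ t`
  -- in R M; these coordinates describe a in terms of the T'-model.
  codomain : (N : Model T₃) (t : Sort Sg) → Car (str (base₃ N)) t → Env (str (RM (red₃.mob N))) (octx (dom′ t))
  codomain N t a = env (coord′ (RM (red₃.mob N)) (fn (Iso.to (Unit.at-model unit (base₃ N))) a))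

  embedF : ∀ t → NatTr (PtF {T = T₃} (ctxObj (inj₁ (inj₁ (inj₁ t)) ∷ []))) (PtF (sortObj (inj₂ (prodS t))))
  embedF t .tr N p = mkPt (At₃.tuple N t (unenvR (red₃.mob N) (codomain N t (env p _ (here refl)))) ▹ ε) tt
  embedF t .tr-cong N {p} {q} e .at = ∷-cases _ (At₃.proj-injective N t _ _ λ s x → Model.≈-trans N
      (At₃.proj-tuple N t _ s x)
    (Model.≈-trans N (unenvR-cong (red₃.mob N) (at (bwd-cong (riso (R'.sorts t)) (RM (red₃.mob N))
        (fn-cong (Iso.to (Unit.at-model unit (base₃ N))) (at e _ (here refl))))) s x)
      (Model.≈-sym N (At₃.proj-tuple N t _ s x)))) (λ _ ())
  embedF t .tr-natural {M} {N} m p .at = ∷-cases _ (At₃.proj-injective N t _ _ λ s x →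
      N.≈-trans (N.fun-cong (proj t x) (∷-cases _ N.≈-refl (λ _ ())))
          (N.≈-trans (N.≈-sym (Hom.fn-fun m (proj t x) _))
        (N.≈-trans (fn-cong m (At₃.proj-tuple M t _ s x)) (N.≈-trans
            (unenvR-natural {M₂} {N₂} m₂ (codomain M t a) s x)
          (N.≈-trans (unenvR-cong N₂ (at nat) s x) (N.≈-sym (At₃.proj-tuple N t _ s x))))))) (λ _ ())
    where
      module N = Model N
      M₂ = red₃.mob M
      N₂ = red₃.mob N
      m₂ = red₃.mhom {M} {N} m
      m₀ = base₂.mhom {M₂} {N₂} m₂
      a = env p _ (here refl)
      nat : EqPt (mapPt (RM-hom {M₂} {N₂} m₂) (coord′ (RM M₂) (fn (Iso.to (Unit.at-model unit (base₃ M))) a)))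
                 (coord′ (RM N₂) (fn (Iso.to (Unit.at-model unit (base₃ N))) (fn m₀ a)))
      nat = pt-trans (tr-natural (bwdT (riso (R'.sorts t))) {RM M₂} {RM N₂} (RM-hom {M₂} {N₂} m₂) _)
        (bwd-cong (riso (R'.sorts t)) (RM N₂) (Model.≈-sym (R'.mob (RM N₂))
            (Unit.unit-natural unit {base₃ M} {base₃ N} m₀ a)))

  module Embed t = FunctionDefinition cax₃ (embedF t)

  -- A separate step, since the graph of the embedding of t mentions the product sort introduced
  -- just before.
  S₄ : MoritaSpec T₃
  S₄ = record
    { FunIx = Sort Sg ; fArgs = λ t → inj₁ (inj₁ (inj₁ t)) ∷ [] ; fCod = λ t → inj₂ (prodS t)
    ; fDef = λ t → Embed.formula t ; fCart = λ t → Embed.formula-cart t ; fFunc = λ t → Embed.formula-functional t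
    ; RelIx = ⊥ ; rArgs = λ () ; rDef = λ () ; rCart = λ ()
    ; ProdIx = ⊥ ; factors = λ ()
    ; SubIx = ⊥ ; subBase = λ () ; subDef = λ () ; subCart = λ () ; OneIx = ⊥ }

  U : Theory (ExtSig S₄)
  U = ExtTheory S₄
  module X₄ = Extension S₄

  chain : MoritaChain Sg T (ExtSig S₄) U
  chain = step S₁ (step S₂ (step S₃ (step S₄ done)))

-- Models of the common extension as corresponding pairs

module ChainModels {Sg Sg' : Signature} {T : Theory Sg} {T' : Theory Sg'} (E : AdjEquiv T T') (cax : CartAx T) where
  open AdjEquiv E
  open Pairs E
  open Chain E cax

  module Parts (X : Structure (ExtSig S₄)) where
    module X = Structure X
    str₃ : Structure (ExtSig S₃)
    str₃ = reduct (inclusion S₄) X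
    str₂ : Structure (ExtSig S₂)
    str₂ = reduct (inclusion S₃) str₃
    str₁ : Structure (ExtSig S₁)
    str₁ = reduct (inclusion S₂) str₂
    mPart : Structure Sg
    mPart = reduct (inclusion S₁) str₁
    module Z₁ = Structure str₁
    module Z₂ = Structure str₂
    module Z₃ = Structure str₃

    private
      args : ∀ {ss} → Fam (λ s → X.Car (inj₁ (inj₁ (ν s)))) ss → Z₃.Env (map inj₁ (map ν ss))
      args e = mapFam inj₁ {P = Z₃.Car} (mapFam ν {P = Z₂.Car} e)
      args-cong : ∀ {ss} {d e : Fam (λ s → X.Car (inj₁ (inj₁ (ν s)))) ss} → (∀ s x → d s x X.≈ e s x) →
          args d Z₃.≋ args e
      args-cong {d = d} {e} p = mapFam-cong (inclusion S₃) str₃ (map-cases ν _ λ s x →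
        X.≈-trans (X.≈-≡ (mapFam-mapVar ν {P = Z₂.Car} d s x))
            (X.≈-trans (p s x) (X.≈-≡ (sym (mapFam-mapVar ν {P = Z₂.Car} e s x)))))

    nPart : Structure Sg'
    nPart .Structure.Car s = X.Car (inj₁ (inj₁ (ν s)))
    nPart .Structure._≈_ = X._≈_
    nPart .Structure.≈-refl = X.≈-refl
    nPart .Structure.≈-sym = X.≈-sym
    nPart .Structure.≈-trans = X.≈-trans
    nPart .Structure.fun f e = Z₃.fun (defF (_ , _ , f)) (args e)
    nPart .Structure.fun-cong f p = Z₃.fun-cong (defF (_ , _ , f)) (args-cong p)
    nPart .Structure.rl r e = Z₃.rl (defR (_ , r)) (args e)
    nPart .Structure.rl-cong r p = Z₃.rl-cong (defR (_ , r)) (args-cong p)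

    cMap : ∀ s → Car nPart s → Env mPart (octx (dom s))
    cMap s b t x = Z₁.fun (proj s x) (Z₂.fun (incl s) (b ▹ ε) ▹ ε)

    dMap : ∀ t → Car mPart t → Env nPart (octx (dom′ t))
    dMap t a s x = Z₃.fun (proj t (mapVar ν x)) (X.fun (defF t) (a ▹ ε) ▹ ε)

    -- The axioms of `U` in self-dual form: exchanging T with T' swaps `vM` with `vN`, the two
    -- halves of the pair, and the P-fields with the Q-fields. Thus both extensions can be compared
    -- through one condition.
    record Good : Set where
      no-eta-equality
      field
        vM : ∀ a → Valid mPart (axiom T a)
        vN : ∀ a → Valid nPart (axiom T' a)
        pair : Pair (model T mPart vM) (model T' nPart vN) cMap dMap
        tupleP : ∀ s → Env mPart (octx (dom s)) → X.Car (inj₁ (inj₁ (inj₁ (prodSort s))))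
        projP-tuple : ∀ s e t x → Z₁.fun (proj s x) (tupleP s e ▹ ε) X.≈ e t x
        projP-injective : ∀ s a b → (∀ t (x : t ∈ octx (dom s)) → Z₁.fun (proj s x) (a ▹ ε) X.≈ Z₁.fun (proj s x)
            (b ▹ ε)) → a X.≈ b
        tupleQ : ∀ t → Env nPart (octx (dom′ t)) → X.Car (inj₁ (inj₂ (prodS t)))
        projQ-tuple : ∀ t e s x → Z₃.fun (proj t (mapVar ν x)) (tupleQ t e ▹ ε) X.≈ e s x
        projQ-injective : ∀ t a b → (∀ s (x : s ∈ octx (dom′ t)) → Z₃.fun (proj t (mapVar ν x)) (a ▹ ε) X.≈ Z₃.fun
            (proj t (mapVar ν x)) (b ▹ ε)) → a X.≈ b

    module Forward (valid : ∀ a → Valid X (axiom U a)) where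
      private
        module I₄ = X₄.IsExt (X₄.isExt X valid)
        N₃ : Model T₃
        N₃ = model T₃ str₃ I₄.base
        N₂ : Model T₂
        N₂ = red₃.mob N₃
        N₁ : Model T₁
        N₁ = red₂.mob N₂
        M : Model T
        M = base₂.mob N₂
        module I₁ = At₁ N₁
        module I₃ = At₃ N₃
        module RM = Model (RM N₂)

        mapped : ∀ {ss} (e : Env nPart ss) → ∀ t x → envR N₂ (mapFam ν {P = Z₂.Car} e) t x RM.≈ toR N₂ (e t x)
        mapped e t x = RM.≈-≡ (cong (toR N₂) (mapFam-mapVar ν {P = Z₂.Car} e t x))

        uHom : Hom nPart (str (RM N₂))
        uHom .fn b = toR N₂ b
        uHom .fn-cong {s} e = tr-cong (fwd (U₂ s)) N₂ e
        uHom .Hom.fn-fun {ss} {s} f e = RM.≈-trans (tr-cong (fwd (U₂ s)) N₂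
            (Op.formula-value f N₂ (mapFam ν {P = Z₂.Car} e) _ (I₃.def-fun (ss , s , f) (mapFam ν {P = Z₂.Car} e))))
          (RM.≈-trans (fwd-bwd (U₂ s) N₂ _) (RM.fun-cong f (mapped e)))
        uHom .Hom.fn-rel {ss} r e q = RM.rl-cong r (mapped e)
            (RelDef.member r N₂ (mapFam ν {P = Z₂.Car} e) (I₃.def-rel (ss , r) (mapFam ν {P = Z₂.Car} e) q))

        -- The symbols of T' were defined by transport along `U₂`, so the bijections `U₂` form an
        -- isomorphism of structures.
        u : Iso nPart (str (RM N₂))
        u = bijective-iso uHom (λ y → fromR N₂ y) (λ {s} y → fwd-bwd (U₂ s) N₂ y)
          (λ {s} {a} {b} e → X.≈-trans (X.≈-sym (bwd-fwd (U₂ s) N₂ a)) (X.≈-trans (bwd-cong (U₂ s) N₂ e) (bwd-fwd (U₂ s) N₂ b)))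
          (λ {ss} r e q → I₃.def-rel⁻¹ (ss , r) (mapFam ν {P = Z₂.Car} e) (RelDef.member-intro r N₂ (mapFam ν {P = Z₂.Car} e) (RM.rl-cong r (λ t x → RM.≈-sym (mapped e t x)) q)))

        module In = Induced E M nPart u

        embed : ∀ t a → X.fun (defF t) (a ▹ ε) X.≈ I₃.tuple t (unenvR N₂ (codomain N₃ t a))
        embed t a = X.≈-trans (X.fun-cong (defF t) (∷-cases _ X.≈-refl (λ _ ())))
            (Embed.formula-value t N₃ (a ▹ ε) _ (I₄.def-fun t (a ▹ ε)))

        d-coord : ∀ t a s x → env (coord′ In.Y (fn (Iso.to In.induced) a)) s x X.≈ dMap t a s x
        d-coord t a s x = X.≈-trans (X.≈-sym (at (tr-natural (bwdT (riso (R'.sorts t))) {RM N₂} {In.Y} (Iso.from u)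
            (fn (Iso.to (Unit.at-model unit M)) a)) s x))
          (X.≈-sym (X.≈-trans (Z₃.fun-cong (proj t (mapVar ν x)) (∷-cases _ (embed t a) (λ _ ())))
              (X.≈-trans (I₃.proj-tuple t _ (ν s) (mapVar ν x))
            (X.≈-≡ (mapFam-mapVar ν {P = Z₂.Car} (λ s x → fromR N₂ (codomain N₃ t a s x)) s x)))))

      good : Good
      good .Good.vM = Model.valid M
      good .Good.vN = Model.valid In.Y
      good .Good.pair = Pair-transport E {M} {model T mPart (Model.valid M)} {In.Y}
          {model T' nPart (Model.valid In.Y)} (iso-refl mPart) (iso-refl nPart)
        (λ s b t x → X.≈-refl) (λ t a s x → X.≈-refl) (In.inducedPair {c = cMap} {d = dMap}
            (λ s b → U₂-coord s N₂ b) d-coord)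
      good .Good.tupleP s e = I₁.tuple s e
      good .Good.projP-tuple s e t x = I₁.proj-tuple s e t x
      good .Good.projP-injective s a b q = I₁.proj-injective s a b q
      good .Good.tupleQ t e = I₃.tuple t (mapFam ν {P = Z₂.Car} e)
      good .Good.projQ-tuple t e s x = X.≈-trans (I₃.proj-tuple t (mapFam ν {P = Z₂.Car} e) (ν s) (mapVar ν x))
          (X.≈-≡ (mapFam-mapVar ν {P = Z₂.Car} e s x))
      good .Good.projQ-injective t a b q = I₃.proj-injective t a b (map-cases ν _ q)

    module Backward (G : Good) where
      open Good G
      private
        Y : Model T'
        Y = model T' nPart vN

        -- Every stage of the reconstruction rebuilds the T-model on the same structure but with
        -- another proof of validity; the pair has to follow it along an identity isomorphism.
        revalidate : (M : Model T) (α : Iso mPart (str M)) → (c : _) (d : _) →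
            (∀ s b → Model._≋_ M (λ t x → fn (Iso.to α) (cMap s b t x)) (c s b)) →
                     (∀ t a → Structure._≋_ nPart (dMap t (fn (Iso.from α) a)) (d t a)) → Pair M Y c d
        revalidate M α c d cc dd = Pair-transport E {model T mPart vM} {M} {Y} {Y} α (iso-refl nPart) cc dd pair

        ext₁ : X₁.IsExt str₁
        ext₁ .X₁.IsExt.base = vM
        ext₁ .X₁.IsExt.def-fun ()
        ext₁ .X₁.IsExt.def-rel ()
        ext₁ .X₁.IsExt.def-rel⁻¹ ()
        ext₁ .X₁.IsExt.tuple = tupleP
        ext₁ .X₁.IsExt.proj-tuple = projP-tuple
        ext₁ .X₁.IsExt.proj-injective = projP-injective
        ext₁ .X₁.IsExt.incl-sat ()
        ext₁ .X₁.IsExt.restrict ()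
        ext₁ .X₁.IsExt.incl-restrict ()
        ext₁ .X₁.IsExt.incl-injective ()
        ext₁ .X₁.IsExt.point ()
        ext₁ .X₁.IsExt.point-unique ()

        N₁ : Model T₁
        N₁ = model T₁ str₁ (X₁.ext-valid str₁ ext₁)
        M₁ : Model T
        M₁ = red₁.mob N₁
        pair₁ : Pair M₁ Y cMap dMap
        pair₁ = revalidate M₁ (iso-refl mPart) cMap dMap (λ s b t x → X.≈-refl) (λ t a s x → X.≈-refl)
        module P₁ = Pair pair₁

        c-injective : ∀ s a b → (∀ t x → cMap s a t x X.≈ cMap s b t x) → a X.≈ b
        c-injective s a b e = X.≈-trans (X.≈-sym (Iso.from-to P₁.u a))
            (X.≈-trans (fn-cong (Iso.from P₁.u) (RX.≈-trans (RX.≈-sym (fwd-bwd (riso (R.sorts s)) M₁ _))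
            (RX.≈-trans (tr-cong (fwd (riso (R.sorts s))) M₁ (mk≈ λ t x → X.≈-trans (P₁.u-coord s a t x)
                (X.≈-trans (e t x) (X.≈-sym (P₁.u-coord s b t x)))))
              (fwd-bwd (riso (R.sorts s)) M₁ _)))) (Iso.from-to P₁.u b))
          where module RX = Model (R.mob M₁)

        inverse : ∀ s → Pt (str M₁) (dom s) → Car nPart s
        inverse s p = fn (Iso.from P₁.u) (tr (fwd (riso (R.sorts s))) M₁ p)

        -- With `c-injective` this makes the coordinate map a bijection from the new sort onto the
        -- points of `dom s`, which is what the subsort axioms of the second step express.
        c-inverse : ∀ s p t x → cMap s (inverse s p) t x X.≈ env p t x
        c-inverse s p t x = X.≈-trans (X.≈-sym (P₁.u-coord s _ t x))
            (at (pt-trans (bwd-cong (riso (R.sorts s)) M₁ (Iso.to-from P₁.u _))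
            (bwd-fwd (riso (R.sorts s)) M₁ p)) t x)

        ext₂ : X₂.IsExt str₂
        ext₂ .X₂.IsExt.base = Model.valid N₁
        ext₂ .X₂.IsExt.def-fun ()
        ext₂ .X₂.IsExt.def-rel ()
        ext₂ .X₂.IsExt.def-rel⁻¹ ()
        ext₂ .X₂.IsExt.tuple ()
        ext₂ .X₂.IsExt.proj-tuple ()
        ext₂ .X₂.IsExt.proj-injective ()
        ext₂ .X₂.IsExt.incl-sat s a = Domain.member-intro s N₁ _ (coord M₁ (fn (Iso.to P₁.u) a))
            (λ t x → X.≈-sym (P₁.u-coord s a t x))
        ext₂ .X₂.IsExt.restrict s x q = inverse s (proj₁ (Domain.member s N₁ x q))
        ext₂ .X₂.IsExt.incl-restrict s x q = projP-injective s _ _ λ t y → X.≈-trans (c-inverse s (proj₁ m) t y)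
            (X.≈-sym (proj₂ m t y))
          where m = Domain.member s N₁ x q
        ext₂ .X₂.IsExt.incl-injective s a b e = c-injective s a b λ t x → Z₁.fun-cong (proj s x)
            (∷-cases _ e (λ _ ()))
        ext₂ .X₂.IsExt.point ()
        ext₂ .X₂.IsExt.point-unique ()

        -- Elements of R of the base model are determined by their coordinates, so the
        -- identification built into the chain agrees with the isomorphism given by the pair.
        toR-u : (N : Model T₂) {c : _} {d : _} (P : Pair (base₂.mob N) Y c d) → ∀ s (b : Car nPart s)
            (b' : Car (str N) (ν s)) →
                (∀ t x → Model._≈_ (base₂.mob N) (projF s x (red₂.mob N) (inclF s N b')) (c s b t x)) → Model._≈_
                    (RM N) (toR N b') (fn (Iso.to (Pair.u P)) b)
        toR-u N P s b b' e = RX.≈-trans (RX.≈-sym (fwd-bwd (riso (R.sorts s)) (base₂.mob N) _))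
            (RX.≈-trans (tr-cong (fwd (riso (R.sorts s))) (base₂.mob N)
            (mk≈ λ t x → Model.≈-trans (base₂.mob N) (U₂-coord s N b' t x)
                (Model.≈-trans (base₂.mob N) (e t x) (Model.≈-sym (base₂.mob N) (Pair.u-coord P s b t x)))))
            (fwd-bwd (riso (R.sorts s)) (base₂.mob N) _))
          where module RX = Model (RM N)

        N₂ : Model T₂
        N₂ = model T₂ str₂ (X₂.ext-valid str₂ ext₂)
        pair₂ : Pair (base₂.mob N₂) Y cMap dMap
        pair₂ = revalidate (base₂.mob N₂) (iso-refl mPart) cMap dMap (λ s b t x → X.≈-refl) (λ t a s x → X.≈-refl)
        module P₂ = Pair pair₂
        module RM₂ = Model (RM N₂)

        toR-u₂ : ∀ s (b : Car nPart s) → toR N₂ b RM₂.≈ fn (Iso.to P₂.u) b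
        toR-u₂ s b = toR-u N₂ pair₂ s b b (λ t x → X.≈-refl)

        unν : ∀ {ss} → Z₂.Env (map ν ss) → Env nPart ss
        unν e s x = e (ν s) (mapVar ν x)

        unν-args : ∀ {ss} (e : Z₂.Env (map ν ss)) → args (unν e) Z₃.≋ mapFam inj₁ {P = Z₃.Car} e
        unν-args e = mapFam-cong (inclusion S₃) str₃ (map-cases ν _ λ s x → X.≈-≡
            (mapFam-mapVar ν {P = Z₂.Car} (unν e) s x))

        ext₃ : X₃.IsExt str₃
        ext₃ .X₃.IsExt.base = Model.valid N₂
        ext₃ .X₃.IsExt.def-fun (ss , s , f) e = Op.value-formula f N₂ e _
            (X.≈-trans (X.≈-sym (Z₃.fun-cong (defF (ss , s , f)) (unν-args e)))
          (X.≈-trans (X.≈-sym (bwd-fwd (U₂ s) N₂ _)) (bwd-cong (U₂ s) N₂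
              (RM₂.≈-trans (toR-u₂ s _) (RM₂.≈-trans (Hom.fn-fun (Iso.to P₂.u) f (unν e))
            (RM₂.fun-cong f (λ t x → RM₂.≈-sym (toR-u₂ t (unν e t x)))))))))
        ext₃ .X₃.IsExt.def-rel (ss , r) e q = RelDef.member-intro r N₂ e
            (RM₂.rl-cong r (λ t x → RM₂.≈-sym (toR-u₂ t (unν e t x)))
          (Hom.fn-rel (Iso.to P₂.u) r (unν e) (Z₃.rl-cong (defR (ss , r)) (λ s x → X.≈-sym (unν-args e s x)) q)))
        ext₃ .X₃.IsExt.def-rel⁻¹ (ss , r) e q = Z₃.rl-cong (defR (ss , r)) (unν-args e)
            (Structure.rl-cong nPart r (λ t x → Iso.from-to P₂.u (unν e t x))
          (Hom.fn-rel (Iso.from P₂.u) r _ (RM₂.rl-cong r (λ t x → toR-u₂ t (unν e t x)) (RelDef.member r N₂ e q))))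
        ext₃ .X₃.IsExt.tuple t e = tupleQ t (unν e)
        ext₃ .X₃.IsExt.proj-tuple t e = map-cases ν _ λ s x → projQ-tuple t (unν e) s x
        ext₃ .X₃.IsExt.proj-injective t a b q = projQ-injective t a b (λ s x → q (ν s) (mapVar ν x))
        ext₃ .X₃.IsExt.incl-sat ()
        ext₃ .X₃.IsExt.restrict ()
        ext₃ .X₃.IsExt.incl-restrict ()
        ext₃ .X₃.IsExt.incl-injective ()
        ext₃ .X₃.IsExt.point ()
        ext₃ .X₃.IsExt.point-unique ()

        N₃ : Model T₃
        N₃ = model T₃ str₃ (X₃.ext-valid str₃ ext₃)
        L₂ : Model T₂
        L₂ = red₃.mob N₃
        pair₃ : Pair (base₃ N₃) Y cMap dMap
        pair₃ = revalidate (base₃ N₃) (iso-refl mPart) cMap dMap (λ s b t x → X.≈-refl) (λ t a s x → X.≈-refl)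
        module P₃ = Pair pair₃
        module RM₃ = Model (RM L₂)

        -- The place where `compat` enters: the coordinates of v a, pushed along u, are those of the
        -- unit at a, which the embedding of t was defined to record.
        d-codomain : ∀ t a s x → dMap t a s x X.≈ fromR L₂ (codomain N₃ t a s x)
        d-codomain t a s x = X.≈-trans (X.≈-sym (P₃.v-coord t a s x))
            (X.≈-trans (X.≈-sym (bwd-fwd (U₂ s) L₂ b)) (bwd-cong (U₂ s) L₂
            (RM₃.≈-trans (toR-u L₂ pair₃ s b b (λ t x → X.≈-refl))
                (at (pt-trans (tr-natural (bwdT (riso (R'.sorts t))) {Y} {RM L₂} (Iso.to P₃.u) (fn (Iso.to P₃.v) a))
              (bwd-cong (riso (R'.sorts t)) (RM L₂) (P₃.compat a))) s x))))
          where b = env (coord′ Y (fn (Iso.to P₃.v) a)) s x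

        ext₄ : X₄.IsExt X
        ext₄ .X₄.IsExt.base = Model.valid N₃
        ext₄ .X₄.IsExt.def-fun t e = Embed.value-formula t N₃ e _
            (At₃.proj-injective N₃ t _ _ (map-cases ν _ λ s x →
          X.≈-trans (Z₃.fun-cong (proj t (mapVar ν x)) (∷-cases _
              (X.fun-cong (defF t) (∷-cases _ X.≈-refl (λ _ ()))) (λ _ ())))
            (X.≈-trans (d-codomain t (e _ (here refl)) s x) (X.≈-sym
                (X.≈-trans (At₃.proj-tuple N₃ t _ (ν s) (mapVar ν x))
              (X.≈-≡ (mapFam-mapVar ν {P = Z₂.Car} (λ s x → fromR L₂
                  (codomain N₃ t (e _ (here refl)) s x)) s x)))))))
        ext₄ .X₄.IsExt.def-rel ()
        ext₄ .X₄.IsExt.def-rel⁻¹ ()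
        ext₄ .X₄.IsExt.tuple ()
        ext₄ .X₄.IsExt.proj-tuple ()
        ext₄ .X₄.IsExt.proj-injective ()
        ext₄ .X₄.IsExt.incl-sat ()
        ext₄ .X₄.IsExt.restrict ()
        ext₄ .X₄.IsExt.incl-restrict ()
        ext₄ .X₄.IsExt.incl-injective ()
        ext₄ .X₄.IsExt.point ()
        ext₄ .X₄.IsExt.point-unique ()

      valid : ∀ a → Valid X (axiom U a)
      valid = X₄.ext-valid X ext₄

-- The two common extensions have isomorphic signatures

-- An indexed family F is coded by C when it is the family of fibres of an arity map.
record Coded {I : Set} (F : I → Set) : Set₁ where
  field
    Code : Set
    ar  : Code → I
    dec : (r : Code) → F (ar r)
    enc : ∀ {i} → F i → Σ Code λ r → ar r ≡ i
    dec-enc : ∀ {i} (f : F i) → subst F (proj₂ (enc f)) (dec (proj₁ (enc f))) ≡ f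
    enc-dec : ∀ r → proj₁ (enc (dec r)) ≡ r

  dec-cong : ∀ {r r' i} → r ≡ r' → (q : ar r ≡ i) (q' : ar r' ≡ i) → subst F q (dec r) ≡ subst F q' (dec r')
  dec-cong refl q q' = cong (λ z → subst F z _) (uip q q')

  enc-subst : ∀ r {i} (q : ar r ≡ i) → proj₁ (enc (subst F q (dec r))) ≡ r
  enc-subst r refl = enc-dec r

module _ {I J : Set} {F : I → Set} {G : J → Set} (A : Coded F) (B : Coded G) (m : I → J) (m-injective : ∀ {i j} → m i ≡ m j → i ≡ j)
         (w : Coded.Code A → Coded.Code B) (w⁻¹ : Coded.Code B → Coded.Code A) (ww⁻¹ : ∀ r → w (w⁻¹ r) ≡ r)
             (w⁻¹w : ∀ r → w⁻¹ (w r) ≡ r)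
         (w-ar : ∀ r → Coded.ar B (w r) ≡ m (Coded.ar A r)) where
  private
    module A = Coded A
    module B = Coded B

  coded-to : ∀ {i} → F i → G (m i)
  coded-to f = subst G (trans (w-ar (proj₁ (A.enc f))) (cong m (proj₂ (A.enc f)))) (B.dec (w (proj₁ (A.enc f))))

  coded-to-dec : ∀ r → coded-to (A.dec r) ≡ subst G (w-ar r) (B.dec (w r))
  coded-to-dec r = B.dec-cong (cong w (A.enc-dec r)) _ (w-ar r)

  private
    back : ∀ {i} r' → B.ar r' ≡ m i → A.ar (w⁻¹ r') ≡ i
    back r' q = m-injective (trans (sym (w-ar (w⁻¹ r'))) (trans (cong B.ar (ww⁻¹ r')) q))

  coded-from : ∀ {i} → G (m i) → F i
  coded-from g = subst F (back (proj₁ (B.enc g)) (proj₂ (B.enc g))) (A.dec (w⁻¹ (proj₁ (B.enc g))))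

  -- Symbols are encoded at an arbitrary index, translated as codes and decoded; injectivity of m
  -- brings the inverse back to the index i. No case analysis at an index of the form m i is
  -- required.
  coded-iso : ∀ i → F i ↔ G (m i)
  coded-iso i = mk↔ₛ′ coded-to coded-from
    (λ g → trans (B.dec-cong (trans (cong w (A.enc-subst _ _)) (ww⁻¹ _)) _ (proj₂ (B.enc g))) (B.dec-enc g))
    (λ f → trans (A.dec-cong (trans (cong w⁻¹ (B.enc-subst _ _)) (w⁻¹w _)) _ (proj₂ (A.enc f))) (A.dec-enc f))

unmapVar : {S S' : Set} (f : S → S') {xs : List S} {t : S'} (i : t ∈ map f xs) → Σ S λ s → Σ (s ∈ xs) λ x → _≡_
    {A = Σ S' (_∈ map f xs)} (f s , mapVar f x) (t , i)
unmapVar f {s ∷ xs} (here refl) = s , here refl , refl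
unmapVar f {s ∷ xs} (there i) with unmapVar f i
... | t , x , refl = t , there x , refl


module Symbols {Sg Sg' : Signature} {T : Theory Sg} {T' : Theory Sg'} (E : AdjEquiv T T') (cax : CartAx T) where
  open Pairs E
  open Chain E cax

  Sort⁺ : Set
  Sort⁺ = ExtSort S₄

  baseS : Sort Sg → Sort⁺
  baseS t = inj₁ (inj₁ (inj₁ (inj₁ t)))
  newS : Sort Sg' → Sort⁺
  newS s = inj₁ (inj₁ (ν s))
  prodP : Sort Sg' → Sort⁺
  prodP s = inj₁ (inj₁ (inj₁ (prodSort s)))
  prodQ : Sort Sg → Sort⁺
  prodQ t = inj₁ (inj₂ (prodS t))

  baseL : List (Sort Sg) → List Sort⁺
  baseL ss = map inj₁ (map inj₁ (map inj₁ (map inj₁ ss)))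
  newL : List (Sort Sg') → List Sort⁺
  newL ss = map inj₁ (map inj₁ (map ν ss))

  -- An unindexed list of the function symbols of the final signature. The indices of `ExtFun S₄`
  -- are built with `map`, which obstructs direct matching at translated arities, so the two
  -- signatures are compared on these codes.
  data Sym : Set where
    old : (ss : List (Sort Sg)) (s : Sort Sg) → Fun Sg ss s → Sym
    new : (ss : List (Sort Sg')) (s : Sort Sg') → Fun Sg' ss s → Sym
    prP : (s : Sort Sg') (t : Sort Sg) → t ∈ octx (dom s) → Sym
    prQ : (t : Sort Sg) (s : Sort Sg') → s ∈ octx (dom′ t) → Sym
    inc : Sort Sg' → Sym
    emb : Sort Sg → Sym

  arity : Sym → List Sort⁺ × Sort⁺
  arity (old ss s f) = baseL ss , baseS s
  arity (new ss s f) = newL ss , newS s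
  arity (prP s t x)  = prodP s ∷ [] , baseS t
  arity (prQ t s x)  = prodQ t ∷ [] , newS s
  arity (inc s)      = newS s ∷ [] , prodP s
  arity (emb t)      = baseS t ∷ [] , prodQ t

  FunAt : List Sort⁺ × Sort⁺ → Set
  FunAt (ss , s) = ExtFun S₄ ss s

  symbol : (r : Sym) → FunAt (arity r)
  symbol (old ss s f) = oldF (oldF (oldF (oldF f)))
  symbol (new ss s f) = oldF (defF (ss , s , f))
  symbol (prP s t x)  = oldF (oldF (oldF (proj s x)))
  symbol (prQ t s x)  = oldF (proj t (mapVar ν x))
  symbol (inc s)      = oldF (oldF (incl s))
  symbol (emb t)      = defF t

  private
    Position : Sort Sg → ExtSort S₂ → Set
    Position t s' = s' ∈ map ν (octx (dom′ t))

    Preimage : ∀ t {s'} → Position t s' → Set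
    Preimage t {s'} i = Σ (Sort Sg') λ s → Σ (s ∈ octx (dom′ t)) λ x → _≡_ {A = Σ (ExtSort S₂) (Position t)}
        (ν s , mapVar ν x) (s' , i)

    -- A projection carries a position in a mapped list; matching on the equation in the preimage
    -- turns that position into `mapVar ν x`, as the code demands.
    encProj : ∀ t {s'} {i : Position t s'} → Preimage t i → Σ Sym λ r → arity r ≡ (prodQ t ∷ [] , inj₁ (inj₁ s'))
    encProj t (s , x , refl) = prQ t s x , refl

    encProj-dec : ∀ t {s'} {i : Position t s'} (p : Preimage t i) → subst FunAt (proj₂ (encProj t p))
        (symbol (proj₁ (encProj t p))) ≡ oldF (proj t i)
    encProj-dec t (s , x , refl) = refl

    encProj-sym : ∀ t {s'} {i : Position t s'} (p : Preimage t i) → proj₁ (encProj t p) ≡ prQ t (proj₁ p)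
        (proj₁ (proj₂ p))
    encProj-sym t (s , x , refl) = refl

    there-injective : ∀ {A : Set} {a : A} {xs : List A} {s s' : A} {x : s ∈ xs} {y : s' ∈ xs} →
                      _≡_ {A = Σ A (_∈ a ∷ xs)} (s , there x) (s' , there y) → _≡_ {A = Σ A (_∈ xs)} (s , x)
                          (s' , y)
    there-injective refl = refl

    ν-mapVar : ∀ {xs : List (Sort Sg')} {s s' : Sort Sg'} (x : s ∈ xs) (y : s' ∈ xs) →
               _≡_ {A = Σ (ExtSort S₂) (_∈ map ν xs)} (ν s , mapVar ν x) (ν s' , mapVar ν y) → _≡_
                   {A = Σ (Sort Sg') (_∈ xs)} (s , x) (s' , y)
    ν-mapVar (here refl) (here refl) e = refl
    ν-mapVar (here refl) (there y) ()
    ν-mapVar (there x) (here refl) ()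
    ν-mapVar (there x) (there y) e with ν-mapVar x y (there-injective e)
    ... | refl = refl

  encode : ∀ {i} → FunAt i → Σ Sym λ r → arity r ≡ i
  encode (oldF (oldF (oldF (oldF f)))) = old _ _ f , refl
  encode (oldF (oldF (oldF (proj s x)))) = prP s _ x , refl
  encode (oldF (oldF (incl s))) = inc s , refl
  encode (oldF (defF (ss , s , f))) = new ss s f , refl
  encode (oldF (proj t i)) = encProj t (unmapVar ν i)
  encode (defF t) = emb t , refl

  encode-symbol : ∀ r → proj₁ (encode (symbol r)) ≡ r
  encode-symbol (old ss s f) = refl
  encode-symbol (new ss s f) = refl
  encode-symbol (prP s t x) = refl
  encode-symbol (prQ t s x) with unmapVar ν (mapVar ν x)
  ... | s' , x' , e = trans (encProj-sym t (s' , x' , e)) (cong (λ z → prQ t (proj₁ z) (proj₂ z)) (ν-mapVar x' x e))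
  encode-symbol (inc s) = refl
  encode-symbol (emb t) = refl

  symbol-encode : ∀ {i} (f : FunAt i) → subst FunAt (proj₂ (encode f)) (symbol (proj₁ (encode f))) ≡ f
  symbol-encode (oldF (oldF (oldF (oldF f)))) = refl
  symbol-encode (oldF (oldF (oldF (proj s x)))) = refl
  symbol-encode (oldF (oldF (incl s))) = refl
  symbol-encode (oldF (defF (ss , s , f))) = refl
  symbol-encode (oldF (proj t i)) = encProj-dec t (unmapVar ν i)
  symbol-encode (defF t) = refl

  codedFun : Coded FunAt
  codedFun = record { Code = Sym ; ar = arity ; dec = symbol ; enc = encode ; dec-enc = symbol-encode ;
      enc-dec = encode-symbol }

  RelSym : Set
  RelSym = (Σ (List (Sort Sg)) (Rel Sg)) ⊎ (Σ (List (Sort Sg')) (Rel Sg'))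

  relArity : RelSym → List Sort⁺
  relArity (inj₁ (ss , r)) = baseL ss
  relArity (inj₂ (ss , r)) = newL ss

  relSymbol : (r : RelSym) → ExtRel S₄ (relArity r)
  relSymbol (inj₁ (ss , r)) = oldR (oldR (oldR (oldR r)))
  relSymbol (inj₂ (ss , r)) = oldR (defR (ss , r))

  relEncode : ∀ {ss} → ExtRel S₄ ss → Σ RelSym λ r → relArity r ≡ ss
  relEncode (oldR (oldR (oldR (oldR r)))) = inj₁ (_ , r) , refl
  relEncode (oldR (defR r)) = inj₂ r , refl

  codedRel : Coded (ExtRel S₄)
  codedRel = record { Code = RelSym ; ar = relArity ; dec = relSymbol ; enc = relEncode
    ; dec-enc = λ { (oldR (oldR (oldR (oldR r)))) → refl ; (oldR (defR r)) → refl }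
    ; enc-dec = λ { (inj₁ r) → refl ; (inj₂ r) → refl } }

-- E' will be the opposite of E; keeping it arbitrary makes the situation symmetric on the nose.
module Swap {Sg Sg' : Signature} {T : Theory Sg} {T' : Theory Sg'} (E : AdjEquiv T T') (E' : AdjEquiv T' T) (cax : CartAx T) (cax' : CartAx T')
            (ctx : ∀ s → octx (Pairs.dom E s) ≡ octx (Pairs.dom′ E' s))
                (ctx′ : ∀ t → octx (Pairs.dom′ E t) ≡ octx (Pairs.dom E' t)) where
  private
    module A = Symbols E cax
    module B = Symbols E' cax'

  -- A base sort of one extension is a subsort in the other, and the products from the first step of
  -- one are those from the third step of the other. Accordingly `swap` exchanges inclusions of
  -- subsorts with embeddings of base sorts.
  swapS : A.Sort⁺ → B.Sort⁺
  swapS (inj₁ (inj₁ (inj₁ (inj₁ t)))) = B.newS t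
  swapS (inj₁ (inj₁ (inj₁ (inj₂ (prodS s))))) = B.prodQ s
  swapS (inj₁ (inj₁ (inj₂ (subS s)))) = B.baseS s
  swapS (inj₁ (inj₂ (prodS t))) = B.prodP t
  swapS (inj₂ (prodS ()))
  swapS (inj₂ (subS ()))
  swapS (inj₂ (oneS ()))

  swap : A.Sym → B.Sym
  swap (A.old ss s f) = B.new ss s f
  swap (A.new ss s f) = B.old ss s f
  swap (A.prP s t x)  = B.prQ s t (subst (t ∈_) (ctx s) x)
  swap (A.prQ t s x)  = B.prP t s (subst (s ∈_) (ctx′ t) x)
  swap (A.inc s)      = B.emb s
  swap (A.emb t)      = B.inc t

  swapR : A.RelSym → B.RelSym
  swapR (inj₁ r) = inj₂ r
  swapR (inj₂ r) = inj₁ r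

  swap-baseL : ∀ ss → B.newL ss ≡ map swapS (A.baseL ss)
  swap-baseL []       = refl
  swap-baseL (s ∷ ss) = cong (B.newS s ∷_) (swap-baseL ss)

  swap-newL : ∀ ss → B.baseL ss ≡ map swapS (A.newL ss)
  swap-newL []       = refl
  swap-newL (s ∷ ss) = cong (B.baseS s ∷_) (swap-newL ss)

  onArity : List A.Sort⁺ × A.Sort⁺ → List B.Sort⁺ × B.Sort⁺
  onArity (ss , s) = map swapS ss , swapS s

  swap-arity : ∀ r → B.arity (swap r) ≡ onArity (A.arity r)
  swap-arity (A.old ss s f) = cong (_, B.newS s) (swap-baseL ss)
  swap-arity (A.new ss s f) = cong (_, B.baseS s) (swap-newL ss)
  swap-arity (A.prP s t x)  = refl
  swap-arity (A.prQ t s x)  = refl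
  swap-arity (A.inc s)      = refl
  swap-arity (A.emb t)      = refl

  swapR-arity : ∀ r → B.relArity (swapR r) ≡ map swapS (A.relArity r)
  swapR-arity (inj₁ (ss , r)) = swap-baseL ss
  swapR-arity (inj₂ (ss , r)) = swap-newL ss

module SwapIso {Sg Sg' : Signature} {T : Theory Sg} {T' : Theory Sg'} (E : AdjEquiv T T') (E' : AdjEquiv T' T) (cax : CartAx T) (cax' : CartAx T')
               (ctx : ∀ s → octx (Pairs.dom E s) ≡ octx (Pairs.dom′ E' s))
                   (ctx′ : ∀ t → octx (Pairs.dom′ E t) ≡ octx (Pairs.dom E' t)) where
  private
    module A = Symbols E cax
    module F = Swap E' E cax' cax (λ t → sym (ctx′ t)) (λ s → sym (ctx s))
    subst-sym : ∀ {S : Set} {t : S} {xs ys : List S} (e : xs ≡ ys) (x : t ∈ xs) → subst (t ∈_) (sym e)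
        (subst (t ∈_) e x) ≡ x
    subst-sym refl x = refl
  open Swap E E' cax cax' ctx ctx′

  swapS-swapS : ∀ s → F.swapS (swapS s) ≡ s
  swapS-swapS (inj₁ (inj₁ (inj₁ (inj₁ t)))) = refl
  swapS-swapS (inj₁ (inj₁ (inj₁ (inj₂ (prodS s))))) = refl
  swapS-swapS (inj₁ (inj₁ (inj₂ (subS s)))) = refl
  swapS-swapS (inj₁ (inj₂ (prodS t))) = refl
  swapS-swapS (inj₂ (prodS ()))
  swapS-swapS (inj₂ (subS ()))
  swapS-swapS (inj₂ (oneS ()))

  swap-swap : ∀ r → F.swap (swap r) ≡ r
  swap-swap (A.old ss s f) = refl
  swap-swap (A.new ss s f) = refl
  swap-swap (A.prP s t x)  = cong (A.prP s t) (subst-sym (ctx s) x)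
  swap-swap (A.prQ t s x)  = cong (A.prQ t s) (subst-sym (ctx′ t) x)
  swap-swap (A.inc s)      = refl
  swap-swap (A.emb t)      = refl

  swapR-swapR : ∀ r → F.swapR (swapR r) ≡ r
  swapR-swapR (inj₁ r) = refl
  swapR-swapR (inj₂ r) = refl

  swapL-injective : ∀ {ss ss'} → map swapS ss ≡ map swapS ss' → ss ≡ ss'
  swapL-injective {ss} {ss'} e = trans (sym (go ss)) (trans (cong (map F.swapS) e) (go ss'))
    where
      go : ∀ ss → map F.swapS (map swapS ss) ≡ ss
      go []       = refl
      go (s ∷ ss) = cong₂ _∷_ (swapS-swapS s) (go ss)

  onArity-injective : ∀ {i j} → onArity i ≡ onArity j → i ≡ j
  onArity-injective {ss , s} {ss' , s'} e = cong₂ _,_ (swapL-injective (cong proj₁ e))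
    (trans (sym (swapS-swapS s)) (trans (cong (λ z → F.swapS (proj₂ z)) e) (swapS-swapS s')))

module SwapSig {Sg Sg' : Signature} {T : Theory Sg} {T' : Theory Sg'} (E : AdjEquiv T T') (E' : AdjEquiv T' T) (cax : CartAx T) (cax' : CartAx T')
               (ctx : ∀ s → octx (Pairs.dom E s) ≡ octx (Pairs.dom′ E' s))
                   (ctx′ : ∀ t → octx (Pairs.dom′ E t) ≡ octx (Pairs.dom E' t)) where
  private
    module A = Symbols E cax
    module B = Symbols E' cax'
    module F = Swap E' E cax' cax (λ t → sym (ctx′ t)) (λ s → sym (ctx s))
    module I = SwapIso E E' cax cax' ctx ctx′
    module J = SwapIso E' E cax' cax (λ t → sym (ctx′ t)) (λ s → sym (ctx s))
    sym-sym : ∀ {S : Set} {x y : S} (e : x ≡ y) → sym (sym e) ≡ e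
    sym-sym refl = refl
  open Swap E E' cax cax' ctx ctx′
  private
    -- Reversing the situation twice yields `sym (sym (ctx s))`, which is not `ctx s` by
    -- computation; the swap with doubled symmetries bridges the gap.
    module G = Swap E E' cax cax' (λ s → sym (sym (ctx s))) (λ t → sym (sym (ctx′ t)))

    sorts-back : ∀ s → swapS (F.swapS s) ≡ s
    sorts-back (inj₁ (inj₁ (inj₁ (inj₁ t)))) = refl
    sorts-back (inj₁ (inj₁ (inj₁ (inj₂ (prodS s))))) = refl
    sorts-back (inj₁ (inj₁ (inj₂ (subS s)))) = refl
    sorts-back (inj₁ (inj₂ (prodS t))) = refl
    sorts-back (inj₂ (prodS ()))
    sorts-back (inj₂ (subS ()))
    sorts-back (inj₂ (oneS ()))

    symbols-back : ∀ r → swap (F.swap r) ≡ r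
    symbols-back r = trans (same (F.swap r)) (J.swap-swap r)
      where
        same : ∀ r → swap r ≡ G.swap r
        same (A.old ss s f) = refl
        same (A.new ss s f) = refl
        same (A.prP s t x)  = cong (λ e → B.prQ s t (subst (t ∈_) e x)) (sym (sym-sym (ctx s)))
        same (A.prQ t s x)  = cong (λ e → B.prP t s (subst (s ∈_) e x)) (sym (sym-sym (ctx′ t)))
        same (A.inc s)      = refl
        same (A.emb t)      = refl

    rels-back : ∀ r → swapR (F.swapR r) ≡ r
    rels-back (inj₁ r) = refl
    rels-back (inj₂ r) = refl

  abstract
    funs : ∀ ss s → ExtFun (Chain.S₄ E cax) ss s ↔ ExtFun (Chain.S₄ E' cax') (map swapS ss) (swapS s)
    funs ss s = coded-iso A.codedFun B.codedFun onArity I.onArity-injective swap F.swap symbols-back I.swap-swap swap-arity (ss , s)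

    rels : ∀ ss → ExtRel (Chain.S₄ E cax) ss ↔ ExtRel (Chain.S₄ E' cax') (map swapS ss)
    rels ss = coded-iso A.codedRel B.codedRel
        (map swapS) I.swapL-injective swapR F.swapR rels-back I.swapR-swapR swapR-arity ss

    funs-symbol : ∀ r → Inverse.to (funs (proj₁ (A.arity r)) (proj₂ (A.arity r))) (A.symbol r) ≡ subst B.FunAt
        (swap-arity r) (B.symbol (swap r))
    funs-symbol r = coded-to-dec A.codedFun B.codedFun onArity I.onArity-injective swap F.swap symbols-back I.swap-swap swap-arity r

    rels-symbol : ∀ r → Inverse.to (rels (A.relArity r)) (A.relSymbol r) ≡ subst (ExtRel (Chain.S₄ E' cax'))
        (swapR-arity r) (B.relSymbol (swapR r))
    rels-symbol r = coded-to-dec A.codedRel B.codedRel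
        (map swapS) I.swapL-injective swapR F.swapR rels-back I.swapR-swapR swapR-arity r

  ι : SigIso (ExtSig (Chain.S₄ E cax)) (ExtSig (Chain.S₄ E' cax'))
  ι = record { sortIso = mk↔ₛ′ swapS F.swapS sorts-back I.swapS-swapS ; funIso = funs ; relIso = rels }

record IsModel {Sg : Signature} (T : Theory Sg) (M : Structure Sg) : Set where
  no-eta-equality
  field
    holds : ∀ a → Valid M (axiom T a)

-- The two common extensions have the same models

module Compare {Sg Sg' : Signature} {T : Theory Sg} {T' : Theory Sg'} (E : AdjEquiv T T') (cax : CartAx T) (cax' : CartAx T') where
  private
    module A = ChainModels E cax
    module B = ChainModels (AdjEquiv-sym E) cax'
    module CA = Chain E cax
    module CB = Chain (AdjEquiv-sym E) cax'
    module SA = Symbols E cax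
    module SB = Symbols (AdjEquiv-sym E) cax'
  open Swap E (AdjEquiv-sym E) cax cax' (λ _ → refl) (λ _ → refl)

  private module W = SwapSig E (AdjEquiv-sym E) cax cax' (λ _ → refl) (λ _ → refl)

  ι : SigIso (ExtSig CA.S₄) (ExtSig CB.S₄)
  ι = W.ι

  private
    m : SigMor (ExtSig CA.S₄) (ExtSig CB.S₄)
    m = SigIso.asMor ι

  module _ (Y : Structure (ExtSig CB.S₄)) where
    private
      module Y = Structure Y
      X : Structure (ExtSig CA.S₄)
      X = reduct m Y
      module X = Structure X
      module PX = A.Parts X
      module PY = B.Parts Y

      -- Stated for an arbitrary equation so that it can be matched with `refl`; the concrete arity
      -- equations are proved by induction on lists and do not compute to it.
      fun-cast : ∀ {ss ss' s} (p : (ss , s) ≡ (ss' , s)) (g : ExtFun CB.S₄ ss s) (e : Y.Env ss) (e' : Y.Env ss') →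
                 (∀ t x → e' t (subst (t ∈_) (cong proj₁ p) x) Y.≈ e t x) → Y.fun
                     (subst SB.FunAt p g) e' Y.≈ Y.fun g e
      fun-cast refl g e e' q = Y.fun-cong g q

      rel-cast : ∀ {ss ss'} (p : ss ≡ ss') (r : ExtRel CB.S₄ ss) (e : Y.Env ss) (e' : Y.Env ss') →
                 (∀ t x → e' t (subst (t ∈_) p x) Y.≈ e t x) → Y.rl (subst (ExtRel CB.S₄) p r) e' → Y.rl r e
      rel-cast refl r e e' q = Y.rl-cong r q

      rel-uncast : ∀ {ss ss'} (p : ss ≡ ss') (r : ExtRel CB.S₄ ss) (e : Y.Env ss) (e' : Y.Env ss') →
                   (∀ t x → e' t (subst (t ∈_) p x) Y.≈ e t x) → Y.rl r e → Y.rl (subst (ExtRel CB.S₄) p r) e'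
      rel-uncast refl r e e' q = Y.rl-cong r (λ t x → Y.≈-sym (q t x))

      fun-≡ : ∀ {ss s} {f g : ExtFun CB.S₄ ss s} → f ≡ g → (e : Y.Env ss) → Y.fun f e Y.≈ Y.fun g e
      fun-≡ refl e = Y.≈-refl

      rel-≡ : ∀ {ss} {r q : ExtRel CB.S₄ ss} → r ≡ q → (e : Y.Env ss) → Y.rl r e → Y.rl q e
      rel-≡ refl e p = p

      cons-cast : ∀ {ss ss'} {j : SB.Sort⁺} (p : ss ≡ ss') (e : Y.Env (j ∷ ss)) (e' : Y.Env (j ∷ ss')) → e' j
          (here refl) Y.≈ e j (here refl) →
                  (∀ t x → e' t (there (subst (t ∈_) p x)) Y.≈ e t (there x)) → ∀ t x → e' t
                      (subst (t ∈_) (cong (j ∷_) p) x) Y.≈ e t x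
      cons-cast refl e e' h q = ∷-cases _ h q

      baseX : ∀ {ss} → Env PX.mPart ss → Y.Env (map swapS (SA.baseL ss))
      baseX e = mapFam swapS {P = Y.Car} (mapFam inj₁ {P = X.Car}
          (mapFam inj₁ {P = PX.Z₃.Car} (mapFam inj₁ {P = PX.Z₂.Car} (mapFam inj₁ {P = PX.Z₁.Car} e))))
      newX : ∀ {ss} → Env PX.nPart ss → Y.Env (map swapS (SA.newL ss))
      newX e = mapFam swapS {P = Y.Car} (mapFam inj₁ {P = X.Car}
          (mapFam inj₁ {P = PX.Z₃.Car} (mapFam CA.ν {P = PX.Z₂.Car} e)))
      baseY : ∀ {ss} → Env PY.mPart ss → Y.Env (SB.baseL ss)
      baseY e = mapFam inj₁ {P = Y.Car} (mapFam inj₁ {P = PY.Z₃.Car}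
          (mapFam inj₁ {P = PY.Z₂.Car} (mapFam inj₁ {P = PY.Z₁.Car} e)))
      newY : ∀ {ss} → Env PY.nPart ss → Y.Env (SB.newL ss)
      newY e = mapFam inj₁ {P = Y.Car} (mapFam inj₁ {P = PY.Z₃.Car} (mapFam CB.ν {P = PY.Z₂.Car} e))

      base-env : ∀ ss (e : Env PX.mPart ss) t x → baseX e t (subst (t ∈_) (swap-baseL ss) x) Y.≈ newY e t x
      base-env []       e t ()
      base-env (s ∷ ss) e = cons-cast (swap-baseL ss) (newY e) (baseX e) Y.≈-refl (base-env ss (tail e))

      new-env : ∀ ss (e : Env PX.nPart ss) t x → newX e t (subst (t ∈_) (swap-newL ss) x) Y.≈ baseY e t x
      new-env []       e t ()
      new-env (s ∷ ss) e = cons-cast (swap-newL ss) (baseY e) (newX e) Y.≈-refl (new-env ss (tail e))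

      base-arg : ∀ {ss} (q : SB.newL ss ≡ map swapS (SA.baseL ss)) (e : Env PX.mPart ss) t x → baseX e t
          (subst (t ∈_) q x) Y.≈ newY e t x
      base-arg {ss} q e t x = Y.≈-trans (Y.≈-≡ (cong (λ q → baseX e t (subst (t ∈_) q x)) (uip q (swap-baseL ss))))
          (base-env ss e t x)

      new-arg : ∀ {ss} (q : SB.baseL ss ≡ map swapS (SA.newL ss)) (e : Env PX.nPart ss) t x → newX e t
          (subst (t ∈_) q x) Y.≈ baseY e t x
      new-arg {ss} q e t x = Y.≈-trans (Y.≈-≡ (cong (λ q → newX e t (subst (t ∈_) q x)) (uip q (swap-newL ss))))
          (new-env ss e t x)

      base-fun : ∀ {ss s} (f : Fun Sg ss s) (e : Env PX.mPart ss) →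
          Structure.fun PX.mPart f e Y.≈ Structure.fun PY.nPart f e
      base-fun {ss} {s} f e = Y.≈-trans (fun-≡ (W.funs-symbol (SA.old ss s f)) (baseX e))
          (fun-cast (cong (_, SB.newS s) (swap-baseL ss)) (SB.symbol (SB.new ss s f)) (newY e) (baseX e)
          (base-arg _ e))

      new-fun : ∀ {ss s} (f : Fun Sg' ss s) (e : Env PX.nPart ss) →
          Structure.fun PX.nPart f e Y.≈ Structure.fun PY.mPart f e
      new-fun {ss} {s} f e = Y.≈-trans (fun-≡ (W.funs-symbol (SA.new ss s f)) (newX e))
          (fun-cast (cong (_, SB.baseS s) (swap-newL ss)) (SB.symbol (SB.old ss s f)) (baseY e) (newX e)
          (new-arg _ e))

      -- The carriers agree by computation of `swapS`, so both maps are identities; only the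
      -- reindexing of arguments along `swap-baseL` has to be compared.
      base-iso : Iso PX.mPart PY.nPart
      base-iso .Iso.to .fn a = a
      base-iso .Iso.to .fn-cong e = e
      base-iso .Iso.to .Hom.fn-fun = base-fun
      base-iso .Iso.to .Hom.fn-rel {ss} r e q = rel-cast (swap-baseL ss) (SB.relSymbol (inj₂ (ss , r))) (newY e)
          (baseX e) (base-arg _ e) (rel-≡ (W.rels-symbol (inj₁ (ss , r))) (baseX e) q)
      base-iso .Iso.from .fn a = a
      base-iso .Iso.from .fn-cong e = e
      base-iso .Iso.from .Hom.fn-fun f e = Y.≈-sym (base-fun f e)
      base-iso .Iso.from .Hom.fn-rel {ss} r e q = rel-≡ (sym (W.rels-symbol (inj₁ (ss , r)))) (baseX e)
          (rel-uncast (swap-baseL ss) (SB.relSymbol (inj₂ (ss , r))) (newY e) (baseX e) (base-arg _ e) q)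
      base-iso .Iso.from-to a = Y.≈-refl
      base-iso .Iso.to-from a = Y.≈-refl

      new-iso : Iso PX.nPart PY.mPart
      new-iso .Iso.to .fn a = a
      new-iso .Iso.to .fn-cong e = e
      new-iso .Iso.to .Hom.fn-fun = new-fun
      new-iso .Iso.to .Hom.fn-rel {ss} r e q = rel-cast (swap-newL ss) (SB.relSymbol (inj₁ (ss , r))) (baseY e)
          (newX e) (new-arg _ e) (rel-≡ (W.rels-symbol (inj₂ (ss , r))) (newX e) q)
      new-iso .Iso.from .fn a = a
      new-iso .Iso.from .fn-cong e = e
      new-iso .Iso.from .Hom.fn-fun f e = Y.≈-sym (new-fun f e)
      new-iso .Iso.from .Hom.fn-rel {ss} r e q = rel-≡ (sym (W.rels-symbol (inj₂ (ss , r)))) (newX e)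
          (rel-uncast (swap-newL ss) (SB.relSymbol (inj₁ (ss , r))) (baseY e) (newX e) (new-arg _ e) q)
      new-iso .Iso.from-to a = Y.≈-refl
      new-iso .Iso.to-from a = Y.≈-refl

      singleton : ∀ {j} (d e : Y.Env (j ∷ [])) → d j (here refl) Y.≈ e j (here refl) → d Y.≋ e
      singleton d e p = ∷-cases _ p (λ _ ())

      projP≈ : ∀ s {t} (x : t ∈ octx (Pairs.dom E s)) a → PX.Z₁.fun (proj s x) (a ▹ ε) Y.≈ PY.Z₃.fun
          (proj s (mapVar CB.ν x)) (a ▹ ε)
      projP≈ s {t} x a = Y.≈-trans (fun-≡ (W.funs-symbol (SA.prP s t x)) _)
          (Y.fun-cong (SB.symbol (SB.prQ s t x)) (singleton _ _ Y.≈-refl))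

      projQ≈ : ∀ t {s} (x : s ∈ octx (Pairs.dom′ E t)) a → PX.Z₃.fun (proj t (mapVar CA.ν x)) (a ▹ ε) Y.≈ PY.Z₁.fun
          (proj t x) (a ▹ ε)
      projQ≈ t {s} x a = Y.≈-trans (fun-≡ (W.funs-symbol (SA.prQ t s x)) _)
          (Y.fun-cong (SB.symbol (SB.prP t s x)) (singleton _ _ Y.≈-refl))

      inc≈ : ∀ s b → PX.Z₂.fun (incl s) (b ▹ ε) Y.≈ Y.fun (defF s) (b ▹ ε)
      inc≈ s b = Y.≈-trans (fun-≡ (W.funs-symbol (SA.inc s)) _) (Y.fun-cong (defF s) (singleton _ _ Y.≈-refl))

      emb≈ : ∀ t a → X.fun (defF t) (a ▹ ε) Y.≈ PY.Z₂.fun (incl t) (a ▹ ε)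
      emb≈ t a = Y.≈-trans (fun-≡ (W.funs-symbol (SA.emb t)) _)
          (Y.fun-cong (oldF (oldF (incl t))) (singleton _ _ Y.≈-refl))

      c≈ : ∀ s b t x → PX.cMap s b t x Y.≈ PY.dMap s b t x
      c≈ s b t x = Y.≈-trans (projP≈ s x _) (PY.Z₃.fun-cong (proj s (mapVar CB.ν x))
          (∷-cases _ (inc≈ s b) (λ _ ())))

      d≈ : ∀ t a s x → PX.dMap t a s x Y.≈ PY.cMap t a s x
      d≈ t a s x = Y.≈-trans (projQ≈ t x _) (PY.Z₁.fun-cong (proj t x) (∷-cases _ (emb≈ t a) (λ _ ())))

    good-reduct : PY.Good → PX.Good
    good-reduct G = G'
      where
        module G = PY.Good G
        vM : ∀ a → Valid PX.mPart (axiom T a)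
        vM a = iso-valid (iso-sym base-iso) (axiom T a) (G.vN a)
        vN : ∀ a → Valid PX.nPart (axiom T' a)
        vN a = iso-valid (iso-sym new-iso) (axiom T' a) (G.vM a)
        G' : PX.Good
        G' .A.Parts.Good.vM = vM
        G' .A.Parts.Good.vN = vN
        G' .A.Parts.Good.pair = Pair-transport E {model T PY.nPart G.vN} {model T PX.mPart vM}
            {model T' PY.mPart G.vM} {model T' PX.nPart vN}
          (iso-sym base-iso) (iso-sym new-iso) (λ s b t x → Y.≈-sym (c≈ s b t x)) (λ t a s x → Y.≈-sym (d≈ t a s x))
              (Pair-unsym E G.pair)
        G' .A.Parts.Good.tupleP s e = G.tupleQ s e
        G' .A.Parts.Good.projP-tuple s e t x = Y.≈-trans (projP≈ s x _) (G.projQ-tuple s e t x)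
        G' .A.Parts.Good.projP-injective s a b q = G.projQ-injective s a b
            (λ t x → Y.≈-trans (Y.≈-sym (projP≈ s x a)) (Y.≈-trans (q t x) (projP≈ s x b)))
        G' .A.Parts.Good.tupleQ t e = G.tupleP t e
        G' .A.Parts.Good.projQ-tuple t e s x = Y.≈-trans (projQ≈ t x _) (G.projP-tuple t e s x)
        G' .A.Parts.Good.projQ-injective t a b q = G.projP-injective t a b
            (λ s x → Y.≈-trans (Y.≈-sym (projQ≈ t x a)) (Y.≈-trans (q s x) (projQ≈ t x b)))

    good-expand : PX.Good → PY.Good
    good-expand G = G'
      where
        module G = PX.Good G
        vM : ∀ a → Valid PY.mPart (axiom T' a)
        vM a = iso-valid new-iso (axiom T' a) (G.vN a)
        vN : ∀ a → Valid PY.nPart (axiom T a)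
        vN a = iso-valid base-iso (axiom T a) (G.vM a)
        G' : PY.Good
        G' .B.Parts.Good.vM = vM
        G' .B.Parts.Good.vN = vN
        G' .B.Parts.Good.pair = Pair-sym E (Pair-transport E {model T PX.mPart G.vM} {model T PY.nPart vN}
            {model T' PX.nPart G.vN} {model T' PY.mPart vM}
          base-iso new-iso (λ s b t x → c≈ s b t x) (λ t a s x → d≈ t a s x) G.pair)
        G' .B.Parts.Good.tupleP t e = G.tupleQ t e
        G' .B.Parts.Good.projP-tuple t e s x = Y.≈-trans (Y.≈-sym (projQ≈ t x _)) (G.projQ-tuple t e s x)
        G' .B.Parts.Good.projP-injective t a b q = G.projQ-injective t a b
            (λ s x → Y.≈-trans (projQ≈ t x a) (Y.≈-trans (q s x) (Y.≈-sym (projQ≈ t x b))))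
        G' .B.Parts.Good.tupleQ s e = G.tupleP s e
        G' .B.Parts.Good.projQ-tuple s e t x = Y.≈-trans (Y.≈-sym (projP≈ s x _)) (G.projP-tuple s e t x)
        G' .B.Parts.Good.projQ-injective s a b q = G.projP-injective s a b
            (λ t x → Y.≈-trans (projP≈ s x a) (Y.≈-trans (q t x) (Y.≈-sym (projP≈ s x b))))

  -- Neither list of axioms is derived from the other directly: validity is converted to `Good`,
  -- exchanged there, and converted back.
  model-reduct : ∀ Y → IsModel (Chain.U (AdjEquiv-sym E) cax') Y → IsModel (Chain.U E cax)
      (reduct (SigIso.asMor ι) Y)
  model-reduct Y v .IsModel.holds = A.Parts.Backward.valid (reduct (SigIso.asMor ι) Y)
      (good-reduct Y (B.Parts.Forward.good Y (IsModel.holds v)))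

  model-expand : ∀ Y → IsModel (Chain.U E cax) (reduct (SigIso.asMor ι) Y) → IsModel
      (Chain.U (AdjEquiv-sym E) cax') Y
  model-expand Y v .IsModel.holds = B.Parts.Backward.valid Y (good-expand Y
      (A.Parts.Forward.good (reduct (SigIso.asMor ι) Y) (IsModel.holds v)))

-- Cartesianness of a formula only depends on which structures are models.

module _ {A B : Signature} (m : SigMor A B) {T : Theory A} {U : Theory B} (cax : CartAx U)
         (ok : (N : Model U) (a : Ax T) → Valid (reduct m (str N)) (axiom T a)) where
  private
    M : Model U → Model T
    M N = model T (reduct m (str N)) (ok N)

  semantic-cart : ∀ {Γ} {φ : Formula A Γ} → Cart T φ → Cart U (trF m φ)
  semantic-cart ⊤-cart = ⊤-cart
  semantic-cart (∧-cart c d) = ∧-cart (semantic-cart c) (semantic-cart d)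
  semantic-cart ≐-cart = ≐-cart
  semantic-cart rel-cart = rel-cart
  semantic-cart (∃-cart {φ = φ} c u) = ∃-cart (semantic-cart c)
      (Complete.unique-sem cax (semantic-cart c) λ N e a b p q →
    Deduced.unique N (unmap m (str N) e) a b (Sat-tr m (str N) φ
        (∷-cases _ (Model.≈-refl N) (λ _ _ → Model.≈-refl N)) p)
        (Sat-tr m (str N) φ (∷-cases _ (Model.≈-refl N) (λ _ _ → Model.≈-refl N)) q))
    where
      module Deduced (N : Model U) where
        module R = Model (M N)
        unique : ∀ e a b → R.Sat φ (a ▹ e) → R.Sat φ (b ▹ e) → a R.≈ b
        unique e a b p q = sound (M N) u (a ▹ b ▹ e)
          (R.Sat-unsub φ _ (∷-cases _ R.≈-refl (λ _ _ → R.≈-refl)) p , R.Sat-unsub φ _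
              (∷-cases _ R.≈-refl (λ _ _ → R.≈-refl)) q)

  semantic-derivable : CartAx T → ∀ a → Derivable U (trSeq m (axiom T a))
  semantic-derivable caxT a = go (axiom T a) (caxT a) (λ N → valid-tr m (str N) (axiom T a) (ok N a))
    where
      go : (σ : Sequent A) → CartSeq T σ → ((N : Model U) → Valid (str N) (trSeq m σ)) → Derivable U (trSeq m σ)
      go (seq Γ φ ψ) (c , d) v = completeness cax (semantic-cart c) (semantic-cart d) v

module _ {A : Signature} {T U : Theory A} (caxT : CartAx T) (caxU : CartAx U) (ok : (N : Model U) (a : Ax T) → Valid (str N) (axiom T a)) where
  -- A version over one fixed signature. Translation along an identity morphism would replace
  -- contexts by mapped contexts, which are equal to them only propositionally.
  semantic-cart′ : ∀ {Γ} {φ : Formula A Γ} → Cart T φ → Cart U φ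
  semantic-cart′ ⊤-cart = ⊤-cart
  semantic-cart′ (∧-cart c d) = ∧-cart (semantic-cart′ c) (semantic-cart′ d)
  semantic-cart′ ≐-cart = ≐-cart
  semantic-cart′ rel-cart = rel-cart
  semantic-cart′ (∃-cart c u) = ∃-cart (semantic-cart′ c) (completeness caxU
    (∧-cart (Deduction.cart-sub U (semantic-cart′ c) _) (Deduction.cart-sub U (semantic-cart′ c) _)) ≐-cart λ N →
        sound (model T (str N) (ok N)) u)

  semantic-derivable′ : ∀ a → Derivable U (axiom T a)
  semantic-derivable′ a = go (axiom T a) (caxT a) (λ N → ok N a)
    where
      go : (σ : Sequent A) → CartSeq T σ → ((N : Model U) → Valid (str N) σ) → Derivable U σ
      go (seq Γ φ ψ) (c , d) v = completeness caxU (semantic-cart′ c) (semantic-cart′ d) v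

module _ {A B : Signature} (m : SigMor A B) {T : Theory A} {U : Theory B} (caxT : CartAx T) (caxU : CartAx U) where
  trTheory-cartAx : CartAx (trTheory m T)
  trTheory-cartAx a = trCart m axiom-rule (proj₁ (caxT a)) , trCart m axiom-rule (proj₂ (caxT a))

  -- By completeness for both theories, derivability of each other's axioms reduces to having the
  -- same models; the translated theory holds in a structure exactly when T holds in its reduct.
  semantic-logEquiv : (∀ Y → IsModel U Y → IsModel T (reduct m Y)) → (∀ Y → IsModel T (reduct m Y) → IsModel U Y) →
      LogEquiv (trTheory m T) U
  semantic-logEquiv ⇒ ⇐ = semantic-derivable m caxU (λ N → IsModel.holds
      (⇒ (str N) (record { holds = Model.valid N }))) caxT ,
    semantic-derivable′ caxU trTheory-cartAx (λ N → IsModel.holds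
        (⇐ (str N) (record { holds = λ a → valid-reduct m (str N) (axiom T a) (Model.valid N a) })))

module _ {Sg Sg' : Signature} {T : Theory Sg} {T' : Theory Sg'} (E : AdjEquiv T T') (cax : CartAx T) (cax' : CartAx T') where
  common-logEquiv : LogEquiv (trTheory (SigIso.asMor (Compare.ι E cax cax')) (Chain.U E cax))
      (Chain.U (AdjEquiv-sym E) cax')
  common-logEquiv = semantic-logEquiv (SigIso.asMor (Compare.ι E cax cax')) {Chain.U E cax}
      {Chain.U (AdjEquiv-sym E) cax'}
    (chain-cartAx (Chain.chain E cax) cax) (chain-cartAx (Chain.chain (AdjEquiv-sym E) cax') cax')
    (Compare.model-reduct E cax cax') (Compare.model-expand E cax cax')

AdjEquiv⇒PreTMorita : (T T' : CartTheory) → AdjEquiv (CartTheory.theory T) (CartTheory.theory T') → CartAx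
    (CartTheory.theory T) → CartAx (CartTheory.theory T') → PreTMorita T T'
AdjEquiv⇒PreTMorita T T' E cax cax' = ExtSig (Chain.S₄ E cax) , Chain.U E cax , ExtSig
    (Chain.S₄ (AdjEquiv-sym E) cax') , Chain.U (AdjEquiv-sym E) cax' ,
    Chain.chain E cax , Chain.chain (AdjEquiv-sym E) cax' , Compare.ι E cax cax' , common-logEquiv E cax cax'

-- The two chains already end in logically equivalent theories, so a single pre-equivalence is
-- enough.
JMorita⇒TMorita : (T T' : CartTheory) → JMorita T T' → TMorita T T'
JMorita⇒TMorita T T' E = [ AdjEquiv⇒PreTMorita T T' (adjointify (Equivalence⇒ModEquiv cax cax' E)) cax cax' ]⁺
  where
    cax = cartTheory-cartAx T
    cax' = cartTheory-cartAx T'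

theorem5p3 : (T T' : CartTheory) → JMorita T T' ⇔ TMorita T T'
theorem5p3 T T' = mk⇔ (JMorita⇒TMorita T T') (TMorita⇒JMorita T T')
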